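{- Let $\Gamma=\mathrm{SL}_3(\mathbb{Z})$. For a prime $q$ let $B_q$ be the set of complete flags $(V_1,V_2)$ in $\mathbb{F}_q^3$ (subspaces $0<V_1<V_2<\mathbb{F}_q^3$ with $\dim V_1=1$, $\dim V_2=2$), and let $\Phi_q:\mathrm{SL}_3(\mathbb{Z})\to\mathrm{Sym}(B_q)$ be the action obtained by reducing modulo $q$ and acting naturally on flags. Then for every $\epsilon>0$ there is a function $f_\epsilon$ on primes with $f_\epsilon(q)\to0$ as $q\to\infty$ such that for every prime $q$ there exists $Y\subset B_q$ with $|Y|\ge(1-f_\epsilon(q))|B_q|$, such that for every $x\in Y$ there exists $Z_x\subset B_q$ with $|Z_x|\ge(1-f_\epsilon(q))|B_q|$, such that for every $y\in Z_x$ there exists $\gamma\in\Gamma$ with $\|\gamma\|_\infty\le q^{1/2+\epsilon}$ and $\Phi_q(\gamma)x=y$.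
   Context: $\|\gamma\|_\infty$ denotes the maximum absolute value of the entries of $\gamma$. -}

module Defs where

open import Level using (Level; 0ℓ) renaming (suc to lsuc)
open import Data.Nat as ℕ using (ℕ; NonZero)
open import Data.Nat.DivMod using (_mod_)
open import Data.Integer as ℤ using (ℤ; +_)
open import Data.Integer.DivMod using (_%ℕ_)
open import Data.Fin as Fin using (Fin; toℕ)
open import Data.Vec using (Vec; []; _∷_; lookup)
open import Data.Product using (Σ; ∃; ∃-syntax; _×_; _,_)
open import Data.List using (List; length)
open import Data.List.Membership.Propositional using (_∈_)
open import Data.List.Relation.Unary.AllPairs using (AllPairs)
open import Relation.Nullary using (¬_)
open import Relation.Binary.PropositionalEquality using (_≡_)
open import Function.Bundles using (_⇔_)

-- The field F_q (q prime; we only need q ≠ 0 for the arithmetic)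

module _ (q : ℕ) .{{_ : NonZero q}} where

  Fq : Set
  Fq = Fin q

  infixl 6 _⊕_
  infixl 7 _⊗_

  _⊕_ : Fq → Fq → Fq
  a ⊕ b = (toℕ a ℕ.+ toℕ b) mod q

  _⊗_ : Fq → Fq → Fq
  a ⊗ b = (toℕ a ℕ.* toℕ b) mod q

  zeroF : Fq
  zeroF = 0 mod q

  red : ℤ → Fq
  red z = (z %ℕ q) mod q

  Pt : Set
  Pt = Vec Fq 3

  zeroPt : Pt
  zeroPt = zeroF ∷ zeroF ∷ zeroF ∷ []

  _+P_ : Pt → Pt → Pt
  (a ∷ b ∷ c ∷ []) +P (a' ∷ b' ∷ c' ∷ []) = (a ⊕ a') ∷ (b ⊕ b') ∷ (c ⊕ c') ∷ []

  _·P_ : Fq → Pt → Pt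
  s ·P (a ∷ b ∷ c ∷ []) = (s ⊗ a) ∷ (s ⊗ b) ∷ (s ⊗ c) ∷ []

  Sub : Set₁
  Sub = Pt → Set

  _⊆_ : Sub → Sub → Set
  V ⊆ W = ∀ p → V p → W p

  _≐_ : Sub → Sub → Set
  V ≐ W = ∀ p → V p ⇔ W p

  IsLine : Sub → Set
  IsLine V = ∃[ v ] (¬ v ≡ zeroPt × (∀ p → V p ⇔ (∃[ c ] p ≡ c ·P v)))

  LinIndep : Pt → Pt → Set
  LinIndep u v = ∀ a b → (a ·P u) +P (b ·P v) ≡ zeroPt → a ≡ zeroF × b ≡ zeroF

  IsPlane : Sub → Set
  IsPlane V = ∃[ u ] ∃[ v ] (LinIndep u v ×
                (∀ p → V p ⇔ (∃[ a ] ∃[ b ] p ≡ (a ·P u) +P (b ·P v))))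

  record Flag : Set₁ where
    constructor flag
    field
      V₁ V₂   : Sub
      line    : IsLine V₁
      plane   : IsPlane V₂
      V₁⊆V₂   : V₁ ⊆ V₂

  open Flag public

  _≈F_ : Flag → Flag → Set
  x ≈F y = (V₁ x ≐ V₁ y) × (V₂ x ≐ V₂ y)

  -- a finite set of flags given as a duplicate-free list; its size is its length
  DistinctFlags : List Flag → Set₁
  DistinctFlags = AllPairs (λ x y → ¬ x ≈F y)

  IsNumFlags : ℕ → Set₁
  IsNumFlags n = ∃[ L ] (DistinctFlags L × length L ≡ n × (∀ x → ∃[ y ] (y ∈ L × x ≈F y)))

i0 i1 i2 : Fin 3
i0 = Fin.zero
i1 = Fin.suc Fin.zero
i2 = Fin.suc (Fin.suc Fin.zero)

Mat3 : Set
Mat3 = Fin 3 → Fin 3 → ℤ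

det3 : Mat3 → ℤ
det3 g =   g i0 i0 ℤ.* (g i1 i1 ℤ.* g i2 i2 ℤ.- g i1 i2 ℤ.* g i2 i1)
         ℤ.- g i0 i1 ℤ.* (g i1 i0 ℤ.* g i2 i2 ℤ.- g i1 i2 ℤ.* g i2 i0)
         ℤ.+ g i0 i2 ℤ.* (g i1 i0 ℤ.* g i2 i1 ℤ.- g i1 i1 ℤ.* g i2 i0)

InSL3ℤ : Mat3 → Set
InSL3ℤ g = det3 g ≡ ℤ.1ℤ

NormInfLe : Mat3 → (ℤ → Set) → Set
NormInfLe g P = ∀ i j → P (g i j)

module _ (q : ℕ) .{{_ : NonZero q}} where

  actPt : Mat3 → Pt q → Pt q
  actPt g p = row Fin.zero ∷ row (Fin.suc Fin.zero) ∷ row (Fin.suc (Fin.suc Fin.zero)) ∷ []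
    where
      row : Fin 3 → Fq q
      row i = _⊕_ q (_⊕_ q (_⊗_ q (red q (g i Fin.zero)) (lookup p Fin.zero))
                           (_⊗_ q (red q (g i (Fin.suc Fin.zero))) (lookup p (Fin.suc Fin.zero))))
                    (_⊗_ q (red q (g i (Fin.suc (Fin.suc Fin.zero)))) (lookup p (Fin.suc (Fin.suc Fin.zero))))

  actSub : Mat3 → Sub q → Sub q
  actSub g V p = ∃[ v ] (V v × actPt g v ≡ p)

  ActsTo : Mat3 → Flag q → Flag q → Set
  ActsTo g x y = _≐_ q (actSub g (V₁ x)) (V₁ y) × _≐_ q (actSub g (V₂ x)) (V₂ y)

open import Data.Rational as ℚ using (ℚ; 0ℚ; 1ℚ; ↥_; ↧ₙ_)
open import Data.Nat.Primality using (Prime)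

ℕtoℚ : ℕ → ℚ
ℕtoℚ n = ℚ._/_ (+ n) 1

TendsToZeroOnPrimes : (ℕ → ℚ) → Set
TendsToZeroOnPrimes f =
  ∀ (δ : ℚ) → 0ℚ ℚ.< δ → ∃[ N ] (∀ q → N ℕ.≤ q → Prime q → ℚ.∣ f q ∣ ℚ.≤ δ)

LargeSet : (q : ℕ) .{{_ : NonZero q}} → ℚ → List (Flag q) → Set₁
LargeSet q c Y = ∀ n → IsNumFlags q n → (1ℚ ℚ.- c) ℚ.* ℕtoℚ n ℚ.≤ ℕtoℚ (length Y)

-- ‖γ‖_∞ ≤ q^(1/2 + ε), for ε = a/d (a = numerator, d = denominator) with ε > 0:
-- equivalently |γᵢⱼ|^(2d) ≤ q^(d + 2a) for all entries.
NormBound : ℚ → ℕ → Mat3 → Set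
NormBound ε q g =
  NormInfLe g (λ z → ℤ.∣ z ∣ ℕ.^ (2 ℕ.* ↧ₙ ε) ℕ.≤ q ℕ.^ (↧ₙ ε ℕ.+ 2 ℕ.* ℤ.∣ ↥ ε ∣))

{-# OPTIONS --safe #-}
module Submission where

open import Defs
open import Data.Nat using (ℕ; NonZero)
open import Data.Nat.Primality using (Prime)
open import Data.Rational using (ℚ; 0ℚ; _<_)
open import Data.Product using (Σ; ∃; ∃-syntax; _×_)
open import Data.List using (List)
open import Data.List.Membership.Propositional using (_∈_)
open import Level using (Level)
open import Data.Bool using (Bool; true; false; T)
open import Data.Empty using (⊥; ⊥-elim)
open import Data.Fin as Fin using (Fin; toℕ)
import Data.Fin.Properties as FinP
open import Data.Integer as ℤ using (ℤ; +_; -[1+_]; 0ℤ; 1ℤ; _+_; _*_; _-_; -_; ∣_∣)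
open import Data.Integer.DivMod using (_%ℕ_; _/ℕ_; n%ℕd<d; a≡a%ℕn+[a/ℕn]*n)
open import Data.Integer.Divisibility.Signed using (_∣_; _∣?_; divides; ∣ᵤ⇒∣; ∣⇒∣ᵤ; ∣m∣n⇒∣m+n; ∣n⇒∣m*n)
import Data.Integer.Properties as ℤP
open import Data.Integer.Tactic.RingSolver using (solve-∀)
open import Data.List using ([]; _∷_; _++_; map; length; upTo; filter; cartesianProduct)
open import Data.List.Membership.Propositional using (find; lose)
open import Data.List.Membership.Propositional.Properties using (∈-map⁺; ∈-map⁻; ∈-upTo⁺; ∈-upTo⁻; ∈-++⁺ˡ; ∈-++⁺ʳ; ∈-++⁻; ∈-∃++; ∈-filter⁺; ∈-filter⁻; ∈-cartesianProduct⁺; ∈-cartesianProduct⁻)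
open import Data.List.Properties using (length-++; length-map; length-upTo; upTo-∷ʳ)
open import Data.List.Relation.Unary.All as All using (All; []; _∷_; all?)
open import Data.List.Relation.Unary.All.Properties using (++⁺; map⁺)
open import Data.List.Relation.Unary.AllPairs as AllPairs using (AllPairs; []; _∷_; allPairs?)
import Data.List.Relation.Unary.AllPairs.Properties as AllPairsP
open import Data.List.Relation.Unary.Any using (Any; here; there; any?)
open import Data.List.Relation.Unary.Unique.Propositional using (Unique)
import Data.List.Relation.Unary.Unique.Propositional.Properties as Unique
open import Data.Nat as ℕ using (zero; suc; z≤n; s≤s)
open import Data.Nat.Coprimality using (Coprime; coprime?; coprime-/gcd; coprime-divisor; coprime-Bézout; gcd≡1⇒coprime; prime⇒coprime)
open import Data.Nat.DivMod using (_%_; _/_; m%n<n; m/n≤m; m/n*n≤m; m/n*n≡m; m*n/n≡m; m≡m%n+[m/n]*n; /-monoˡ-≤; /-monoʳ-≤) renaming (_mod_ to _modℕ_)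
import Data.Nat.Divisibility as ℕD
open import Data.Nat.Divisibility using (divides; ∣-antisym)
open import Data.Nat.GCD using (gcd; gcd[m,n]∣m; gcd[m,n]∣n; gcd[m,n]≡0⇒m≡0; gcd[m,n]≡0⇒n≡0; module Bézout)
open import Data.Nat.Primality using (prime?; prime⇒nonZero; prime⇒nonTrivial; prime⇒irreducible; euclidsLemma)
open import Data.Nat.Primality.Factorisation using (factorise; PrimeFactorisation)
import Data.Nat.Properties as ℕP
open import Data.Nat.Tactic.RingSolver using () renaming (solve-∀ to solveℕ-∀)
open import Data.Product using (_,_; proj₁; proj₂)
open import Data.Product.Properties using (≡-dec)
open import Data.Rational as ℚ using (1ℚ; mkℚ; ↥_; ↧ₙ_; toℚᵘ)
import Data.Rational.Properties as ℚP
open import Data.Rational.Unnormalised as ℚᵘ using (mkℚᵘ; *≤*)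
import Data.Rational.Unnormalised.Properties as ℚᵘP
open import Data.Sum using (_⊎_; inj₁; inj₂; [_,_]′)
open import Data.Unit using (tt)
open import Data.Vec using ([]; _∷_)
open import Function using (_∘_)
open import Function.Bundles using (_⇔_; mk⇔; Equivalence)
open import Relation.Binary.Definitions using (tri<; tri≈; tri>)
open import Relation.Binary.PropositionalEquality
open import Relation.Nullary using (¬_; Dec; yes; no; does; contradiction; ¬?)
open import Relation.Nullary.Decidable using (_×-dec_; _⊎-dec_; map′)

-- Finite sums

-- A flag is recorded as a pair `(v , l)` of projective points modulo `q` with `v ∙ l ≡ 0`, where
-- `l` is a normal vector of the plane. A matrix `g` acts on `v` directly and on `l` through its
-- cofactor matrix, the inverse transpose. There are of the order of `q³` flags, and matrices of
-- determinant one with entries of size about `√q` are just numerous enough to reach most of them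
-- from one flag. What has to be excluded is that their images collide too often.
--
-- Second moment. Choose `T` with `T² < q ≤ 4T²`. A positive proportion of the pairs of rows with
-- entries in `1 … T` can be completed by a top row with entries at most `2T + 1` (`top-row`), which
-- yields `s ≥ T⁶ / 64` matrices (`many-matrices`). If `g` and `h` agree on a flag, then `g − μ h`
-- kills `v` and `cof g − σ cof h` kills `l` for suitable ratios `μ`, `σ`, each a root of a cubic
-- modulo `q`. Hence two matrices agree on at most 9 flags when the last two rows of `g − μ h` are
-- independent for all units `μ`, on at most `54 q` flags when the matrices are not proportional,
-- and trivially on at most `9 q³`. The exceptional pairs are counted through proportional pairs of
-- small integers, because `T² < q` turns congruences between products into equations. Altogether
-- the collisions number at most a constant times `s² log q` (`total-coincidences`), which exceeds
-- perfect equidistribution by only a logarithm.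
--
-- Spectral gap. The logarithm is removed by a lazy random walk along the twelve elementary
-- matrices. Their Laplacian satisfies `⟨ f , Δ f ⟩ ≤ 20 ⟨ Δ f , Δ f ⟩` in every finite action of
-- the group (`E≤20Δ²`), a quantitative form of property (T). It is proved by an explicit
-- certificate: `20 Δ² − Δ` is a sum of squares in the group ring plus an element whose coefficients
-- off the identity are nonpositive and add up to zero with the one at the identity. Each step of
-- the walk contracts the Dirichlet energy by `479/480` and at most doubles the entries of the
-- matrices. After `3k` steps, with `k` proportional to `log q`, the entries have grown by at most
-- `q^(ε/2)`, while the second moment has gained a factor of order `k³`, more than enough against
-- the logarithm.
--
-- A flag that is not reached from `x` is a zero of the diffused hit count, and every zero
-- contributes to its variance. So few pairs of flags remain unconnected (`unreached-total`), and
-- Markov's inequality produces `Y` and the sets `Z` with exceptional proportion `K / (k + 1)`,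
-- which tends to zero.

variable
  ℓ ℓ′ ℓ″ : Level
  𝒜 ℬ 𝒞 : Set ℓ

∑ : List 𝒜 → (𝒜 → ℕ) → ℕ
∑ [] f = 0
∑ (x ∷ xs) f = f x ℕ.+ ∑ xs f

∑-mono : (xs : List 𝒜) {f g : 𝒜 → ℕ} → (∀ x → x ∈ xs → f x ℕ.≤ g x) → ∑ xs f ℕ.≤ ∑ xs g
∑-mono [] h = z≤n
∑-mono (x ∷ xs) h = ℕP.+-mono-≤ (h x (here refl)) (∑-mono xs (λ y m → h y (there m)))

∑-cong : (xs : List 𝒜) {f g : 𝒜 → ℕ} → (∀ x → x ∈ xs → f x ≡ g x) → ∑ xs f ≡ ∑ xs g
∑-cong xs h = ℕP.≤-antisym (∑-mono xs λ x m → ℕP.≤-reflexive (h x m)) (∑-mono xs λ x m → ℕP.≤-reflexive (sym (h x m)))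

∑-++ : (xs ys : List 𝒜) (f : 𝒜 → ℕ) → ∑ (xs ++ ys) f ≡ ∑ xs f ℕ.+ ∑ ys f
∑-++ [] ys f = refl
∑-++ (x ∷ xs) ys f = trans (cong (f x ℕ.+_) (∑-++ xs ys f)) (sym (ℕP.+-assoc (f x) _ _))

∑-+ : (xs : List 𝒜) (f g : 𝒜 → ℕ) → ∑ xs (λ x → f x ℕ.+ g x) ≡ ∑ xs f ℕ.+ ∑ xs g
∑-+ [] f g = refl
∑-+ (x ∷ xs) f g = trans (cong (λ s → f x ℕ.+ g x ℕ.+ s) (∑-+ xs f g)) (lem (f x) (g x) (∑ xs f) (∑ xs g))
  where lem : ∀ a b c d → a ℕ.+ b ℕ.+ (c ℕ.+ d) ≡ a ℕ.+ c ℕ.+ (b ℕ.+ d)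
        lem = solveℕ-∀

∑-*ˡ : (xs : List 𝒜) (k : ℕ) (f : 𝒜 → ℕ) → ∑ xs (λ x → k ℕ.* f x) ≡ k ℕ.* ∑ xs f
∑-*ˡ [] k f = sym (ℕP.*-zeroʳ k)
∑-*ˡ (x ∷ xs) k f = trans (cong (k ℕ.* f x ℕ.+_) (∑-*ˡ xs k f)) (sym (ℕP.*-distribˡ-+ k (f x) _))

∑-*ʳ : (xs : List 𝒜) (k : ℕ) (f : 𝒜 → ℕ) → ∑ xs (λ x → f x ℕ.* k) ≡ ∑ xs f ℕ.* k
∑-*ʳ [] k f = refl
∑-*ʳ (x ∷ xs) k f = trans (cong (f x ℕ.* k ℕ.+_) (∑-*ʳ xs k f)) (sym (ℕP.*-distribʳ-+ k (f x) _))

∑-const : (xs : List 𝒜) (k : ℕ) → ∑ xs (λ _ → k) ≡ length xs ℕ.* k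
∑-const [] k = refl
∑-const (x ∷ xs) k = cong (k ℕ.+_) (∑-const xs k)

∑-zero : (xs : List 𝒜) → ∑ xs (λ _ → 0) ≡ 0
∑-zero xs = trans (∑-const xs 0) (ℕP.*-zeroʳ (length xs))

∑-bound : (xs : List 𝒜) (k : ℕ) {f : 𝒜 → ℕ} → (∀ x → x ∈ xs → f x ℕ.≤ k) → ∑ xs f ℕ.≤ length xs ℕ.* k
∑-bound xs k h = ℕP.≤-trans (∑-mono xs h) (ℕP.≤-reflexive (∑-const xs k))

∑-swap : (xs : List 𝒜) (ys : List ℬ) (f : 𝒜 → ℬ → ℕ) → ∑ xs (λ x → ∑ ys (f x)) ≡ ∑ ys (λ y → ∑ xs (λ x → f x y))
∑-swap [] ys f = sym (∑-zero ys)
∑-swap (x ∷ xs) ys f = trans (cong (∑ ys (f x) ℕ.+_) (∑-swap xs ys f)) (sym (∑-+ ys (f x) _))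

∑-map : (g : 𝒜 → ℬ) (xs : List 𝒜) (f : ℬ → ℕ) → ∑ (map g xs) f ≡ ∑ xs (f ∘ g)
∑-map g [] f = refl
∑-map g (x ∷ xs) f = cong (f (g x) ℕ.+_) (∑-map g xs f)

∑-× : (xs : List 𝒜) (ys : List ℬ) (f : 𝒜 × ℬ → ℕ) → ∑ (cartesianProduct xs ys) f ≡ ∑ xs (λ x → ∑ ys (λ y → f (x , y)))
∑-× [] ys f = refl
∑-× (x ∷ xs) ys f = trans (∑-++ (map (x ,_) ys) _ f) (cong₂ ℕ._+_ (∑-map (x ,_) ys f) (∑-× xs ys f))

∑-product : (xs : List 𝒜) (ys : List ℬ) (f : 𝒜 → ℕ) (g : ℬ → ℕ) → ∑ xs (λ x → ∑ ys (λ y → f x ℕ.* g y)) ≡ ∑ xs f ℕ.* ∑ ys g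
∑-product xs ys f g = trans (∑-cong xs λ x _ → ∑-*ˡ ys (f x) g) (∑-*ʳ xs (∑ ys g) f)

∑-elem : (xs : List 𝒜) (f : 𝒜 → ℕ) {x : 𝒜} → x ∈ xs → f x ℕ.≤ ∑ xs f
∑-elem (x ∷ xs) f (here refl) = ℕP.m≤m+n (f x) _
∑-elem (x ∷ xs) f (there m) = ℕP.≤-trans (∑-elem xs f m) (ℕP.m≤n+m _ (f x))

-- indicator of a decidable proposition
⟦_⟧ : {P : Set ℓ″} → Dec P → ℕ
⟦ yes _ ⟧ = 1
⟦ no _ ⟧ = 0

⟦⟧-yes : {P : Set ℓ″} (d : Dec P) → P → ⟦ d ⟧ ≡ 1
⟦⟧-yes (yes _) _ = refl
⟦⟧-yes (no ¬p) p = contradiction p ¬p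

⟦⟧-no : {P : Set ℓ″} (d : Dec P) → ¬ P → ⟦ d ⟧ ≡ 0
⟦⟧-no (yes p) ¬p = contradiction p ¬p
⟦⟧-no (no _) _ = refl

⟦⟧-≤ : {P : Set ℓ″} (d : Dec P) {n : ℕ} → (P → 1 ℕ.≤ n) → ⟦ d ⟧ ℕ.≤ n
⟦⟧-≤ (yes p) h = h p
⟦⟧-≤ (no _) h = z≤n

⟦⟧≤1 : {P : Set ℓ″} (d : Dec P) → ⟦ d ⟧ ℕ.≤ 1
⟦⟧≤1 d = ⟦⟧-≤ d λ _ → ℕP.≤-refl

⟦⟧-1≤ : {P : Set ℓ″} (d : Dec P) → P → 1 ℕ.≤ ⟦ d ⟧
⟦⟧-1≤ d p = ℕP.≤-reflexive (sym (⟦⟧-yes d p))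

⟦⟧-mono : {P : Set ℓ} {Q : Set ℓ′} (d : Dec P) (e : Dec Q) → (P → Q) → ⟦ d ⟧ ℕ.≤ ⟦ e ⟧
⟦⟧-mono d e h = ⟦⟧-≤ d λ p → ⟦⟧-1≤ e (h p)

⟦⟧-*-mono : {P : Set ℓ} (d : Dec P) {m n : ℕ} → (P → m ℕ.≤ n) → ⟦ d ⟧ ℕ.* m ℕ.≤ ⟦ d ⟧ ℕ.* n
⟦⟧-*-mono (yes p) h = ℕP.*-monoʳ-≤ 1 (h p)
⟦⟧-*-mono (no _) h = z≤n

length-filter-∑ : {P : 𝒜 → Set ℓ″} (P? : ∀ x → Dec (P x)) (xs : List 𝒜) → length (filter P? xs) ≡ ∑ xs (λ x → ⟦ P? x ⟧)
length-filter-∑ P? [] = refl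
length-filter-∑ P? (x ∷ xs) with P? x
... | yes _ = cong suc (length-filter-∑ P? xs)
... | no _ = length-filter-∑ P? xs

∑-filter : {P : 𝒜 → Set ℓ″} (P? : ∀ x → Dec (P x)) (xs : List 𝒜) (f : 𝒜 → ℕ) → ∑ (filter P? xs) f ≡ ∑ xs (λ x → ⟦ P? x ⟧ ℕ.* f x)
∑-filter P? [] f = refl
∑-filter P? (x ∷ xs) f with P? x
... | yes _ = cong₂ ℕ._+_ (sym (ℕP.+-identityʳ (f x))) (∑-filter P? xs f)
... | no _ = ∑-filter P? xs f

∑-remove : (as : List 𝒜) (x : 𝒜) (bs : List 𝒜) (f : 𝒜 → ℕ) → ∑ (as ++ x ∷ bs) f ≡ f x ℕ.+ ∑ (as ++ bs) f
∑-remove as x bs f = trans (∑-++ as (x ∷ bs) f) (trans (lem (∑ as f) (f x) (∑ bs f)) (cong (f x ℕ.+_) (sym (∑-++ as bs f))))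
  where lem : ∀ a b c → a ℕ.+ (b ℕ.+ c) ≡ b ℕ.+ (a ℕ.+ c)
        lem = solveℕ-∀

∈-remove : (as : List 𝒜) {x y : 𝒜} {bs : List 𝒜} → y ∈ as ++ x ∷ bs → ¬ y ≡ x → y ∈ as ++ bs
∈-remove as {bs = bs} m ne with ∈-++⁻ as m
... | inj₁ m' = ∈-++⁺ˡ m'
... | inj₂ (here e) = contradiction e ne
... | inj₂ (there m') = ∈-++⁺ʳ as m'

-- The image of the head is cut out of `ys`; injectivity keeps the images of the tail in what is
-- left.
∑-injection : (xs : List 𝒜) {ys : List ℬ} (g : 𝒜 → ℬ) (F : ℬ → ℕ) → Unique xs → (∀ x → x ∈ xs → g x ∈ ys) →
  (∀ x y → x ∈ xs → y ∈ xs → g x ≡ g y → x ≡ y) → ∑ xs (F ∘ g) ℕ.≤ ∑ ys F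
∑-injection [] g F u h inj = z≤n
∑-injection (x ∷ xs) g F (x∉ ∷ u) h inj with ∈-∃++ (h x (here refl))
... | as , bs , refl = ℕP.≤-trans (ℕP.+-monoʳ-≤ (F (g x)) (∑-injection xs g F u
        (λ y m → ∈-remove as (h y (there m)) λ e → All.lookup x∉ m (inj x y (here refl) (there m) (sym e)))
        (λ y z m m' → inj y z (there m) (there m'))))
        (ℕP.≤-reflexive (sym (∑-remove as (g x) bs F)))

-- The form in which solutions are counted by encoding them: membership and injectivity are asked
-- only of elements satisfying `P`, and the code may be required to satisfy a condition `Q` of its
-- own.
count-injection : {P : 𝒜 → Set ℓ″} {Q : ℬ → Set ℓ′} (P? : ∀ x → Dec (P x)) (Q? : ∀ x → Dec (Q x)) (xs : List 𝒜) {ys : List ℬ} (g : 𝒜 → ℬ) → Unique xs →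
  (∀ x → x ∈ xs → P x → g x ∈ ys × Q (g x)) →
  (∀ x y → x ∈ xs → y ∈ xs → P x → P y → g x ≡ g y → x ≡ y) → ∑ xs (λ x → ⟦ P? x ⟧) ℕ.≤ ∑ ys (λ y → ⟦ Q? y ⟧)
count-injection P? Q? [] g u h inj = z≤n
count-injection P? Q? (x ∷ xs) g (x∉ ∷ u) h inj with P? x
... | no _ = count-injection P? Q? xs g u (λ y m → h y (there m)) (λ y z m m' → inj y z (there m) (there m'))
... | yes px with h x (here refl) px
... | gx∈ , qx with ∈-∃++ gx∈
... | as , bs , refl = ℕP.≤-trans (ℕP.+-mono-≤ (⟦⟧-1≤ (Q? (g x)) qx) (count-injection P? Q? xs g u
        (λ y m py → ∈-remove as (proj₁ (h y (there m) py)) (λ e → All.lookup x∉ m (inj x y (here refl) (there m) px py (sym e))) , proj₂ (h y (there m) py))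
        (λ y z m m' → inj y z (there m) (there m'))))
        (ℕP.≤-reflexive (sym (∑-remove as (g x) bs _)))

count≤1 : {P : 𝒜 → Set ℓ″} (P? : ∀ x → Dec (P x)) (xs : List 𝒜) → Unique xs →
  (∀ x y → x ∈ xs → y ∈ xs → P x → P y → x ≡ y) → ∑ xs (λ x → ⟦ P? x ⟧) ℕ.≤ 1
count≤1 P? [] u h = z≤n
count≤1 P? (x ∷ xs) (x∉ ∷ u) h with P? x
... | no _ = count≤1 P? xs u (λ y z m m' → h y z (there m) (there m'))
... | yes px = s≤s (ℕP.≤-reflexive (trans (∑-cong xs λ y m → ⟦⟧-no (P? y) λ py → All.lookup x∉ m (h x y (here refl) (there m) px py)) (∑-zero xs)))

-- Finite sums of integers

∑ℤ : List 𝒜 → (𝒜 → ℤ) → ℤ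
∑ℤ [] f = 0ℤ
∑ℤ (x ∷ xs) f = f x ℤ.+ ∑ℤ xs f

∑ℤ-cong : (xs : List 𝒜) {f g : 𝒜 → ℤ} → (∀ x → x ∈ xs → f x ≡ g x) → ∑ℤ xs f ≡ ∑ℤ xs g
∑ℤ-cong [] h = refl
∑ℤ-cong (x ∷ xs) h = cong₂ ℤ._+_ (h x (here refl)) (∑ℤ-cong xs λ y m → h y (there m))

∑ℤ-mono : (xs : List 𝒜) {f g : 𝒜 → ℤ} → (∀ x → x ∈ xs → f x ℤ.≤ g x) → ∑ℤ xs f ℤ.≤ ∑ℤ xs g
∑ℤ-mono [] h = ℤP.≤-refl
∑ℤ-mono (x ∷ xs) h = ℤP.+-mono-≤ (h x (here refl)) (∑ℤ-mono xs λ y m → h y (there m))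

∑ℤ-0 : (xs : List 𝒜) → ∑ℤ xs (λ _ → 0ℤ) ≡ 0ℤ
∑ℤ-0 [] = refl
∑ℤ-0 (x ∷ xs) = trans (ℤP.+-identityˡ _) (∑ℤ-0 xs)

∑ℤ-nonneg : (xs : List 𝒜) {f : 𝒜 → ℤ} → (∀ x → x ∈ xs → 0ℤ ℤ.≤ f x) → 0ℤ ℤ.≤ ∑ℤ xs f
∑ℤ-nonneg xs h = ℤP.≤-trans (ℤP.≤-reflexive (sym (∑ℤ-0 xs))) (∑ℤ-mono xs h)

∑ℤ-+ : (xs : List 𝒜) (f g : 𝒜 → ℤ) → ∑ℤ xs (λ x → f x ℤ.+ g x) ≡ ∑ℤ xs f ℤ.+ ∑ℤ xs g
∑ℤ-+ [] f g = refl
∑ℤ-+ (x ∷ xs) f g = trans (cong (λ s → f x ℤ.+ g x ℤ.+ s) (∑ℤ-+ xs f g)) (lem (f x) (g x) (∑ℤ xs f) (∑ℤ xs g))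
  where lem : ∀ a b c d → a ℤ.+ b ℤ.+ (c ℤ.+ d) ≡ a ℤ.+ c ℤ.+ (b ℤ.+ d)
        lem = solve-∀

∑ℤ-*ˡ : (xs : List 𝒜) (k : ℤ) (f : 𝒜 → ℤ) → ∑ℤ xs (λ x → k ℤ.* f x) ≡ k ℤ.* ∑ℤ xs f
∑ℤ-*ˡ [] k f = sym (ℤP.*-zeroʳ k)
∑ℤ-*ˡ (x ∷ xs) k f = trans (cong (λ s → k ℤ.* f x ℤ.+ s) (∑ℤ-*ˡ xs k f)) (sym (ℤP.*-distribˡ-+ k (f x) _))

∑ℤ-*ʳ : (xs : List 𝒜) (k : ℤ) (f : 𝒜 → ℤ) → ∑ℤ xs (λ x → f x ℤ.* k) ≡ ∑ℤ xs f ℤ.* k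
∑ℤ-*ʳ xs k f = trans (∑ℤ-cong xs λ x _ → ℤP.*-comm (f x) k) (trans (∑ℤ-*ˡ xs k f) (ℤP.*-comm k _))

∑ℤ-const : (xs : List 𝒜) (k : ℤ) → ∑ℤ xs (λ _ → k) ≡ + length xs ℤ.* k
∑ℤ-const [] k = refl
∑ℤ-const (x ∷ xs) k = trans (cong (λ s → k ℤ.+ s) (∑ℤ-const xs k)) (lem (+ length xs) k)
  where lem : ∀ n k → k ℤ.+ n ℤ.* k ≡ (+ 1 ℤ.+ n) ℤ.* k
        lem = solve-∀

∑ℤ-swap : (xs : List 𝒜) (ys : List ℬ) (f : 𝒜 → ℬ → ℤ) → ∑ℤ xs (λ x → ∑ℤ ys (f x)) ≡ ∑ℤ ys (λ y → ∑ℤ xs (λ x → f x y))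
∑ℤ-swap [] ys f = sym (∑ℤ-0 ys)
∑ℤ-swap (x ∷ xs) ys f = trans (cong (λ s → ∑ℤ ys (f x) ℤ.+ s) (∑ℤ-swap xs ys f)) (sym (∑ℤ-+ ys (f x) _))

∑ℤ-++ : (xs ys : List 𝒜) (f : 𝒜 → ℤ) → ∑ℤ (xs ++ ys) f ≡ ∑ℤ xs f ℤ.+ ∑ℤ ys f
∑ℤ-++ [] ys f = sym (ℤP.+-identityˡ _)
∑ℤ-++ (x ∷ xs) ys f = trans (cong (λ s → f x ℤ.+ s) (∑ℤ-++ xs ys f)) (sym (ℤP.+-assoc (f x) _ _))

∑ℤ-map : (g : 𝒜 → ℬ) (xs : List 𝒜) (f : ℬ → ℤ) → ∑ℤ (map g xs) f ≡ ∑ℤ xs (f ∘ g)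
∑ℤ-map g [] f = refl
∑ℤ-map g (x ∷ xs) f = cong (λ s → f (g x) ℤ.+ s) (∑ℤ-map g xs f)

∑ℤ-pos : (xs : List 𝒜) (f : 𝒜 → ℕ) → ∑ℤ xs (λ x → + f x) ≡ + ∑ xs f
∑ℤ-pos [] f = refl
∑ℤ-pos (x ∷ xs) f = cong (λ s → + f x ℤ.+ s) (∑ℤ-pos xs f)

∑ℤ-elem : (xs : List 𝒜) (f : 𝒜 → ℤ) → (∀ x → x ∈ xs → 0ℤ ℤ.≤ f x) → ∀ {x} → x ∈ xs → f x ℤ.≤ ∑ℤ xs f
∑ℤ-elem (x ∷ xs) f h (here refl) = ℤP.≤-trans (ℤP.≤-reflexive (sym (ℤP.+-identityʳ (f x)))) (ℤP.+-monoʳ-≤ (f x) (∑ℤ-nonneg xs λ y m → h y (there m)))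
∑ℤ-elem (x ∷ xs) f h (there m) = ℤP.≤-trans (∑ℤ-elem xs f (λ y m → h y (there m)) m) (ℤP.≤-trans (ℤP.≤-reflexive (sym (ℤP.+-identityˡ _))) (ℤP.+-monoˡ-≤ _ (h x (here refl))))

-- An injection between duplicate-free lists of equal length is onto, so it reindexes the sum. This
-- gives invariance under translation by a group element.
∑ℤ-bijection : (xs : List 𝒜) {ys : List ℬ} (g : 𝒜 → ℬ) (F : ℬ → ℤ) → Unique xs → length xs ≡ length ys → (∀ x → x ∈ xs → g x ∈ ys) →
  (∀ x y → x ∈ xs → y ∈ xs → g x ≡ g y → x ≡ y) → ∑ℤ xs (F ∘ g) ≡ ∑ℤ ys F
∑ℤ-bijection [] {[]} g F u len h inj = refl
∑ℤ-bijection (x ∷ xs) g F (x∉ ∷ u) len h inj with ∈-∃++ (h x (here refl))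
... | as , bs , refl = trans (cong (λ s → F (g x) ℤ.+ s) (∑ℤ-bijection xs g F u
        (ℕP.suc-injective (trans len (trans (length-++ as) (trans (ℕP.+-suc (length as) (length bs)) (cong suc (sym (length-++ as)))))))
        (λ y m → ∈-remove as (h y (there m)) λ e → All.lookup x∉ m (inj x y (here refl) (there m) (sym e)))
        (λ y z m m' → inj y z (there m) (there m'))))
        (trans (cong (λ s → F (g x) ℤ.+ s) (∑ℤ-++ as bs F)) (trans (lem (F (g x)) (∑ℤ as F) (∑ℤ bs F)) (sym (∑ℤ-++ as (g x ∷ bs) F))))
  where lem : ∀ a b c → a ℤ.+ (b ℤ.+ c) ≡ b ℤ.+ (a ℤ.+ c)
        lem = solve-∀

-- Integer vectors and 3 × 3 matrices

record V3 : Set where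
  constructor v3
  field vx vy vz : ℤ
open V3 public

record M3 : Set where
  constructor mat
  field a₁₁ a₁₂ a₁₃ a₂₁ a₂₂ a₂₃ a₃₁ a₃₂ a₃₃ : ℤ

v3-≡ : ∀ {a b c a' b' c'} → a ≡ a' → b ≡ b' → c ≡ c' → v3 a b c ≡ v3 a' b' c'
v3-≡ refl refl refl = refl

mat-≡ : ∀ {a b c d e f g h i a' b' c' d' e' f' g' h' i'} → a ≡ a' → b ≡ b' → c ≡ c' → d ≡ d' → e ≡ e' → f ≡ f' → g ≡ g' → h ≡ h' → i ≡ i' →
  mat a b c d e f g h i ≡ mat a' b' c' d' e' f' g' h' i'
mat-≡ refl refl refl refl refl refl refl refl refl = refl

infixl 7 _·_ _⊙_ _∙_
infixl 6 _⊞_ _⊟_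
infixl 8 _×ᵥ_
infixr 7 _⋆_

_∙_ : V3 → V3 → ℤ
v3 a b c ∙ v3 a' b' c' = a * a' + b * b' + c * c'

_×ᵥ_ : V3 → V3 → V3
v3 a b c ×ᵥ v3 a' b' c' = v3 (b * c' - c * b') (c * a' - a * c') (a * b' - b * a')

_⋆_ : ℤ → V3 → V3
k ⋆ v3 a b c = v3 (k * a) (k * b) (k * c)

_⊞_ _⊟_ : V3 → V3 → V3
v3 a b c ⊞ v3 a' b' c' = v3 (a + a') (b + b') (c + c')
v3 a b c ⊟ v3 a' b' c' = v3 (a - a') (b - b') (c - c')

row₁ row₂ row₃ : M3 → V3
row₁ (mat a b c d e f g h i) = v3 a b c
row₂ (mat a b c d e f g h i) = v3 d e f
row₃ (mat a b c d e f g h i) = v3 g h i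

rows : V3 → V3 → V3 → M3
rows (v3 a b c) (v3 d e f) (v3 g h i) = mat a b c d e f g h i

_⊙_ : M3 → V3 → V3
g ⊙ v = v3 (row₁ g ∙ v) (row₂ g ∙ v) (row₃ g ∙ v)

transpose : M3 → M3
transpose (mat a b c d e f g h i) = mat a d g b e h c f i

_·_ : M3 → M3 → M3
mat a b c d e f g h i · mat a' b' c' d' e' f' g' h' i' =
  mat (a * a' + b * d' + c * g') (a * b' + b * e' + c * h') (a * c' + b * f' + c * i')
      (d * a' + e * d' + f * g') (d * b' + e * e' + f * h') (d * c' + e * f' + f * i')
      (g * a' + h * d' + i * g') (g * b' + h * e' + i * h') (g * c' + h * f' + i * i')

det : M3 → ℤ
det (mat a b c d e f g h i) = a * (e * i - f * h) - b * (d * i - f * g) + c * (d * h - e * g)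

-- The signed minors without transposition: for determinant one this is the inverse transpose, by
-- which normal vectors of planes are moved.
cof : M3 → M3
cof (mat a b c d e f g h i) = mat (e * i - f * h) (f * g - d * i) (d * h - e * g) (h * c - i * b) (i * a - g * c) (g * b - h * a) (b * f - c * e) (c * d - a * f) (a * e - b * d)

𝟙 : M3
𝟙 = mat 1ℤ 0ℤ 0ℤ 0ℤ 1ℤ 0ℤ 0ℤ 0ℤ 1ℤ

inverse : M3 → M3
inverse g = transpose (cof g)

SL : M3 → Set
SL g = det g ≡ 1ℤ

scalar : ℤ → M3
scalar k = mat k 0ℤ 0ℤ 0ℤ k 0ℤ 0ℤ 0ℤ k

·-assoc : ∀ g h k → (g · h) · k ≡ g · (h · k)
·-assoc (mat a b c d e f g h i) (mat a' b' c' d' e' f' g' h' i') (mat k₁ k₂ k₃ k₄ k₅ k₆ k₇ k₈ k₉) =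
  mat-≡ (l a b c a' b' c' d' e' f' g' h' i' k₁ k₄ k₇) (l a b c a' b' c' d' e' f' g' h' i' k₂ k₅ k₈) (l a b c a' b' c' d' e' f' g' h' i' k₃ k₆ k₉)
        (l d e f a' b' c' d' e' f' g' h' i' k₁ k₄ k₇) (l d e f a' b' c' d' e' f' g' h' i' k₂ k₅ k₈) (l d e f a' b' c' d' e' f' g' h' i' k₃ k₆ k₉)
        (l g h i a' b' c' d' e' f' g' h' i' k₁ k₄ k₇) (l g h i a' b' c' d' e' f' g' h' i' k₂ k₅ k₈) (l g h i a' b' c' d' e' f' g' h' i' k₃ k₆ k₉)
  where
    l : ∀ a b c a' b' c' d' e' f' g' h' i' x y z →
      (a * a' + b * d' + c * g') * x + (a * b' + b * e' + c * h') * y + (a * c' + b * f' + c * i') * z ≡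
      a * (a' * x + b' * y + c' * z) + b * (d' * x + e' * y + f' * z) + c * (g' * x + h' * y + i' * z)
    l = solve-∀

⊙-· : ∀ g h v → (g · h) ⊙ v ≡ g ⊙ (h ⊙ v)
⊙-· (mat a b c d e f g h i) (mat a' b' c' d' e' f' g' h' i') (v3 x y z) =
  v3-≡ (l a b c a' b' c' d' e' f' g' h' i' x y z) (l d e f a' b' c' d' e' f' g' h' i' x y z) (l g h i a' b' c' d' e' f' g' h' i' x y z)
  where
    l : ∀ a b c a' b' c' d' e' f' g' h' i' x y z →
      (a * a' + b * d' + c * g') * x + (a * b' + b * e' + c * h') * y + (a * c' + b * f' + c * i') * z ≡
      a * (a' * x + b' * y + c' * z) + b * (d' * x + e' * y + f' * z) + c * (g' * x + h' * y + i' * z)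
    l = solve-∀

·-identityˡ : ∀ g → 𝟙 · g ≡ g
·-identityˡ (mat a b c d e f g h i) = mat-≡ (l₁ a d g) (l₁ b e h) (l₁ c f i) (l₂ a d g) (l₂ b e h) (l₂ c f i) (l₃ a d g) (l₃ b e h) (l₃ c f i)
  where
    l₁ : ∀ x y z → 1ℤ * x + 0ℤ * y + 0ℤ * z ≡ x
    l₁ = solve-∀
    l₂ : ∀ x y z → 0ℤ * x + 1ℤ * y + 0ℤ * z ≡ y
    l₂ = solve-∀
    l₃ : ∀ x y z → 0ℤ * x + 0ℤ * y + 1ℤ * z ≡ z
    l₃ = solve-∀

·-identityʳ : ∀ g → g · 𝟙 ≡ g
·-identityʳ (mat a b c d e f g h i) = mat-≡ (l₁ a b c) (l₂ a b c) (l₃ a b c) (l₁ d e f) (l₂ d e f) (l₃ d e f) (l₁ g h i) (l₂ g h i) (l₃ g h i)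
  where
    l₁ : ∀ x y z → x * 1ℤ + y * 0ℤ + z * 0ℤ ≡ x
    l₁ = solve-∀
    l₂ : ∀ x y z → x * 0ℤ + y * 1ℤ + z * 0ℤ ≡ y
    l₂ = solve-∀
    l₃ : ∀ x y z → x * 0ℤ + y * 0ℤ + z * 1ℤ ≡ z
    l₃ = solve-∀

𝟙-⊙ : ∀ v → 𝟙 ⊙ v ≡ v
𝟙-⊙ (v3 x y z) = v3-≡ (l₁ x y z) (l₂ x y z) (l₃ x y z)
  where
    l₁ : ∀ x y z → 1ℤ * x + 0ℤ * y + 0ℤ * z ≡ x
    l₁ = solve-∀
    l₂ : ∀ x y z → 0ℤ * x + 1ℤ * y + 0ℤ * z ≡ y
    l₂ = solve-∀
    l₃ : ∀ x y z → 0ℤ * x + 0ℤ * y + 1ℤ * z ≡ z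
    l₃ = solve-∀

transpose-· : ∀ g h → transpose (g · h) ≡ transpose h · transpose g
transpose-· (mat a b c d e f g h i) (mat a' b' c' d' e' f' g' h' i') =
  mat-≡ (l a b c a' d' g') (l d e f a' d' g') (l g h i a' d' g') (l a b c b' e' h') (l d e f b' e' h') (l g h i b' e' h') (l a b c c' f' i') (l d e f c' f' i') (l g h i c' f' i')
  where
    l : ∀ a b c x y z → a * x + b * y + c * z ≡ x * a + y * b + z * c
    l = solve-∀

-- Each entry is an instance of the Cauchy-Binet formula for a minor of a product.
cof-· : ∀ g h → cof (g · h) ≡ cof g · cof h
cof-· (mat a b c d e f g h i) (mat a' b' c' d' e' f' g' h' i') =
  mat-≡ (l d e f g h i b' e' h' c' f' i') (l d e f g h i c' f' i' a' d' g') (l d e f g h i a' d' g' b' e' h')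
        (l g h i a b c b' e' h' c' f' i') (l g h i a b c c' f' i' a' d' g') (l g h i a b c a' d' g' b' e' h')
        (l a b c d e f b' e' h' c' f' i') (l a b c d e f c' f' i' a' d' g') (l a b c d e f a' d' g' b' e' h')
  where
    l : ∀ a b c a' b' c' x y z x' y' z' →
      (a * x + b * y + c * z) * (a' * x' + b' * y' + c' * z') - (a * x' + b * y' + c * z') * (a' * x + b' * y + c' * z) ≡
      (b * c' - c * b') * (y * z' - y' * z) + (c * a' - a * c') * (z * x' - z' * x) + (a * b' - b * a') * (x * y' - x' * y)
    l = solve-∀

cof-involutive : ∀ g → SL g → cof (cof g) ≡ g
cof-involutive (mat a b c d e f g h i) δ =
  mat-≡ (s a (l₁ a b c d e f g h i)) (s b (l₂ a b c d e f g h i)) (s c (l₃ a b c d e f g h i))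
        (s d (l₄ a b c d e f g h i)) (s e (l₅ a b c d e f g h i)) (s f (l₆ a b c d e f g h i))
        (s g (l₇ a b c d e f g h i)) (s h (l₈ a b c d e f g h i)) (s i (l₉ a b c d e f g h i))
  where
    D = a * (e * i - f * h) - b * (d * i - f * g) + c * (d * h - e * g)
    s : ∀ {x} y → x ≡ y * D → x ≡ y
    s y p = trans p (trans (cong (y *_) δ) (ℤP.*-identityʳ y))
    l₁ : ∀ a b c d e f g h i → (i * a - g * c) * (a * e - b * d) - (g * b - h * a) * (c * d - a * f) ≡ a * (a * (e * i - f * h) - b * (d * i - f * g) + c * (d * h - e * g))
    l₁ = solve-∀
    l₂ : ∀ a b c d e f g h i → (g * b - h * a) * (b * f - c * e) - (h * c - i * b) * (a * e - b * d) ≡ b * (a * (e * i - f * h) - b * (d * i - f * g) + c * (d * h - e * g))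
    l₂ = solve-∀
    l₃ : ∀ a b c d e f g h i → (h * c - i * b) * (c * d - a * f) - (i * a - g * c) * (b * f - c * e) ≡ c * (a * (e * i - f * h) - b * (d * i - f * g) + c * (d * h - e * g))
    l₃ = solve-∀
    l₄ : ∀ a b c d e f g h i → (c * d - a * f) * (d * h - e * g) - (a * e - b * d) * (f * g - d * i) ≡ d * (a * (e * i - f * h) - b * (d * i - f * g) + c * (d * h - e * g))
    l₄ = solve-∀
    l₅ : ∀ a b c d e f g h i → (a * e - b * d) * (e * i - f * h) - (b * f - c * e) * (d * h - e * g) ≡ e * (a * (e * i - f * h) - b * (d * i - f * g) + c * (d * h - e * g))
    l₅ = solve-∀
    l₆ : ∀ a b c d e f g h i → (b * f - c * e) * (f * g - d * i) - (c * d - a * f) * (e * i - f * h) ≡ f * (a * (e * i - f * h) - b * (d * i - f * g) + c * (d * h - e * g))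
    l₆ = solve-∀
    l₇ : ∀ a b c d e f g h i → (f * g - d * i) * (g * b - h * a) - (d * h - e * g) * (i * a - g * c) ≡ g * (a * (e * i - f * h) - b * (d * i - f * g) + c * (d * h - e * g))
    l₇ = solve-∀
    l₈ : ∀ a b c d e f g h i → (d * h - e * g) * (h * c - i * b) - (e * i - f * h) * (g * b - h * a) ≡ h * (a * (e * i - f * h) - b * (d * i - f * g) + c * (d * h - e * g))
    l₈ = solve-∀
    l₉ : ∀ a b c d e f g h i → (e * i - f * h) * (i * a - g * c) - (f * g - d * i) * (h * c - i * b) ≡ i * (a * (e * i - f * h) - b * (d * i - f * g) + c * (d * h - e * g))
    l₉ = solve-∀

·-inverseˡ : ∀ g → SL g → inverse g · g ≡ 𝟙
·-inverseˡ (mat a b c d e f g h i) δ = mat-≡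
    (trans (l₁ a b c d e f g h i) δ) (l₂ b e h c f i) (l₂′ b e h c f i)
    (l₃ a d g c f i) (trans (l₅ a b c d e f g h i) δ) (l₄ a d g c f i)
    (l₆ a d g b e h) (l₇ a d g b e h) (trans (l₉ a b c d e f g h i) δ)
  where
    l₁ : ∀ a b c d e f g h i → (e * i - f * h) * a + (h * c - i * b) * d + (b * f - c * e) * g ≡ a * (e * i - f * h) - b * (d * i - f * g) + c * (d * h - e * g)
    l₁ = solve-∀
    l₂ : ∀ b e h c f i → (e * i - f * h) * b + (h * c - i * b) * e + (b * f - c * e) * h ≡ 0ℤ
    l₂ = solve-∀
    l₂′ : ∀ b e h c f i → (e * i - f * h) * c + (h * c - i * b) * f + (b * f - c * e) * i ≡ 0ℤ
    l₂′ = solve-∀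
    l₃ : ∀ a d g c f i → (f * g - d * i) * a + (i * a - g * c) * d + (c * d - a * f) * g ≡ 0ℤ
    l₃ = solve-∀
    l₄ : ∀ a d g c f i → (f * g - d * i) * c + (i * a - g * c) * f + (c * d - a * f) * i ≡ 0ℤ
    l₄ = solve-∀
    l₅ : ∀ a b c d e f g h i → (f * g - d * i) * b + (i * a - g * c) * e + (c * d - a * f) * h ≡ a * (e * i - f * h) - b * (d * i - f * g) + c * (d * h - e * g)
    l₅ = solve-∀
    l₆ : ∀ a d g b e h → (d * h - e * g) * a + (g * b - h * a) * d + (a * e - b * d) * g ≡ 0ℤ
    l₆ = solve-∀
    l₇ : ∀ a d g b e h → (d * h - e * g) * b + (g * b - h * a) * e + (a * e - b * d) * h ≡ 0ℤ
    l₇ = solve-∀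
    l₉ : ∀ a b c d e f g h i → (d * h - e * g) * c + (g * b - h * a) * f + (a * e - b * d) * i ≡ a * (e * i - f * h) - b * (d * i - f * g) + c * (d * h - e * g)
    l₉ = solve-∀

det-𝟙 : SL 𝟙
det-𝟙 = refl

det-· : ∀ g h → det (g · h) ≡ det g * det h
det-· (mat a b c d e f g h i) k@(mat a' b' c' d' e' f' g' h' i') =
  trans (l (a * a' + b * d' + c * g') (a * b' + b * e' + c * h') (a * c' + b * f' + c * i') (d * a' + e * d' + f * g') (d * b' + e * e' + f * h') (d * c' + e * f' + f * i')
           (g * a' + h * d' + i * g') (g * b' + h * e' + i * h') (g * c' + h * f' + i * i'))
  (trans (cong (λ m → (a * a' + b * d' + c * g') * M3.a₁₁ m + (a * b' + b * e' + c * h') * M3.a₁₂ m + (a * c' + b * f' + c * i') * M3.a₁₃ m) (cof-· (mat a b c d e f g h i) k))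
  (l' a b c (e * i - f * h) (f * g - d * i) (d * h - e * g) a' b' c' d' e' f' g' h' i' ⟫ cong (_* det k) (l a b c d e f g h i)))
  where
    _⟫_ : ∀ {x y z : ℤ} → x ≡ y → z ≡ y → x ≡ z
    p ⟫ q = trans p (sym q)
    l : ∀ a b c d e f g h i → a * (e * i - f * h) - b * (d * i - f * g) + c * (d * h - e * g) ≡ a * (e * i - f * h) + b * (f * g - d * i) + c * (d * h - e * g)
    l = solve-∀
    l' : ∀ a b c x y z a' b' c' d' e' f' g' h' i' →
      (a * a' + b * d' + c * g') * (x * (e' * i' - f' * h') + y * (h' * c' - i' * b') + z * (b' * f' - c' * e')) +
      (a * b' + b * e' + c * h') * (x * (f' * g' - d' * i') + y * (i' * a' - g' * c') + z * (c' * d' - a' * f')) +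
      (a * c' + b * f' + c * i') * (x * (d' * h' - e' * g') + y * (g' * b' - h' * a') + z * (a' * e' - b' * d')) ≡
      (a * x + b * y + c * z) * (a' * (e' * i' - f' * h') - b' * (d' * i' - f' * g') + c' * (d' * h' - e' * g'))
    l' = solve-∀

cof-transpose : ∀ g → cof (transpose g) ≡ transpose (cof g)
cof-transpose (mat a b c d e f g h i) =
  mat-≡ (l e i h f) (l h c b i) (l b f e c) (l f g i d) (l i a c g) (l c d f a) (l d h g e) (l g b a h) (l a e d b)
  where
    l : ∀ x y z w → x * y - z * w ≡ x * y - w * z
    l = solve-∀

inverse-involutive : ∀ g → SL g → inverse (inverse g) ≡ g
inverse-involutive g δ = trans (cong transpose (cof-transpose (cof g))) (cof-involutive g δ)

SL-inverse : ∀ g → SL g → SL (inverse g)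
SL-inverse g δ = trans (sym (ℤP.*-identityʳ _)) (trans (cong (det (inverse g) *_) (sym δ)) (trans (sym (det-· (inverse g) g)) (cong det (·-inverseˡ g δ))))

SL-· : ∀ g h → SL g → SL h → SL (g · h)
SL-· g h δ ε = trans (det-· g h) (cong₂ _*_ δ ε)

·-inverseʳ : ∀ g → SL g → g · inverse g ≡ 𝟙
·-inverseʳ g δ = trans (cong (_· inverse g) (sym (inverse-involutive g δ))) (·-inverseˡ (inverse g) (SL-inverse g δ))

inverse-· : ∀ g h → inverse (g · h) ≡ inverse h · inverse g
inverse-· g h = trans (cong transpose (cof-· g h)) (transpose-· (cof g) (cof h))

SL-cof : ∀ g → SL g → SL (cof g)
SL-cof g δ = trans (det-transpose (cof g)) (SL-inverse g δ)
  where
    det-transpose : ∀ m → det m ≡ det (transpose m)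
    det-transpose (mat a b c d e f g h i) = l a b c d e f g h i
      where l : ∀ a b c d e f g h i → a * (e * i - f * h) - b * (d * i - f * g) + c * (d * h - e * g) ≡ a * (e * i - h * f) - d * (b * i - h * c) + g * (b * f - e * c)
            l = solve-∀

-- Cauchy-Binet for the minors of two vectors. It lets collinearity be tested before or after
-- applying an invertible matrix.
×ᵥ-⊙ : ∀ g u v → (g ⊙ u) ×ᵥ (g ⊙ v) ≡ cof g ⊙ (u ×ᵥ v)
×ᵥ-⊙ (mat a b c d e f g h i) (v3 x y z) (v3 x' y' z') = v3-≡ (l d e f g h i x y z x' y' z') (l g h i a b c x y z x' y' z') (l a b c d e f x y z x' y' z')
  where
    l : ∀ a b c a' b' c' x y z x' y' z' →
      (a * x + b * y + c * z) * (a' * x' + b' * y' + c' * z') - (a' * x + b' * y + c' * z) * (a * x' + b * y' + c * z') ≡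
      (b * c' - c * b') * (y * z' - z * y') + (c * a' - a * c') * (z * x' - x * z') + (a * b' - b * a') * (x * y' - y * x')
    l = solve-∀

∙-⊙ : ∀ g u v → (transpose g ⊙ u) ∙ v ≡ u ∙ (g ⊙ v)
∙-⊙ (mat a b c d e f g h i) (v3 x y z) (v3 x' y' z') = l a b c d e f g h i x y z x' y' z'
  where
    l : ∀ a b c d e f g h i x y z x' y' z' → (a * x + d * y + g * z) * x' + (b * x + e * y + h * z) * y' + (c * x + f * y + i * z) * z' ≡
      x * (a * x' + b * y' + c * z') + y * (d * x' + e * y' + f * z') + z * (g * x' + h * y' + i * z')
    l = solve-∀

_≟ᴹ_ : (g h : M3) → Dec (g ≡ h)
mat a b c d e f g h i ≟ᴹ mat a' b' c' d' e' f' g' h' i' =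
  map′ (λ { (p₁ , p₂ , p₃ , p₄ , p₅ , p₆ , p₇ , p₈ , p₉) → mat-≡ p₁ p₂ p₃ p₄ p₅ p₆ p₇ p₈ p₉ })
       (λ { refl → refl , refl , refl , refl , refl , refl , refl , refl , refl })
       (a ℤ.≟ a' ×-dec b ℤ.≟ b' ×-dec c ℤ.≟ c' ×-dec d ℤ.≟ d' ×-dec e ℤ.≟ e' ×-dec f ℤ.≟ f' ×-dec g ℤ.≟ g' ×-dec h ℤ.≟ h' ×-dec i ℤ.≟ i')

_≟ⱽ_ : (v w : V3) → Dec (v ≡ w)
v3 a b c ≟ⱽ v3 a' b' c' = map′ (λ { (p , q , r) → v3-≡ p q r }) (λ { refl → refl , refl , refl }) (a ℤ.≟ a' ×-dec b ℤ.≟ b' ×-dec c ℤ.≟ c')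

-- The sum-of-squares certificate

-- Conjugations by signed permutation matrices, written out on entries so that evaluating the
-- certificate only permutes entries and flips signs.
swap₁₂ cycle sign₁ sign₂ : M3 → M3
swap₁₂ (mat a b c d e f g h i) = mat e d (- f) b a (- c) (- h) (- g) i
cycle (mat a b c d e f g h i) = mat e f d h i g b c a
sign₁ (mat a b c d e f g h i) = mat a (- b) (- c) (- d) e f (- g) h i
sign₂ (mat a b c d e f g h i) = mat a (- b) c (- d) e (- f) g (- h) i

Symmetry : Set
Symmetry = Bool × ℕ × Bool × Bool

iterateCycle : ℕ → M3 → M3
iterateCycle zero t = t
iterateCycle (suc k) t = cycle (iterateCycle k t)

optionally : Bool → (M3 → M3) → M3 → M3
optionally true φ t = φ t
optionally false φ t = t

apply : Symmetry → M3 → M3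
apply (w , k , x , y) t = optionally y sign₂ (optionally x sign₁ (iterateCycle k (optionally w swap₁₂ t)))

-- The coefficients at `el` of three elements of the group ring whose squares form the certificate.
-- `sym-el` carries `el` to a chosen representative of its orbit under the symmetries, so that
-- equivalent quotients merge early in the Gram table.
record Entry : Set where
  constructor entry
  field ξ₁ ξ₂ ξ₃ : ℤ
        sym-el : Symmetry
        el : M3
open Entry

-- Each of the three coefficient columns adds up to zero, as `total ≡ 0` forces, since `Δ` has total
-- zero as well. Apart from that the squares only approximate a multiple of `20 Δ² − Δ`; the
-- discrepancy goes into the favourable remainder.
cert : List Entry
cert =
  entry -[1+ 26766 ] (+ 0) (+ 0) (false , 0 , false , false) (mat 1ℤ 0ℤ 0ℤ 0ℤ 1ℤ 0ℤ 0ℤ 0ℤ 1ℤ) ∷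
  entry (+ 10739) (+ 3022) (+ 1229) (true , 1 , false , false) (mat 1ℤ 0ℤ 1ℤ 0ℤ 1ℤ 0ℤ 0ℤ 0ℤ 1ℤ) ∷
  entry -[1+ 8386 ] (+ 3022) -[1+ 1228 ] (false , 2 , false , false) (mat 1ℤ 0ℤ 0ℤ 0ℤ 1ℤ 0ℤ -[1+ 0 ] 0ℤ 1ℤ) ∷
  entry (+ 8985) -[1+ 2432 ] -[1+ 1393 ] (true , 0 , false , false) (mat 1ℤ 0ℤ 0ℤ -[1+ 0 ] 1ℤ 0ℤ 0ℤ 0ℤ 1ℤ) ∷
  entry (+ 9038) -[1+ 2339 ] (+ 1394) (false , 0 , false , false) (mat 1ℤ -[1+ 0 ] 0ℤ 0ℤ 1ℤ 0ℤ 0ℤ 0ℤ 1ℤ) ∷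
  entry (+ 22302) -[1+ 950 ] -[1+ 1217 ] (false , 1 , false , false) (mat 1ℤ 0ℤ 0ℤ 0ℤ 1ℤ -[1+ 0 ] 0ℤ 0ℤ 1ℤ) ∷
  entry (+ 9524) -[1+ 2339 ] -[1+ 1393 ] (true , 0 , false , true) (mat 1ℤ 0ℤ 0ℤ 1ℤ 1ℤ 0ℤ 0ℤ 0ℤ 1ℤ) ∷
  entry (+ 7617) -[1+ 319 ] (+ 1218) (true , 2 , false , false) (mat 1ℤ 0ℤ 0ℤ 0ℤ 1ℤ 0ℤ 0ℤ 1ℤ 1ℤ) ∷
  entry (+ 10739) (+ 3022) (+ 1229) (true , 1 , false , true) (mat 1ℤ 0ℤ -[1+ 0 ] 0ℤ 1ℤ 0ℤ 0ℤ 0ℤ 1ℤ) ∷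
  entry (+ 13862) -[1+ 950 ] (+ 1239) (true , 2 , false , true) (mat 1ℤ 0ℤ 0ℤ 0ℤ 1ℤ 0ℤ 0ℤ -[1+ 0 ] 1ℤ) ∷
  entry -[1+ 39076 ] -[1+ 319 ] -[1+ 1238 ] (false , 1 , false , true) (mat 1ℤ 0ℤ 0ℤ 0ℤ 1ℤ 1ℤ 0ℤ 0ℤ 1ℤ) ∷
  entry -[1+ 8386 ] (+ 3022) -[1+ 1228 ] (false , 2 , false , true) (mat 1ℤ 0ℤ 0ℤ 0ℤ 1ℤ 0ℤ 1ℤ 0ℤ 1ℤ) ∷
  entry (+ 19158) -[1+ 2432 ] (+ 1394) (false , 0 , false , true) (mat 1ℤ 1ℤ 0ℤ 0ℤ 1ℤ 0ℤ 0ℤ 0ℤ 1ℤ) ∷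
  entry -[1+ 9403 ] (+ 3867) (+ 1425) (false , 0 , false , false) (mat 1ℤ -[1+ 0 ] 0ℤ 0ℤ 1ℤ 0ℤ 0ℤ -[1+ 0 ] 1ℤ) ∷
  entry -[1+ 4081 ] (+ 4856) (+ 1455) (false , 0 , true , false) (mat 1ℤ 1ℤ 1ℤ 0ℤ 1ℤ 0ℤ 0ℤ 0ℤ 1ℤ) ∷
  entry (+ 1102) (+ 5863) -[1+ 313 ] (false , 2 , true , false) (mat 1ℤ 0ℤ 0ℤ 0ℤ 1ℤ 0ℤ 1ℤ 1ℤ 1ℤ) ∷
  entry -[1+ 3916 ] (+ 4367) (+ 314) (false , 1 , false , false) (mat 1ℤ 0ℤ -[1+ 0 ] 0ℤ 1ℤ -[1+ 0 ] 0ℤ 0ℤ 1ℤ) ∷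
  entry -[1+ 438 ] -[1+ 3149 ] (+ 314) (false , 1 , true , true) (mat 1ℤ 0ℤ 1ℤ 0ℤ 1ℤ -[1+ 0 ] 0ℤ 0ℤ 1ℤ) ∷
  entry -[1+ 3967 ] -[1+ 3311 ] (+ 797) (false , 0 , false , true) (mat 1ℤ 1ℤ 0ℤ 0ℤ 1ℤ 0ℤ 0ℤ 1ℤ 1ℤ) ∷
  entry (+ 5067) (+ 1058) -[1+ 313 ] (false , 2 , true , true) (mat 1ℤ 0ℤ 0ℤ 0ℤ 1ℤ 0ℤ -[1+ 0 ] 1ℤ 1ℤ) ∷
  entry -[1+ 7204 ] -[1+ 796 ] -[1+ 796 ] (false , 1 , false , false) (mat 1ℤ 0ℤ 0ℤ -[1+ 0 ] 1ℤ -[1+ 0 ] 0ℤ 0ℤ 1ℤ) ∷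
  entry -[1+ 2723 ] -[1+ 129 ] -[1+ 796 ] (false , 1 , true , true) (mat 1ℤ 0ℤ 0ℤ 1ℤ 1ℤ -[1+ 0 ] 0ℤ 0ℤ 1ℤ) ∷
  entry (+ 1802) -[1+ 1185 ] (+ 314) (false , 2 , false , true) (mat 1ℤ 0ℤ 0ℤ 0ℤ 1ℤ 0ℤ 1ℤ -[1+ 0 ] 1ℤ) ∷
  entry -[1+ 4603 ] -[1+ 184 ] (+ 1455) (false , 0 , false , false) (mat 1ℤ -[1+ 0 ] -[1+ 0 ] 0ℤ 1ℤ 0ℤ 0ℤ 0ℤ 1ℤ) ∷
  entry -[1+ 10204 ] -[1+ 2161 ] (+ 767) (false , 0 , true , true) (mat 1ℤ -[1+ 0 ] 1ℤ 0ℤ 1ℤ 0ℤ 0ℤ 0ℤ 1ℤ) ∷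
  entry -[1+ 5404 ] -[1+ 2645 ] (+ 797) (false , 0 , true , true) (mat 1ℤ -[1+ 0 ] 0ℤ 0ℤ 1ℤ 0ℤ 0ℤ 1ℤ 1ℤ) ∷
  entry (+ 1664) (+ 2892) -[1+ 766 ] (false , 2 , true , false) (mat 1ℤ 0ℤ 0ℤ -[1+ 0 ] 1ℤ 0ℤ 1ℤ 0ℤ 1ℤ) ∷
  entry (+ 3630) -[1+ 1709 ] (+ 314) (false , 2 , false , false) (mat 1ℤ 0ℤ 0ℤ 0ℤ 1ℤ 0ℤ -[1+ 0 ] -[1+ 0 ] 1ℤ) ∷
  entry -[1+ 2286 ] -[1+ 1797 ] -[1+ 1454 ] (false , 2 , false , false) (mat 1ℤ 0ℤ 0ℤ -[1+ 0 ] 1ℤ 0ℤ -[1+ 0 ] 0ℤ 1ℤ) ∷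
  entry (+ 10785) (+ 3899) -[1+ 313 ] (false , 1 , false , true) (mat 1ℤ 0ℤ 1ℤ 0ℤ 1ℤ 1ℤ 0ℤ 0ℤ 1ℤ) ∷
  entry (+ 5171) (+ 7135) -[1+ 313 ] (false , 1 , true , false) (mat 1ℤ 0ℤ -[1+ 0 ] 0ℤ 1ℤ 1ℤ 0ℤ 0ℤ 1ℤ) ∷
  entry (+ 6582) -[1+ 7308 ] -[1+ 1424 ] (false , 1 , false , true) (mat 1ℤ 0ℤ 0ℤ -[1+ 0 ] 1ℤ 1ℤ 0ℤ 0ℤ 1ℤ) ∷
  entry (+ 3801) -[1+ 2760 ] -[1+ 1424 ] (false , 1 , true , false) (mat 1ℤ 0ℤ 0ℤ 1ℤ 1ℤ 1ℤ 0ℤ 0ℤ 1ℤ) ∷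
  entry (+ 1459) -[1+ 4125 ] -[1+ 1454 ] (false , 2 , false , true) (mat 1ℤ 0ℤ 0ℤ 1ℤ 1ℤ 0ℤ 1ℤ 0ℤ 1ℤ) ∷
  entry -[1+ 705 ] -[1+ 680 ] (+ 1425) (false , 0 , true , false) (mat 1ℤ 1ℤ 0ℤ 0ℤ 1ℤ 0ℤ 0ℤ -[1+ 0 ] 1ℤ) ∷
  entry -[1+ 591 ] -[1+ 7874 ] (+ 767) (false , 0 , false , true) (mat 1ℤ 1ℤ -[1+ 0 ] 0ℤ 1ℤ 0ℤ 0ℤ 0ℤ 1ℤ) ∷
  entry -[1+ 381 ] (+ 5892) -[1+ 766 ] (false , 2 , true , true) (mat 1ℤ 0ℤ 0ℤ 1ℤ 1ℤ 0ℤ -[1+ 0 ] 0ℤ 1ℤ) ∷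
  entry (+ 11040) (+ 5662) (+ 1811) (false , 1 , false , false) (mat 1ℤ 0ℤ 1ℤ -[1+ 0 ] 1ℤ -[1+ 0 ] 0ℤ 0ℤ 1ℤ) ∷
  entry -[1+ 1400 ] -[1+ 605 ] (+ 1613) (true , 2 , true , false) (mat 1ℤ 0ℤ 0ℤ -[1+ 0 ] 1ℤ 0ℤ 0ℤ -[1+ 0 ] 1ℤ) ∷
  entry (+ 1922) -[1+ 1577 ] (+ 989) (true , 0 , true , false) (mat 1ℤ 0ℤ 0ℤ 1ℤ 1ℤ -[1+ 0 ] -[1+ 0 ] 0ℤ 1ℤ) ∷
  entry -[1+ 2399 ] -[1+ 5512 ] (+ 858) (true , 0 , true , false) (mat 1ℤ 0ℤ 1ℤ 1ℤ 1ℤ 0ℤ 0ℤ 0ℤ 1ℤ) ∷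
  entry (+ 10587) -[1+ 1180 ] -[1+ 1612 ] (true , 1 , false , true) (mat 1ℤ -[1+ 0 ] -[1+ 0 ] 0ℤ 1ℤ 1ℤ 0ℤ 0ℤ 1ℤ) ∷
  entry -[1+ 4279 ] (+ 1252) (+ 555) (false , 1 , true , true) (mat 1ℤ 0ℤ 0ℤ 0ℤ 1ℤ -[1+ 0 ] 1ℤ 0ℤ 1ℤ) ∷
  entry (+ 1441) (+ 7118) (+ 639) (true , 0 , false , true) (mat 1ℤ 0ℤ 0ℤ 1ℤ 1ℤ 1ℤ 1ℤ 0ℤ 1ℤ) ∷
  entry (+ 5728) -[1+ 3716 ] (+ 858) (true , 0 , true , true) (mat 1ℤ 0ℤ -[1+ 0 ] -[1+ 0 ] 1ℤ 0ℤ 0ℤ 0ℤ 1ℤ) ∷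
  entry (+ 63) -[1+ 9420 ] (+ 981) (true , 0 , false , true) (mat 1ℤ 0ℤ -[1+ 0 ] 1ℤ 1ℤ 0ℤ 0ℤ 0ℤ 1ℤ) ∷
  entry (+ 3377) -[1+ 1357 ] (+ 1074) (false , 1 , false , true) (mat 1ℤ 0ℤ 0ℤ 0ℤ 1ℤ 1ℤ 1ℤ 0ℤ 1ℤ) ∷
  entry (+ 631) (+ 4875) (+ 989) (true , 0 , true , true) (mat 1ℤ 0ℤ 0ℤ -[1+ 0 ] 1ℤ -[1+ 0 ] 1ℤ 0ℤ 1ℤ) ∷
  entry (+ 7321) -[1+ 4661 ] -[1+ 1810 ] (false , 2 , true , false) (mat 1ℤ -[1+ 0 ] 0ℤ 0ℤ 1ℤ 0ℤ 1ℤ 0ℤ 1ℤ) ∷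
  entry -[1+ 3577 ] -[1+ 894 ] -[1+ 988 ] (true , 1 , false , false) (mat 1ℤ 0ℤ 1ℤ 0ℤ 1ℤ 0ℤ 0ℤ 1ℤ 1ℤ) ∷
  entry -[1+ 1462 ] -[1+ 2350 ] -[1+ 1933 ] (false , 2 , false , true) (mat 1ℤ 1ℤ 0ℤ 0ℤ 1ℤ 0ℤ 1ℤ 0ℤ 1ℤ) ∷
  entry (+ 3583) (+ 930) -[1+ 2131 ] (true , 1 , false , false) (mat 1ℤ -[1+ 0 ] 1ℤ 0ℤ 1ℤ -[1+ 0 ] 0ℤ 0ℤ 1ℤ) ∷
  entry (+ 6849) (+ 4528) -[1+ 1933 ] (false , 2 , false , false) (mat 1ℤ -[1+ 0 ] 0ℤ 0ℤ 1ℤ 0ℤ -[1+ 0 ] 0ℤ 1ℤ) ∷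
  entry -[1+ 1551 ] (+ 8607) (+ 1095) (false , 2 , false , true) (mat 1ℤ 0ℤ 0ℤ -[1+ 0 ] 1ℤ 0ℤ 1ℤ -[1+ 0 ] 1ℤ) ∷
  entry -[1+ 6673 ] (+ 2471) -[1+ 2131 ] (true , 1 , true , false) (mat 1ℤ 1ℤ -[1+ 0 ] 0ℤ 1ℤ -[1+ 0 ] 0ℤ 0ℤ 1ℤ) ∷
  entry -[1+ 2933 ] -[1+ 4677 ] (+ 555) (false , 1 , false , false) (mat 1ℤ 0ℤ 0ℤ 0ℤ 1ℤ -[1+ 0 ] -[1+ 0 ] 0ℤ 1ℤ) ∷
  entry (+ 7644) -[1+ 3381 ] (+ 1074) (false , 1 , true , false) (mat 1ℤ 0ℤ 0ℤ 0ℤ 1ℤ 1ℤ -[1+ 0 ] 0ℤ 1ℤ) ∷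
  entry -[1+ 2129 ] (+ 2973) -[1+ 744 ] (false , 0 , true , false) (mat 1ℤ 1ℤ 0ℤ 0ℤ 1ℤ -[1+ 0 ] 0ℤ 0ℤ 1ℤ) ∷
  entry (+ 683) (+ 833) -[1+ 554 ] (false , 0 , true , false) (mat 1ℤ 1ℤ 1ℤ 0ℤ 1ℤ 0ℤ 0ℤ 1ℤ 1ℤ) ∷
  entry -[1+ 2198 ] (+ 6697) (+ 745) (false , 2 , true , false) (mat 1ℤ 0ℤ 0ℤ 1ℤ 1ℤ 0ℤ 1ℤ 1ℤ 1ℤ) ∷
  entry -[1+ 11958 ] -[1+ 3137 ] -[1+ 638 ] (true , 1 , true , true) (mat 1ℤ 0ℤ 1ℤ 0ℤ 1ℤ 0ℤ 0ℤ -[1+ 0 ] 1ℤ) ∷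
  entry -[1+ 12320 ] -[1+ 3007 ] (+ 1934) (false , 1 , false , true) (mat 1ℤ 0ℤ -[1+ 0 ] -[1+ 0 ] 1ℤ 1ℤ 0ℤ 0ℤ 1ℤ) ∷
  entry (+ 326) -[1+ 4728 ] -[1+ 857 ] (true , 2 , false , false) (mat 1ℤ 1ℤ 0ℤ 0ℤ 1ℤ 0ℤ 1ℤ 1ℤ 1ℤ) ∷
  entry (+ 4557) -[1+ 1788 ] -[1+ 1612 ] (true , 1 , true , true) (mat 1ℤ 1ℤ 1ℤ 0ℤ 1ℤ 1ℤ 0ℤ 0ℤ 1ℤ) ∷
  entry -[1+ 4935 ] -[1+ 2900 ] -[1+ 857 ] (true , 2 , true , true) (mat 1ℤ -[1+ 0 ] 0ℤ 0ℤ 1ℤ 0ℤ -[1+ 0 ] 1ℤ 1ℤ) ∷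
  entry (+ 2627) (+ 5038) -[1+ 988 ] (true , 1 , true , false) (mat 1ℤ 0ℤ -[1+ 0 ] 0ℤ 1ℤ 0ℤ 0ℤ 1ℤ 1ℤ) ∷
  entry -[1+ 2471 ] -[1+ 285 ] -[1+ 744 ] (false , 0 , false , false) (mat 1ℤ -[1+ 0 ] 0ℤ 0ℤ 1ℤ -[1+ 0 ] 0ℤ 0ℤ 1ℤ) ∷
  entry (+ 1583) (+ 3139) -[1+ 554 ] (false , 0 , false , false) (mat 1ℤ -[1+ 0 ] -[1+ 0 ] 0ℤ 1ℤ 0ℤ 0ℤ 1ℤ 1ℤ) ∷
  entry -[1+ 7802 ] (+ 5226) (+ 1811) (false , 1 , true , true) (mat 1ℤ 0ℤ -[1+ 0 ] 1ℤ 1ℤ -[1+ 0 ] 0ℤ 0ℤ 1ℤ) ∷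
  entry (+ 14764) -[1+ 2274 ] -[1+ 638 ] (true , 1 , false , true) (mat 1ℤ 0ℤ -[1+ 0 ] 0ℤ 1ℤ 0ℤ 0ℤ -[1+ 0 ] 1ℤ) ∷
  entry -[1+ 2770 ] -[1+ 3321 ] -[1+ 980 ] (true , 2 , false , true) (mat 1ℤ -[1+ 0 ] 0ℤ 0ℤ 1ℤ 0ℤ 1ℤ -[1+ 0 ] 1ℤ) ∷
  entry -[1+ 2440 ] -[1+ 4257 ] (+ 2132) (true , 2 , true , true) (mat 1ℤ 0ℤ 0ℤ 1ℤ 1ℤ 0ℤ 0ℤ 1ℤ 1ℤ) ∷
  entry -[1+ 5234 ] (+ 1062) -[1+ 1094 ] (false , 0 , true , true) (mat 1ℤ -[1+ 0 ] 0ℤ 0ℤ 1ℤ 1ℤ 0ℤ 0ℤ 1ℤ) ∷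
  entry (+ 9604) (+ 3442) -[1+ 1073 ] (false , 0 , true , true) (mat 1ℤ -[1+ 0 ] 1ℤ 0ℤ 1ℤ 0ℤ 0ℤ -[1+ 0 ] 1ℤ) ∷
  entry (+ 120) -[1+ 7422 ] (+ 2132) (true , 2 , false , false) (mat 1ℤ 0ℤ 0ℤ -[1+ 0 ] 1ℤ 0ℤ 0ℤ 1ℤ 1ℤ) ∷
  entry -[1+ 3247 ] (+ 5249) (+ 745) (false , 2 , true , true) (mat 1ℤ 0ℤ 0ℤ -[1+ 0 ] 1ℤ 0ℤ -[1+ 0 ] 1ℤ 1ℤ) ∷
  entry -[1+ 10014 ] (+ 1843) -[1+ 1073 ] (false , 0 , false , true) (mat 1ℤ 1ℤ -[1+ 0 ] 0ℤ 1ℤ 0ℤ 0ℤ -[1+ 0 ] 1ℤ) ∷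
  entry -[1+ 137 ] (+ 2791) (+ 1095) (false , 2 , false , false) (mat 1ℤ 0ℤ 0ℤ 1ℤ 1ℤ 0ℤ -[1+ 0 ] -[1+ 0 ] 1ℤ) ∷
  entry -[1+ 665 ] (+ 2172) -[1+ 1094 ] (false , 0 , false , true) (mat 1ℤ 1ℤ 0ℤ 0ℤ 1ℤ 1ℤ 0ℤ 0ℤ 1ℤ) ∷
  entry -[1+ 10527 ] -[1+ 6919 ] (+ 981) (true , 0 , false , false) (mat 1ℤ 0ℤ 1ℤ -[1+ 0 ] 1ℤ 0ℤ 0ℤ 0ℤ 1ℤ) ∷
  entry -[1+ 187 ] (+ 5736) (+ 639) (true , 0 , false , false) (mat 1ℤ 0ℤ 0ℤ -[1+ 0 ] 1ℤ 1ℤ -[1+ 0 ] 0ℤ 1ℤ) ∷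
  entry -[1+ 652 ] -[1+ 3704 ] -[1+ 1810 ] (false , 2 , true , true) (mat 1ℤ 1ℤ 0ℤ 0ℤ 1ℤ 0ℤ -[1+ 0 ] 0ℤ 1ℤ) ∷
  entry -[1+ 3596 ] -[1+ 4703 ] (+ 1613) (true , 2 , false , true) (mat 1ℤ 0ℤ 0ℤ 1ℤ 1ℤ 0ℤ 0ℤ -[1+ 0 ] 1ℤ) ∷
  entry -[1+ 3121 ] (+ 2804) -[1+ 980 ] (true , 2 , true , false) (mat 1ℤ 1ℤ 0ℤ 0ℤ 1ℤ 0ℤ -[1+ 0 ] -[1+ 0 ] 1ℤ) ∷
  entry (+ 1765) (+ 3351) (+ 1934) (false , 1 , true , false) (mat 1ℤ 0ℤ 1ℤ 1ℤ 1ℤ 1ℤ 0ℤ 0ℤ 1ℤ) ∷ []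

-- A search key with the entries as digits to base 17, where `-[1+ n ]` is read as `8 + n`. Distinct
-- matrices may share a key, so `insert` still compares matrices.
code : M3 → ℕ
code (mat a b c d e f g h i) = k a (k b (k c (k d (k e (k f (k g (k h (k i 0))))))))
  where
    k : ℤ → ℕ → ℕ
    k (+ n) acc = 17 ℕ.* acc ℕ.+ n
    k -[1+ n ] acc = 17 ℕ.* acc ℕ.+ (8 ℕ.+ n)

data Tree : Set where
  leaf : Tree
  node : Tree → ℕ → ℤ → M3 → Tree → Tree

insert : ℤ → M3 → ℕ → Tree → Tree
insert c t n leaf = node leaf n c t leaf
insert c t n (node l m d u r) with n ℕ.≡ᵇ m
... | true with t ≟ᴹ u
...   | yes _ = node l m (c + d) u r
...   | no _ = node (insert c t n l) m d u r
insert c t n (node l m d u r) | false with n ℕ.<ᵇ m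
...   | true = node (insert c t n l) m d u r
...   | false = node l m d u (insert c t n r)

addAll : List (ℤ × M3) → Tree → Tree
addAll [] T = T
addAll ((c , t) ∷ l) T = insert c t (code t) (addAll l T)

rowTerms : Entry → List Entry → List (ℤ × M3)
rowTerms g [] = []
rowTerms g (h ∷ hs) = (ξ₁ g * ξ₁ h + ξ₂ g * ξ₂ h + ξ₃ g * ξ₃ h , apply (sym-el g) (el h · inverse (el g))) ∷ rowTerms g hs

gram : List Entry → List Entry → Tree
gram [] hs = leaf
gram (g ∷ gs) hs = addAll (rowTerms g hs) (gram gs hs)

smallest : M3 → ℕ → List M3 → M3
smallest t n [] = t
smallest t n (u ∷ us) with code u
... | m with m ℕ.<ᵇ n
...   | true = smallest u m us
...   | false = smallest t n us

candidates : M3 → List M3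
candidates t = l₃ ++ map sign₂ l₃
  where
    l₀ = t ∷ inverse t ∷ []
    l₁ = l₀ ++ map swap₁₂ l₀
    l₂ = l₁ ++ (map cycle l₁ ++ map cycle (map cycle l₁))
    l₃ = l₂ ++ map sign₁ l₂

-- The element of least key among the 48 images of `t` under the symmetries and inversion.
-- Coefficients of equivalent elements are thereby added before their signs are examined.
canonical : M3 → M3
canonical t with det t ℤ.≟ 1ℤ
... | yes _ = smallest t (code t) (candidates t)
... | no _ = t

insertCanonical : ℤ → M3 → Tree → Tree
insertCanonical c t T with canonical t
... | u = insert c u (code u) T

mergeScaled : ℤ → Tree → Tree → Tree
mergeScaled k leaf T = T
mergeScaled k (node l n c t r) T = insertCanonical (k * c) t (mergeScaled k l (mergeScaled k r T))

mergeList : ℤ → List (ℤ × M3) → Tree → Tree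
mergeList k [] T = T
mergeList k ((c , t) ∷ l) T = insertCanonical (k * c) t (mergeList k l T)

generators : List M3
generators =
  mat 1ℤ 1ℤ 0ℤ 0ℤ 1ℤ 0ℤ 0ℤ 0ℤ 1ℤ ∷ mat 1ℤ (- 1ℤ) 0ℤ 0ℤ 1ℤ 0ℤ 0ℤ 0ℤ 1ℤ ∷
  mat 1ℤ 0ℤ 1ℤ 0ℤ 1ℤ 0ℤ 0ℤ 0ℤ 1ℤ ∷ mat 1ℤ 0ℤ (- 1ℤ) 0ℤ 1ℤ 0ℤ 0ℤ 0ℤ 1ℤ ∷
  mat 1ℤ 0ℤ 0ℤ 1ℤ 1ℤ 0ℤ 0ℤ 0ℤ 1ℤ ∷ mat 1ℤ 0ℤ 0ℤ (- 1ℤ) 1ℤ 0ℤ 0ℤ 0ℤ 1ℤ ∷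
  mat 1ℤ 0ℤ 0ℤ 0ℤ 1ℤ 1ℤ 0ℤ 0ℤ 1ℤ ∷ mat 1ℤ 0ℤ 0ℤ 0ℤ 1ℤ (- 1ℤ) 0ℤ 0ℤ 1ℤ ∷
  mat 1ℤ 0ℤ 0ℤ 0ℤ 1ℤ 0ℤ 1ℤ 0ℤ 1ℤ ∷ mat 1ℤ 0ℤ 0ℤ 0ℤ 1ℤ 0ℤ (- 1ℤ) 0ℤ 1ℤ ∷
  mat 1ℤ 0ℤ 0ℤ 0ℤ 1ℤ 0ℤ 0ℤ 1ℤ 1ℤ ∷ mat 1ℤ 0ℤ 0ℤ 0ℤ 1ℤ 0ℤ 0ℤ (- 1ℤ) 1ℤ ∷ []

laplacian : List (ℤ × M3)
laplacian = (+ 12 , 𝟙) ∷ map (λ s → - 1ℤ , s) generators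

products : List (ℤ × M3) → List (ℤ × M3) → List (ℤ × M3)
products [] hs = []
products ((a , g) ∷ gs) hs = map (λ { (b , h) → a * b , h · inverse g }) hs ++ products gs hs

-- The remainder `49000000 (20 Δ² − Δ) − 20 (ξ₁* ξ₁ + ξ₂* ξ₂ + ξ₃* ξ₃)`, symmetrised by `canonical`.
defect : List Entry → List (ℤ × M3) → Tree
defect C L = mergeScaled (- (+ 20)) (gram C C) (mergeList (+ 980000000) (products L L) (mergeList (- (+ 49000000)) L leaf))

total : Tree → ℤ
total leaf = 0ℤ
total (node l _ c _ r) = c + (total l + total r)

-- With total zero, such an element is a nonnegative combination of differences `𝟙 − u`, and these
-- are nonnegative against any function that is largest at the identity.
data Favourable : Tree → Set where
  leaf : Favourable leaf
  node : ∀ {l n c u r} → Favourable l → u ≡ 𝟙 ⊎ (c ℤ.≤ 0ℤ × SL u) → Favourable r → Favourable (node l n c u r)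

favourable? : (T : Tree) → Dec (Favourable T)
favourable? leaf = yes leaf
favourable? (node l _ c u r) = map′ (λ { (f , g , h) → node f g h }) (λ { (node f g h) → f , g , h })
  (favourable? l ×-dec (u ≟ᴹ 𝟙 ⊎-dec (c ℤ.≤? 0ℤ ×-dec det u ℤ.≟ 1ℤ)) ×-dec favourable? r)

does-true : ∀ {P : Set} (d : Dec P) → does d ≡ true → P
does-true (yes p) _ = p

SL? : ∀ g → Dec (SL g)
SL? g = det g ℤ.≟ 1ℤ

abstract
  -- All checks are carried out by evaluation here; hiding the witness ensures that the table is
  -- never recomputed by later conversions.
  certificate : ∃[ C ] (All (λ e → SL (el e)) C × Favourable (defect C laplacian) × total (defect C laplacian) ≡ 0ℤ)
  certificate = cert , does-true (all? (λ e → SL? (el e)) cert) refl , does-true (favourable? (defect cert laplacian)) refl , refl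

generators-SL : All SL generators
generators-SL = does-true (all? SL? generators) refl

-- A group-ring element is evaluated as the sum of its coefficients times `ρ`. The hypotheses on `ρ`
-- are the properties of an autocorrelation averaged over the symmetries, and every operation on
-- trees is shown to preserve this evaluation.
module Certificate
  (C : List Entry) (C-SL : All (SL ∘ Entry.el) C) (L : List (ℤ × M3))
  (defect-favourable : Favourable (defect C L)) (defect-total : total (defect C L) ≡ 0ℤ)
  (ρ : M3 → ℤ)
  (ρ-swap : ∀ t → SL t → SL (swap₁₂ t) × ρ (swap₁₂ t) ≡ ρ t)
  (ρ-cycle : ∀ t → SL t → SL (cycle t) × ρ (cycle t) ≡ ρ t)
  (ρ-sign₁ : ∀ t → SL t → SL (sign₁ t) × ρ (sign₁ t) ≡ ρ t)
  (ρ-sign₂ : ∀ t → SL t → SL (sign₂ t) × ρ (sign₂ t) ≡ ρ t)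
  (ρ-inverse : ∀ t → SL t → ρ (inverse t) ≡ ρ t)
  (ρ-max : ∀ t → SL t → ρ t ℤ.≤ ρ 𝟙) where

  private
    Same : M3 → M3 → Set
    Same t u = SL u × ρ u ≡ ρ t

    close : ∀ {t} (φ : M3 → M3) → (∀ u → SL u → SL (φ u) × ρ (φ u) ≡ ρ u) → ∀ {l} → All (Same t) l → All (Same t) (map φ l)
    close φ h [] = []
    close φ h (_∷_ {x = u} (δ , e) a) = (proj₁ (h u δ) , trans (proj₂ (h u δ)) e) ∷ close φ h a

    candidates-same : ∀ t → SL t → All (Same t) (candidates t)
    candidates-same t δ = ++⁺ s₃ (close sign₂ ρ-sign₂ s₃)
      where
        s₀ : All (Same t) (t ∷ inverse t ∷ [])
        s₀ = (δ , refl) ∷ (SL-inverse t δ , ρ-inverse t δ) ∷ []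
        s₁ = ++⁺ s₀ (close swap₁₂ ρ-swap s₀)
        s₂ = ++⁺ s₁ (++⁺ (close cycle ρ-cycle s₁) (close cycle ρ-cycle (close cycle ρ-cycle s₁)))
        s₃ = ++⁺ s₂ (close sign₁ ρ-sign₁ s₂)

    smallest-∈ : ∀ {P : M3 → Set} t n l → P t → All P l → P (smallest t n l)
    smallest-∈ t n [] p a = p
    smallest-∈ t n (u ∷ us) p (q ∷ a) with code u
    ... | m with m ℕ.<ᵇ n
    ...   | true = smallest-∈ u m us q a
    ...   | false = smallest-∈ t n us p a

    canonical-ρ : ∀ t → ρ (canonical t) ≡ ρ t
    canonical-ρ t with det t ℤ.≟ 1ℤ
    ... | yes δ = proj₂ (smallest-∈ {Same t} t (code t) (candidates t) (δ , refl) (candidates-same t δ))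
    ... | no _ = refl

    optionally-same : ∀ {t} (φ : M3 → M3) → (∀ u → SL u → SL (φ u) × ρ (φ u) ≡ ρ u) → ∀ b u → Same t u → Same t (optionally b φ u)
    optionally-same φ h true u (δ , e) = proj₁ (h u δ) , trans (proj₂ (h u δ)) e
    optionally-same φ h false u s = s

    iterateCycle-same : ∀ {t} k u → Same t u → Same t (iterateCycle k u)
    iterateCycle-same zero u s = s
    iterateCycle-same (suc k) u s = optionally-same cycle ρ-cycle true (iterateCycle k u) (iterateCycle-same k u s)

    apply-ρ : ∀ σ t → SL t → ρ (apply σ t) ≡ ρ t
    apply-ρ (w , k , x , y) t δ = proj₂ s₃
      where
        s₀ : Same t (optionally w swap₁₂ t)
        s₀ = optionally-same swap₁₂ ρ-swap w t (δ , refl)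
        s₁ = iterateCycle-same k (optionally w swap₁₂ t) s₀
        s₂ = optionally-same sign₁ ρ-sign₁ x (iterateCycle k (optionally w swap₁₂ t)) s₁
        s₃ = optionally-same sign₂ ρ-sign₂ y (optionally x sign₁ (iterateCycle k (optionally w swap₁₂ t))) s₂

  ⟨_⟩ : List (ℤ × M3) → ℤ
  ⟨ [] ⟩ = 0ℤ
  ⟨ (c , t) ∷ l ⟩ = c * ρ t + ⟨ l ⟩

  private
    ⟪_⟫ : Tree → ℤ
    ⟪ leaf ⟫ = 0ℤ
    ⟪ node l n c t r ⟫ = c * ρ t + (⟪ l ⟫ + ⟪ r ⟫)

    insert-eval : ∀ c t n T → ⟪ insert c t n T ⟫ ≡ c * ρ t + ⟪ T ⟫
    insert-eval c t n leaf = refl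
    insert-eval c t n (node l m d u r) with n ℕ.≡ᵇ m
    ... | true with t ≟ᴹ u
    ...   | yes refl = lem c d (ρ t) (⟪ l ⟫ + ⟪ r ⟫)
            where lem : ∀ c d x y → (c + d) * x + y ≡ c * x + (d * x + y)
                  lem = solve-∀
    ...   | no _ = trans (cong (λ z → d * ρ u + (z + ⟪ r ⟫)) (insert-eval c t n l)) (lem (c * ρ t) (d * ρ u) ⟪ l ⟫ ⟪ r ⟫)
            where lem : ∀ c d x y → d + (c + x + y) ≡ c + (d + (x + y))
                  lem = solve-∀
    insert-eval c t n (node l m d u r) | false with n ℕ.<ᵇ m
    ...   | true = trans (cong (λ z → d * ρ u + (z + ⟪ r ⟫)) (insert-eval c t n l)) (lem (c * ρ t) (d * ρ u) ⟪ l ⟫ ⟪ r ⟫)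
            where lem : ∀ c d x y → d + (c + x + y) ≡ c + (d + (x + y))
                  lem = solve-∀
    ...   | false = trans (cong (λ z → d * ρ u + (⟪ l ⟫ + z)) (insert-eval c t n r)) (lem (c * ρ t) (d * ρ u) ⟪ l ⟫ ⟪ r ⟫)
            where lem : ∀ c d x y → d + (x + (c + y)) ≡ c + (d + (x + y))
                  lem = solve-∀

    addAll-eval : ∀ l T → ⟪ addAll l T ⟫ ≡ ⟨ l ⟩ + ⟪ T ⟫
    addAll-eval [] T = sym (ℤP.+-identityˡ _)
    addAll-eval ((c , t) ∷ l) T = trans (insert-eval c t (code t) (addAll l T)) (trans (cong (λ z → c * ρ t + z) (addAll-eval l T)) (sym (ℤP.+-assoc (c * ρ t) ⟨ l ⟩ ⟪ T ⟫)))

    insertCanonical-eval : ∀ c t T → ⟪ insertCanonical c t T ⟫ ≡ c * ρ t + ⟪ T ⟫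
    insertCanonical-eval c t T = trans (insert-eval c (canonical t) (code (canonical t)) T) (cong (λ z → c * z + ⟪ T ⟫) (canonical-ρ t))

    mergeScaled-eval : ∀ k S T → ⟪ mergeScaled k S T ⟫ ≡ k * ⟪ S ⟫ + ⟪ T ⟫
    mergeScaled-eval k leaf T = sym (trans (cong (_+ ⟪ T ⟫) (ℤP.*-zeroʳ k)) (ℤP.+-identityˡ _))
    mergeScaled-eval k (node l n c t r) T = trans (insertCanonical-eval (k * c) t (mergeScaled k l (mergeScaled k r T)))
      (trans (cong (λ z → k * c * ρ t + z) (trans (mergeScaled-eval k l (mergeScaled k r T)) (cong (λ z → k * ⟪ l ⟫ + z) (mergeScaled-eval k r T))))
      (lem k c (ρ t) ⟪ l ⟫ ⟪ r ⟫ ⟪ T ⟫))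
      where lem : ∀ k c x l r t → k * c * x + (k * l + (k * r + t)) ≡ k * (c * x + (l + r)) + t
            lem = solve-∀

    mergeList-eval : ∀ k l T → ⟪ mergeList k l T ⟫ ≡ k * ⟨ l ⟩ + ⟪ T ⟫
    mergeList-eval k [] T = sym (trans (cong (_+ ⟪ T ⟫) (ℤP.*-zeroʳ k)) (ℤP.+-identityˡ _))
    mergeList-eval k ((c , t) ∷ l) T = trans (insertCanonical-eval (k * c) t (mergeList k l T)) (trans (cong (λ z → k * c * ρ t + z) (mergeList-eval k l T)) (lem k c (ρ t) ⟨ l ⟩ ⟪ T ⟫))
      where lem : ∀ k c x l t → k * c * x + (k * l + t) ≡ k * (c * x + l) + t
            lem = solve-∀

  pair : ℤ → M3 → M3 → ℤ
  pair c g h = c * ρ (h · inverse g)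

  rowSum : (Entry → ℤ) → Entry → ℤ
  rowSum e g = ∑ℤ C λ h → pair (e g * e h) (Entry.el g) (Entry.el h)

  square : (Entry → ℤ) → ℤ
  square e = ∑ℤ C (rowSum e)

  private
    rowTerms-eval : ∀ g hs → SL (Entry.el g) → All (SL ∘ Entry.el) hs →
      ⟨ rowTerms g hs ⟩ ≡ ∑ℤ hs λ h → (Entry.ξ₁ g * Entry.ξ₁ h + Entry.ξ₂ g * Entry.ξ₂ h + Entry.ξ₃ g * Entry.ξ₃ h) * ρ (Entry.el h · inverse (Entry.el g))
    rowTerms-eval g [] δ a = refl
    rowTerms-eval g (h ∷ hs) δ (ε ∷ a) = cong₂ (λ y z → (Entry.ξ₁ g * Entry.ξ₁ h + Entry.ξ₂ g * Entry.ξ₂ h + Entry.ξ₃ g * Entry.ξ₃ h) * y + z)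
      (apply-ρ (Entry.sym-el g) (Entry.el h · inverse (Entry.el g)) (SL-· (Entry.el h) (inverse (Entry.el g)) ε (SL-inverse (Entry.el g) δ)))
      (rowTerms-eval g hs δ a)

    split₃ : ∀ {A : Set} (xs : List A) (f g h k : A → ℤ) → ∑ℤ xs (λ x → (f x + g x + h x) * k x) ≡ ∑ℤ xs (λ x → f x * k x) + ∑ℤ xs (λ x → g x * k x) + ∑ℤ xs (λ x → h x * k x)
    split₃ xs f g h k = trans (∑ℤ-cong xs λ x _ → lem (f x) (g x) (h x) (k x)) (trans (∑ℤ-+ xs (λ x → f x * k x + g x * k x) (λ x → h x * k x)) (cong (_+ ∑ℤ xs (λ x → h x * k x)) (∑ℤ-+ xs (λ x → f x * k x) (λ x → g x * k x))))
      where lem : ∀ f g h k → (f + g + h) * k ≡ f * k + g * k + h * k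
            lem = solve-∀

    gram-eval : ∀ gs → All (SL ∘ Entry.el) gs → ⟪ gram gs C ⟫ ≡ ∑ℤ gs (rowSum Entry.ξ₁) + ∑ℤ gs (rowSum Entry.ξ₂) + ∑ℤ gs (rowSum Entry.ξ₃)
    gram-eval [] [] = refl
    gram-eval (g ∷ gs) (δ ∷ a) = trans (addAll-eval (rowTerms g C) (gram gs C))
      (trans (cong₂ _+_ (trans (rowTerms-eval g C δ C-SL)
         (split₃ C (λ h → Entry.ξ₁ g * Entry.ξ₁ h) (λ h → Entry.ξ₂ g * Entry.ξ₂ h) (λ h → Entry.ξ₃ g * Entry.ξ₃ h) (λ h → ρ (Entry.el h · inverse (Entry.el g))))) (gram-eval gs a))
      (lem (rowSum Entry.ξ₁ g) (rowSum Entry.ξ₂ g) (rowSum Entry.ξ₃ g) (∑ℤ gs (rowSum Entry.ξ₁)) (∑ℤ gs (rowSum Entry.ξ₂)) (∑ℤ gs (rowSum Entry.ξ₃))))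
      where lem : ∀ a b c x y z → a + b + c + (x + y + z) ≡ a + x + (b + y) + (c + z)
            lem = solve-∀

    -- Off the identity the coefficients are nonpositive, so replacing `ρ u` by the maximum `ρ 𝟙`
    -- can only lower the value.
    favourable-bound : ∀ T → Favourable T → total T * ρ 𝟙 ℤ.≤ ⟪ T ⟫
    favourable-bound leaf leaf = ℤP.≤-refl
    favourable-bound (node l n c u r) (node fl f fr) = ℤP.≤-trans (ℤP.≤-reflexive (lem c (total l) (total r) (ρ 𝟙)))
       (ℤP.+-mono-≤ (point f) (ℤP.+-mono-≤ (favourable-bound l fl) (favourable-bound r fr)))
      where
        lem : ∀ c x y z → (c + (x + y)) * z ≡ c * z + (x * z + y * z)
        lem = solve-∀
        point : u ≡ 𝟙 ⊎ (c ℤ.≤ 0ℤ × SL u) → c * ρ 𝟙 ℤ.≤ c * ρ u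
        point (inj₁ refl) = ℤP.≤-refl
        point (inj₂ (c≤0 , δ)) = ℤP.*-monoˡ-≤-nonPos c {{ℤ.nonPositive c≤0}} (ρ-max u δ)

  -- The defect is favourable with total zero, hence evaluates to something nonnegative; unfolding
  -- the evaluation of its three ingredients gives the inequality.
  positivity : 0ℤ ℤ.≤ - (+ 20) * (square Entry.ξ₁ + square Entry.ξ₂ + square Entry.ξ₃) + (+ 980000000 * ⟨ products L L ⟩ + - (+ 49000000) * ⟨ L ⟩)
  positivity = ℤP.≤-trans (ℤP.≤-reflexive (sym (trans (cong (_* ρ 𝟙) defect-total) (ℤP.*-zeroˡ (ρ 𝟙)))))
    (ℤP.≤-trans (favourable-bound (defect C L) defect-favourable)
    (ℤP.≤-reflexive (trans (mergeScaled-eval (- (+ 20)) (gram C C) (mergeList (+ 980000000) (products L L) (mergeList (- (+ 49000000)) L leaf)))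
      (cong₂ (λ x y → - (+ 20) * x + y) (gram-eval C C-SL)
        (trans (mergeList-eval (+ 980000000) (products L L) (mergeList (- (+ 49000000)) L leaf))
          (cong (λ z → + 980000000 * ⟨ products L L ⟩ + z) (trans (mergeList-eval (- (+ 49000000)) L leaf) (ℤP.+-identityʳ _))))))))

-- Conjugation by the rotations of the cube

open import Data.List.Membership.DecPropositional _≟ᴹ_ using (_∈?_)

conjugate : M3 → M3 → M3
conjugate w t = (w · t) · inverse w

swapᴹ cycleᴹ sign₁ᴹ sign₂ᴹ : M3
swapᴹ = mat 0ℤ 1ℤ 0ℤ 1ℤ 0ℤ 0ℤ 0ℤ 0ℤ (- 1ℤ)
cycleᴹ = mat 0ℤ 1ℤ 0ℤ 0ℤ 0ℤ 1ℤ 1ℤ 0ℤ 0ℤ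
sign₁ᴹ = mat 1ℤ 0ℤ 0ℤ 0ℤ (- 1ℤ) 0ℤ 0ℤ 0ℤ (- 1ℤ)
sign₂ᴹ = mat (- 1ℤ) 0ℤ 0ℤ 0ℤ 1ℤ 0ℤ 0ℤ 0ℤ (- 1ℤ)

W-generators : List M3
W-generators = swapᴹ ∷ cycleᴹ ∷ sign₁ᴹ ∷ sign₂ᴹ ∷ []

W-generators-SL : All SL W-generators
W-generators-SL = does-true (all? SL? W-generators) refl

generators-unique : Unique generators
generators-unique = does-true (allPairs? (λ g h → ¬? (g ≟ᴹ h)) generators) refl

abstract
  -- The 24 signed permutation matrices of determinant one, that is, the rotations of the cube.
  W : List M3
  W = w₃ ++ map (sign₂ᴹ ·_) w₃
    where
      w₁ : List M3
      w₁ = 𝟙 ∷ swapᴹ ∷ []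
      w₂ : List M3
      w₂ = w₁ ++ (map (cycleᴹ ·_) w₁ ++ map (λ w → cycleᴹ · (cycleᴹ · w)) w₁)
      w₃ : List M3
      w₃ = w₂ ++ map (sign₁ᴹ ·_) w₂

  length-W : length W ≡ 24
  length-W = refl

  W-SL : All SL W
  W-SL = does-true (all? SL? W) refl

  W-unique : Unique W
  W-unique = does-true (allPairs? (λ g h → ¬? (g ≟ᴹ h)) W) refl

  -- Right multiplication by a generator permutes `W`, so averages over conjugation by `W` do not
  -- change when the argument is conjugated by that generator.
  W-closed : All (λ v → All (λ w → w · v ∈ W) W) W-generators
  W-closed = does-true (all? (λ v → all? (λ w → (w · v) ∈? W) W) W-generators) refl

  generators-conjugate : All (λ w → All (λ s → conjugate w s ∈ generators) generators) W
  generators-conjugate = does-true (all? (λ w → all? (λ s → conjugate w s ∈? generators) generators) W) refl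

-- In a product with a signed permutation matrix a single summand survives in each entry. The index
-- names its position, and `N`, `n` or `M` records a change of sign or a double one.
module Selections where
  open ℤP using (neg-involutive)
  p₁ : ∀ x y z → 1ℤ * x + 0ℤ * y + 0ℤ * z ≡ x
  p₁ = solve-∀
  p₂ : ∀ x y z → 0ℤ * x + 1ℤ * y + 0ℤ * z ≡ y
  p₂ = solve-∀
  p₃ : ∀ x y z → 0ℤ * x + 0ℤ * y + 1ℤ * z ≡ z
  p₃ = solve-∀
  n₁ : ∀ x y z → - 1ℤ * x + 0ℤ * y + 0ℤ * z ≡ - x
  n₁ = solve-∀
  n₂ : ∀ x y z → 0ℤ * x + - 1ℤ * y + 0ℤ * z ≡ - y
  n₂ = solve-∀
  n₃ : ∀ x y z → 0ℤ * x + 0ℤ * y + - 1ℤ * z ≡ - z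
  n₃ = solve-∀
  P₁ : ∀ x y z → x * 1ℤ + y * 0ℤ + z * 0ℤ ≡ x
  P₁ = solve-∀
  P₂ : ∀ x y z → x * 0ℤ + y * 1ℤ + z * 0ℤ ≡ y
  P₂ = solve-∀
  P₃ : ∀ x y z → x * 0ℤ + y * 0ℤ + z * 1ℤ ≡ z
  P₃ = solve-∀
  N₁ : ∀ x y z → x * - 1ℤ + y * 0ℤ + z * 0ℤ ≡ - x
  N₁ = solve-∀
  N₂ : ∀ x y z → x * 0ℤ + y * - 1ℤ + z * 0ℤ ≡ - y
  N₂ = solve-∀
  N₃ : ∀ x y z → x * 0ℤ + y * 0ℤ + z * - 1ℤ ≡ - z
  N₃ = solve-∀
  M₁ : ∀ x y z → - x * - 1ℤ + y * 0ℤ + z * 0ℤ ≡ x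
  M₁ = solve-∀
  M₂ : ∀ x y z → x * 0ℤ + - y * - 1ℤ + z * 0ℤ ≡ y
  M₂ = solve-∀
  M₃ : ∀ x y z → x * 0ℤ + y * 0ℤ + - z * - 1ℤ ≡ z
  M₃ = solve-∀
open Selections

swap-conjugate : ∀ t → swap₁₂ t ≡ conjugate swapᴹ t
swap-conjugate (mat a b c d e f g h i) = sym (trans
  (cong (_· inverse swapᴹ) (mat-≡ (p₂ a d g) (p₂ b e h) (p₂ c f i) (p₁ a d g) (p₁ b e h) (p₁ c f i) (n₃ a d g) (n₃ b e h) (n₃ c f i)))
  (mat-≡ (P₂ d e f) (P₁ d e f) (N₃ d e f) (P₂ a b c) (P₁ a b c) (N₃ a b c) (P₂ (- g) (- h) (- i)) (P₁ (- g) (- h) (- i)) (M₃ (- g) (- h) i)))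

cycle-conjugate : ∀ t → cycle t ≡ conjugate cycleᴹ t
cycle-conjugate (mat a b c d e f g h i) = sym (trans
  (cong (_· inverse cycleᴹ) (mat-≡ (p₂ a d g) (p₂ b e h) (p₂ c f i) (p₃ a d g) (p₃ b e h) (p₃ c f i) (p₁ a d g) (p₁ b e h) (p₁ c f i)))
  (mat-≡ (P₂ d e f) (P₃ d e f) (P₁ d e f) (P₂ g h i) (P₃ g h i) (P₁ g h i) (P₂ a b c) (P₃ a b c) (P₁ a b c)))

sign₁-conjugate : ∀ t → sign₁ t ≡ conjugate sign₁ᴹ t
sign₁-conjugate (mat a b c d e f g h i) = sym (trans
  (cong (_· inverse sign₁ᴹ) (mat-≡ (p₁ a d g) (p₁ b e h) (p₁ c f i) (n₂ a d g) (n₂ b e h) (n₂ c f i) (n₃ a d g) (n₃ b e h) (n₃ c f i)))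
  (mat-≡ (P₁ a b c) (N₂ a b c) (N₃ a b c) (P₁ (- d) (- e) (- f)) (M₂ (- d) e (- f)) (M₃ (- d) (- e) f) (P₁ (- g) (- h) (- i)) (M₂ (- g) h (- i)) (M₃ (- g) (- h) i)))

sign₂-conjugate : ∀ t → sign₂ t ≡ conjugate sign₂ᴹ t
sign₂-conjugate (mat a b c d e f g h i) = sym (trans
  (cong (_· inverse sign₂ᴹ) (mat-≡ (n₁ a d g) (n₁ b e h) (n₁ c f i) (p₂ a d g) (p₂ b e h) (p₂ c f i) (n₃ a d g) (n₃ b e h) (n₃ c f i)))
  (mat-≡ (M₁ a (- b) (- c)) (P₂ (- a) (- b) (- c)) (M₃ (- a) (- b) c) (N₁ d e f) (P₂ d e f) (N₃ d e f) (M₁ g (- h) (- i)) (P₂ (- g) (- h) (- i)) (M₃ (- g) (- h) i)))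

SL-conjugate : ∀ w t → SL w → SL t → SL (conjugate w t)
SL-conjugate w t ω δ = SL-· (w · t) (inverse w) (SL-· w t ω δ) (SL-inverse w ω)

conjugate-· : ∀ w v t → conjugate w (conjugate v t) ≡ conjugate (w · v) t
conjugate-· w v t = begin
  (w · ((v · t) · inverse v)) · inverse w ≡⟨ cong (_· inverse w) (sym (·-assoc w (v · t) (inverse v))) ⟩
  ((w · (v · t)) · inverse v) · inverse w ≡⟨ ·-assoc (w · (v · t)) (inverse v) (inverse w) ⟩
  (w · (v · t)) · (inverse v · inverse w) ≡⟨ cong₂ _·_ (sym (·-assoc w v t)) (sym (inverse-· w v)) ⟩
  ((w · v) · t) · inverse (w · v) ∎
  where open ≡-Reasoning

conjugate-inverse : ∀ w t → SL w → conjugate w (inverse t) ≡ inverse (conjugate w t)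
conjugate-inverse w t ω = sym (begin
  inverse ((w · t) · inverse w) ≡⟨ inverse-· (w · t) (inverse w) ⟩
  inverse (inverse w) · inverse (w · t) ≡⟨ cong₂ _·_ (inverse-involutive w ω) (inverse-· w t) ⟩
  w · (inverse t · inverse w) ≡⟨ sym (·-assoc w (inverse t) (inverse w)) ⟩
  (w · inverse t) · inverse w ∎)
  where open ≡-Reasoning

cancelʳ : ∀ g h → SL g → (h · inverse g) · g ≡ h
cancelʳ g h δ = trans (·-assoc h (inverse g) g) (trans (cong (h ·_) (·-inverseˡ g δ)) (·-identityʳ h))

cancelˡ : ∀ g h → SL g → inverse g · (g · h) ≡ h
cancelˡ g h δ = trans (sym (·-assoc (inverse g) g h)) (trans (cong (_· h) (·-inverseˡ g δ)) (·-identityˡ h))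

square≥0 : ∀ x → 0ℤ ℤ.≤ x * x
square≥0 (+ n) = ℤP.≤-trans (ℤ.+≤+ z≤n) (ℤP.≤-reflexive (ℤP.pos-* n n))
square≥0 -[1+ n ] = ℤ.+≤+ z≤n

-- Autocorrelation under a finite action

module Action {A : Set} (X : List A) (uniq : Unique X) (act : M3 → A → A)
  (act∈ : ∀ g x → SL g → x ∈ X → act g x ∈ X)
  (act-· : ∀ g h x → SL g → SL h → x ∈ X → act (g · h) x ≡ act g (act h x))
  (act-𝟙 : ∀ x → x ∈ X → act 𝟙 x ≡ x) where

  act-inverse : ∀ g x → SL g → x ∈ X → act (inverse g) (act g x) ≡ x
  act-inverse g x δ m = trans (sym (act-· (inverse g) g x (SL-inverse g δ) δ m)) (trans (cong (λ k → act k x) (·-inverseˡ g δ)) (act-𝟙 x m))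

  ∑-act : ∀ g → SL g → (F : A → ℤ) → ∑ℤ X (λ x → F (act g x)) ≡ ∑ℤ X F
  ∑-act g δ F = ∑ℤ-bijection X (act g) F uniq refl (λ x m → act∈ g x δ m)
    (λ x y m m' e → trans (sym (act-inverse g x δ m)) (trans (cong (act (inverse g)) e) (act-inverse g y δ m')))

  module Correlation (f : A → ℤ) where

    R : M3 → ℤ
    R t = ∑ℤ X λ x → f x * f (act t x)

    -- The substitution `y = g x` leaves only the quotient `h g⁻¹`.
    R-pair : ∀ g h → SL g → SL h → ∑ℤ X (λ x → f (act g x) * f (act h x)) ≡ R (h · inverse g)
    R-pair g h δ ε = trans (∑ℤ-cong X λ x m → cong (λ y → f (act g x) * f y)
        (trans (cong (λ k → act k x) (sym (cancelʳ g h δ))) (act-· (h · inverse g) g x (SL-· h (inverse g) ε (SL-inverse g δ)) δ m)))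
      (∑-act g δ λ y → f y * f (act (h · inverse g) y))

    R-inverse : ∀ t → SL t → R (inverse t) ≡ R t
    R-inverse t δ = trans (cong R (sym (·-identityˡ (inverse t)))) (trans (sym (R-pair t 𝟙 δ refl))
      (∑ℤ-cong X λ x m → trans (cong (λ y → f (act t x) * f y) (act-𝟙 x m)) (ℤP.*-comm (f (act t x)) (f x))))

    R-𝟙 : R 𝟙 ≡ ∑ℤ X (λ x → f x * f x)
    R-𝟙 = ∑ℤ-cong X λ x m → cong (λ y → f x * f y) (act-𝟙 x m)

    ∑-difference² : ∀ t → SL t → ∑ℤ X (λ x → (f x - f (act t x)) * (f x - f (act t x))) ≡ + 2 * (R 𝟙 - R t)
    ∑-difference² t δ = trans (∑ℤ-cong X λ x _ → lem (f x) (f (act t x))) (trans (∑ℤ-+ X _ _)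
      (trans (cong₂ _+_ (∑ℤ-+ X _ _) (∑ℤ-*ˡ X (- (+ 2)) _)) (trans (cong₂ (λ a b → a + b + - (+ 2) * R t) (sym R-𝟙) (trans (∑-act t δ (λ y → f y * f y)) (sym R-𝟙))) (lem' (R 𝟙) (R t)))))
      where
        lem : ∀ x y → (x - y) * (x - y) ≡ x * x + y * y + - (+ 2) * (x * y)
        lem = solve-∀
        lem' : ∀ x y → x + x + - (+ 2) * y ≡ + 2 * (x - y)
        lem' = solve-∀

    -- Since `f` and its translate have the same norm, the sum of `(f x − f (t x))²` is twice
    -- `R 𝟙 − R t`.
    R-max : ∀ t → SL t → R t ℤ.≤ R 𝟙
    R-max t δ = ℤP.0≤i-j⇒j≤i {R 𝟙} {R t} (ℤP.*-cancelˡ-≤-pos 0ℤ (R 𝟙 - R t) (+ 2) (subst (λ z → 0ℤ ℤ.≤ z) (∑-difference² t δ) (∑ℤ-nonneg X λ x _ → square≥0 (f x - f (act t x)))))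

    -- By `R-pair` the quotient of `w t` and `w` is the conjugate; so translating `f` by `w`
    -- conjugates the argument of its autocorrelation.
    R-shift : ∀ w t → SL w → SL t → ∑ℤ X (λ x → f (act w x) * f (act w (act t x))) ≡ R (conjugate w t)
    R-shift w t ω δ = trans (∑ℤ-cong X λ x m → cong (λ y → f (act w x) * f y) (sym (act-· w t x ω δ m))) (R-pair w (w · t) ω (SL-· w t ω δ))

    -- Expanding the square and summing over `X` turns every product of translates into a
    -- correlation at `h g⁻¹`. Read backwards, this says that `R` is of positive type.
    quadratic : ∀ {I : Set} (C : List I) (e : I → ℤ) (el : I → M3) → All (SL ∘ el) C →
      ∑ℤ X (λ x → ∑ℤ C (λ g → e g * f (act (el g) x)) * ∑ℤ C (λ g → e g * f (act (el g) x))) ≡ ∑ℤ C λ g → ∑ℤ C λ h → e g * e h * R (el h · inverse (el g))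
    quadratic C e el sl = begin
      ∑ℤ X (λ x → S x * S x) ≡⟨ ∑ℤ-cong X (λ x _ → trans (sym (∑ℤ-*ʳ C (S x) (λ g → e g * F g x))) (∑ℤ-cong C λ g _ → sym (∑ℤ-*ˡ C (e g * F g x) (λ h → e h * F h x)))) ⟩
      ∑ℤ X (λ x → ∑ℤ C λ g → ∑ℤ C λ h → e g * F g x * (e h * F h x)) ≡⟨ ∑ℤ-swap X C (λ x g → ∑ℤ C λ h → e g * F g x * (e h * F h x)) ⟩
      ∑ℤ C (λ g → ∑ℤ X λ x → ∑ℤ C λ h → e g * F g x * (e h * F h x)) ≡⟨ ∑ℤ-cong C (λ g _ → ∑ℤ-swap X C (λ x h → e g * F g x * (e h * F h x))) ⟩
      ∑ℤ C (λ g → ∑ℤ C λ h → ∑ℤ X λ x → e g * F g x * (e h * F h x)) ≡⟨ ∑ℤ-cong C (λ g mg → ∑ℤ-cong C λ h mh →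
         trans (∑ℤ-cong X λ x _ → lem (e g) (F g x) (e h) (F h x)) (trans (∑ℤ-*ˡ X (e g * e h) (λ x → F g x * F h x)) (cong (e g * e h *_) (R-pair (el g) (el h) (All.lookup sl mg) (All.lookup sl mh))))) ⟩
      ∑ℤ C (λ g → ∑ℤ C λ h → e g * e h * R (el h · inverse (el g))) ∎
      where
        open ≡-Reasoning
        F = λ g x → f (act (el g) x)
        S = λ x → ∑ℤ C λ g → e g * F g x
        lem : ∀ a b c d → a * b * (c * d) ≡ a * c * (b * d)
        lem = solve-∀

-- The spectral gap

∑ℤ-products : ∀ (ρ : M3 → ℤ) (L : List (ℤ × M3)) (K : List (ℤ × M3)) →
  ∑ℤ (products L K) (λ p → proj₁ p * ρ (proj₂ p)) ≡ ∑ℤ L (λ g → ∑ℤ K λ h → proj₁ g * proj₁ h * ρ (proj₂ h · inverse (proj₂ g)))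
∑ℤ-products ρ [] K = refl
∑ℤ-products ρ ((a , g) ∷ L) K = trans (∑ℤ-++ (map _ K) (products L K) (λ p → proj₁ p * ρ (proj₂ p))) (cong₂ _+_ (∑ℤ-map _ K (λ p → proj₁ p * ρ (proj₂ p))) (∑ℤ-products ρ L K))

W-closed-∈ : ∀ {v} → v ∈ W-generators → ∀ w → w ∈ W → w · v ∈ W
W-closed-∈ mv w mw = All.lookup (All.lookup W-closed mv) mw

·-cancelʳ : ∀ v w w' → SL v → w · v ≡ w' · v → w ≡ w'
·-cancelʳ v w w' δ e = trans (sym (undo w)) (trans (cong (_· inverse v) e) (undo w'))
  where undo : ∀ w → (w · v) · inverse v ≡ w
        undo w = trans (·-assoc w v (inverse v)) (trans (cong (w ·_) (·-inverseʳ v δ)) (·-identityʳ w))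

conjugate-injective : ∀ w s s' → SL w → conjugate w s ≡ conjugate w s' → s ≡ s'
conjugate-injective w s s' ω e = trans (sym (cancelˡ w s ω)) (trans (cong (inverse w ·_) (·-cancelʳ (inverse w) (w · s) (w · s') (SL-inverse w ω) e)) (cancelˡ w s' ω))

module Gap {A : Set} (X : List A) (uniq : Unique X) (act : M3 → A → A)
  (act∈ : ∀ g x → SL g → x ∈ X → act g x ∈ X)
  (act-· : ∀ g h x → SL g → SL h → x ∈ X → act (g · h) x ≡ act g (act h x))
  (act-𝟙 : ∀ x → x ∈ X → act 𝟙 x ≡ x) where

  open Action X uniq act act∈ act-· act-𝟙

  neighbours : (A → ℤ) → A → ℤ
  neighbours f x = ∑ℤ generators λ s → f (act s x)

  -- `Δ` is the Laplacian of the graph joining `x` to `s x`; `B` equals `24 − Δ`, which is 24 times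
  -- the lazy random walk.
  Δ B : (A → ℤ) → A → ℤ
  Δ f x = + 12 * f x - neighbours f x
  B f x = + 12 * f x + neighbours f x

  infix 8 ⟨_,_⟩
  ⟨_,_⟩ : (A → ℤ) → (A → ℤ) → ℤ
  ⟨ f , g ⟩ = ∑ℤ X λ x → f x * g x

  E : (A → ℤ) → ℤ
  E f = ⟨ f , Δ f ⟩

  private
    generator-SL : ∀ {s} → s ∈ generators → SL s
    generator-SL = All.lookup generators-SL

    W-∈-SL : ∀ {w} → w ∈ W → SL w
    W-∈-SL = All.lookup W-SL

    module Positivity (f : A → ℤ) where
      open Correlation f

      -- Averaging over `W` supplies the invariance used by the certificate and leaves the values at
      -- `Δ` and `Δ²` recognisable, because `W` permutes the generators.
      ρ : M3 → ℤ
      ρ t = ∑ℤ W λ w → R (conjugate w t)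

      invariant : ∀ v → v ∈ W-generators → ∀ t → ρ (conjugate v t) ≡ ρ t
      invariant v mv t = trans (∑ℤ-cong W λ w _ → cong R (conjugate-· w v t))
        (∑ℤ-bijection W (_· v) (λ w → R (conjugate w t)) W-unique refl (W-closed-∈ mv) (λ w w' _ _ → ·-cancelʳ v w w' (All.lookup W-generators-SL mv)))

      symmetric : ∀ (φ : M3 → M3) v → v ∈ W-generators → (∀ t → φ t ≡ conjugate v t) → ∀ t → SL t → SL (φ t) × ρ (φ t) ≡ ρ t
      symmetric φ v mv h t δ = subst SL (sym (h t)) (SL-conjugate v t (All.lookup W-generators-SL mv) δ) , trans (cong ρ (h t)) (invariant v mv t)

      laplacian-SL : All (SL ∘ proj₂) laplacian
      laplacian-SL = All.tabulate λ { (here refl) → refl ; (there m) → tail m }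
        where tail : ∀ {x} → x ∈ map (λ s → - 1ℤ , s) generators → SL (proj₂ x)
              tail m with ∈-map⁻ (λ s → - 1ℤ , s) m
              ... | s , ms , refl = generator-SL ms

      Δ-laplacian : ∀ (g : A → ℤ) x → x ∈ X → ∑ℤ laplacian (λ p → proj₁ p * g (act (proj₂ p) x)) ≡ Δ g x
      Δ-laplacian g x m = cong₂ _+_ (cong (λ y → + 12 * g y) (act-𝟙 x m))
        (trans (∑ℤ-map (λ s → - 1ℤ , s) generators (λ p → proj₁ p * g (act (proj₂ p) x))) (trans (∑ℤ-*ˡ generators (- 1ℤ) λ s → g (act s x)) (ℤP.-1*i≡-i _)))

      translate : M3 → A → ℤ
      translate w x = f (act w x)

      -- Moving `w` past a generator conjugates the generator, and conjugation by `w` permutes the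
      -- generators. Hence `Δ` commutes with translation by `W`.
      Δ-translate : ∀ w → w ∈ W → ∀ x → x ∈ X → Δ (translate w) x ≡ Δ f (act w x)
      Δ-translate w mw x m = cong (λ z → + 12 * f (act w x) - z) (trans
          (∑ℤ-cong generators λ s ms → cong f (begin
            act w (act s x) ≡⟨ sym (act-· w s x ω (generator-SL ms) m) ⟩
            act (w · s) x ≡⟨ cong (λ k → act k x) (sym (cancelʳ w (w · s) ω)) ⟩
            act (conjugate w s · w) x ≡⟨ act-· (conjugate w s) w x (SL-conjugate w s ω (generator-SL ms)) ω m ⟩
            act (conjugate w s) (act w x) ∎))
          (∑ℤ-bijection generators (conjugate w) (λ s → f (act s (act w x))) generators-unique refl
            (λ s ms → All.lookup (All.lookup generators-conjugate mw) ms) (λ s s' _ _ → conjugate-injective w s s' ω)))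
        where
          open ≡-Reasoning
          ω = W-∈-SL mw

      ρ-translate : ∀ t → SL t → ρ t ≡ ∑ℤ W λ w → Correlation.R (translate w) t
      ρ-translate t δ = ∑ℤ-cong W λ w mw → sym (R-shift w t (W-∈-SL mw) δ)

      -- By `R-shift`, `ρ` is a sum of autocorrelations of the translates of `f`, and each of them
      -- contributes a sum of squares.
      quadratic-ρ : ∀ {I : Set} (C : List I) (e : I → ℤ) (el : I → M3) → All (SL ∘ el) C →
        ∑ℤ C (λ g → ∑ℤ C λ h → e g * e h * ρ (el h · inverse (el g))) ≡
        ∑ℤ W λ w → ∑ℤ X λ x → ∑ℤ C (λ g → e g * translate w (act (el g) x)) * ∑ℤ C (λ g → e g * translate w (act (el g) x))
      quadratic-ρ C e el sl = begin
        ∑ℤ C (λ g → ∑ℤ C λ h → e g * e h * ρ (el h · inverse (el g))) ≡⟨ ∑ℤ-cong C (λ g mg → ∑ℤ-cong C λ h mh → trans (cong (e g * e h *_) (ρ-translate (el h · inverse (el g)) (sl-quot g h mg mh))) (sym (∑ℤ-*ˡ W (e g * e h) _))) ⟩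
        ∑ℤ C (λ g → ∑ℤ C λ h → ∑ℤ W (term g h)) ≡⟨ ∑ℤ-cong C (λ g _ → ∑ℤ-swap C W (term g)) ⟩
        ∑ℤ C (λ g → ∑ℤ W λ w → ∑ℤ C λ h → term g h w) ≡⟨ ∑ℤ-swap C W (λ g w → ∑ℤ C λ h → term g h w) ⟩
        ∑ℤ W (λ w → ∑ℤ C λ g → ∑ℤ C λ h → term g h w) ≡⟨ ∑ℤ-cong W (λ w _ → sym (Correlation.quadratic (translate w) C e el sl)) ⟩
        (∑ℤ W λ w → ∑ℤ X λ x → ∑ℤ C (λ g → e g * translate w (act (el g) x)) * ∑ℤ C (λ g → e g * translate w (act (el g) x))) ∎
        where
          open ≡-Reasoning
          term = λ g h w → e g * e h * Correlation.R (translate w) (el h · inverse (el g))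
          sl-quot = λ g h mg mh → SL-· (el h) (inverse (el g)) (All.lookup sl mh) (SL-inverse (el g) (All.lookup sl mg))

      module Cert (C : List Entry) (C-SL : All (SL ∘ Entry.el) C) (fav : Favourable (defect C laplacian)) (tot : total (defect C laplacian) ≡ 0ℤ) where

        open Certificate C C-SL laplacian fav tot ρ
          (symmetric swap₁₂ swapᴹ (here refl) swap-conjugate)
          (symmetric cycle cycleᴹ (there (here refl)) cycle-conjugate)
          (symmetric sign₁ sign₁ᴹ (there (there (here refl))) sign₁-conjugate)
          (symmetric sign₂ sign₂ᴹ (there (there (there (here refl)))) sign₂-conjugate)
          (λ t δ → ∑ℤ-cong W λ w mw → trans (cong R (conjugate-inverse w t (W-∈-SL mw))) (R-inverse (conjugate w t) (SL-conjugate w t (W-∈-SL mw) δ)))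
          (λ t δ → ∑ℤ-mono W λ w mw → ℤP.≤-trans (R-max (conjugate w t) (SL-conjugate w t (W-∈-SL mw) δ))
             (ℤP.≤-reflexive (cong R (sym (trans (cong (_· inverse w) (·-identityʳ w)) (·-inverseʳ w (W-∈-SL mw)))))))
          renaming (⟨_⟩ to evaluate)

        evaluate-∑ : ∀ L → evaluate L ≡ ∑ℤ L (λ g → proj₁ g * ρ (proj₂ g))
        evaluate-∑ [] = refl
        evaluate-∑ ((c , t) ∷ L) = cong (λ z → c * ρ t + z) (evaluate-∑ L)

        square≥0ᶜ : ∀ e → 0ℤ ℤ.≤ square e
        square≥0ᶜ e = ℤP.≤-trans (∑ℤ-nonneg W λ w _ → ∑ℤ-nonneg X λ x _ → square≥0 (∑ℤ C λ g → e g * translate w (act (Entry.el g) x))) (ℤP.≤-reflexive (sym (quadratic-ρ C e Entry.el C-SL)))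

        Δ²-eval : evaluate (products laplacian laplacian) ≡ + 24 * ⟨ Δ f , Δ f ⟩
        Δ²-eval = begin
          evaluate (products laplacian laplacian) ≡⟨ evaluate-∑ (products laplacian laplacian) ⟩
          ∑ℤ (products laplacian laplacian) (λ g → proj₁ g * ρ (proj₂ g)) ≡⟨ ∑ℤ-products ρ laplacian laplacian ⟩
          ∑ℤ laplacian (λ g → ∑ℤ laplacian λ h → proj₁ g * proj₁ h * ρ (proj₂ h · inverse (proj₂ g))) ≡⟨ quadratic-ρ laplacian proj₁ proj₂ laplacian-SL ⟩
          ∑ℤ W (λ w → ∑ℤ X λ x → S w x * S w x) ≡⟨ ∑ℤ-cong W (λ w mw → trans (∑ℤ-cong X λ x m → cong₂ _*_ (eq w mw x m) (eq w mw x m)) (∑-act w (W-∈-SL mw) λ y → Δ f y * Δ f y)) ⟩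
          ∑ℤ W (λ _ → ⟨ Δ f , Δ f ⟩) ≡⟨ trans (∑ℤ-const W ⟨ Δ f , Δ f ⟩) (cong (λ n → + n * ⟨ Δ f , Δ f ⟩) length-W) ⟩
          + 24 * ⟨ Δ f , Δ f ⟩ ∎
          where
            open ≡-Reasoning
            S : M3 → A → ℤ
            S w x = ∑ℤ laplacian λ g → proj₁ g * translate w (act (proj₂ g) x)
            eq : ∀ w → w ∈ W → ∀ x → x ∈ X → S w x ≡ Δ f (act w x)
            eq w mw x m = trans (Δ-laplacian (translate w) x m) (Δ-translate w mw x m)

        Δ-eval : evaluate laplacian ≡ + 24 * E f
        Δ-eval = begin
          evaluate laplacian ≡⟨ evaluate-∑ laplacian ⟩
          ∑ℤ laplacian (λ g → proj₁ g * ρ (proj₂ g)) ≡⟨ ∑ℤ-cong laplacian (λ g m → trans (cong (proj₁ g *_) (ρ-translate (proj₂ g) (All.lookup laplacian-SL m))) (sym (∑ℤ-*ˡ W (proj₁ g) (λ w → Correlation.R (translate w) (proj₂ g))))) ⟩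
          ∑ℤ laplacian (λ g → ∑ℤ W λ w → proj₁ g * Correlation.R (translate w) (proj₂ g)) ≡⟨ ∑ℤ-swap laplacian W (λ g w → proj₁ g * Correlation.R (translate w) (proj₂ g)) ⟩
          ∑ℤ W (λ w → ∑ℤ laplacian λ g → proj₁ g * Correlation.R (translate w) (proj₂ g)) ≡⟨ ∑ℤ-cong W (λ w mw → each w mw) ⟩
          ∑ℤ W (λ _ → E f) ≡⟨ trans (∑ℤ-const W (E f)) (cong (λ n → + n * E f) length-W) ⟩
          + 24 * E f ∎
          where
            open ≡-Reasoning
            lem : ∀ c a b → c * (a * b) ≡ a * (c * b)
            lem = solve-∀
            each : ∀ w → w ∈ W → ∑ℤ laplacian (λ g → proj₁ g * Correlation.R (translate w) (proj₂ g)) ≡ E f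
            each w mw = begin
              ∑ℤ laplacian (λ g → proj₁ g * Correlation.R (translate w) (proj₂ g)) ≡⟨ ∑ℤ-cong laplacian (λ g _ → trans (sym (∑ℤ-*ˡ X (proj₁ g) (λ x → translate w x * translate w (act (proj₂ g) x)))) (∑ℤ-cong X λ x _ → lem (proj₁ g) (translate w x) (translate w (act (proj₂ g) x)))) ⟩
              ∑ℤ laplacian (λ g → ∑ℤ X λ x → translate w x * (proj₁ g * translate w (act (proj₂ g) x))) ≡⟨ ∑ℤ-swap laplacian X (λ g x → translate w x * (proj₁ g * translate w (act (proj₂ g) x))) ⟩
              ∑ℤ X (λ x → ∑ℤ laplacian λ g → translate w x * (proj₁ g * translate w (act (proj₂ g) x))) ≡⟨ ∑ℤ-cong X (λ x m → trans (∑ℤ-*ˡ laplacian (translate w x) (λ g → proj₁ g * translate w (act (proj₂ g) x))) (cong (translate w x *_) (trans (Δ-laplacian (translate w) x m) (Δ-translate w mw x m)))) ⟩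
              ∑ℤ X (λ x → f (act w x) * Δ f (act w x)) ≡⟨ ∑-act w (W-∈-SL mw) (λ y → f y * Δ f y) ⟩
              E f ∎

        conclusion : E f ℤ.≤ + 20 * ⟨ Δ f , Δ f ⟩
        -- The common factor is `49000000 · 24`: the scale of the certificate times the 24 elements
        -- of `W`, each of which contributes the same `E f` and the same norm of `Δ f`.
        conclusion = ℤP.*-cancelˡ-≤-pos (E f) (+ 20 * ⟨ Δ f , Δ f ⟩) (+ 1176000000) (ℤP.0≤i-j⇒j≤i (ℤP.≤-trans positivity
          (ℤP.≤-trans (ℤP.+-monoˡ-≤ (+ 980000000 * evaluate (products laplacian laplacian) + - (+ 49000000) * evaluate laplacian)
              (ℤP.*-monoˡ-≤-nonPos (- (+ 20)) {0ℤ} {square Entry.ξ₁ + square Entry.ξ₂ + square Entry.ξ₃} (ℤP.+-mono-≤ (ℤP.+-mono-≤ (square≥0ᶜ Entry.ξ₁) (square≥0ᶜ Entry.ξ₂)) (square≥0ᶜ Entry.ξ₃))))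
           (ℤP.≤-reflexive (trans (cong₂ (λ a b → - (+ 20) * 0ℤ + (+ 980000000 * a + - (+ 49000000) * b)) Δ²-eval Δ-eval) (lem ⟨ Δ f , Δ f ⟩ (E f)))))))
          where
            lem : ∀ d e → - (+ 20) * 0ℤ + (+ 980000000 * (+ 24 * d) + - (+ 49000000) * (+ 24 * e)) ≡ + 1176000000 * (+ 20 * d) - + 1176000000 * e
            lem = solve-∀

  -- In spectral terms, the eigenvalues of `Δ` avoid the open interval from 0 to `1/20`, whatever
  -- the finite action. The certificate enters as a module parameter, so it stays folded.
  E≤20Δ² : ∀ f → E f ℤ.≤ + 20 * ⟨ Δ f , Δ f ⟩
  E≤20Δ² f with certificate
  ... | C , C-SL , favourable , zero-total = Positivity.Cert.conclusion f C C-SL favourable zero-total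

  private
    R : (A → ℤ) → M3 → ℤ
    R = Correlation.R

    ⟨,⟩-comm : ∀ f g → ⟨ f , g ⟩ ≡ ⟨ g , f ⟩
    ⟨,⟩-comm f g = ∑ℤ-cong X λ x _ → ℤP.*-comm (f x) (g x)

    ⟨,⟩-linear : ∀ f g h a b → ⟨ f , (λ x → a * g x + b * h x) ⟩ ≡ a * ⟨ f , g ⟩ + b * ⟨ f , h ⟩
    ⟨,⟩-linear f g h a b = trans (∑ℤ-cong X λ x _ → lem (f x) (g x) (h x) a b) (trans (∑ℤ-+ X _ _) (cong₂ _+_ (∑ℤ-*ˡ X a (λ x → f x * g x)) (∑ℤ-*ˡ X b (λ x → f x * h x))))
      where lem : ∀ f g h a b → f * (a * g + b * h) ≡ a * (f * g) + b * (f * h)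
            lem = solve-∀

    ⟨⟩-neighbours : ∀ f g → ⟨ f , neighbours g ⟩ ≡ ∑ℤ generators λ s → ∑ℤ X λ x → f x * g (act s x)
    ⟨⟩-neighbours f g = trans (∑ℤ-cong X λ x _ → sym (∑ℤ-*ˡ generators (f x) λ s → g (act s x))) (∑ℤ-swap X generators λ x s → f x * g (act s x))

  inverse-generators : All (λ s → inverse s ∈ generators) generators
  inverse-generators = does-true (all? (λ s → inverse s ∈? generators) generators) refl

  -- Substituting `s⁻¹ x` moves the translation to the other factor, and inversion permutes the
  -- generators.
  neighbours-symmetric : ∀ f g → ⟨ f , neighbours g ⟩ ≡ ⟨ neighbours f , g ⟩
  neighbours-symmetric f g = begin
    ⟨ f , neighbours g ⟩ ≡⟨ ⟨⟩-neighbours f g ⟩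
    (∑ℤ generators λ s → ∑ℤ X λ x → f x * g (act s x)) ≡⟨ ∑ℤ-cong generators (λ s ms → shift s (All.lookup generators-SL ms)) ⟩
    (∑ℤ generators λ s → ∑ℤ X λ x → g x * f (act (inverse s) x)) ≡⟨ ∑ℤ-bijection generators inverse (λ s → ∑ℤ X λ x → g x * f (act s x)) generators-unique refl (λ s ms → All.lookup inverse-generators ms)
       (λ s s' ms ms' e → trans (sym (inverse-involutive s (All.lookup generators-SL ms))) (trans (cong inverse e) (inverse-involutive s' (All.lookup generators-SL ms')))) ⟩
    (∑ℤ generators λ s → ∑ℤ X λ x → g x * f (act s x)) ≡⟨ sym (⟨⟩-neighbours g f) ⟩
    ⟨ g , neighbours f ⟩ ≡⟨ ⟨,⟩-comm g (neighbours f) ⟩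
    ⟨ neighbours f , g ⟩ ∎
    where
      open ≡-Reasoning
      shift : ∀ s → SL s → ∑ℤ X (λ x → f x * g (act s x)) ≡ ∑ℤ X (λ x → g x * f (act (inverse s) x))
      shift s δ = trans (∑ℤ-cong X λ x m → trans (ℤP.*-comm (f x) (g (act s x))) (cong (λ y → g (act s x) * f y) (sym (act-inverse s x δ m))))
        (∑-act s δ λ y → g y * f (act (inverse s) y))

  Δ-symmetric : ∀ f g → ⟨ f , Δ g ⟩ ≡ ⟨ Δ f , g ⟩
  Δ-symmetric f g = begin
    ⟨ f , Δ g ⟩ ≡⟨ ∑ℤ-cong X (λ x _ → cong (f x *_) (lem (g x) (neighbours g x))) ⟩
    ⟨ f , (λ x → + 12 * g x + - 1ℤ * neighbours g x) ⟩ ≡⟨ ⟨,⟩-linear f g (neighbours g) (+ 12) (- 1ℤ) ⟩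
    + 12 * ⟨ f , g ⟩ + - 1ℤ * ⟨ f , neighbours g ⟩ ≡⟨ cong₂ (λ a b → + 12 * a + - 1ℤ * b) (⟨,⟩-comm f g) (trans (neighbours-symmetric f g) (⟨,⟩-comm (neighbours f) g)) ⟩
    + 12 * ⟨ g , f ⟩ + - 1ℤ * ⟨ g , neighbours f ⟩ ≡⟨ sym (⟨,⟩-linear g f (neighbours f) (+ 12) (- 1ℤ)) ⟩
    ⟨ g , (λ x → + 12 * f x + - 1ℤ * neighbours f x) ⟩ ≡⟨ ∑ℤ-cong X (λ x _ → cong (g x *_) (sym (lem (f x) (neighbours f x)))) ⟩
    ⟨ g , Δ f ⟩ ≡⟨ ⟨,⟩-comm g (Δ f) ⟩
    ⟨ Δ f , g ⟩ ∎
    where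
      open ≡-Reasoning
      lem : ∀ a b → + 12 * a - b ≡ + 12 * a + - 1ℤ * b
      lem = solve-∀

  private
    R-of-generators : ∀ f → ∑ℤ generators (R f) ≡ ⟨ f , neighbours f ⟩
    R-of-generators f = sym (⟨⟩-neighbours f f)

    ⟨f,Δf⟩ : ∀ f → E f ≡ + 12 * ⟨ f , f ⟩ - ⟨ f , neighbours f ⟩
    ⟨f,Δf⟩ f = trans (∑ℤ-cong X λ x _ → cong (f x *_) (lem (f x) (neighbours f x))) (trans (⟨,⟩-linear f f (neighbours f) (+ 12) (- 1ℤ)) (sym (lem ⟨ f , f ⟩ ⟨ f , neighbours f ⟩)))
      where lem : ∀ a b → + 12 * a - b ≡ + 12 * a + - 1ℤ * b
            lem = solve-∀

    ∑-sum² : ∀ f s → SL s → ∑ℤ X (λ x → (f x + f (act s x)) * (f x + f (act s x))) ≡ + 2 * ⟨ f , f ⟩ + + 2 * R f s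
    ∑-sum² f s δ = trans (∑ℤ-cong X λ x _ → lem (f x) (f (act s x))) (trans (∑ℤ-+ X _ _)
      (trans (cong₂ _+_ (∑ℤ-+ X _ _) (∑ℤ-*ˡ X (+ 2) _)) (trans (cong (λ a → ⟨ f , f ⟩ + a + + 2 * R f s) (∑-act s δ (λ y → f y * f y))) (lem' ⟨ f , f ⟩ (R f s)))))
      where
        lem : ∀ x y → (x + y) * (x + y) ≡ x * x + y * y + + 2 * (x * y)
        lem = solve-∀
        lem' : ∀ x y → x + x + + 2 * y ≡ + 2 * x + + 2 * y
        lem' = solve-∀

  -- Exhibits `E` as an energy: it is nonnegative, and it controls the difference of `f` along each
  -- single edge.
  Dirichlet : ∀ f → ∑ℤ generators (λ s → ∑ℤ X λ x → (f x - f (act s x)) * (f x - f (act s x))) ≡ + 2 * E f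
  Dirichlet f = begin
    ∑ℤ generators (λ s → ∑ℤ X λ x → (f x - f (act s x)) * (f x - f (act s x))) ≡⟨ ∑ℤ-cong generators (λ s ms → trans (Correlation.∑-difference² f s (All.lookup generators-SL ms)) (trans (cong (λ z → + 2 * (z - R f s)) (Correlation.R-𝟙 f)) (lem ⟨ f , f ⟩ (R f s)))) ⟩
    ∑ℤ generators (λ s → + 2 * ⟨ f , f ⟩ + - (+ 2) * R f s) ≡⟨ trans (∑ℤ-+ generators (λ _ → + 2 * ⟨ f , f ⟩) (λ s → - (+ 2) * R f s)) (cong₂ _+_ (∑ℤ-const generators (+ 2 * ⟨ f , f ⟩)) (trans (∑ℤ-*ˡ generators (- (+ 2)) (R f)) (cong (- (+ 2) *_) (R-of-generators f)))) ⟩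
    + 12 * (+ 2 * ⟨ f , f ⟩) + - (+ 2) * ⟨ f , neighbours f ⟩ ≡⟨ lem' ⟨ f , f ⟩ ⟨ f , neighbours f ⟩ ⟩
    + 2 * (+ 12 * ⟨ f , f ⟩ - ⟨ f , neighbours f ⟩) ≡⟨ cong (+ 2 *_) (sym (⟨f,Δf⟩ f)) ⟩
    + 2 * E f ∎
    where
      open ≡-Reasoning
      lem : ∀ x y → + 2 * (x - y) ≡ + 2 * x + - (+ 2) * y
      lem = solve-∀
      lem' : ∀ x y → + 12 * (+ 2 * x) + - (+ 2) * y ≡ + 2 * (+ 12 * x - y)
      lem' = solve-∀

  -- The counterpart of `Dirichlet` for the squares of the sums `f x + f (s x)`.
  E≤24 : ∀ f → E f ℤ.≤ + 24 * ⟨ f , f ⟩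
  E≤24 f = ℤP.0≤i-j⇒j≤i {+ 24 * ⟨ f , f ⟩} {E f} (ℤP.*-cancelˡ-≤-pos 0ℤ (+ 24 * ⟨ f , f ⟩ - E f) (+ 2)
      (ℤP.≤-trans (∑ℤ-nonneg generators λ s _ → ∑ℤ-nonneg X λ x _ → square≥0 (f x + f (act s x))) (ℤP.≤-reflexive (begin
    ∑ℤ generators (λ s → ∑ℤ X λ x → (f x + f (act s x)) * (f x + f (act s x))) ≡⟨ ∑ℤ-cong generators (λ s ms → ∑-sum² f s (All.lookup generators-SL ms)) ⟩
    ∑ℤ generators (λ s → + 2 * ⟨ f , f ⟩ + + 2 * R f s) ≡⟨ trans (∑ℤ-+ generators (λ _ → + 2 * ⟨ f , f ⟩) (λ s → + 2 * R f s)) (cong₂ _+_ (∑ℤ-const generators (+ 2 * ⟨ f , f ⟩)) (trans (∑ℤ-*ˡ generators (+ 2) (R f)) (cong (+ 2 *_) (R-of-generators f)))) ⟩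
    + 12 * (+ 2 * ⟨ f , f ⟩) + + 2 * ⟨ f , neighbours f ⟩ ≡⟨ lem ⟨ f , f ⟩ ⟨ f , neighbours f ⟩ ⟩
    + 2 * (+ 24 * ⟨ f , f ⟩ - (+ 12 * ⟨ f , f ⟩ - ⟨ f , neighbours f ⟩)) ≡⟨ cong (λ z → + 2 * (+ 24 * ⟨ f , f ⟩ - z)) (sym (⟨f,Δf⟩ f)) ⟩
    + 2 * (+ 24 * ⟨ f , f ⟩ - E f) ∎))))
    where
      open ≡-Reasoning
      lem : ∀ x y → + 12 * (+ 2 * x) + + 2 * y ≡ + 2 * (+ 24 * x - (+ 12 * x - y))
      lem = solve-∀

-- Decay of variance under the lazy walk

≤⇒0≤- : ∀ {x y : ℤ} → x ℤ.≤ y → 0ℤ ℤ.≤ y - x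
≤⇒0≤- = ℤP.i≤j⇒0≤j-i

0≤-⇒≤ : ∀ {x y : ℤ} → 0ℤ ℤ.≤ y - x → x ℤ.≤ y
0≤-⇒≤ {x} {y} = ℤP.0≤i-j⇒j≤i {y} {x}

*-nonneg : ∀ {x y : ℤ} → 0ℤ ℤ.≤ x → 0ℤ ℤ.≤ y → 0ℤ ℤ.≤ x * y
*-nonneg {+ m} {+ n} _ _ = ℤP.≤-trans (ℤ.+≤+ z≤n) (ℤP.≤-reflexive (ℤP.pos-* m n))

+-nonneg : ∀ {x y : ℤ} → 0ℤ ℤ.≤ x → 0ℤ ℤ.≤ y → 0ℤ ℤ.≤ x + y
+-nonneg = ℤP.+-mono-≤

*-monoˡ : ∀ n {x y : ℤ} → x ℤ.≤ y → + n * x ℤ.≤ + n * y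
*-monoˡ n = ℤP.*-monoˡ-≤-nonNeg (+ n)

-- Opaque, so that unification never unfolds the multiples of these numerals.
abstract
  mixing-factor contraction dilation : ℕ
  mixing-factor = 519 ℕ.* 24
  contraction = 2874
  dilation = 2880

  mixing-factor-≡ : mixing-factor ≡ 519 ℕ.* 24
  mixing-factor-≡ = refl

  contraction-≡ : contraction ≡ 2874
  contraction-≡ = refl

  dilation-≡ : dilation ≡ 5 ℕ.* (24 ℕ.* 24)
  dilation-≡ = refl

  dilation-contraction : contraction ℕ.* 480 ≡ dilation ℕ.* 479
  dilation-contraction = refl

  contraction≤dilation : contraction ℕ.≤ dilation
  contraction≤dilation = ℕP.≤ᵇ⇒≤ 2874 2880 _

  1≤dilation : 1 ℕ.≤ dilation
  1≤dilation = s≤s z≤n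

module Mixing {A : Set} (X : List A) (uniq : Unique X) (act : M3 → A → A)
  (act∈ : ∀ g x → SL g → x ∈ X → act g x ∈ X)
  (act-· : ∀ g h x → SL g → SL h → x ∈ X → act (g · h) x ≡ act g (act h x))
  (act-𝟙 : ∀ x → x ∈ X → act 𝟙 x ≡ x) where

  open Gap X uniq act act∈ act-· act-𝟙 public
  open Action X uniq act act∈ act-· act-𝟙

  S : (A → ℤ) → ℤ
  S f = ∑ℤ X f

  N : ℤ
  N = + length X

  -- This is `N²` times the variance, so no division occurs.
  Var : (A → ℤ) → ℤ
  Var f = N * ⟨ f , f ⟩ - S f * S f

  B^ : ℕ → (A → ℤ) → A → ℤ
  B^ zero f = f
  B^ (suc m) f = B (B^ m f)

  ⟨⟩-nonneg : ∀ f → 0ℤ ℤ.≤ ⟨ f , f ⟩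
  ⟨⟩-nonneg f = ∑ℤ-nonneg X λ x _ → square≥0 (f x)

  E-nonneg : ∀ f → 0ℤ ℤ.≤ E f
  E-nonneg f = ℤP.*-cancelˡ-≤-pos 0ℤ (E f) (+ 2) (ℤP.≤-trans (∑ℤ-nonneg generators λ s _ → ∑ℤ-nonneg X λ x _ → square≥0 (f x - f (act s x))) (ℤP.≤-reflexive (Dirichlet f)))

  private
    B-Δ : ∀ f x → B f x ≡ + 24 * f x - Δ f x
    B-Δ f x = lem (f x) (neighbours f x)
      where lem : ∀ a b → + 12 * a + b ≡ + 24 * a - (+ 12 * a - b)
            lem = solve-∀

    neighbours-B : ∀ f x → neighbours (B f) x ≡ + 24 * neighbours f x - neighbours (Δ f) x
    neighbours-B f x = trans (∑ℤ-cong generators λ s _ → trans (B-Δ f (act s x)) (lem (f (act s x)) (Δ f (act s x)))) (trans (∑ℤ-+ generators (λ s → + 24 * f (act s x)) (λ s → - 1ℤ * Δ f (act s x)))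
        (trans (cong₂ _+_ (∑ℤ-*ˡ generators (+ 24) (λ s → f (act s x))) (∑ℤ-*ˡ generators (- 1ℤ) (λ s → Δ f (act s x)))) (sym (lem (neighbours f x) (neighbours (Δ f) x)))))
      where lem : ∀ a b → + 24 * a - b ≡ + 24 * a + - 1ℤ * b
            lem = solve-∀

    Δ-B : ∀ f x → Δ (B f) x ≡ + 24 * Δ f x - Δ (Δ f) x
    Δ-B f x = trans (cong₂ (λ a b → + 12 * a - b) (B-Δ f x) (neighbours-B f x)) (lem (f x) (neighbours f x) (Δ f x) (neighbours (Δ f) x) refl)
      where
        lem' : ∀ a b d → + 12 * (+ 24 * a - (+ 12 * a - b)) - (+ 24 * b - d) ≡ + 24 * (+ 12 * a - b) - (+ 12 * (+ 12 * a - b) - d)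
        lem' = solve-∀
        lem : ∀ a b c d → c ≡ + 12 * a - b → + 12 * (+ 24 * a - c) - (+ 24 * b - d) ≡ + 24 * c - (+ 12 * c - d)
        lem a b _ d refl = lem' a b d

    expand : ∀ f g h k → ∑ℤ X (λ x → (+ 24 * f x - g x) * (+ 24 * h x - k x)) ≡ + 576 * ⟨ f , h ⟩ + - (+ 24) * ⟨ f , k ⟩ + (- (+ 24) * ⟨ g , h ⟩ + ⟨ g , k ⟩)
    expand f g h k = trans (∑ℤ-cong X λ x _ → lem (f x) (g x) (h x) (k x)) (trans (∑ℤ-+ X (λ x → + 576 * (f x * h x) + - (+ 24) * (f x * k x)) (λ x → - (+ 24) * (g x * h x) + g x * k x))
      (cong₂ _+_ (trans (∑ℤ-+ X (λ x → + 576 * (f x * h x)) (λ x → - (+ 24) * (f x * k x))) (cong₂ _+_ (∑ℤ-*ˡ X (+ 576) (λ x → f x * h x)) (∑ℤ-*ˡ X (- (+ 24)) (λ x → f x * k x))))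
                 (trans (∑ℤ-+ X (λ x → - (+ 24) * (g x * h x)) (λ x → g x * k x)) (cong (_+ ⟨ g , k ⟩) (∑ℤ-*ˡ X (- (+ 24)) (λ x → g x * h x))))))
      where lem : ∀ f g h k → (+ 24 * f - g) * (+ 24 * h - k) ≡ + 576 * (f * h) + - (+ 24) * (f * k) + (- (+ 24) * (g * h) + g * k)
            lem = solve-∀

  E-B : ∀ f → E (B f) ≡ + 576 * E f - + 48 * ⟨ Δ f , Δ f ⟩ + E (Δ f)
  E-B f = trans (∑ℤ-cong X λ x _ → cong₂ _*_ (B-Δ f x) (Δ-B f x)) (trans (expand f (Δ f) (Δ f) (Δ (Δ f)))
      (trans (cong (λ z → + 576 * E f + - (+ 24) * z + (- (+ 24) * ⟨ Δ f , Δ f ⟩ + E (Δ f))) (Δ-symmetric f (Δ f))) (lem (E f) ⟨ Δ f , Δ f ⟩ (E (Δ f)))))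
    where lem : ∀ e d z → + 576 * e + - (+ 24) * d + (- (+ 24) * d + z) ≡ + 576 * e - + 48 * d + z
          lem = solve-∀

  ⟨B,B⟩ : ∀ f → ⟨ B f , B f ⟩ ≡ + 576 * ⟨ f , f ⟩ - + 48 * E f + ⟨ Δ f , Δ f ⟩
  ⟨B,B⟩ f = trans (∑ℤ-cong X λ x _ → cong₂ _*_ (B-Δ f x) (B-Δ f x)) (trans (expand f (Δ f) f (Δ f))
      (trans (cong (λ z → + 576 * ⟨ f , f ⟩ + - (+ 24) * E f + (- (+ 24) * z + ⟨ Δ f , Δ f ⟩)) (sym (Δ-symmetric f f))) (lem ⟨ f , f ⟩ (E f) ⟨ Δ f , Δ f ⟩)))
    where lem : ∀ a e d → + 576 * a + - (+ 24) * e + (- (+ 24) * e + d) ≡ + 576 * a - + 48 * e + d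
          lem = solve-∀

  S-B : ∀ f → S (B f) ≡ + 24 * S f
  S-B f = trans (∑ℤ-+ X (λ x → + 12 * f x) (neighbours f)) (trans (cong₂ _+_ (∑ℤ-*ˡ X (+ 12) f) (trans (∑ℤ-swap X generators (λ x s → f (act s x)))
      (trans (∑ℤ-cong generators λ s ms → ∑-act s (All.lookup generators-SL ms) f) (∑ℤ-const generators (S f))))) (lem (S f)))
    where lem : ∀ a → + 12 * a + + 12 * a ≡ + 24 * a
          lem = solve-∀

  S-B^ : ∀ m f → S (B^ m f) ≡ (+ 24) ℤ.^ m * S f
  S-B^ zero f = sym (ℤP.*-identityˡ (S f))
  S-B^ (suc m) f = trans (S-B (B^ m f)) (trans (cong (+ 24 *_) (S-B^ m f)) (sym (ℤP.*-assoc (+ 24) ((+ 24) ℤ.^ m) (S f))))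

  -- In `E-B`, bounding `E (Δ f)` by `24 ⟨ Δ f , Δ f ⟩` leaves `576 E f − 24 ⟨ Δ f , Δ f ⟩`, and the
  -- gap inequality subtracts at least `24/20` of `E f`. Relative to `24² = 576` the rate is
  -- `2874/2880 = 479/480`.
  E-decay : ∀ f → + 5 * E (B f) ℤ.≤ + 2874 * E f
  E-decay f = 0≤-⇒≤ (subst (0ℤ ℤ.≤_) (sym (trans (cong (λ z → + 2874 * E f - + 5 * z) (E-B f)) (lem (E f) ⟨ Δ f , Δ f ⟩ (E (Δ f)))))
     (+-nonneg (*-nonneg {+ 6} (ℤ.+≤+ z≤n) (≤⇒0≤- (E≤20Δ² f))) (*-nonneg {+ 5} (ℤ.+≤+ z≤n) (≤⇒0≤- (E≤24 (Δ f))))))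
    where lem : ∀ e d z → + 2874 * e - + 5 * (+ 576 * e - + 48 * d + z) ≡ + 6 * (+ 20 * d - e) + + 5 * (+ 24 * d - z)
          lem = solve-∀

  E-decay^ : ∀ m f → (+ 5) ℤ.^ m * E (B^ m f) ℤ.≤ (+ 2874) ℤ.^ m * E f
  E-decay^ zero f = ℤP.≤-refl
  E-decay^ (suc m) f = begin
    + 5 * (+ 5) ℤ.^ m * E (B (B^ m f)) ≡⟨ lem ((+ 5) ℤ.^ m) (E (B (B^ m f))) ⟩
    (+ 5) ℤ.^ m * (+ 5 * E (B (B^ m f))) ≤⟨ ℤP.*-monoˡ-≤-nonNeg ((+ 5) ℤ.^ m) {{power-nonNeg m}} (E-decay (B^ m f)) ⟩
    (+ 5) ℤ.^ m * (+ 2874 * E (B^ m f)) ≡⟨ lem' ((+ 5) ℤ.^ m) (E (B^ m f)) ⟩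
    + 2874 * ((+ 5) ℤ.^ m * E (B^ m f)) ≤⟨ *-monoˡ 2874 (E-decay^ m f) ⟩
    + 2874 * ((+ 2874) ℤ.^ m * E f) ≡⟨ sym (ℤP.*-assoc (+ 2874) ((+ 2874) ℤ.^ m) (E f)) ⟩
    + 2874 * (+ 2874) ℤ.^ m * E f ∎
    where
      open ℤP.≤-Reasoning
      lem : ∀ p e → + 5 * p * e ≡ p * (+ 5 * e)
      lem = solve-∀
      lem' : ∀ p e → p * (+ 2874 * e) ≡ + 2874 * (p * e)
      lem' = solve-∀
      power-nonNeg : ∀ m → ℤ.NonNegative ((+ 5) ℤ.^ m)
      power-nonNeg m = ℤ.nonNegative (nn m)
        where nn : ∀ m → 0ℤ ℤ.≤ (+ 5) ℤ.^ m
              nn zero = ℤ.+≤+ z≤n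
              nn (suc m) = *-nonneg {+ 5} (ℤ.+≤+ z≤n) (nn m)

  record Poincaré (D : ℕ) : Set where
    constructor poincaré-bound
    field Var≤E : ∀ f → Var f ℤ.≤ + D * (N * E f)
  open Poincaré

  -- Because `B = 24 − Δ` multiplies the sum of `f` by 24, the two sides differ by exactly
  -- `N ⟨ Δ f , Δ f ⟩`.
  Var-B : ∀ f → + 576 * Var f ℤ.≤ Var (B f) + + 48 * (N * E f)
  Var-B f = 0≤-⇒≤ (subst (0ℤ ℤ.≤_) (sym (trans (cong₂ (λ a b → N * a - b * b + + 48 * (N * E f) - + 576 * Var f) (⟨B,B⟩ f) (S-B f)) (lem N ⟨ f , f ⟩ (E f) ⟨ Δ f , Δ f ⟩ (S f)))) (*-nonneg {N} (ℤ.+≤+ z≤n) (⟨⟩-nonneg (Δ f))))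
    where lem : ∀ n a e d s → n * (+ 576 * a - + 48 * e + d) - + 24 * s * (+ 24 * s) + + 48 * (n * e) - + 576 * (n * a - s * s) ≡ n * d
          lem = solve-∀

  -- Applying the inequality to `B f`, whose energy is smaller, replaces the constant `D` by
  -- `(2874 D + 240) / 2880`. This is at most `D − 1` once `D ≥ 520`, so any constant can be lowered
  -- step by step to 519.
  Poincaré-improve : ∀ k → Poincaré (suc (519 ℕ.+ k)) → Poincaré (519 ℕ.+ k)
  Poincaré-improve k P = poincaré-bound λ f → ℤP.*-cancelˡ-≤-pos (Var f) (+ (519 ℕ.+ k) * (N * E f)) (+ 2880) (begin
    + 2880 * Var f ≡⟨ l₁ (Var f) ⟩
    + 5 * (+ 576 * Var f) ≤⟨ *-monoˡ 5 (Var-B f) ⟩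
    + 5 * (Var (B f) + + 48 * (N * E f)) ≤⟨ *-monoˡ 5 (ℤP.+-monoˡ-≤ (+ 48 * (N * E f)) (Var≤E P (B f))) ⟩
    + 5 * (+ suc (519 ℕ.+ k) * (N * E (B f)) + + 48 * (N * E f)) ≡⟨ l₂ (+ suc (519 ℕ.+ k)) N (E (B f)) (E f) ⟩
    + suc (519 ℕ.+ k) * (N * (+ 5 * E (B f))) + + 240 * (N * E f) ≤⟨ ℤP.+-monoˡ-≤ (+ 240 * (N * E f)) (*-monoˡ (suc (519 ℕ.+ k)) (*-monoˡ (length X) (E-decay f))) ⟩
    + suc (519 ℕ.+ k) * (N * (+ 2874 * E f)) + + 240 * (N * E f) ≡⟨ cong (λ z → z * (N * (+ 2874 * E f)) + + 240 * (N * E f)) (ℤP.pos-+ 520 k) ⟩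
    (+ 520 + + k) * (N * (+ 2874 * E f)) + + 240 * (N * E f) ≤⟨ 0≤-⇒≤ (subst (0ℤ ℤ.≤_) (sym (l₃ (+ k) N (E f))) (*-nonneg {+ 6 * + k} (*-nonneg {+ 6} {+ k} (ℤ.+≤+ z≤n) (ℤ.+≤+ z≤n)) (*-nonneg {N} (ℤ.+≤+ z≤n) (E-nonneg f)))) ⟩
    + 2880 * ((+ 519 + + k) * (N * E f)) ≡⟨ cong (λ z → + 2880 * (z * (N * E f))) (sym (ℤP.pos-+ 519 k)) ⟩
    + 2880 * (+ (519 ℕ.+ k) * (N * E f)) ∎)
    where
      open ℤP.≤-Reasoning
      l₁ : ∀ v → + 2880 * v ≡ + 5 * (+ 576 * v)
      l₁ = solve-∀
      l₂ : ∀ d n b e → + 5 * (d * (n * b) + + 48 * (n * e)) ≡ d * (n * (+ 5 * b)) + + 240 * (n * e)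
      l₂ = solve-∀
      l₃ : ∀ k n e → + 2880 * ((+ 519 + k) * (n * e)) - ((+ 520 + k) * (n * (+ 2874 * e)) + + 240 * (n * e)) ≡ + 6 * k * (n * e)
      l₃ = solve-∀

  Poincaré-mono : ∀ {D D'} → D ℕ.≤ D' → Poincaré D → Poincaré D'
  Poincaré-mono {D} {D'} le P = poincaré-bound λ f → ℤP.≤-trans (Var≤E P f) (ℤP.*-monoʳ-≤-nonNeg (N * E f) {{ℤ.nonNegative (*-nonneg {N} (ℤ.+≤+ z≤n) (E-nonneg f))}} (ℤ.+≤+ le))

  Poincaré-519 : ∀ k → Poincaré (519 ℕ.+ k) → Poincaré 519
  Poincaré-519 zero P = P
  Poincaré-519 (suc k) P = Poincaré-519 k (Poincaré-improve k (subst Poincaré (ℕP.+-suc 519 k) P))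

  -- An upper bound for the effective resistance between `x` and `y`; it composes along paths, so it
  -- expresses connectedness without mentioning paths.
  Near : A → A → Set
  Near x y = ∃[ D ] (∀ f → (f x - f y) * (f x - f y) ℤ.≤ + D * E f)

  Near-refl : ∀ {x} → Near x x
  Near-refl {x} = 0 , λ f → ℤP.≤-reflexive (lem (f x) (E f))
    where lem : ∀ a e → (a - a) * (a - a) ≡ 0ℤ * e
          lem = solve-∀

  Near-sym : ∀ {x y} → Near x y → Near y x
  Near-sym {x} {y} (D , h) = D , λ f → subst (ℤ._≤ + D * E f) (lem (f x) (f y)) (h f)
    where lem : ∀ a b → (a - b) * (a - b) ≡ (b - a) * (b - a)
          lem = solve-∀

  Near-trans : ∀ {x y z} → Near x y → Near y z → Near x z
  Near-trans {x} {y} {z} (D , h) (D' , h') = 2 ℕ.* D ℕ.+ 2 ℕ.* D' , λ f → begin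
    (f x - f z) * (f x - f z) ≤⟨ 0≤-⇒≤ (subst (0ℤ ℤ.≤_) (sym (lem (f x) (f y) (f z))) (square≥0 (f x - f y - (f y - f z)))) ⟩
    + 2 * ((f x - f y) * (f x - f y)) + + 2 * ((f y - f z) * (f y - f z)) ≤⟨ ℤP.+-mono-≤ (*-monoˡ 2 (h f)) (*-monoˡ 2 (h' f)) ⟩
    + 2 * (+ D * E f) + + 2 * (+ D' * E f) ≡⟨ lem' (+ D) (+ D') (E f) ⟩
    (+ 2 * + D + + 2 * + D') * E f ≡⟨ cong (_* E f) (sym (trans (ℤP.pos-+ (2 ℕ.* D) (2 ℕ.* D')) (cong₂ _+_ (ℤP.pos-* 2 D) (ℤP.pos-* 2 D')))) ⟩
    + (2 ℕ.* D ℕ.+ 2 ℕ.* D') * E f ∎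
    where
      open ℤP.≤-Reasoning
      lem : ∀ a b c → + 2 * ((a - b) * (a - b)) + + 2 * ((b - c) * (b - c)) - (a - c) * (a - c) ≡ (a - b - (b - c)) * (a - b - (b - c))
      lem = solve-∀
      lem' : ∀ a b e → + 2 * (a * e) + + 2 * (b * e) ≡ (+ 2 * a + + 2 * b) * e
      lem' = solve-∀

  Near-step : ∀ {s x} → s ∈ generators → x ∈ X → Near x (act s x)
  Near-step {s} {x} ms mx = 2 , λ f → ℤP.≤-trans (∑ℤ-elem X (λ x → (f x - f (act s x)) * (f x - f (act s x))) (λ x _ → square≥0 (f x - f (act s x))) mx)
    (ℤP.≤-trans (∑ℤ-elem generators (λ s → ∑ℤ X λ x → (f x - f (act s x)) * (f x - f (act s x))) (λ s _ → ∑ℤ-nonneg X λ x _ → square≥0 (f x - f (act s x))) ms) (ℤP.≤-reflexive (Dirichlet f)))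

  private
    sum-near : ∀ x₀ xs → (∀ x → x ∈ xs → Near x x₀) → ∃[ D ] (∀ f → ∑ℤ xs (λ x → (f x - f x₀) * (f x - f x₀)) ℤ.≤ + D * E f)
    sum-near x₀ [] h = 0 , λ f → ℤP.≤-refl
    sum-near x₀ (x ∷ xs) h with h x (here refl) | sum-near x₀ xs (λ y m → h y (there m))
    ... | D , p | D' , p' = D ℕ.+ D' , λ f → ℤP.≤-trans (ℤP.+-mono-≤ (p f) (p' f)) (ℤP.≤-reflexive (trans (sym (ℤP.*-distribʳ-+ (E f) (+ D) (+ D'))) (cong (_* E f) (sym (ℤP.pos-+ D D')))))

    Var≤ : ∀ f c → Var f ℤ.≤ N * ∑ℤ X (λ x → (f x - c) * (f x - c))
    Var≤ f c = 0≤-⇒≤ (subst (0ℤ ℤ.≤_) (sym (trans (cong (λ z → N * z - Var f) (trans (∑ℤ-cong X λ x _ → lem₁ (f x) c) (trans (∑ℤ-+ X (λ x → f x * f x + - (+ 2) * c * f x) (λ _ → c * c))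
        (cong₂ _+_ (trans (∑ℤ-+ X (λ x → f x * f x) (λ x → - (+ 2) * c * f x)) (cong (λ z → ⟨ f , f ⟩ + z) (∑ℤ-*ˡ X (- (+ 2) * c) f))) (∑ℤ-const X (c * c)))))) (lem₂ N ⟨ f , f ⟩ c (S f))))
        (square≥0 (S f - N * c)))
      where
        lem₁ : ∀ x c → (x - c) * (x - c) ≡ x * x + - (+ 2) * c * x + c * c
        lem₁ = solve-∀
        lem₂ : ∀ n a c s → n * (a + - (+ 2) * c * s + n * (c * c)) - (n * a - s * s) ≡ (s - n * c) * (s - n * c)
        lem₂ = solve-∀

  -- Summing the squares of `f x − f x₀` bounds the variance with some constant that depends on the
  -- graph. The spectral gap then lowers it to the uniform value 519.
  connected⇒Poincaré : ∀ x₀ → (∀ x → x ∈ X → Near x x₀) → Poincaré 519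
  connected⇒Poincaré x₀ h = from (sum-near x₀ X h)
    where
      from : ∃[ D ] (∀ f → ∑ℤ X (λ x → (f x - f x₀) * (f x - f x₀)) ℤ.≤ + D * E f) → Poincaré 519
      from (D , p) = Poincaré-519 D (Poincaré-mono (ℕP.m≤n+m D 519) (poincaré-bound λ f → ℤP.≤-trans (Var≤ f (f x₀)) (ℤP.≤-trans (*-monoˡ (length X) (p f)) (ℤP.≤-reflexive (lem N (+ D) (E f))))))
        where lem : ∀ n d e → n * (d * e) ≡ d * (n * e)
              lem = solve-∀

  -- Variance is bounded by energy, energy decays geometrically, and the initial energy is at most
  -- `24 ⟨ f , f ⟩`; hence the factor `519 · 24`. The powers of 5 clear the denominators of
  -- `E-decay`.
  mixing : Poincaré 519 → ∀ m f → (+ 5) ℤ.^ m * Var (B^ m f) ℤ.≤ + mixing-factor * (N * ((+ contraction) ℤ.^ m * ⟨ f , f ⟩))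
  mixing P m f = generic 519 24 mixing-factor (+ 5) contraction mixing-factor-≡ (nn 5 m) (Var≤E P (B^ m f)) (subst (λ c → (+ 5) ℤ.^ m * E (B^ m f) ℤ.≤ (+ c) ℤ.^ m * E f) (sym contraction-≡) (E-decay^ m f)) (E≤24 f)
    where
      open ℤP.≤-Reasoning
      nn : ∀ k m → 0ℤ ℤ.≤ (+ k) ℤ.^ m
      nn k zero = ℤ.+≤+ z≤n
      nn k (suc m) = *-nonneg {+ k} (ℤ.+≤+ z≤n) (nn k m)
      l₁ : ∀ p d n e → p * (d * (n * e)) ≡ d * (n * (p * e))
      l₁ = solve-∀
      l₂ : ∀ p n e d c → d * (n * (p * (c * e))) ≡ d * c * (n * (p * e))
      l₂ = solve-∀
      generic : ∀ D c A a b → A ≡ D ℕ.* c → 0ℤ ℤ.≤ a ℤ.^ m → Var (B^ m f) ℤ.≤ + D * (N * E (B^ m f)) → a ℤ.^ m * E (B^ m f) ℤ.≤ (+ b) ℤ.^ m * E f → E f ℤ.≤ + c * ⟨ f , f ⟩ →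
        a ℤ.^ m * Var (B^ m f) ℤ.≤ + A * (N * ((+ b) ℤ.^ m * ⟨ f , f ⟩))
      generic D c A a b refl a≥0 h₁ h₂ h₃ = begin
        a ℤ.^ m * Var (B^ m f) ≤⟨ ℤP.*-monoˡ-≤-nonNeg (a ℤ.^ m) {{ℤ.nonNegative a≥0}} h₁ ⟩
        a ℤ.^ m * (+ D * (N * E (B^ m f))) ≡⟨ l₁ (a ℤ.^ m) (+ D) N (E (B^ m f)) ⟩
        + D * (N * (a ℤ.^ m * E (B^ m f))) ≤⟨ *-monoˡ D (*-monoˡ (length X) h₂) ⟩
        + D * (N * ((+ b) ℤ.^ m * E f)) ≤⟨ *-monoˡ D (*-monoˡ (length X) (ℤP.*-monoˡ-≤-nonNeg ((+ b) ℤ.^ m) {{ℤ.nonNegative (nn b m)}} h₃)) ⟩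
        + D * (N * ((+ b) ℤ.^ m * (+ c * ⟨ f , f ⟩))) ≡⟨ l₂ ((+ b) ℤ.^ m) N ⟨ f , f ⟩ (+ D) (+ c) ⟩
        + D * + c * (N * ((+ b) ℤ.^ m * ⟨ f , f ⟩)) ≡⟨ cong (λ t → t * (N * ((+ b) ℤ.^ m * ⟨ f , f ⟩))) (ℤP.pos-* D c) ⟨
        + (D ℕ.* c) * (N * ((+ b) ℤ.^ m * ⟨ f , f ⟩)) ∎

-- Projective points and flags modulo q

module Modular (q : ℕ) .{{_ : NonZero q}} (pr : Prime q) where

  Z : ℤ → Set
  Z a = + q ∣ a

  Z? : ∀ a → Dec (Z a)
  Z? a = + q ∣? a

  Z-0 : Z 0ℤ
  Z-0 = divides 0ℤ refl

  Z-≡0 : ∀ {a} → a ≡ 0ℤ → Z a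
  Z-≡0 refl = Z-0

  -- Congruences are derived in one pattern: the expression is displayed as an explicit combination
  -- of known multiples of `q`, and the ring solver checks the identity.
  Z₁ : ∀ k {a e} → Z a → e ≡ k * a → Z e
  Z₁ k p refl = ∣n⇒∣m*n k p

  Z₂ : ∀ k l {a b e} → Z a → Z b → e ≡ k * a + l * b → Z e
  Z₂ k l p r refl = ∣m∣n⇒∣m+n (∣n⇒∣m*n k p) (∣n⇒∣m*n l r)

  Z₃ : ∀ k l m {a b c e} → Z a → Z b → Z c → e ≡ k * a + l * b + m * c → Z e
  Z₃ k l m p r s refl = ∣m∣n⇒∣m+n (∣m∣n⇒∣m+n (∣n⇒∣m*n k p) (∣n⇒∣m*n l r)) (∣n⇒∣m*n m s)

  Z-prime : ∀ a b → Z (a * b) → Z a ⊎ Z b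
  Z-prime a b p with euclidsLemma ∣ a ∣ ∣ b ∣ pr (subst (q ℕD.∣_) (ℤP.abs-* a b) (∣⇒∣ᵤ p))
  ... | inj₁ d = inj₁ (∣ᵤ⇒∣ d)
  ... | inj₂ d = inj₂ (∣ᵤ⇒∣ d)

  Z-cancel : ∀ a b → ¬ Z a → Z (a * b) → Z b
  Z-cancel a b na p = [ (λ z → contradiction z na) , (λ z → z) ]′ (Z-prime a b p)

  ¬Z-* : ∀ {a b} → ¬ Z a → ¬ Z b → ¬ Z (a * b)
  ¬Z-* {a} {b} na nb p = nb (Z-cancel a b na p)

  1<q : 1 ℕ.< q
  1<q = ℕ.nonTrivial⇒n>1 q {{prime⇒nonTrivial pr}}

  Z-small : ∀ a → ∣ a ∣ ℕ.< q → Z a → a ≡ 0ℤ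
  Z-small a lt p with ∣ a ∣ in eq
  ... | zero = ℤP.∣i∣≡0⇒i≡0 eq
  ... | suc n = contradiction (ℕD.∣⇒≤ {{ℕ.≢-nonZero {suc n} λ ()}} (subst (q ℕD.∣_) eq (∣⇒∣ᵤ p))) (ℕP.<⇒≱ lt)

  ¬Z-1 : ¬ Z 1ℤ
  ¬Z-1 p with Z-small 1ℤ 1<q p
  ... | ()

  mod : ℤ → ℤ
  mod z = + (z %ℕ q)

  mod-≡ : ∀ z → Z (z - mod z)
  mod-≡ z = divides (z /ℕ q) (trans (cong (_- mod z) (a≡a%ℕn+[a/ℕn]*n z q)) (lem (mod z) (z /ℕ q * + q)))
    where lem : ∀ a b → a + b - a ≡ b
          lem = solve-∀

  residues : List ℤ
  residues = map +_ (upTo q)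

  ∈-residues : ∀ {n} → n ℕ.< q → + n ∈ residues
  ∈-residues n<q = ∈-map⁺ +_ (∈-upTo⁺ n<q)

  residues-∈ : ∀ {z} → z ∈ residues → ∃[ n ] (n ℕ.< q × z ≡ + n)
  residues-∈ m with ∈-map⁻ +_ m
  ... | n , mn , e = n , ∈-upTo⁻ mn , e

  residues-unique : Unique residues
  residues-unique = Unique.map⁺ (λ { refl → refl }) (Unique.upTo⁺ q)

  length-residues : length residues ≡ q
  length-residues = trans (length-map +_ (upTo q)) (length-upTo q)

  mod-∈ : ∀ z → mod z ∈ residues
  mod-∈ z = ∈-residues (n%ℕd<d z q)

  ∣m-n∣<q : ∀ {m n} → m ℕ.< q → n ℕ.< q → ∣ + m - + n ∣ ℕ.< q
  ∣m-n∣<q {m} {n} lm ln = subst (ℕ._< q) (sym (trans (cong ∣_∣ (ℤP.[+m]-[+n]≡m⊖n m n)) (ℤP.∣m⊖n∣≡∣n⊖m∣ m n))) (below (ℕP.≤-total m n))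
    where
      below : m ℕ.≤ n ⊎ n ℕ.≤ m → ∣ n ℤ.⊖ m ∣ ℕ.< q
      below (inj₁ le) = subst (λ z → ∣ z ∣ ℕ.< q) (sym (ℤP.⊖-≥ le)) (ℕP.≤-<-trans (ℕP.m∸n≤m n m) ln)
      below (inj₂ le) = subst (ℕ._< q) (sym (trans (ℤP.∣m⊖n∣≡∣n⊖m∣ n m) (cong ∣_∣ (ℤP.⊖-≥ le)))) (ℕP.≤-<-trans (ℕP.m∸n≤m m n) lm)

  residue-≡ : ∀ {a b} → a ∈ residues → b ∈ residues → Z (a - b) → a ≡ b
  residue-≡ ma mb p with residues-∈ ma | residues-∈ mb
  ... | m , lm , refl | n , ln , refl = ℤP.i-j≡0⇒i≡j (+ m) (+ n) (Z-small (+ m - + n) (∣m-n∣<q lm ln) p)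

  ¬Z-residue : ∀ {n} → ¬ n ≡ 0 → n ℕ.< q → ¬ Z (+ n)
  ¬Z-residue n≢0 lt p = n≢0 (ℤP.+-injective (Z-small (+ _) lt p))

  inverse-exists : ∀ a → ¬ Z a → ∃[ b ] Z (1ℤ - a * b)
  inverse-exists a na with a %ℕ q in eq
  ... | zero = contradiction (Z₁ 1ℤ (mod-≡ a) (trans (trans (lem a) (cong (λ r → a - + r) (sym eq))) (sym (ℤP.*-identityˡ (a - mod a))))) na
    where lem : ∀ a → a ≡ a - 0ℤ
          lem = solve-∀
  ... | suc r with coprime-Bézout (prime⇒coprime {n = suc r} pr (subst (ℕ._< q) eq (n%ℕd<d a q)))
  ...   | Bézout.-+ x y e = + y , Z₂ (- + y) (- + x) (mod-≡ a) (divides 1ℤ refl) (trans (cong (λ z → z - a * + y) one) (trans (lem a (+ suc r) (+ y) (+ x) (+ q)) (cong (λ r → - + y * (a - + r) + - + x * (1ℤ * + q)) (sym eq))))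
    where
      one : 1ℤ ≡ + y * + suc r - + x * + q
      one = sym (trans (cong₂ (λ u v → u - v) (trans (sym (ℤP.pos-* y (suc r))) (cong +_ (sym e))) (sym (ℤP.pos-* x q))) (trans (cong (_- + (x ℕ.* q)) (ℤP.pos-+ 1 (x ℕ.* q))) (cancel (+ (x ℕ.* q)))))
        where cancel : ∀ t → 1ℤ + t - t ≡ 1ℤ
              cancel = solve-∀
      lem : ∀ a r y x q → y * r - x * q - a * y ≡ - y * (a - r) + - x * (1ℤ * q)
      lem = solve-∀
  ...   | Bézout.+- x y e = - + y , Z₂ (+ y) (+ x) (mod-≡ a) (divides 1ℤ refl) (trans (cong (λ z → z - a * - + y) one) (trans (lem a (+ suc r) (+ y) (+ x) (+ q)) (cong (λ r → + y * (a - + r) + + x * (1ℤ * + q)) (sym eq))))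
    where
      one : 1ℤ ≡ + x * + q - + y * + suc r
      one = sym (trans (cong₂ (λ u v → u - v) (trans (sym (ℤP.pos-* x q)) (cong +_ (sym e))) (sym (ℤP.pos-* y (suc r)))) (trans (cong (_- + (y ℕ.* suc r)) (ℤP.pos-+ 1 (y ℕ.* suc r))) (cancel (+ (y ℕ.* suc r)))))
        where cancel : ∀ t → 1ℤ + t - t ≡ 1ℤ
              cancel = solve-∀
      lem : ∀ a r y x q → x * q - y * r - a * - y ≡ y * (a - r) + x * (1ℤ * q)
      lem = solve-∀

  inv : ℤ → ℤ
  inv a with Z? a
  ... | yes _ = 0ℤ
  ... | no na = proj₁ (inverse-exists a na)

  inv-≡ : ∀ a → ¬ Z a → Z (1ℤ - a * inv a)
  inv-≡ a na with Z? a
  ... | yes z = contradiction z na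
  ... | no na' = proj₂ (inverse-exists a na')

  record Zⱽ (v : V3) : Set where
    constructor zⱽ
    field zx : Z (vx v)
          zy : Z (vy v)
          zz : Z (vz v)
  open Zⱽ public

  Zⱽ? : ∀ v → Dec (Zⱽ v)
  Zⱽ? (v3 a b c) with Z? a ×-dec (Z? b ×-dec Z? c)
  ... | yes (x , y , z) = yes (zⱽ x y z)
  ... | no n = no λ { (zⱽ x y z) → n (x , y , z) }

  infix 4 _∼_
  record _∼_ (v w : V3) : Set where
    constructor scaled
    field factor : ℤ
          factor-unit : ¬ Z factor
          difference : Zⱽ (v ⊟ factor ⋆ w)

  ∼-refl : ∀ v → v ∼ v
  ∼-refl v = scaled 1ℤ ¬Z-1 (zⱽ (Z-≡0 (lem (vx v))) (Z-≡0 (lem (vy v))) (Z-≡0 (lem (vz v))))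
    where lem : ∀ a → a - 1ℤ * a ≡ 0ℤ
          lem = solve-∀

  ¬Z-inverse : ∀ {c d} → Z (1ℤ - c * d) → ¬ Z d
  ¬Z-inverse {c} {d} p z = ¬Z-1 (Z₂ 1ℤ c p z (lem c d))
    where lem : ∀ c d → 1ℤ ≡ 1ℤ * (1ℤ - c * d) + c * d
          lem = solve-∀

  ∼-sym : ∀ {v w} → v ∼ w → w ∼ v
  ∼-sym {v} {w} (scaled c nc (zⱽ x y z)) with inverse-exists c nc
  ... | d , p = scaled d (¬Z-inverse {c} p) (zⱽ (Z₂ (- d) (vx w) x p (lem (vx v) (vx w) c d)) (Z₂ (- d) (vy w) y p (lem (vy v) (vy w) c d)) (Z₂ (- d) (vz w) z p (lem (vz v) (vz w) c d)))
    where lem : ∀ v w c d → w - d * v ≡ - d * (v - c * w) + w * (1ℤ - c * d)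
          lem = solve-∀

  ∼-trans : ∀ {u v w} → u ∼ v → v ∼ w → u ∼ w
  ∼-trans {u} {v} {w} (scaled c nc (zⱽ x y z)) (scaled d nd (zⱽ x' y' z')) = scaled (c * d) (¬Z-* nc nd)
      (zⱽ (Z₂ 1ℤ c x x' (lem (vx u) (vx v) (vx w) c d)) (Z₂ 1ℤ c y y' (lem (vy u) (vy v) (vy w) c d)) (Z₂ 1ℤ c z z' (lem (vz u) (vz v) (vz w) c d)))
    where lem : ∀ u v w c d → u - c * d * w ≡ 1ℤ * (u - c * v) + c * (v - d * w)
          lem = solve-∀

  Zⱽ-∼ : ∀ {v w} → v ∼ w → Zⱽ w → Zⱽ v
  Zⱽ-∼ {v} {w} (scaled c _ (zⱽ x y z)) (zⱽ x' y' z') = zⱽ (Z₂ 1ℤ c x x' (lem (vx v) (vx w) c)) (Z₂ 1ℤ c y y' (lem (vy v) (vy w) c)) (Z₂ 1ℤ c z z' (lem (vz v) (vz w) c))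
    where lem : ∀ v w c → v ≡ 1ℤ * (v - c * w) + c * w
          lem = solve-∀

  Z-∙ : ∀ u v → Zⱽ v → Z (u ∙ v)
  Z-∙ (v3 a b c) (v3 x y z) (zⱽ p r s) = Z₃ a b c p r s refl

  Z-∙-∼ : ∀ {v w l m} → v ∼ w → l ∼ m → Z (w ∙ m) → Z (v ∙ l)
  Z-∙-∼ {v3 x y z} {v3 x' y' z'} {l@(v3 a b c)} {m@(v3 a' b' c')} (scaled k _ p) (scaled n _ r) zm =
    Z₃ 1ℤ k (k * n) (Z-∙ l (v3 x y z ⊟ k ⋆ v3 x' y' z') p) (Z-∙ (v3 x' y' z') (l ⊟ n ⋆ m) r) zm (lem x y z x' y' z' a b c a' b' c' k n)
    where lem : ∀ x y z x' y' z' a b c a' b' c' k n → x * a + y * b + z * c ≡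
                 1ℤ * (a * (x - k * x') + b * (y - k * y') + c * (z - k * z')) + k * (x' * (a - n * a') + y' * (b - n * b') + z' * (c - n * c')) + k * n * (x' * a' + y' * b' + z' * c')
          lem = solve-∀

  ⊙-∼ : ∀ g {v w} → v ∼ w → g ⊙ v ∼ g ⊙ w
  ⊙-∼ (mat a b c d e f g h i) {v3 x y z} {v3 x' y' z'} (scaled k nk (zⱽ p r s)) = scaled k nk (zⱽ (Z₃ a b c p r s (lem a b c x y z x' y' z' k)) (Z₃ d e f p r s (lem d e f x y z x' y' z' k)) (Z₃ g h i p r s (lem g h i x y z x' y' z' k)))
    where lem : ∀ a b c x y z x' y' z' k → a * x + b * y + c * z - k * (a * x' + b * y' + c * z') ≡ a * (x - k * x') + b * (y - k * y') + c * (z - k * z')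
          lem = solve-∀

  Zⱽ-⊙ : ∀ g {v} → Zⱽ v → Zⱽ (g ⊙ v)
  Zⱽ-⊙ g {v} p = zⱽ (Z-∙ (row₁ g) v p) (Z-∙ (row₂ g) v p) (Z-∙ (row₃ g) v p)

  ⊙-inverse : ∀ g v → SL g → inverse g ⊙ (g ⊙ v) ≡ v
  ⊙-inverse g v δ = trans (sym (⊙-· (inverse g) g v)) (trans (cong (_⊙ v) (·-inverseˡ g δ)) (𝟙-⊙ v))

  ¬Zⱽ-⊙ : ∀ g {v} → SL g → ¬ Zⱽ v → ¬ Zⱽ (g ⊙ v)
  ¬Zⱽ-⊙ g {v} δ nv p = nv (subst Zⱽ (⊙-inverse g v δ) (Zⱽ-⊙ (inverse g) p))

  -- The representative of a projective point whose first coordinate that is nonzero modulo `q`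
  -- equals 1, the later coordinates being residues.
  normalise : V3 → V3
  normalise (v3 x y z) with Z? x | Z? y
  ... | no _ | _ = v3 1ℤ (mod (inv x * y)) (mod (inv x * z))
  ... | yes _ | no _ = v3 0ℤ 1ℤ (mod (inv y * z))
  ... | yes _ | yes _ = v3 0ℤ 0ℤ 1ℤ

  private
    quotient-≡ : ∀ x y → ¬ Z x → Z (y - x * mod (inv x * y))
    quotient-≡ x y nx = Z₂ y x (inv-≡ x nx) (mod-≡ (inv x * y)) (lem x y (inv x) (mod (inv x * y)))
      where lem : ∀ x y i m → y - x * m ≡ y * (1ℤ - x * i) + x * (i * y - m)
            lem = solve-∀
    self : ∀ x → x - x * 1ℤ ≡ 0ℤ
    self = solve-∀
    null : ∀ x y → x - y * 0ℤ ≡ 1ℤ * x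
    null = solve-∀

  normalise-∼ : ∀ v → ¬ Zⱽ v → v ∼ normalise v
  normalise-∼ (v3 x y z) nv with Z? x | Z? y
  ... | no nx | _ = scaled x nx (zⱽ (Z-≡0 (self x)) (quotient-≡ x y nx) (quotient-≡ x z nx))
  ... | yes zx | no ny = scaled y ny (zⱽ (Z₁ 1ℤ zx (null x y)) (Z-≡0 (self y)) (quotient-≡ y z ny))
  ... | yes zx | yes zy = scaled z (λ zz → nv (zⱽ zx zy zz)) (zⱽ (Z₁ 1ℤ zx (null x z)) (Z₁ 1ℤ zy (null y z)) (Z-≡0 (self z)))

  data Point : V3 → Set where
    point₁ : ∀ {a b} → a ∈ residues → b ∈ residues → Point (v3 1ℤ a b)
    point₂ : ∀ {a} → a ∈ residues → Point (v3 0ℤ 1ℤ a)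
    point₃ : Point (v3 0ℤ 0ℤ 1ℤ)

  normalise-point : ∀ v → Point (normalise v)
  normalise-point (v3 x y z) with Z? x | Z? y
  ... | no _ | _ = point₁ (mod-∈ (inv x * y)) (mod-∈ (inv x * z))
  ... | yes _ | no _ = point₂ (mod-∈ (inv y * z))
  ... | yes _ | yes _ = point₃

  Point-nonzero : ∀ {v} → Point v → ¬ Zⱽ v
  Point-nonzero (point₁ _ _) (zⱽ p _ _) = ¬Z-1 p
  Point-nonzero (point₂ _) (zⱽ _ p _) = ¬Z-1 p
  Point-nonzero point₃ (zⱽ _ _ p) = ¬Z-1 p

  private
    unit : ∀ c a b → Z (1ℤ - c * 1ℤ) → Z (a - c * b) → Z (a - b)
    unit c a b p r = Z₂ 1ℤ (- b) r p (lem a b c)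
      where lem : ∀ a b c → a - b ≡ 1ℤ * (a - c * b) + - b * (1ℤ - c * 1ℤ)
            lem = solve-∀
    clash : ∀ {c} → ¬ Z (1ℤ - c * 0ℤ)
    clash {c} p = ¬Z-1 (Z₁ 1ℤ p (lem c))
      where lem : ∀ c → 1ℤ ≡ 1ℤ * (1ℤ - c * 0ℤ)
            lem = solve-∀
    clash' : ∀ {c} → ¬ Z c → ¬ Z (0ℤ - c * 1ℤ)
    clash' {c} nc p = nc (Z₁ (- 1ℤ) p (lem c))
      where lem : ∀ c → c ≡ - 1ℤ * (0ℤ - c * 1ℤ)
            lem = solve-∀

  -- Leading ones in the same position force the factor to be 1 modulo `q`; in different positions
  -- they contradict each other.
  Point-∼ : ∀ {v w} → Point v → Point w → v ∼ w → v ≡ w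
  Point-∼ (point₁ {a} {b} ma mb) (point₁ {a'} {b'} ma' mb') (scaled c nc (zⱽ p r s)) = v3-≡ refl (residue-≡ ma ma' (unit c a a' p r)) (residue-≡ mb mb' (unit c b b' p s))
  Point-∼ (point₁ _ _) (point₂ _) (scaled c nc (zⱽ p _ _)) = contradiction p (clash {c})
  Point-∼ (point₁ _ _) point₃ (scaled c nc (zⱽ p _ _)) = contradiction p (clash {c})
  Point-∼ (point₂ _) (point₁ _ _) (scaled c nc (zⱽ p _ _)) = contradiction p (clash' nc)
  Point-∼ (point₂ {a} ma) (point₂ {a'} ma') (scaled c nc (zⱽ _ p r)) = v3-≡ refl refl (residue-≡ ma ma' (unit c a a' p r))
  Point-∼ (point₂ _) point₃ (scaled c nc (zⱽ _ p _)) = contradiction p (clash {c})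
  Point-∼ point₃ (point₁ _ _) (scaled c nc (zⱽ p _ _)) = contradiction p (clash' nc)
  Point-∼ point₃ (point₂ _) (scaled c nc (zⱽ _ p _)) = contradiction p (clash' nc)
  Point-∼ point₃ point₃ _ = refl

  normalise-unique : ∀ {v p} → ¬ Zⱽ v → Point p → v ∼ p → normalise v ≡ p
  normalise-unique {v} nv pp e = Point-∼ (normalise-point v) pp (∼-trans (∼-sym (normalise-∼ v nv)) e)

  chart₁ chart₂ points : List V3
  chart₁ = map (λ p → v3 1ℤ (proj₁ p) (proj₂ p)) (cartesianProduct residues residues)
  chart₂ = map (v3 0ℤ 1ℤ) residues
  points = chart₁ ++ (chart₂ ++ (v3 0ℤ 0ℤ 1ℤ ∷ []))

  ∈-points : ∀ {v} → Point v → v ∈ points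
  ∈-points (point₁ ma mb) = ∈-++⁺ˡ (∈-map⁺ (λ p → v3 1ℤ (proj₁ p) (proj₂ p)) (∈-cartesianProduct⁺ ma mb))
  ∈-points (point₂ ma) = ∈-++⁺ʳ chart₁ (∈-++⁺ˡ (∈-map⁺ (v3 0ℤ 1ℤ) ma))
  ∈-points point₃ = ∈-++⁺ʳ chart₁ (∈-++⁺ʳ chart₂ (here refl))

  points-∈ : ∀ {v} → v ∈ points → Point v
  points-∈ m with ∈-++⁻ chart₁ m
  ... | inj₁ m₁ with ∈-map⁻ (λ p → v3 1ℤ (proj₁ p) (proj₂ p)) m₁
  ...   | (a , b) , mab , refl = point₁ (proj₁ (∈-cartesianProduct⁻ residues residues mab)) (proj₂ (∈-cartesianProduct⁻ residues residues mab))
  points-∈ m | inj₂ m₂ with ∈-++⁻ chart₂ m₂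
  ...   | inj₁ m₃ with ∈-map⁻ (v3 0ℤ 1ℤ) m₃
  ...     | a , ma , refl = point₂ ma
  points-∈ m | inj₂ m₂ | inj₂ (here refl) = point₃

  points-unique : Unique points
  points-unique = Unique.++⁺ (Unique.map⁺ (λ { refl → refl }) (Unique.cartesianProduct⁺ residues-unique residues-unique))
    (Unique.++⁺ (Unique.map⁺ (λ { refl → refl }) residues-unique) (All.[] AllPairs.∷ AllPairs.[]) disjoint₂) disjoint₁
    where
      disjoint₂ : ∀ {v} → ¬ (v ∈ chart₂ × v ∈ v3 0ℤ 0ℤ 1ℤ ∷ [])
      disjoint₂ (m , here refl) with ∈-map⁻ (v3 0ℤ 1ℤ) m
      ... | _ , _ , ()
      disjoint₁ : ∀ {v} → ¬ (v ∈ chart₁ × v ∈ chart₂ ++ (v3 0ℤ 0ℤ 1ℤ ∷ []))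
      disjoint₁ (m , m') with ∈-map⁻ (λ p → v3 1ℤ (proj₁ p) (proj₂ p)) m | ∈-++⁻ chart₂ m'
      ... | _ , _ , refl | inj₁ m₃ with ∈-map⁻ (v3 0ℤ 1ℤ) m₃
      ...   | _ , _ , ()
      disjoint₁ (m , m') | _ , _ , refl | inj₂ (here ())

  FlagRep : Set
  FlagRep = V3 × V3

  incident? : (x : FlagRep) → Dec (Z (proj₁ x ∙ proj₂ x))
  incident? x = Z? (proj₁ x ∙ proj₂ x)

  flags : List FlagRep
  flags = filter incident? (cartesianProduct points points)

  record IsFlag (x : FlagRep) : Set where
    constructor isFlag
    field point-v : Point (proj₁ x)
          point-l : Point (proj₂ x)
          incident : Z (proj₁ x ∙ proj₂ x)
  open IsFlag public

  ∈-flags : ∀ {x} → IsFlag x → x ∈ flags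
  ∈-flags (isFlag p r s) = ∈-filter⁺ incident? (∈-cartesianProduct⁺ (∈-points p) (∈-points r)) s

  flags-∈ : ∀ {x} → x ∈ flags → IsFlag x
  flags-∈ {x} m with ∈-filter⁻ incident? {xs = cartesianProduct points points} m
  ... | m' , s = isFlag (points-∈ (proj₁ (∈-cartesianProduct⁻ points points m'))) (points-∈ (proj₂ (∈-cartesianProduct⁻ points points m'))) s

  flags-unique : Unique flags
  flags-unique = Unique.filter⁺ incident? (Unique.cartesianProduct⁺ points-unique points-unique)

  -- Both vectors are normalised again, so coincidence of images becomes propositional equality and
  -- can be decided.
  act : M3 → FlagRep → FlagRep
  act g (v , l) = normalise (g ⊙ v) , normalise (cof g ⊙ l)

  ∙-invariant : ∀ g v l → SL g → (g ⊙ v) ∙ (cof g ⊙ l) ≡ v ∙ l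
  ∙-invariant g v l δ = trans (sym (∙-⊙ (cof g) (g ⊙ v) l)) (cong (_∙ l) (⊙-inverse g v δ))

  act-unique : ∀ g {v l w m} → SL g → IsFlag (v , l) → Point w → Point m → g ⊙ v ∼ w → cof g ⊙ l ∼ m → act g (v , l) ≡ (w , m)
  act-unique g δ (isFlag pv pl _) pw pm e e' = cong₂ _,_ (normalise-unique (¬Zⱽ-⊙ g δ (Point-nonzero pv)) pw e) (normalise-unique (¬Zⱽ-⊙ (cof g) (SL-cof g δ) (Point-nonzero pl)) pm e')

  act-∼ˡ : ∀ g {v l} → SL g → Point v → g ⊙ v ∼ proj₁ (act g (v , l))
  act-∼ˡ g δ pv = normalise-∼ _ (¬Zⱽ-⊙ g δ (Point-nonzero pv))

  act-∼ʳ : ∀ g {v l} → SL g → Point l → cof g ⊙ l ∼ proj₂ (act g (v , l))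
  act-∼ʳ g δ pl = normalise-∼ _ (¬Zⱽ-⊙ (cof g) (SL-cof g δ) (Point-nonzero pl))

  act-isFlag : ∀ g {x} → SL g → IsFlag x → IsFlag (act g x)
  act-isFlag g {v , l} δ (isFlag pv pl s) = isFlag (normalise-point _) (normalise-point _)
    (Z-∙-∼ (∼-sym (act-∼ˡ g {v} {l} δ pv)) (∼-sym (act-∼ʳ g {v} {l} δ pl)) (subst Z (sym (∙-invariant g v l δ)) s))

  act-∈ : ∀ g x → SL g → x ∈ flags → act g x ∈ flags
  act-∈ g x δ m = ∈-flags (act-isFlag g δ (flags-∈ m))

  act-· : ∀ g h x → SL g → SL h → x ∈ flags → act (g · h) x ≡ act g (act h x)
  act-· g h (v , l) δ ε m with flags-∈ m
  ... | fx@(isFlag pv pl s) = act-unique (g · h) (SL-· g h δ ε) fx (normalise-point _) (normalise-point _)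
      (subst (_∼ proj₁ (act g (act h (v , l)))) (sym (⊙-· g h v)) (∼-trans (⊙-∼ g (act-∼ˡ h {v} {l} ε pv)) (act-∼ˡ g {l = proj₂ (act h (v , l))} δ (normalise-point _))))
      (subst (_∼ proj₂ (act g (act h (v , l)))) (sym (trans (cong (_⊙ l) (cof-· g h)) (⊙-· (cof g) (cof h) l))) (∼-trans (⊙-∼ (cof g) (act-∼ʳ h {v} {l} ε pl)) (act-∼ʳ g {v = proj₁ (act h (v , l))} δ (normalise-point _))))

  act-𝟙 : ∀ x → x ∈ flags → act 𝟙 x ≡ x
  act-𝟙 (v , l) m with flags-∈ m
  ... | fx@(isFlag pv pl s) = act-unique 𝟙 refl fx pv pl (subst (_∼ v) (sym (𝟙-⊙ v)) (∼-refl v)) (subst (_∼ l) (sym (𝟙-⊙ l)) (∼-refl l))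

-- Connectedness of the graph on flags

module Connected (q : ℕ) .{{_ : NonZero q}} (pr : Prime q) where
  open Modular q pr
  open Mixing flags flags-unique act act-∈ act-· act-𝟙

  private
    e₁₂ e₁₃ e₂₁⁻ e₂₃ e₂₃⁻ e₃₁⁻ e₃₂ : M3
    e₁₂ = mat 1ℤ 1ℤ 0ℤ 0ℤ 1ℤ 0ℤ 0ℤ 0ℤ 1ℤ
    e₁₃ = mat 1ℤ 0ℤ 1ℤ 0ℤ 1ℤ 0ℤ 0ℤ 0ℤ 1ℤ
    e₂₁⁻ = mat 1ℤ 0ℤ 0ℤ (- 1ℤ) 1ℤ 0ℤ 0ℤ 0ℤ 1ℤ
    e₂₃ = mat 1ℤ 0ℤ 0ℤ 0ℤ 1ℤ 1ℤ 0ℤ 0ℤ 1ℤ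
    e₂₃⁻ = mat 1ℤ 0ℤ 0ℤ 0ℤ 1ℤ (- 1ℤ) 0ℤ 0ℤ 1ℤ
    e₃₁⁻ = mat 1ℤ 0ℤ 0ℤ 0ℤ 1ℤ 0ℤ (- 1ℤ) 0ℤ 1ℤ
    e₃₂ = mat 1ℤ 0ℤ 0ℤ 0ℤ 1ℤ 0ℤ 0ℤ 1ℤ 1ℤ

    m₁₂ : e₁₂ ∈ generators
    m₁₂ = here refl
    m₁₃ : e₁₃ ∈ generators
    m₁₃ = there (there (here refl))
    m₂₁ : e₂₁⁻ ∈ generators
    m₂₁ = there (there (there (there (there (here refl)))))
    m₂₃ : e₂₃ ∈ generators
    m₂₃ = there (there (there (there (there (there (here refl))))))
    m₂₃⁻ : e₂₃⁻ ∈ generators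
    m₂₃⁻ = there (there (there (there (there (there (there (here refl)))))))
    m₃₁ : e₃₁⁻ ∈ generators
    m₃₁ = there (there (there (there (there (there (there (there (there (here refl)))))))))
    m₃₂ : e₃₂ ∈ generators
    m₃₂ = there (there (there (there (there (there (there (there (there (there (here refl))))))))))

    move : ∀ {s} → s ∈ generators → ∀ {v l w m} → IsFlag (v , l) → Point w → Point m → s ⊙ v ≡ w → cof s ⊙ l ≡ m → Near (v , l) (w , m)
    move {s} ms {v} {l} {w} {m} fx pw pm e e' = subst (Near (v , l)) (act-unique s (All.lookup generators-SL ms) fx pw pm (subst (s ⊙ v ∼_) e (∼-refl (s ⊙ v))) (subst (cof s ⊙ l ∼_) e' (∼-refl (cof s ⊙ l)))) (Near-step ms (∈-flags fx))

    -- Only the point is steered at this stage; the plane follows along and may become anything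
    -- incident.
    Reach : FlagRep → V3 → Set
    Reach x w = ∃[ m ] (IsFlag (w , m) × Near x (w , m))

    moveᵛ : ∀ {s} → s ∈ generators → ∀ {v l w} → IsFlag (v , l) → Point w → s ⊙ v ≡ w → Reach (v , l) w
    moveᵛ {s} ms {v} {l} {w} fx@(isFlag pv pl _) pw e = proj₂ (act s (v , l)) , subst (λ u → IsFlag (u , proj₂ (act s (v , l)))) p (act-isFlag s δ fx) ,
        subst (λ u → Near (v , l) (u , proj₂ (act s (v , l)))) p (Near-step ms (∈-flags fx))
      where
        δ = All.lookup generators-SL ms
        p : proj₁ (act s (v , l)) ≡ w
        p = normalise-unique (¬Zⱽ-⊙ s δ (Point-nonzero pv)) pw (subst (s ⊙ v ∼_) e (∼-refl (s ⊙ v)))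

    _then_ : ∀ {x v w} → Reach x v → (∀ m → IsFlag (v , m) → Reach (v , m) w) → Reach x w
    (m , fm , near) then next with next m fm
    ... | m' , fm' , near' = m' , fm' , Near-trans near near'

    ∈₀ : 0ℤ ∈ residues
    ∈₀ = ∈-residues (ℕP.<-trans (s≤s z≤n) 1<q)

    ∈₁ : 1ℤ ∈ residues
    ∈₁ = ∈-residues 1<q

    pick₁ : ∀ a b → 1ℤ * 1ℤ + 0ℤ * a + 0ℤ * b ≡ 1ℤ
    pick₁ = solve-∀
    pick₂ : ∀ a b → 0ℤ * 1ℤ + 1ℤ * a + 0ℤ * b ≡ a
    pick₂ = solve-∀
    pick₃ : ∀ a b → 0ℤ * 1ℤ + 0ℤ * a + 1ℤ * b ≡ b
    pick₃ = solve-∀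

    to-1-0-b : ∀ n {b l} → n ℕ.< q → b ∈ residues → IsFlag (v3 1ℤ (+ n) b , l) → Reach (v3 1ℤ (+ n) b , l) (v3 1ℤ 0ℤ b)
    to-1-0-b zero {l = l} lt mb fx = l , fx , Near-refl
    to-1-0-b (suc n) {b} {l} lt mb fx = moveᵛ m₂₁ {w = v3 1ℤ (+ n) b} fx (point₁ (∈-residues (ℕP.<-trans (ℕP.n<1+n n) lt)) mb) (v3-≡ (pick₁ (+ suc n) b) (lem (+ n) b) (pick₃ (+ suc n) b))
        then λ m fm → to-1-0-b n (ℕP.<-trans (ℕP.n<1+n n) lt) mb fm
      where lem : ∀ a b → - 1ℤ * 1ℤ + 1ℤ * (1ℤ + a) + 0ℤ * b ≡ a
            lem = solve-∀

    to-1-0-0 : ∀ n {l} → n ℕ.< q → IsFlag (v3 1ℤ 0ℤ (+ n) , l) → Reach (v3 1ℤ 0ℤ (+ n) , l) (v3 1ℤ 0ℤ 0ℤ)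
    to-1-0-0 zero {l} lt fx = l , fx , Near-refl
    to-1-0-0 (suc n) {l} lt fx = moveᵛ m₃₁ {w = v3 1ℤ 0ℤ (+ n)} fx (point₁ ∈₀ (∈-residues (ℕP.<-trans (ℕP.n<1+n n) lt))) (v3-≡ (pick₁ 0ℤ (+ suc n)) (pick₂ 0ℤ (+ suc n)) (lem (+ n)))
        then λ m fm → to-1-0-0 n (ℕP.<-trans (ℕP.n<1+n n) lt) fm
      where lem : ∀ b → - 1ℤ * 1ℤ + 0ℤ * 0ℤ + 1ℤ * (1ℤ + b) ≡ b
            lem = solve-∀

    from-chart₁ : ∀ {a b l} → a ∈ residues → b ∈ residues → IsFlag (v3 1ℤ a b , l) → Reach (v3 1ℤ a b , l) (v3 1ℤ 0ℤ 0ℤ)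
    from-chart₁ ma mb fx with residues-∈ ma | residues-∈ mb
    ... | n , ln , refl | k , lk , refl = to-1-0-b n ln mb fx then λ m fm → to-1-0-0 k lk fm

    -- A point with first coordinate zero is first given leading coordinate 1 by `e₁₂` or `e₁₃`;
    -- then `e₂₁⁻` and `e₃₁⁻` count the other two coordinates down to zero.
    to-e₁ : ∀ {v l} → IsFlag (v , l) → Reach (v , l) (v3 1ℤ 0ℤ 0ℤ)
    to-e₁ fx@(isFlag (point₁ ma mb) _ _) = from-chart₁ ma mb fx
    to-e₁ fx@(isFlag (point₂ {a} ma) _ _) = moveᵛ m₁₂ {w = v3 1ℤ 1ℤ a} fx (point₁ ∈₁ ma) (v3-≡ (l₁ a) (l₂ a) (l₃ a)) then λ m fm → from-chart₁ ∈₁ ma fm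
      where l₁ : ∀ a → 1ℤ * 0ℤ + 1ℤ * 1ℤ + 0ℤ * a ≡ 1ℤ
            l₁ = solve-∀
            l₂ : ∀ a → 0ℤ * 0ℤ + 1ℤ * 1ℤ + 0ℤ * a ≡ 1ℤ
            l₂ = solve-∀
            l₃ : ∀ a → 0ℤ * 0ℤ + 0ℤ * 1ℤ + 1ℤ * a ≡ a
            l₃ = solve-∀
    to-e₁ fx@(isFlag point₃ _ _) = moveᵛ m₁₃ {w = v3 1ℤ 0ℤ 1ℤ} fx (point₁ ∈₀ ∈₁) refl then λ m fm → from-chart₁ ∈₀ ∈₁ fm

    e₁-fixed : Z 0ℤ → ∀ {l} → Point l → Z (v3 1ℤ 0ℤ 0ℤ ∙ l) → IsFlag (v3 1ℤ 0ℤ 0ℤ , l)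
    e₁-fixed _ pl z = isFlag (point₁ ∈₀ ∈₀) pl z

    incident₀ : ∀ c → 1ℤ * 0ℤ + 0ℤ * 1ℤ + 0ℤ * c ≡ 0ℤ
    incident₀ = solve-∀

    -- The matrix `e₂₃` fixes the first basis vector, while its cofactor matrix lowers the last
    -- coordinate of the normal by one.
    down : ∀ n → n ℕ.< q → Near (v3 1ℤ 0ℤ 0ℤ , v3 0ℤ 1ℤ (+ n)) (v3 1ℤ 0ℤ 0ℤ , v3 0ℤ 1ℤ 0ℤ)
    down zero lt = Near-refl
    down (suc n) lt = Near-trans
        (move m₂₃ {m = v3 0ℤ 1ℤ (+ n)} (isFlag (point₁ ∈₀ ∈₀) (point₂ (∈-residues lt)) (Z-≡0 (incident₀ (+ suc n)))) (point₁ ∈₀ ∈₀) (point₂ (∈-residues (ℕP.<-trans (ℕP.n<1+n n) lt))) refl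
          (v3-≡ (l₁ (+ suc n)) (l₂ (+ suc n)) (l₃ (+ n))))
        (down n (ℕP.<-trans (ℕP.n<1+n n) lt))
      where l₁ : ∀ c → 1ℤ * 0ℤ + 0ℤ * 1ℤ + 0ℤ * c ≡ 0ℤ
            l₁ = solve-∀
            l₂ : ∀ c → 0ℤ * 0ℤ + 1ℤ * 1ℤ + 0ℤ * c ≡ 1ℤ
            l₂ = solve-∀
            l₃ : ∀ c → 0ℤ * 0ℤ + - 1ℤ * 1ℤ + 1ℤ * (1ℤ + c) ≡ c
            l₃ = solve-∀

  base : FlagRep
  base = v3 1ℤ 0ℤ 0ℤ , v3 0ℤ 0ℤ 1ℤ

  private
    -- Incidence makes the first coordinate of the normal vanish, which rules out the first chart.
    -- In the second chart the normal is brought to `(0 , 1 , 0)`, then to `(0 , 1 , 1)`, then to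
    -- `(0 , 0 , 1)`.
    from-e₁ : ∀ {l} → IsFlag (v3 1ℤ 0ℤ 0ℤ , l) → Near (v3 1ℤ 0ℤ 0ℤ , l) base
    from-e₁ (isFlag _ (point₁ {a} {b} _ _) z) = contradiction (Z₁ 1ℤ z (lem a b)) ¬Z-1
      where lem : ∀ a b → 1ℤ ≡ 1ℤ * (1ℤ * 1ℤ + 0ℤ * a + 0ℤ * b)
            lem = solve-∀
    from-e₁ (isFlag _ (point₂ mc) z) with residues-∈ mc
    ... | n , lt , refl = Near-trans (down n lt) (Near-trans
        (move m₂₃⁻ {m = v3 0ℤ 1ℤ 1ℤ} (isFlag (point₁ ∈₀ ∈₀) (point₂ ∈₀) Z-0) (point₁ ∈₀ ∈₀) (point₂ ∈₁) refl refl)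
        (move m₃₂ {m = v3 0ℤ 0ℤ 1ℤ} (isFlag (point₁ ∈₀ ∈₀) (point₂ ∈₁) Z-0) (point₁ ∈₀ ∈₀) point₃ refl refl))
    from-e₁ (isFlag _ point₃ _) = Near-refl

  poincaré : Poincaré 519
  poincaré = connected⇒Poincaré base λ x m → reach x (flags-∈ m)
    where
      reach : ∀ x → IsFlag x → Near x base
      reach (v , l) fx with to-e₁ fx
      ... | m , fm , near = Near-trans near (from-e₁ fm)

-- Flags on which two matrices agree

pencil : M3 → M3 → ℤ → M3
pencil (mat a b c d e f g h i) (mat a' b' c' d' e' f' g' h' i') μ =
  mat (a - μ * a') (b - μ * b') (c - μ * c') (d - μ * d') (e - μ * e') (f - μ * f') (g - μ * g') (h - μ * h') (i - μ * i')

mixed : V3 → V3 → V3 → V3 → V3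
mixed u w u' w' = u ×ᵥ w' ⊞ u' ×ᵥ w

-- The middle coefficients, up to sign, of the cubic `det (g − μ h)` in `μ`; the outer ones are
-- `det g` and `det h`.
linear quadratic : M3 → M3 → ℤ
linear g h = row₁ g ∙ mixed (row₂ g) (row₃ g) (row₂ h) (row₃ h) + row₁ h ∙ row₁ (cof g)
quadratic g h = row₁ h ∙ mixed (row₂ g) (row₃ g) (row₂ h) (row₃ h) + row₁ g ∙ row₁ (cof h)

det-pencil : ∀ g h μ → det (pencil g h μ) ≡ det g - μ * linear g h + μ * μ * quadratic g h - μ * μ * μ * det h
det-pencil (mat a b c d e f g h i) (mat a' b' c' d' e' f' g' h' i') μ = begin
  det (pencil (mat a b c d e f g h i) (mat a' b' c' d' e' f' g' h' i') μ) ≡⟨ expand (a - μ * a') (b - μ * b') (c - μ * c') (d - μ * d') (e - μ * e') (f - μ * f') (g - μ * g') (h - μ * h') (i - μ * i') ⟩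
  (a - μ * a') * ((e - μ * e') * (i - μ * i') - (f - μ * f') * (h - μ * h')) + (b - μ * b') * ((f - μ * f') * (g - μ * g') - (d - μ * d') * (i - μ * i')) + (c - μ * c') * ((d - μ * d') * (h - μ * h') - (e - μ * e') * (g - μ * g'))
    ≡⟨ cong₂ _+_ (cong₂ (λ s t → (a - μ * a') * s + (b - μ * b') * t) (minor e f h i e' f' h' i' μ) (minor f d i g f' d' i' g' μ)) (cong ((c - μ * c') *_) (minor d e g h d' e' g' h' μ)) ⟩
  (a - μ * a') * (U₁ - μ * Q₁ + μ * μ * R₁) + (b - μ * b') * (U₂ - μ * Q₂ + μ * μ * R₂) + (c - μ * c') * (U₃ - μ * Q₃ + μ * μ * R₃)
    ≡⟨ combine a b c a' b' c' U₁ U₂ U₃ Q₁ Q₂ Q₃ R₁ R₂ R₃ μ ⟩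
  (a * U₁ + b * U₂ + c * U₃) - μ * linear G H + μ * μ * quadratic G H - μ * μ * μ * (a' * R₁ + b' * R₂ + c' * R₃)
    ≡⟨ cong₂ (λ s t → s - μ * linear G H + μ * μ * quadratic G H - μ * μ * μ * t) (sym (expand a b c d e f g h i)) (sym (expand a' b' c' d' e' f' g' h' i')) ⟩
  det G - μ * linear G H + μ * μ * quadratic G H - μ * μ * μ * det H ∎
  where
    open ≡-Reasoning
    G = mat a b c d e f g h i
    H = mat a' b' c' d' e' f' g' h' i'
    U₁ = e * i - f * h
    U₂ = f * g - d * i
    U₃ = d * h - e * g
    Q₁ = e * i' - f * h' + (e' * i - f' * h)
    Q₂ = f * g' - d * i' + (f' * g - d' * i)
    Q₃ = d * h' - e * g' + (d' * h - e' * g)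
    R₁ = e' * i' - f' * h'
    R₂ = f' * g' - d' * i'
    R₃ = d' * h' - e' * g'
    expand : ∀ a b c d e f g h i → a * (e * i - f * h) - b * (d * i - f * g) + c * (d * h - e * g) ≡ a * (e * i - f * h) + b * (f * g - d * i) + c * (d * h - e * g)
    expand = solve-∀
    minor : ∀ e f h i e' f' h' i' μ → (e - μ * e') * (i - μ * i') - (f - μ * f') * (h - μ * h') ≡ e * i - f * h - μ * (e * i' - f * h' + (e' * i - f' * h)) + μ * μ * (e' * i' - f' * h')
    minor = solve-∀
    combine : ∀ a b c a' b' c' p₁ p₂ p₃ q₁ q₂ q₃ r₁ r₂ r₃ μ → (a - μ * a') * (p₁ - μ * q₁ + μ * μ * r₁) + (b - μ * b') * (p₂ - μ * q₂ + μ * μ * r₂) + (c - μ * c') * (p₃ - μ * q₃ + μ * μ * r₃) ≡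
      (a * p₁ + b * p₂ + c * p₃) - μ * (a * q₁ + b * q₂ + c * q₃ + (a' * p₁ + b' * p₂ + c' * p₃)) + μ * μ * (a' * q₁ + b' * q₂ + c' * q₃ + (a * r₁ + b * r₂ + c * r₃)) - μ * μ * μ * (a' * r₁ + b' * r₂ + c' * r₃)
    combine = solve-∀

adjugate-⊙ : ∀ g v → transpose (cof g) ⊙ (g ⊙ v) ≡ det g ⋆ v
adjugate-⊙ (mat a b c d e f g h i) (v3 x y z) = v3-≡ (l₁ a b c d e f g h i x y z) (l₂ a b c d e f g h i x y z) (l₃ a b c d e f g h i x y z)
  where
    l₁ : ∀ a b c d e f g h i x y z → (e * i - f * h) * (a * x + b * y + c * z) + (h * c - i * b) * (d * x + e * y + f * z) + (b * f - c * e) * (g * x + h * y + i * z) ≡ (a * (e * i - f * h) - b * (d * i - f * g) + c * (d * h - e * g)) * x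
    l₁ = solve-∀
    l₂ : ∀ a b c d e f g h i x y z → (f * g - d * i) * (a * x + b * y + c * z) + (i * a - g * c) * (d * x + e * y + f * z) + (c * d - a * f) * (g * x + h * y + i * z) ≡ (a * (e * i - f * h) - b * (d * i - f * g) + c * (d * h - e * g)) * y
    l₂ = solve-∀
    l₃ : ∀ a b c d e f g h i x y z → (d * h - e * g) * (a * x + b * y + c * z) + (g * b - h * a) * (d * x + e * y + f * z) + (a * e - b * d) * (g * x + h * y + i * z) ≡ (a * (e * i - f * h) - b * (d * i - f * g) + c * (d * h - e * g)) * z
    l₃ = solve-∀

length≤3 : ∀ {A : Set} {xs : List A} → Unique xs →
  (∀ {a b c d} → a ∈ xs → b ∈ xs → c ∈ xs → d ∈ xs → ¬ a ≡ b → ¬ a ≡ c → ¬ a ≡ d → ¬ b ≡ c → ¬ b ≡ d → ¬ c ≡ d → ⊥) → length xs ℕ.≤ 3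
length≤3 {xs = []} u h = z≤n
length≤3 {xs = _ ∷ []} u h = s≤s z≤n
length≤3 {xs = _ ∷ _ ∷ []} u h = s≤s (s≤s z≤n)
length≤3 {xs = _ ∷ _ ∷ _ ∷ []} u h = s≤s (s≤s (s≤s z≤n))
length≤3 {xs = _ ∷ _ ∷ _ ∷ _ ∷ _} ((ab ∷ ac ∷ ad ∷ _) ∷ (bc ∷ bd ∷ _) ∷ (cd ∷ _) ∷ _) h =
  ⊥-elim (h (here refl) (there (here refl)) (there (there (here refl))) (there (there (there (here refl)))) ab ac ad bc bd cd)

module Fixed (q : ℕ) .{{_ : NonZero q}} (pr : Prime q) where
  open Modular q pr

  private
    -- Successive divided differences: distinct roots can be cancelled, so two roots give a
    -- quadratic relation, three determine their sum, and a fourth must equal the third.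
    cubic-roots : ∀ (p r : ℤ) {a b c d} → a ∈ residues → b ∈ residues → c ∈ residues → d ∈ residues →
      ¬ a ≡ b → ¬ a ≡ c → ¬ a ≡ d → ¬ b ≡ c → ¬ b ≡ d → ¬ c ≡ d →
      Z (1ℤ - a * p + a * a * r - a * a * a * 1ℤ) → Z (1ℤ - b * p + b * b * r - b * b * b * 1ℤ) → Z (1ℤ - c * p + c * c * r - c * c * c * 1ℤ) → Z (1ℤ - d * p + d * d * r - d * d * d * 1ℤ) → ⊥
    cubic-roots p r {a} {b} {c} {d} ma mb mc md ab ac ad bc bd cd za zb zc zd = cd (residue-≡ mc md (Z₂ (- 1ℤ) 1ℤ abc abd (l₃ a b c d r)))
      where
        ne : ∀ {x y} → x ∈ residues → y ∈ residues → ¬ x ≡ y → ¬ Z (x - y)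
        ne mx my n z = n (residue-≡ mx my z)
        l₁ : ∀ a b p r → (a - b) * (- p + (a + b) * r - (a * a + a * b + b * b)) ≡ 1ℤ * (1ℤ - a * p + a * a * r - a * a * a * 1ℤ) + - 1ℤ * (1ℤ - b * p + b * b * r - b * b * b * 1ℤ)
        l₁ = solve-∀
        two : ∀ {x} → x ∈ residues → ¬ a ≡ x → Z (1ℤ - x * p + x * x * r - x * x * x * 1ℤ) → Z (- p + (a + x) * r - (a * a + a * x + x * x))
        two {x} mx n zx = Z-cancel (a - x) (- p + (a + x) * r - (a * a + a * x + x * x)) (ne ma mx n) (Z₂ 1ℤ (- 1ℤ) za zx (l₁ a x p r))
        l₂ : ∀ a b c p r → (b - c) * (r - (a + b + c)) ≡ 1ℤ * (- p + (a + b) * r - (a * a + a * b + b * b)) + - 1ℤ * (- p + (a + c) * r - (a * a + a * c + c * c))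
        l₂ = solve-∀
        three : ∀ {x} → x ∈ residues → ¬ a ≡ x → ¬ b ≡ x → Z (1ℤ - x * p + x * x * r - x * x * x * 1ℤ) → Z (r - (a + b + x))
        three {x} mx n n' zx = Z-cancel (b - x) (r - (a + b + x)) (ne mb mx n') (Z₂ 1ℤ (- 1ℤ) (two mb ab zb) (two mx n zx) (l₂ a b x p r))
        abc = three mc ac bc zc
        abd = three md ad bd zd
        l₃ : ∀ a b c d r → c - d ≡ - 1ℤ * (r - (a + b + c)) + 1ℤ * (r - (a + b + d))
        l₃ = solve-∀

  -- the admissible ratios μ with γ v ≡ μ γ′ v are the roots of a cubic
  Root : M3 → M3 → ℤ → Set
  Root g h μ = ¬ Z μ × Z (det (pencil g h μ))

  root? : ∀ g h μ → Dec (Root g h μ)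
  root? g h μ = ¬? (Z? μ) ×-dec Z? (det (pencil g h μ))

  roots : M3 → M3 → List ℤ
  roots g h = filter (root? g h) residues

  roots≤3 : ∀ g h → SL g → SL h → length (roots g h) ℕ.≤ 3
  roots≤3 g h δ ε = length≤3 (Unique.filter⁺ (root? g h) residues-unique) λ ma mb mc md ab ac ad bc bd cd →
      cubic-roots (linear g h) (quadratic g h) (residue ma) (residue mb) (residue mc) (residue md) ab ac ad bc bd cd (root ma) (root mb) (root mc) (root md)
    where
      residue : ∀ {μ} → μ ∈ roots g h → μ ∈ residues
      residue m = proj₁ (∈-filter⁻ (root? g h) {xs = residues} m)
      root : ∀ {μ} → μ ∈ roots g h → Z (1ℤ - μ * linear g h + μ * μ * quadratic g h - μ * μ * μ * 1ℤ)
      root {μ} m = subst Z (trans (det-pencil g h μ) (cong₂ (λ u v → u - μ * linear g h + μ * μ * quadratic g h - μ * μ * μ * v) δ ε)) (proj₂ (proj₂ (∈-filter⁻ (root? g h) {xs = residues} m)))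

  pencil-⊙ : ∀ g h μ v → pencil g h μ ⊙ v ≡ (g ⊙ v) ⊟ μ ⋆ (h ⊙ v)
  pencil-⊙ (mat a b c d e f g h i) (mat a' b' c' d' e' f' g' h' i') μ (v3 x y z) = v3-≡ (lem a b c a' b' c' μ x y z) (lem d e f d' e' f' μ x y z) (lem g h i g' h' i' μ x y z)
    where lem : ∀ a b c a' b' c' μ x y z → (a - μ * a') * x + (b - μ * b') * y + (c - μ * c') * z ≡ a * x + b * y + c * z - μ * (a' * x + b' * y + c' * z)
          lem = solve-∀

  Z-⋆ : ∀ k v → ¬ Z k → Zⱽ (k ⋆ v) → Zⱽ v
  Z-⋆ k (v3 x y z) nk (zⱽ p r s) = zⱽ (Z-cancel k x nk p) (Z-cancel k y nk r) (Z-cancel k z nk s)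

  -- The adjugate applied to `m v` is `det m` times `v`; a unit determinant would therefore make `v`
  -- vanish.
  det-kernel : ∀ m v → ¬ Zⱽ v → Zⱽ (m ⊙ v) → Z (det m)
  det-kernel m v nv z = decide (Z? (det m))
    where
      scaled-zero : Zⱽ (det m ⋆ v)
      scaled-zero = subst Zⱽ (adjugate-⊙ m v) (Zⱽ-⊙ (transpose (cof m)) {m ⊙ v} z)
      decide : Dec (Z (det m)) → Z (det m)
      decide (yes p) = p
      decide (no nd) = contradiction (Z-⋆ (det m) v nd scaled-zero) nv

  Kernel : M3 → M3 → V3 → ℤ → Set
  Kernel g h v μ = Zⱽ (pencil g h μ ⊙ v)

  kernel? : ∀ g h v μ → Dec (Kernel g h v μ)
  kernel? g h v μ = Zⱽ? (pencil g h μ ⊙ v)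

  common-image : ∀ g h v → ¬ Zⱽ v → g ⊙ v ∼ h ⊙ v → ∃[ μ ] (μ ∈ roots g h × Kernel g h v μ)
  common-image g h v nv (scaled c nc (zⱽ p r s)) = mod c , ∈-filter⁺ (root? g h) (mod-∈ c) ((λ z → nc (Z₂ 1ℤ 1ℤ (mod-≡ c) z (split c (mod c)))) , det-kernel (pencil g h (mod c)) v nv k) , k
    where
      split : ∀ a b → a ≡ 1ℤ * (a - b) + 1ℤ * b
      split = solve-∀
      lem : ∀ x y c m → x - m * y ≡ 1ℤ * (x - c * y) + y * (c - m)
      lem = solve-∀
      k : Zⱽ (pencil g h (mod c) ⊙ v)
      k = subst Zⱽ (sym (pencil-⊙ g h (mod c) v)) (zⱽ (Z₂ 1ℤ (vx (h ⊙ v)) p (mod-≡ c) (lem (vx (g ⊙ v)) (vx (h ⊙ v)) c (mod c))) (Z₂ 1ℤ (vy (h ⊙ v)) r (mod-≡ c) (lem (vy (g ⊙ v)) (vy (h ⊙ v)) c (mod c))) (Z₂ 1ℤ (vz (h ⊙ v)) s (mod-≡ c) (lem (vz (g ⊙ v)) (vz (h ⊙ v)) c (mod c))))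

  _≟ᶠ_ : (x y : FlagRep) → Dec (x ≡ y)
  (v , l) ≟ᶠ (w , m) = map′ (λ { (refl , refl) → refl }) (λ { refl → refl , refl }) (v ≟ⱽ w ×-dec l ≟ⱽ m)

  coincidences : M3 → M3 → ℕ
  coincidences g h = ∑ flags λ x → ⟦ act g x ≟ᶠ act h x ⟧

  kernel-flag? : ∀ g h μ σ (x : FlagRep) → Dec (Kernel g h (proj₁ x) μ × Kernel (cof g) (cof h) (proj₂ x) σ)
  kernel-flag? g h μ σ x = kernel? g h (proj₁ x) μ ×-dec kernel? (cof g) (cof h) (proj₂ x) σ

  private
    coincide : ∀ g h x → SL g → SL h → x ∈ flags → act g x ≡ act h x →
      1 ℕ.≤ ∑ (roots g h) λ μ → ∑ (roots (cof g) (cof h)) λ σ → ⟦ kernel-flag? g h μ σ x ⟧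
    coincide g h (v , l) δ ε m e = from (common-image g h v (Point-nonzero pv) eᵛ) (common-image (cof g) (cof h) l (Point-nonzero pl) eˡ)
      where
        pv : Point v
        pv = point-v (flags-∈ m)
        pl : Point l
        pl = point-l (flags-∈ m)
        eᵛ : g ⊙ v ∼ h ⊙ v
        eᵛ = ∼-trans (act-∼ˡ g {v} {l} δ pv) (subst (λ y → proj₁ y ∼ h ⊙ v) (sym e) (∼-sym (act-∼ˡ h {v} {l} ε pv)))
        eˡ : cof g ⊙ l ∼ cof h ⊙ l
        eˡ = ∼-trans (act-∼ʳ g {v} {l} δ pl) (subst (λ y → proj₂ y ∼ cof h ⊙ l) (sym e) (∼-sym (act-∼ʳ h {v} {l} ε pl)))
        from : ∃[ μ ] (μ ∈ roots g h × Kernel g h v μ) → ∃[ σ ] (σ ∈ roots (cof g) (cof h) × Kernel (cof g) (cof h) l σ) →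
          1 ℕ.≤ ∑ (roots g h) λ μ → ∑ (roots (cof g) (cof h)) λ σ → ⟦ kernel-flag? g h μ σ (v , l) ⟧
        from (μ , mμ , kμ) (σ , mσ , kσ) = ℕP.≤-trans (⟦⟧-1≤ (kernel-flag? g h μ σ (v , l)) (kμ , kσ))
            (ℕP.≤-trans (∑-elem (roots (cof g) (cof h)) (λ σ → ⟦ kernel-flag? g h μ σ (v , l) ⟧) mσ) (∑-elem (roots g h) (λ μ → ∑ (roots (cof g) (cof h)) λ σ → ⟦ kernel-flag? g h μ σ (v , l) ⟧) mμ))

  -- A common flag has a ratio `μ` on its point and a ratio `σ` on its normal vector. Each takes at
  -- most three values, and `K` bounds the flags for one choice of both.
  coincidences≤ : ∀ g h K → SL g → SL h →
    (∀ μ σ → μ ∈ roots g h → σ ∈ roots (cof g) (cof h) → ∑ flags (λ x → ⟦ kernel-flag? g h μ σ x ⟧) ℕ.≤ K) → coincidences g h ℕ.≤ 9 ℕ.* K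
  coincidences≤ g h K δ ε bound = begin
    coincidences g h ≤⟨ ∑-mono flags (λ x m → ⟦⟧-≤ (act g x ≟ᶠ act h x) (coincide g h x δ ε m)) ⟩
    ∑ flags (λ x → ∑ Rs λ μ → ∑ Rs' λ σ → ⟦ kernel-flag? g h μ σ x ⟧) ≡⟨ ∑-swap flags Rs (λ x μ → ∑ Rs' λ σ → ⟦ kernel-flag? g h μ σ x ⟧) ⟩
    ∑ Rs (λ μ → ∑ flags λ x → ∑ Rs' λ σ → ⟦ kernel-flag? g h μ σ x ⟧) ≡⟨ ∑-cong Rs (λ μ _ → ∑-swap flags Rs' (λ x σ → ⟦ kernel-flag? g h μ σ x ⟧)) ⟩
    ∑ Rs (λ μ → ∑ Rs' λ σ → ∑ flags λ x → ⟦ kernel-flag? g h μ σ x ⟧) ≤⟨ ∑-bound Rs (length Rs' ℕ.* K) (λ μ mμ → ∑-bound Rs' K λ σ mσ → bound μ σ mμ mσ) ⟩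
    length Rs ℕ.* (length Rs' ℕ.* K) ≤⟨ ℕP.*-mono-≤ (roots≤3 g h δ ε) (ℕP.*-monoˡ-≤ K (roots≤3 (cof g) (cof h) (SL-cof g δ) (SL-cof h ε))) ⟩
    3 ℕ.* (3 ℕ.* K) ≡⟨ sym (ℕP.*-assoc 3 3 K) ⟩
    9 ℕ.* K ∎
    where
      open ℕP.≤-Reasoning
      Rs = roots g h
      Rs' = roots (cof g) (cof h)

  parallel : ∀ u w → ¬ Zⱽ u → ¬ Zⱽ w → Zⱽ (u ×ᵥ w) → u ∼ w
  parallel u@(v3 a b c) w@(v3 x y z) nu nw (zⱽ p r s) = choose (Z? x) (Z? y)
    where
      build : ∀ t → Zⱽ (u ⊟ t ⋆ w) → u ∼ w
      build t d = scaled t (λ zt → nu (zⱽ (Z₂ 1ℤ x (zx d) zt (l a t x)) (Z₂ 1ℤ y (zy d) zt (l b t y)) (Z₂ 1ℤ z (zz d) zt (l c t z)))) d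
        where l : ∀ a t x → a ≡ 1ℤ * (a - t * x) + x * t
              l = solve-∀
      same : ∀ a i x → a - a * i * x ≡ a * (1ℤ - x * i)
      same = solve-∀
      pos : ∀ a b i x y → b - a * i * y ≡ - i * (a * y - b * x) + b * (1ℤ - x * i)
      pos = solve-∀
      neg : ∀ a b i x y → b - a * i * y ≡ i * (b * x - a * y) + b * (1ℤ - x * i)
      neg = solve-∀
      choose : Dec (Z x) → Dec (Z y) → u ∼ w
      choose (no nx) _ = build (a * inv x) (zⱽ (Z₁ a (inv-≡ x nx) (same a (inv x) x)) (Z₂ (- inv x) b s (inv-≡ x nx) (pos a b (inv x) x y)) (Z₂ (inv x) c r (inv-≡ x nx) (neg a c (inv x) x z)))
      choose (yes _) (no ny) = build (b * inv y) (zⱽ (Z₂ (inv y) a s (inv-≡ y ny) (neg b a (inv y) y x)) (Z₁ b (inv-≡ y ny) (same b (inv y) y)) (Z₂ (- inv y) c p (inv-≡ y ny) (pos b c (inv y) y z)))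
      choose (yes zx') (yes zy') = build (c * inv z) (zⱽ (Z₂ (- inv z) a r (inv-≡ z nz) (pos c a (inv z) z x)) (Z₂ (inv z) b p (inv-≡ z nz) (neg c b (inv z) z y)) (Z₁ c (inv-≡ z nz) (same c (inv z) z)))
        where nz : ¬ Z z
              nz zz' = nw (zⱽ zx' zy' zz')

  orthogonal : ∀ u w v → ¬ Zⱽ (u ×ᵥ w) → ¬ Zⱽ v → Z (u ∙ v) → Z (w ∙ v) → v ∼ u ×ᵥ w
  orthogonal u@(v3 a b c) w@(v3 a' b' c') v@(v3 x y z) n nv p r = parallel v (u ×ᵥ w) nv n (zⱽ (Z₂ a (- a') r p (l₁ a b c a' b' c' x y z)) (Z₂ b (- b') r p (l₂ a b c a' b' c' x y z)) (Z₂ c (- c') r p (l₃ a b c a' b' c' x y z)))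
    where
      l₁ : ∀ a b c a' b' c' x y z → y * (a * b' - b * a') - z * (c * a' - a * c') ≡ a * (a' * x + b' * y + c' * z) + - a' * (a * x + b * y + c * z)
      l₁ = solve-∀
      l₂ : ∀ a b c a' b' c' x y z → z * (b * c' - c * b') - x * (a * b' - b * a') ≡ b * (a' * x + b' * y + c' * z) + - b' * (a * x + b * y + c * z)
      l₂ = solve-∀
      l₃ : ∀ a b c a' b' c' x y z → x * (c * a' - a * c') - y * (b * c' - c * b') ≡ c * (a' * x + b' * y + c' * z) + - c' * (a * x + b * y + c * z)
      l₃ = solve-∀

  orthogonal-unique : ∀ u w {v v'} → ¬ Zⱽ (u ×ᵥ w) → Point v → Point v' → Z (u ∙ v) → Z (w ∙ v) → Z (u ∙ v') → Z (w ∙ v') → v ≡ v'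
  orthogonal-unique u w {v} {v'} n pv pv' a b c d = Point-∼ pv pv' (∼-trans (orthogonal u w v n (Point-nonzero pv) a b) (∼-sym (orthogonal u w v' n (Point-nonzero pv') c d)))

-- Number of flags on which two matrices agree

module FixedCounts (q : ℕ) .{{_ : NonZero q}} (pr : Prime q) where
  open Modular q pr
  open Fixed q pr

  private
    1≤q : 1 ℕ.≤ q
    1≤q = ℕP.<⇒≤ 1<q

    chart₁-count : ∀ b → ¬ Zⱽ b → ∑ residues (λ x → ∑ residues λ y → ⟦ Z? (b ∙ v3 1ℤ x y) ⟧) ℕ.≤ q
    chart₁-count (v3 b₁ b₂ b₃) nb = ℕP.≤-trans (choose (Z? b₃) (Z? b₂)) (ℕP.≤-reflexive (trans (ℕP.*-identityʳ (length residues)) length-residues))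
      where
        dy : ∀ b₁ b₂ b₃ x y y' → b₃ * (y - y') ≡ 1ℤ * (b₁ * 1ℤ + b₂ * x + b₃ * y) + - 1ℤ * (b₁ * 1ℤ + b₂ * x + b₃ * y')
        dy = solve-∀
        dx : ∀ b₁ b₂ b₃ x x' y → b₂ * (x - x') ≡ 1ℤ * (b₁ * 1ℤ + b₂ * x + b₃ * y) + - 1ℤ * (b₁ * 1ℤ + b₂ * x' + b₃ * y)
        dx = solve-∀
        d₁ : ∀ b₁ b₂ b₃ x y → b₁ ≡ 1ℤ * (b₁ * 1ℤ + b₂ * x + b₃ * y) + - x * b₂ + - y * b₃
        d₁ = solve-∀
        choose : Dec (Z b₃) → Dec (Z b₂) → ∑ residues (λ x → ∑ residues λ y → ⟦ Z? (v3 b₁ b₂ b₃ ∙ v3 1ℤ x y) ⟧) ℕ.≤ length residues ℕ.* 1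
        choose (no n₃) _ = ∑-bound residues 1 λ x _ → count≤1 (λ y → Z? (v3 b₁ b₂ b₃ ∙ v3 1ℤ x y)) residues residues-unique
          λ y y' my my' p r → residue-≡ my my' (Z-cancel b₃ (y - y') n₃ (Z₂ 1ℤ (- 1ℤ) p r (dy b₁ b₂ b₃ x y y')))
        choose (yes _) (no n₂) = ℕP.≤-trans (ℕP.≤-reflexive (∑-swap residues residues (λ x y → ⟦ Z? (v3 b₁ b₂ b₃ ∙ v3 1ℤ x y) ⟧))) (∑-bound residues 1 λ y _ → count≤1 (λ x → Z? (v3 b₁ b₂ b₃ ∙ v3 1ℤ x y)) residues residues-unique
          λ x x' mx mx' p r → residue-≡ mx mx' (Z-cancel b₂ (x - x') n₂ (Z₂ 1ℤ (- 1ℤ) p r (dx b₁ b₂ b₃ x x' y))))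
        choose (yes z₃) (yes z₂) = ℕP.≤-trans (ℕP.≤-reflexive (trans (∑-cong residues λ x _ → trans (∑-cong residues λ y _ → ⟦⟧-no (Z? (v3 b₁ b₂ b₃ ∙ v3 1ℤ x y)) λ p → nb (zⱽ (Z₃ 1ℤ (- x) (- y) p z₂ z₃ (d₁ b₁ b₂ b₃ x y)) z₂ z₃)) (∑-zero residues)) (∑-zero residues))) z≤n

    points-sum : ∀ (F : V3 → ℕ) → ∑ points F ≡ ∑ residues (λ x → ∑ residues λ y → F (v3 1ℤ x y)) ℕ.+ (∑ residues (λ x → F (v3 0ℤ 1ℤ x)) ℕ.+ (F (v3 0ℤ 0ℤ 1ℤ) ℕ.+ 0))
    points-sum F = trans (∑-++ chart₁ (chart₂ ++ (v3 0ℤ 0ℤ 1ℤ ∷ [])) F) (cong₂ ℕ._+_ (trans (∑-map (λ p → v3 1ℤ (proj₁ p) (proj₂ p)) (cartesianProduct residues residues) F) (∑-× residues residues (λ p → F (v3 1ℤ (proj₁ p) (proj₂ p)))))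
      (trans (∑-++ chart₂ (v3 0ℤ 0ℤ 1ℤ ∷ []) F) (cong (ℕ._+ (F (v3 0ℤ 0ℤ 1ℤ) ℕ.+ 0)) (∑-map (v3 0ℤ 1ℤ) residues F))))

    3q : q ℕ.+ (q ℕ.+ (q ℕ.+ 0)) ≡ 3 ℕ.* q
    3q = refl

  -- Each of the three charts of the projective plane contributes at most `q` points.
  line-count : ∀ b → ¬ Zⱽ b → ∑ points (λ v → ⟦ Z? (b ∙ v) ⟧) ℕ.≤ 3 ℕ.* q
  line-count b nb = ℕP.≤-trans (ℕP.≤-reflexive (points-sum (λ v → ⟦ Z? (b ∙ v) ⟧)))
    (ℕP.+-mono-≤ (chart₁-count b nb) (ℕP.+-mono-≤ (ℕP.≤-trans (∑-bound residues 1 (λ x _ → ⟦⟧≤1 (Z? (b ∙ v3 0ℤ 1ℤ x)))) (ℕP.≤-reflexive (trans (ℕP.*-identityʳ (length residues)) length-residues))) (ℕP.+-mono-≤ (ℕP.≤-trans (⟦⟧≤1 (Z? (b ∙ v3 0ℤ 0ℤ 1ℤ))) 1≤q) z≤n)))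

  private
    points-count : ∑ points (λ _ → 1) ℕ.≤ 3 ℕ.* (q ℕ.* q)
    points-count = ℕP.≤-trans (ℕP.≤-reflexive (points-sum (λ _ → 1))) (ℕP.+-mono-≤ (ℕP.≤-trans (∑-bound residues q λ x _ → ℕP.≤-reflexive ones) (ℕP.≤-reflexive (cong (ℕ._* q) length-residues)))
        (ℕP.+-mono-≤ (ℕP.≤-trans (ℕP.≤-reflexive ones) q≤qq) (ℕP.+-mono-≤ (ℕP.≤-trans 1≤q q≤qq) z≤n)))
      where
        ones : ∑ residues (λ _ → 1) ≡ q
        ones = trans (∑-const residues 1) (trans (ℕP.*-identityʳ (length residues)) length-residues)
        q≤qq : q ℕ.≤ q ℕ.* q
        q≤qq = ℕP.m≤m*n q q

    flags-sum : ∀ (F : FlagRep → ℕ) → ∑ flags F ≡ ∑ points λ v → ∑ points λ l → ⟦ incident? (v , l) ⟧ ℕ.* F (v , l)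
    flags-sum F = trans (∑-filter incident? (cartesianProduct points points) F) (∑-× points points (λ x → ⟦ incident? x ⟧ ℕ.* F x))

  flags-count : length flags ℕ.≤ 9 ℕ.* (q ℕ.* q ℕ.* q)
  flags-count = begin
    length flags ≡⟨ sym (trans (∑-const flags 1) (ℕP.*-identityʳ (length flags))) ⟩
    ∑ flags (λ _ → 1) ≡⟨ flags-sum (λ _ → 1) ⟩
    (∑ points λ v → ∑ points λ l → ⟦ incident? (v , l) ⟧ ℕ.* 1) ≤⟨ ∑-mono points (λ v mv → ℕP.≤-trans (∑-mono points (λ l _ → ℕP.≤-reflexive (ℕP.*-identityʳ ⟦ incident? (v , l) ⟧))) (line-count v (Point-nonzero (points-∈ mv)))) ⟩
    ∑ points (λ _ → 3 ℕ.* q) ≡⟨ trans (∑-const points (3 ℕ.* q)) (cong (ℕ._* (3 ℕ.* q)) (sym (trans (∑-const points 1) (ℕP.*-identityʳ (length points))))) ⟩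
    ∑ points (λ _ → 1) ℕ.* (3 ℕ.* q) ≤⟨ ℕP.*-monoˡ-≤ (3 ℕ.* q) points-count ⟩
    3 ℕ.* (q ℕ.* q) ℕ.* (3 ℕ.* q) ≡⟨ lem q ⟩
    9 ℕ.* (q ℕ.* q ℕ.* q) ∎
    where
      open ℕP.≤-Reasoning
      lem : ∀ q → 3 ℕ.* (q ℕ.* q) ℕ.* (3 ℕ.* q) ≡ 9 ℕ.* (q ℕ.* q ℕ.* q)
      lem = solveℕ-∀

  -- the flags (v , l) with v on the line b^⊥ and l on the line a^⊥
  pencil-count : ∀ b a → ¬ Zⱽ b → ¬ Zⱽ a → (∑ points λ v → ∑ points λ l → ⟦ Z? (b ∙ v) ⟧ ℕ.* ⟦ Z? (v ∙ l) ×-dec Z? (a ∙ l) ⟧) ℕ.≤ 6 ℕ.* q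
  pencil-count b a nb na = begin
    (∑ points λ v → ∑ points λ l → ⟦ Z? (b ∙ v) ⟧ ℕ.* ⟦ Z? (v ∙ l) ×-dec Z? (a ∙ l) ⟧) ≡⟨ ∑-cong points (λ v _ → ∑-*ˡ points ⟦ Z? (b ∙ v) ⟧ (λ l → ⟦ Z? (v ∙ l) ×-dec Z? (a ∙ l) ⟧)) ⟩
    (∑ points λ v → ⟦ Z? (b ∙ v) ⟧ ℕ.* ∑ points (λ l → ⟦ Z? (v ∙ l) ×-dec Z? (a ∙ l) ⟧)) ≤⟨ ∑-mono points (λ v mv → each v (Z? (b ∙ v)) (Zⱽ? (v ×ᵥ a))) ⟩
    (∑ points λ v → ⟦ Z? (b ∙ v) ⟧ ℕ.+ ⟦ Zⱽ? (v ×ᵥ a) ⟧ ℕ.* (3 ℕ.* q)) ≡⟨ ∑-+ points (λ v → ⟦ Z? (b ∙ v) ⟧) (λ v → ⟦ Zⱽ? (v ×ᵥ a) ⟧ ℕ.* (3 ℕ.* q)) ⟩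
    ∑ points (λ v → ⟦ Z? (b ∙ v) ⟧) ℕ.+ ∑ points (λ v → ⟦ Zⱽ? (v ×ᵥ a) ⟧ ℕ.* (3 ℕ.* q)) ≤⟨ ℕP.+-mono-≤ (line-count b nb) (ℕP.≤-trans (ℕP.≤-reflexive (∑-*ʳ points (3 ℕ.* q) (λ v → ⟦ Zⱽ? (v ×ᵥ a) ⟧))) (ℕP.*-monoˡ-≤ (3 ℕ.* q) one)) ⟩
    3 ℕ.* q ℕ.+ 1 ℕ.* (3 ℕ.* q) ≡⟨ lem q ⟩
    6 ℕ.* q ∎
    where
      open ℕP.≤-Reasoning
      lem : ∀ q → 3 ℕ.* q ℕ.+ 1 ℕ.* (3 ℕ.* q) ≡ 6 ℕ.* q
      lem = solveℕ-∀
      one : ∑ points (λ v → ⟦ Zⱽ? (v ×ᵥ a) ⟧) ℕ.≤ 1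
      one = count≤1 (λ v → Zⱽ? (v ×ᵥ a)) points points-unique λ v w mv mw p r →
        Point-∼ (points-∈ mv) (points-∈ mw) (∼-trans (parallel v a (Point-nonzero (points-∈ mv)) na p) (∼-sym (parallel w a (Point-nonzero (points-∈ mw)) na r)))
      -- If `v` and `a` are independent, then `l` is determined as their common normal. The one
      -- remaining point, proportional to `a`, admits a whole line of normals.
      each : ∀ v → (d : Dec (Z (b ∙ v))) → (e : Dec (Zⱽ (v ×ᵥ a))) → ⟦ d ⟧ ℕ.* ∑ points (λ l → ⟦ Z? (v ∙ l) ×-dec Z? (a ∙ l) ⟧) ℕ.≤ ⟦ d ⟧ ℕ.+ ⟦ e ⟧ ℕ.* (3 ℕ.* q)
      each v (no _) e = z≤n
      each v (yes _) (yes _) = ℕP.≤-trans (ℕP.≤-reflexive (ℕP.*-identityˡ _)) (ℕP.≤-trans (ℕP.≤-trans (∑-mono points λ l _ → ⟦⟧-mono (Z? (v ∙ l) ×-dec Z? (a ∙ l)) (Z? (a ∙ l)) proj₂) (line-count a na))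
        (ℕP.≤-trans (ℕP.≤-reflexive (sym (ℕP.*-identityˡ (3 ℕ.* q)))) (ℕP.m≤n+m (1 ℕ.* (3 ℕ.* q)) 1)))
      each v (yes _) (no n) = ℕP.≤-trans (ℕP.≤-reflexive (ℕP.*-identityˡ _)) (count≤1 (λ l → Z? (v ∙ l) ×-dec Z? (a ∙ l)) points points-unique λ l m ml mm p r →
        orthogonal-unique v a n (points-∈ ml) (points-∈ mm) (proj₁ p) (proj₂ p) (proj₁ r) (proj₂ r))

  record Zᴹ (m : M3) : Set where
    constructor zᴹ
    field z₁ : Zⱽ (row₁ m)
          z₂ : Zⱽ (row₂ m)
          z₃ : Zⱽ (row₃ m)
  open Zᴹ

  nonzero-row : ∀ m → ¬ Zᴹ m → ∃[ b ] (¬ Zⱽ b × (∀ v → Zⱽ (m ⊙ v) → Z (b ∙ v)))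
  nonzero-row m n = choose (Zⱽ? (row₁ m)) (Zⱽ? (row₂ m))
    where
      choose : Dec (Zⱽ (row₁ m)) → Dec (Zⱽ (row₂ m)) → ∃[ b ] (¬ Zⱽ b × (∀ v → Zⱽ (m ⊙ v) → Z (b ∙ v)))
      choose (no n₁) _ = row₁ m , n₁ , λ v → zx
      choose (yes _) (no n₂) = row₂ m , n₂ , λ v → zy
      choose (yes p₁) (yes p₂) = row₃ m , (λ p₃ → n (zᴹ p₁ p₂ p₃)) , λ v → zz

  -- Minors are quadratic in the entries, which is why the ratio is squared.
  cof-congruent : ∀ g h σ → Zᴹ (pencil g h σ) → Zᴹ (pencil (cof g) (cof h) (σ * σ))
  cof-congruent (mat a b c d e f g h i) (mat a' b' c' d' e' f' g' h' i') σ (zᴹ (zⱽ pa pb pc) (zⱽ pd pe pf) (zⱽ pg ph pi)) =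
    zᴹ (zⱽ (m e i f h e' i' f' h' pe pi pf ph) (m f g d i f' g' d' i' pf pg pd pi) (m d h e g d' h' e' g' pd ph pe pg))
       (zⱽ (m h c i b h' c' i' b' ph pc pi pb) (m i a g c i' a' g' c' pi pa pg pc) (m g b h a g' b' h' a' pg pb ph pa))
       (zⱽ (m b f c e b' f' c' e' pb pf pc pe) (m c d a f c' d' a' f' pc pd pa pf) (m a e b d a' e' b' d' pa pe pb pd))
    where
      m : ∀ x y z w x' y' z' w' → Z (x - σ * x') → Z (y - σ * y') → Z (z - σ * z') → Z (w - σ * w') → Z (x * y - z * w - σ * σ * (x' * y' - z' * w'))
      m x y z w x' y' z' w' px py pz pw = Z₂ 1ℤ (- 1ℤ) (Z₂ y (σ * x') px py refl) (Z₂ w (σ * z') pz pw refl) (lem x y z w x' y' z' w' σ)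
        where lem : ∀ x y z w x' y' z' w' σ → x * y - z * w - σ * σ * (x' * y' - z' * w') ≡ 1ℤ * (y * (x - σ * x') + σ * x' * (y - σ * y')) + - 1ℤ * (w * (z - σ * z') + σ * z' * (w - σ * w'))
              lem = solve-∀

  -- `NonScalar` says that `g` and `h` are not proportional modulo `q`. `Good` says that the last
  -- two rows of `g − μ h` are independent for every unit `μ`, so that its rank is at least two; it
  -- involves only the two rows listed in a tuple.
  NonScalar Good : M3 → M3 → Set
  NonScalar g h = ∀ μ → ¬ Z μ → ¬ Zᴹ (pencil g h μ)
  Good g h = ∀ μ → ¬ Z μ → ¬ Zⱽ (row₂ (pencil g h μ) ×ᵥ row₃ (pencil g h μ))

  NonScalar-cof : ∀ g h → SL g → SL h → NonScalar g h → NonScalar (cof g) (cof h)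
  NonScalar-cof g h δ ε n σ nσ p = n (σ * σ) (¬Z-* nσ nσ) (subst₂ (λ g h → Zᴹ (pencil g h (σ * σ))) (cof-involutive g δ) (cof-involutive h ε) (cof-congruent (cof g) (cof h) σ p))

  private
    root-unit : ∀ g h {μ} → μ ∈ roots g h → ¬ Z μ
    root-unit g h m = proj₁ (proj₂ (∈-filter⁻ (root? g h) {xs = residues} m))

  -- A nonzero row of the pencil confines `v` to a line, and a nonzero row of the pencil of
  -- cofactors confines `l` likewise, so `pencil-count` applies for each pair of ratios.
  coincidences-nonScalar : ∀ g h → SL g → SL h → NonScalar g h → coincidences g h ℕ.≤ 9 ℕ.* (6 ℕ.* q)
  coincidences-nonScalar g h δ ε n = coincidences≤ g h (6 ℕ.* q) δ ε λ μ σ mμ mσ →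
      bound μ σ (nonzero-row (pencil g h μ) (n μ (root-unit g h mμ))) (nonzero-row (pencil (cof g) (cof h) σ) (NonScalar-cof g h δ ε n σ (root-unit (cof g) (cof h) mσ)))
    where
      bound : ∀ μ σ → ∃[ b ] (¬ Zⱽ b × (∀ v → Zⱽ (pencil g h μ ⊙ v) → Z (b ∙ v))) → ∃[ a ] (¬ Zⱽ a × (∀ v → Zⱽ (pencil (cof g) (cof h) σ ⊙ v) → Z (a ∙ v))) →
        ∑ flags (λ x → ⟦ kernel-flag? g h μ σ x ⟧) ℕ.≤ 6 ℕ.* q
      bound μ σ (b , nb , hb) (a , na , ha) = ℕP.≤-trans (ℕP.≤-reflexive (flags-sum (λ x → ⟦ kernel-flag? g h μ σ x ⟧))) (ℕP.≤-trans (∑-mono points λ v _ → ∑-mono points λ l _ → each v l (Z? (v ∙ l)) (kernel-flag? g h μ σ (v , l))) (pencil-count b a nb na))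
        where
          each : ∀ v l → (d : Dec (Z (v ∙ l))) (e : Dec (Kernel g h v μ × Kernel (cof g) (cof h) l σ)) → ⟦ d ⟧ ℕ.* ⟦ e ⟧ ℕ.≤ ⟦ Z? (b ∙ v) ⟧ ℕ.* ⟦ Z? (v ∙ l) ×-dec Z? (a ∙ l) ⟧
          each v l (no _) _ = z≤n
          each v l (yes _) (no _) = z≤n
          each v l (yes p) (yes (kv , kl)) = ℕP.*-mono-≤ (⟦⟧-1≤ (Z? (b ∙ v)) (hb v kv)) (⟦⟧-1≤ (Z? (v ∙ l) ×-dec Z? (a ∙ l)) (p , ha l kl))

  coincidences-trivial : ∀ g h → coincidences g h ℕ.≤ 9 ℕ.* (q ℕ.* q ℕ.* q)
  coincidences-trivial g h = ℕP.≤-trans (∑-bound flags 1 λ x _ → ⟦⟧≤1 (act g x ≟ᶠ act h x)) (ℕP.≤-trans (ℕP.≤-reflexive (ℕP.*-identityʳ (length flags))) flags-count)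

  scalar-zero : ∀ k w → ¬ Zⱽ w → Zⱽ (k ⋆ w) → Z k
  scalar-zero k w nw p = decide (Z? k)
    where decide : Dec (Z k) → Z k
          decide (yes z) = z
          decide (no nk) = contradiction (Z-⋆ k w nk p) nw

  independent : ∀ x y u w → ¬ Zⱽ (u ×ᵥ w) → Zⱽ (x ⋆ u ⊞ y ⋆ w) → Z x × Z y
  independent x y u@(v3 a b c) w@(v3 a' b' c') n (zⱽ p r s) =
      scalar-zero x (u ×ᵥ w) n (zⱽ (Z₂ c' (- b') r s (lx b c b' c' x y)) (Z₂ a' (- c') s p (lx c a c' a' x y)) (Z₂ b' (- a') p r (lx a b a' b' x y))) ,
      scalar-zero y (u ×ᵥ w) n (zⱽ (Z₂ b (- c) s r (ly b c b' c' x y)) (Z₂ c (- a) p s (ly c a c' a' x y)) (Z₂ a (- b) r p (ly a b a' b' x y)))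
    where
      lx : ∀ b c b' c' x y → x * (b * c' - c * b') ≡ c' * (x * b + y * b') + - b' * (x * c + y * c')
      lx = solve-∀
      ly : ∀ b c b' c' x y → y * (b * c' - c * b') ≡ b * (x * c + y * c') + - c * (x * b + y * b')
      ly = solve-∀

  private
    -- In a relation between the rows of `r` the coefficient of the first row is a unit, because the
    -- other two rows are independent. Eliminating it between two relations shows them to be
    -- proportional.
    left-kernel : ∀ r m m' → ¬ Zⱽ (row₂ r ×ᵥ row₃ r) → ¬ Zⱽ m → ¬ Zⱽ m' → Zⱽ (transpose r ⊙ m) → Zⱽ (transpose r ⊙ m') → m ∼ m'
    left-kernel (mat a b c d e f g h i) m@(v3 x y z) m'@(v3 x' y' z') n nm nm' (zⱽ p₁ p₂ p₃) (zⱽ r₁ r₂ r₃) =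
        parallel m m' nm nm' (zⱽ (Z-cancel x (y * z' - z * y') x-unit (Z₂ (- y) (- z) (proj₂ AB) (proj₁ AB) (lem x y z x' y' z'))) (proj₂ AB) (proj₁ AB))
      where
        elim : ∀ a d g x y z x' y' z' → (x * y' - y * x') * d + - (z * x' - x * z') * g ≡ - x' * (a * x + d * y + g * z) + x * (a * x' + d * y' + g * z')
        elim = solve-∀
        AB' : Z (x * y' - y * x') × Z (- (z * x' - x * z'))
        AB' = independent (x * y' - y * x') (- (z * x' - x * z')) (v3 d e f) (v3 g h i) n
          (zⱽ (Z₂ (- x') x p₁ r₁ (elim a d g x y z x' y' z')) (Z₂ (- x') x p₂ r₂ (elim b e h x y z x' y' z')) (Z₂ (- x') x p₃ r₃ (elim c f i x y z x' y' z')))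
        double : ∀ t → t ≡ - 1ℤ * - t
        double = solve-∀
        AB : Z (x * y' - y * x') × Z (z * x' - x * z')
        AB = proj₁ AB' , Z₁ (- 1ℤ) (proj₂ AB') (double (z * x' - x * z'))
        drop : ∀ a d g x y z → y * d + z * g ≡ 1ℤ * (a * x + d * y + g * z) + - a * x
        drop = solve-∀
        x-unit : ¬ Z x
        x-unit zx' = nm (zⱽ zx' (proj₁ yz) (proj₂ yz))
          where yz : Z y × Z z
                yz = independent y z (v3 d e f) (v3 g h i) n (zⱽ (Z₂ 1ℤ (- a) p₁ zx' (drop a d g x y z)) (Z₂ 1ℤ (- b) p₂ zx' (drop b e h x y z)) (Z₂ 1ℤ (- c) p₃ zx' (drop c f i x y z)))
        lem : ∀ x y z x' y' z' → x * (y * z' - z * y') ≡ - y * (z * x' - x * z') + - z * (x * y' - y * x')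
        lem = solve-∀

    transpose-pencil : ∀ g h μ → transpose (pencil g h μ) ≡ pencil (transpose g) (transpose h) μ
    transpose-pencil g h μ = refl

    transpose-cof : ∀ g l → SL g → transpose g ⊙ (cof g ⊙ l) ≡ l
    transpose-cof g l δ = trans (cong (λ k → transpose k ⊙ (cof g ⊙ l)) (sym (cof-involutive g δ))) (⊙-inverse (cof g) l (SL-cof g δ))

    -- Put `m = cof h l`, so that `l = hᵀ m`. Multiplying `cof g l ≡ σ m` by `gᵀ` gives
    -- `l ≡ σ gᵀ m`, hence `(g − σ⁻¹ h)ᵀ m ≡ 0`: the condition on normals becomes a left kernel of
    -- the original pencil.
    co-kernel : ∀ g h l σ → SL g → SL h → ¬ Z σ → Kernel (cof g) (cof h) l σ → Zⱽ (transpose (pencil g h (inv σ)) ⊙ (cof h ⊙ l))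
    co-kernel g h l σ δ ε nσ k = subst Zⱽ (sym (pencil-⊙ (transpose g) (transpose h) (inv σ) m)) (subst (λ w → Zⱽ (transpose g ⊙ m ⊟ inv σ ⋆ w)) (sym (transpose-cof h l ε)) (finish (transpose g ⊙ m) l step))
      where
        m : V3
        m = cof h ⊙ l
        w = cof g ⊙ l
        linear-⊟ : ∀ t w m → transpose t ⊙ (w ⊟ σ ⋆ m) ≡ (transpose t ⊙ w) ⊟ σ ⋆ (transpose t ⊙ m)
        linear-⊟ (mat a b c d e f g h i) (v3 x y z) (v3 x' y' z') = v3-≡ (lem a d g x y z x' y' z' σ) (lem b e h x y z x' y' z' σ) (lem c f i x y z x' y' z' σ)
          where lem : ∀ a d g x y z x' y' z' σ → a * (x - σ * x') + d * (y - σ * y') + g * (z - σ * z') ≡ a * x + d * y + g * z - σ * (a * x' + d * y' + g * z')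
                lem = solve-∀
        step : Zⱽ (l ⊟ σ ⋆ (transpose g ⊙ m))
        step = subst (λ u → Zⱽ (u ⊟ σ ⋆ (transpose g ⊙ m))) (transpose-cof g l δ) (subst Zⱽ (linear-⊟ g w m) (Zⱽ-⊙ (transpose g) {w ⊟ σ ⋆ m} (subst Zⱽ (pencil-⊙ (cof g) (cof h) σ l) k)))
        finish : ∀ u l → Zⱽ (l ⊟ σ ⋆ u) → Zⱽ (u ⊟ inv σ ⋆ l)
        finish (v3 x y z) (v3 x' y' z') (zⱽ p r s) = zⱽ (Z₂ (- inv σ) x p (inv-≡ σ nσ) (lem x x' σ (inv σ))) (Z₂ (- inv σ) y r (inv-≡ σ nσ) (lem y y' σ (inv σ))) (Z₂ (- inv σ) z s (inv-≡ σ nσ) (lem z z' σ (inv σ)))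
          where lem : ∀ x l σ t → x - t * l ≡ - t * (l - σ * x) + x * (1ℤ - σ * t)
                lem = solve-∀

    co-kernel-unique : ∀ g h l l' σ → SL g → SL h → Good g h → ¬ Z σ → Point l → Point l' → Kernel (cof g) (cof h) l σ → Kernel (cof g) (cof h) l' σ → l ≡ l'
    co-kernel-unique g h l l' σ δ ε good nσ pl pl' k k' = Point-∼ pl pl' (subst₂ _∼_ (transpose-cof h l ε) (transpose-cof h l' ε) (⊙-∼ (transpose h) {cof h ⊙ l} {cof h ⊙ l'}
        (left-kernel (pencil g h (inv σ)) (cof h ⊙ l) (cof h ⊙ l') (good (inv σ) (¬Z-inverse {σ} (inv-≡ σ nσ))) (¬Zⱽ-⊙ (cof h) {l} (SL-cof h ε) (Point-nonzero pl)) (¬Zⱽ-⊙ (cof h) {l'} (SL-cof h ε) (Point-nonzero pl'))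
          (co-kernel g h l σ δ ε nσ k) (co-kernel g h l' σ δ ε nσ k'))))

  -- Rank at least two leaves a single point in the right kernel and a single normal through the
  -- left kernel, hence one flag for each of the nine pairs of ratios.
  coincidences-good : ∀ g h → SL g → SL h → Good g h → coincidences g h ℕ.≤ 9
  coincidences-good g h δ ε good = coincidences≤ g h 1 δ ε λ μ σ mμ mσ → count≤1 (kernel-flag? g h μ σ) flags flags-unique
    λ { (v , l) (v' , l') m m' (kv , kl) (kv' , kl') → cong₂ _,_
       (orthogonal-unique (row₂ (pencil g h μ)) (row₃ (pencil g h μ)) (good μ (root-unit g h mμ)) (point-v (flags-∈ m)) (point-v (flags-∈ m')) (zy kv) (zz kv) (zy kv') (zz kv'))
       (co-kernel-unique g h l l' σ δ ε good (root-unit (cof g) (cof h) mσ) (point-l (flags-∈ m)) (point-l (flags-∈ m')) kl kl') }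

-- Pairs of proportional vectors of small integers

range : ℕ → List ℕ
range n = map suc (upTo n)

∈-range : ∀ {n k} → 1 ℕ.≤ k → k ℕ.≤ n → k ∈ range n
∈-range {k = suc k} _ le = ∈-map⁺ suc (∈-upTo⁺ le)

range-∈ : ∀ {n k} → k ∈ range n → 1 ℕ.≤ k × k ℕ.≤ n
range-∈ m with ∈-map⁻ suc m
... | k , mk , refl = s≤s z≤n , ∈-upTo⁻ mk

range-unique : ∀ n → Unique (range n)
range-unique n = Unique.map⁺ ℕP.suc-injective (Unique.upTo⁺ n)

length-range : ∀ n → length (range n) ≡ n
length-range n = trans (length-map suc (upTo n)) (length-upTo n)

∑-range-suc : ∀ n (F : ℕ → ℕ) → ∑ (range (suc n)) F ≡ ∑ (range n) F ℕ.+ F (suc n)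
∑-range-suc n F = begin
  ∑ (map suc (upTo (suc n))) F ≡⟨ ∑-map suc (upTo (suc n)) F ⟩
  ∑ (upTo (suc n)) (λ k → F (suc k)) ≡⟨ cong (λ l → ∑ l (λ k → F (suc k))) (sym (upTo-∷ʳ n)) ⟩
  ∑ (upTo n ++ (n ∷ [])) (λ k → F (suc k)) ≡⟨ ∑-++ (upTo n) (n ∷ []) (λ k → F (suc k)) ⟩
  ∑ (upTo n) (λ k → F (suc k)) ℕ.+ (F (suc n) ℕ.+ 0) ≡⟨ cong₂ ℕ._+_ (sym (∑-map suc (upTo n) F)) (ℕP.+-identityʳ (F (suc n))) ⟩
  ∑ (range n) F ℕ.+ F (suc n) ∎
  where open ≡-Reasoning

∑-range-+ : ∀ m k (F : ℕ → ℕ) → ∑ (range (m ℕ.+ k)) F ≡ ∑ (range m) F ℕ.+ ∑ (range k) (λ i → F (m ℕ.+ i))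
∑-range-+ m zero F = trans (cong (λ n → ∑ (range n) F) (ℕP.+-identityʳ m)) (sym (ℕP.+-identityʳ _))
∑-range-+ m (suc k) F = begin
  ∑ (range (m ℕ.+ suc k)) F ≡⟨ cong (λ n → ∑ (range n) F) (ℕP.+-suc m k) ⟩
  ∑ (range (suc (m ℕ.+ k))) F ≡⟨ ∑-range-suc (m ℕ.+ k) F ⟩
  ∑ (range (m ℕ.+ k)) F ℕ.+ F (suc (m ℕ.+ k)) ≡⟨ cong₂ ℕ._+_ (∑-range-+ m k F) (cong F (sym (ℕP.+-suc m k))) ⟩
  ∑ (range m) F ℕ.+ ∑ (range k) (λ i → F (m ℕ.+ i)) ℕ.+ F (m ℕ.+ suc k) ≡⟨ ℕP.+-assoc (∑ (range m) F) _ _ ⟩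
  ∑ (range m) F ℕ.+ (∑ (range k) (λ i → F (m ℕ.+ i)) ℕ.+ F (m ℕ.+ suc k)) ≡⟨ cong (∑ (range m) F ℕ.+_) (sym (∑-range-suc k (λ i → F (m ℕ.+ i)))) ⟩
  ∑ (range m) F ℕ.+ ∑ (range (suc k)) (λ i → F (m ℕ.+ i)) ∎
  where open ≡-Reasoning

∑-range-mono : ∀ {m n} (F : ℕ → ℕ) → m ℕ.≤ n → ∑ (range m) F ℕ.≤ ∑ (range n) F
∑-range-mono {m} F le with ℕP.m≤n⇒∃[o]m+o≡n le
... | o , refl = ℕP.≤-trans (ℕP.m≤m+n _ _) (ℕP.≤-reflexive (sym (∑-range-+ m o F)))

infixl 7 _÷_
-- Division made total by `T ÷ 0 = 0`, so that it can be summed over a variable divisor without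
-- instance arguments.
_÷_ : ℕ → ℕ → ℕ
T ÷ zero = 0
T ÷ suc d = T / suc d

*-÷-≤ : ∀ T d → d ℕ.* (T ÷ d) ℕ.≤ T
*-÷-≤ T zero = z≤n
*-÷-≤ T (suc d) = ℕP.≤-trans (ℕP.≤-reflexive (ℕP.*-comm (suc d) (T / suc d))) (m/n*n≤m T (suc d))

÷-antitone : ∀ T {d e} → 1 ℕ.≤ d → d ℕ.≤ e → T ÷ e ℕ.≤ T ÷ d
÷-antitone T {suc d} {suc e} _ le = /-monoʳ-≤ T le

÷-≤ : ∀ T d → T ÷ d ℕ.≤ T
÷-≤ T zero = z≤n
÷-≤ T (suc d) = m/n≤m T (suc d)

*-≤⇒≤-÷ : ∀ T d u → 1 ℕ.≤ d → d ℕ.* u ℕ.≤ T → u ℕ.≤ T ÷ d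
*-≤⇒≤-÷ T (suc d) u _ le = ℕP.≤-trans (ℕP.≤-reflexive (sym (trans (cong (_/ suc d) (ℕP.*-comm (suc d) u)) (m*n/n≡m u (suc d))))) (/-monoˡ-≤ (suc d) le)

multiples-count : ∀ T d → 1 ℕ.≤ d → ∑ (range T) (λ u → ⟦ d ℕ.* u ℕ.≤? T ⟧) ℕ.≤ T ÷ d
multiples-count T d 1≤d = ℕP.≤-trans (count-injection (λ u → d ℕ.* u ℕ.≤? T) (λ _ → yes tt) (range T) {range (T ÷ d)} (λ u → u) (range-unique T)
    (λ u m le → ∈-range (proj₁ (range-∈ m)) (*-≤⇒≤-÷ T d u 1≤d le) , tt) (λ _ _ _ _ _ _ e → e))
  (ℕP.≤-reflexive (trans (∑-const (range (T ÷ d)) 1) (trans (ℕP.*-identityʳ _) (length-range (T ÷ d)))))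

harmonic : ℕ → ℕ
harmonic T = ∑ (range T) (T ÷_)

-- The divisors from `2 ^ j` up to the next power of two number `2 ^ j`, and each has quotient at
-- most `T ÷ 2 ^ j`. Every one of the `L` dyadic blocks thus contributes at most `T`.
harmonic≤ : ∀ T L → T ℕ.< 2 ℕ.^ L → harmonic T ℕ.≤ L ℕ.* T
harmonic≤ T L lt = ℕP.≤-trans (∑-range-mono (T ÷_) (ℕP.≤-pred (ℕP.≤-trans lt (ℕP.≤-reflexive (sym (suc-mersenne L)))))) (dyadic L)
  where
    mersenne : ℕ → ℕ
    mersenne zero = 0
    mersenne (suc j) = mersenne j ℕ.+ suc (mersenne j)
    suc-mersenne : ∀ j → suc (mersenne j) ≡ 2 ℕ.^ j
    suc-mersenne zero = refl
    suc-mersenne (suc j) = trans (cong₂ ℕ._+_ (suc-mersenne j) (trans (suc-mersenne j) (sym (ℕP.+-identityʳ (2 ℕ.^ j))))) refl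
    dyadic : ∀ j → ∑ (range (mersenne j)) (T ÷_) ℕ.≤ j ℕ.* T
    dyadic zero = z≤n
    dyadic (suc j) = begin
      ∑ (range (m ℕ.+ suc m)) (T ÷_) ≡⟨ ∑-range-+ m (suc m) (T ÷_) ⟩
      ∑ (range m) (T ÷_) ℕ.+ ∑ (range (suc m)) (λ i → T ÷ (m ℕ.+ i)) ≤⟨ ℕP.+-mono-≤ (dyadic j) (∑-bound (range (suc m)) (T ÷ suc m) λ i mi → ÷-antitone T (s≤s z≤n) (ℕP.≤-trans (ℕP.≤-reflexive (ℕP.+-comm 1 m)) (ℕP.+-monoʳ-≤ m (proj₁ (range-∈ mi))))) ⟩
      j ℕ.* T ℕ.+ length (range (suc m)) ℕ.* (T ÷ suc m) ≤⟨ ℕP.+-monoʳ-≤ (j ℕ.* T) (ℕP.≤-trans (ℕP.≤-reflexive (cong (ℕ._* (T ÷ suc m)) (length-range (suc m)))) (*-÷-≤ T (suc m))) ⟩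
      j ℕ.* T ℕ.+ T ≡⟨ ℕP.+-comm (j ℕ.* T) T ⟩
      suc j ℕ.* T ∎
      where
        open ℕP.≤-Reasoning
        m = mersenne j

proportional? : (e e' f f' : ℕ) → Dec (e ℕ.* f' ≡ e' ℕ.* f)
proportional? e e' f f' = e ℕ.* f' ℕ.≟ e' ℕ.* f

proportional-count : ℕ → ℕ
proportional-count T = ∑ (range T) λ e → ∑ (range T) λ e' → ∑ (range T) λ f → ∑ (range T) λ f' → ⟦ proportional? e e' f f' ⟧

-- a proportional quadruple is (d u, d w, k u, k w) with d = gcd e e′, k = gcd f f′
record Split (e e' f f' : ℕ) : Set where
  field
    d k u w : ℕ
    d≡ : d ≡ gcd e e'
    k≡ : k ≡ gcd f f'
    u≡ : e ≡ u ℕ.* d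
    w≡ : e' ≡ w ℕ.* d
    u≡' : f ≡ u ℕ.* k
    w≡' : f' ≡ w ℕ.* k

divide : ∀ e e' → 1 ℕ.≤ e → Σ ℕ λ u → Σ ℕ λ w → e ≡ u ℕ.* gcd e e' × e' ≡ w ℕ.* gcd e e' × Coprime u w
divide e e' 1≤e = e / gcd e e' , e' / gcd e e' , sym (m/n*n≡m (gcd[m,n]∣m e e')) , sym (m/n*n≡m (gcd[m,n]∣n e e')) , coprime-/gcd e e'
  where instance
    nz : NonZero (gcd e e')
    nz = ℕ.≢-nonZero λ g≡0 → contradiction (gcd[m,n]≡0⇒m≡0 g≡0) λ e≡0 → ℕP.<⇒≢ 1≤e (sym e≡0)

positive-factor : ∀ {e} u d → 1 ℕ.≤ e → e ≡ u ℕ.* d → 1 ℕ.≤ u × 1 ℕ.≤ d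
positive-factor zero d 1≤e refl = contradiction 1≤e λ ()
positive-factor (suc u) zero 1≤e eq = contradiction (ℕP.≤-trans 1≤e (ℕP.≤-reflexive (trans eq (ℕP.*-zeroʳ (suc u))))) λ ()
positive-factor (suc u) (suc d) _ _ = s≤s z≤n , s≤s z≤n

-- Dividing by the two greatest common divisors gives reduced fractions of equal value, and these
-- have equal numerators and denominators.
divide-both : ∀ e e' f f' → 1 ℕ.≤ e → 1 ℕ.≤ e' → 1 ℕ.≤ f → 1 ℕ.≤ f' → e ℕ.* f' ≡ e' ℕ.* f → Split e e' f f'
divide-both e e' f f' 1≤e 1≤e' 1≤f 1≤f' eq with divide e e' 1≤e | divide f f' 1≤f
... | u , w , eu , ew , cop | u' , w' , fu , fw , cop' = record { d = gcd e e' ; k = gcd f f' ; u = u ; w = w ; d≡ = refl ; k≡ = refl ; u≡ = eu ; w≡ = ew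
    ; u≡' = trans fu (cong (ℕ._* gcd f f') (sym u≡u')) ; w≡' = trans fw (cong (ℕ._* gcd f f') (sym w≡w')) }
  where
    1≤dk : 1 ℕ.≤ gcd e e' ℕ.* gcd f f'
    1≤dk = ℕP.*-mono-≤ (proj₂ (positive-factor u (gcd e e') 1≤e eu)) (proj₂ (positive-factor u' (gcd f f') 1≤f fu))
    lem : ∀ u d w k → u ℕ.* d ℕ.* (w ℕ.* k) ≡ u ℕ.* w ℕ.* (d ℕ.* k)
    lem = solveℕ-∀
    cross : u ℕ.* w' ≡ w ℕ.* u'
    cross = ℕP.*-cancelʳ-≡ (u ℕ.* w') (w ℕ.* u') (gcd e e' ℕ.* gcd f f') {{ℕ.>-nonZero 1≤dk}} (trans (sym (lem u (gcd e e') w' (gcd f f'))) (trans (trans (cong₂ ℕ._*_ (sym eu) (sym fw)) (trans eq (cong₂ ℕ._*_ ew fu))) (lem w (gcd e e') u' (gcd f f'))))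
    u≡u' : u ≡ u'
    u≡u' = ∣-antisym (coprime-divisor cop (divides w' (trans (sym cross) (ℕP.*-comm u w')))) (coprime-divisor cop' (divides w (trans (ℕP.*-comm w' u) cross)))
    w≡w' : w ≡ w'
    w≡w' = ℕP.*-cancelʳ-≡ w w' u {{ℕ.>-nonZero (proj₁ (positive-factor u (gcd e e') 1≤e eu))}} (trans (cong (w ℕ.*_) u≡u') (trans (sym cross) (ℕP.*-comm u w')))

Quadruple : Set
Quadruple = (ℕ × ℕ) × (ℕ × ℕ)

module _ (T : ℕ) where
  quads : List Quadruple
  quads = cartesianProduct (cartesianProduct (range T) (range T)) (cartesianProduct (range T) (range T))

  quads-unique : Unique quads
  quads-unique = Unique.cartesianProduct⁺ (Unique.cartesianProduct⁺ (range-unique T) (range-unique T)) (Unique.cartesianProduct⁺ (range-unique T) (range-unique T))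

  quads-sum : ∀ (F : Quadruple → ℕ) → ∑ quads F ≡ ∑ (range T) λ a → ∑ (range T) λ b → ∑ (range T) λ c → ∑ (range T) λ d → F ((a , b) , (c , d))
  quads-sum F = trans (∑-× (cartesianProduct (range T) (range T)) (cartesianProduct (range T) (range T)) F)
    (trans (∑-× (range T) (range T) (λ p → ∑ (cartesianProduct (range T) (range T)) λ r → F (p , r)))
      (∑-cong (range T) λ a _ → ∑-cong (range T) λ b _ → ∑-× (range T) (range T) (λ r → F ((a , b) , r))))

  -- `Prop` is proportionality of the given quadruple; `Small` is what the bounds by `T` become on
  -- its code, where both gcds multiply both parts of the reduced fraction.
  Prop Small : Quadruple → Set
  Prop ((e , e') , (f , f')) = e ℕ.* f' ≡ e' ℕ.* f
  Small ((d , k) , (u , w)) = (d ℕ.⊔ k) ℕ.* u ℕ.≤ T × (d ℕ.⊔ k) ℕ.* w ℕ.≤ T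

  prop? : ∀ x → Dec (Prop x)
  prop? ((e , e') , (f , f')) = proportional? e e' f f'
  small? : ∀ x → Dec (Small x)
  small? ((d , k) , (u , w)) = ((d ℕ.⊔ k) ℕ.* u ℕ.≤? T) ×-dec ((d ℕ.⊔ k) ℕ.* w ℕ.≤? T)

  encode : Quadruple → Quadruple
  encode ((e , e') , (f , f')) = (gcd e e' , gcd f f') , (e ÷ gcd e e' , e' ÷ gcd e e')

  bounds : ∀ {x} → x ∈ quads → let ((a , b) , (c , d)) = x in ((1 ℕ.≤ a × a ℕ.≤ T) × (1 ℕ.≤ b × b ℕ.≤ T)) × ((1 ℕ.≤ c × c ℕ.≤ T) × (1 ℕ.≤ d × d ℕ.≤ T))
  bounds m with ∈-cartesianProduct⁻ (cartesianProduct (range T) (range T)) (cartesianProduct (range T) (range T)) m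
  ... | m₁ , m₂ with ∈-cartesianProduct⁻ (range T) (range T) m₁ | ∈-cartesianProduct⁻ (range T) (range T) m₂
  ...   | p , r | s , t = (range-∈ p , range-∈ r) , (range-∈ s , range-∈ t)

  ÷-exact : ∀ {e} u d → 1 ℕ.≤ d → e ≡ u ℕ.* d → e ÷ d ≡ u
  ÷-exact u (suc d) _ refl = m*n/n≡m u (suc d)

  ⊔-*-≤ : ∀ d k u → u ℕ.* d ℕ.≤ T → u ℕ.* k ℕ.≤ T → (d ℕ.⊔ k) ℕ.* u ℕ.≤ T
  ⊔-*-≤ d k u p r = ℕP.≤-trans (ℕP.≤-reflexive (trans (ℕP.*-comm (d ℕ.⊔ k) u) (ℕP.*-distribˡ-⊔ u d k))) (ℕP.⊔-lub p r)

  encode-split : ∀ e e' f f' → 1 ℕ.≤ e → (s : Split e e' f f') → encode ((e , e') , (f , f')) ≡ ((Split.d s , Split.k s) , (Split.u s , Split.w s))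
  encode-split e e' f f' 1≤e s = cong₂ _,_ (cong₂ _,_ (sym d≡) (sym k≡)) (cong₂ _,_ (÷-exact u (gcd e e') 1≤g (trans u≡ (cong (u ℕ.*_) d≡))) (÷-exact w (gcd e e') 1≤g (trans w≡ (cong (w ℕ.*_) d≡))))
    where
      open Split s
      1≤g : 1 ℕ.≤ gcd e e'
      1≤g = subst (1 ℕ.≤_) d≡ (proj₂ (positive-factor u d 1≤e u≡))

  encode-∈ : ∀ x → x ∈ quads → Prop x → encode x ∈ quads × Small (encode x)
  encode-∈ ((e , e') , (f , f')) m eq with bounds m
  ... | ((1≤e , e≤) , (1≤e' , e'≤)) , ((1≤f , f≤) , (1≤f' , f'≤)) = subst (λ x → x ∈ quads × Small x) (sym (encode-split e e' f f' 1≤e s))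
        (∈-cartesianProduct⁺ (∈-cartesianProduct⁺ (mem d (proj₂ pd) (factor-≤ u d (proj₁ pd) (subst (ℕ._≤ T) u≡ e≤))) (mem k (proj₂ pk) (factor-≤ u k (proj₁ pk) (subst (ℕ._≤ T) u≡' f≤))))
                            (∈-cartesianProduct⁺ (mem u (proj₁ pd) (factor-≤' u d (proj₂ pd) (subst (ℕ._≤ T) u≡ e≤))) (mem w (proj₁ pw) (factor-≤' w d (proj₂ pd) (subst (ℕ._≤ T) w≡ e'≤)))) ,
         (⊔-*-≤ d k u (subst (ℕ._≤ T) u≡ e≤) (subst (ℕ._≤ T) u≡' f≤) , ⊔-*-≤ d k w (subst (ℕ._≤ T) w≡ e'≤) (subst (ℕ._≤ T) w≡' f'≤)))
    where
      s = divide-both e e' f f' 1≤e 1≤e' 1≤f 1≤f' eq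
      open Split s
      pd = positive-factor u d 1≤e u≡
      pk = positive-factor u k 1≤f u≡'
      pw = positive-factor w d 1≤e' w≡
      mem : ∀ n → 1 ℕ.≤ n → n ℕ.≤ T → n ∈ range T
      mem n = ∈-range
      factor-≤ : ∀ u d → 1 ℕ.≤ u → u ℕ.* d ℕ.≤ T → d ℕ.≤ T
      factor-≤ u d p le = ℕP.≤-trans (ℕP.≤-trans (ℕP.≤-reflexive (sym (ℕP.*-identityˡ d))) (ℕP.*-monoˡ-≤ d p)) le
      factor-≤' : ∀ u d → 1 ℕ.≤ d → u ℕ.* d ℕ.≤ T → u ℕ.≤ T
      factor-≤' u d p le = ℕP.≤-trans (ℕP.≤-trans (ℕP.≤-reflexive (sym (ℕP.*-identityʳ u))) (ℕP.*-monoʳ-≤ u p)) le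

  encode-injective : ∀ x y → x ∈ quads → y ∈ quads → Prop x → Prop y → encode x ≡ encode y → x ≡ y
  encode-injective ((e , e') , (f , f')) ((E , E') , (F , F')) m M eq EQ h with bounds m | bounds M
  ... | ((1≤e , _) , (1≤e' , _)) , ((1≤f , _) , (1≤f' , _)) | ((1≤E , _) , (1≤E' , _)) , ((1≤F , _) , (1≤F' , _)) =
      same (trans (sym (encode-split e e' f f' 1≤e s)) (trans h (encode-split E E' F F' 1≤E S)))
    where
      s = divide-both e e' f f' 1≤e 1≤e' 1≤f 1≤f' eq
      S = divide-both E E' F F' 1≤E 1≤E' 1≤F 1≤F' EQ
      module s = Split s
      module S = Split S
      same : ((s.d , s.k) , (s.u , s.w)) ≡ ((S.d , S.k) , (S.u , S.w)) → ((e , e') , (f , f')) ≡ ((E , E') , (F , F'))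
      same h' = cong₂ _,_ (cong₂ _,_ (trans s.u≡ (trans (cong₂ ℕ._*_ hu hd) (sym S.u≡))) (trans s.w≡ (trans (cong₂ ℕ._*_ hw hd) (sym S.w≡))))
                          (cong₂ _,_ (trans s.u≡' (trans (cong₂ ℕ._*_ hu hk) (sym S.u≡'))) (trans s.w≡' (trans (cong₂ ℕ._*_ hw hk) (sym S.w≡'))))
        where
          hd = cong (λ x → proj₁ (proj₁ x)) h'
          hk = cong (λ x → proj₂ (proj₁ x)) h'
          hu = cong (λ x → proj₁ (proj₂ x)) h'
          hw = cong (λ x → proj₂ (proj₂ x)) h'

  Φ : ℕ → ℕ → ℕ
  Φ d k = (T ÷ (d ℕ.⊔ k)) ℕ.* (T ÷ (d ℕ.⊔ k))

  small-count : ∑ quads (λ x → ⟦ small? x ⟧) ℕ.≤ ∑ (range T) λ d → ∑ (range T) λ k → Φ d k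
  small-count = ℕP.≤-trans (ℕP.≤-reflexive (quads-sum (λ x → ⟦ small? x ⟧))) (∑-mono (range T) λ d md → ∑-mono (range T) λ k _ → inner d k (ℕP.≤-trans (proj₁ (range-∈ md)) (ℕP.m≤m⊔n d k)))
    where
      both : ∀ {P Q : Set} (p : Dec P) (r : Dec Q) → ⟦ p ×-dec r ⟧ ℕ.≤ ⟦ p ⟧ ℕ.* ⟦ r ⟧
      both (yes _) (yes _) = ℕP.≤-refl
      both (yes _) (no _) = z≤n
      both (no _) (yes _) = z≤n
      both (no _) (no _) = z≤n
      inner : ∀ d k → 1 ℕ.≤ d ℕ.⊔ k → ∑ (range T) (λ u → ∑ (range T) λ w → ⟦ small? ((d , k) , (u , w)) ⟧) ℕ.≤ Φ d k
      inner d k p = ℕP.≤-trans (∑-mono (range T) λ u _ → ∑-mono (range T) λ w _ → both ((d ℕ.⊔ k) ℕ.* u ℕ.≤? T) ((d ℕ.⊔ k) ℕ.* w ℕ.≤? T))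
        (ℕP.≤-trans (ℕP.≤-reflexive (∑-product (range T) (range T) (λ u → ⟦ (d ℕ.⊔ k) ℕ.* u ℕ.≤? T ⟧) (λ w → ⟦ (d ℕ.⊔ k) ℕ.* w ℕ.≤? T ⟧))) (ℕP.*-mono-≤ (multiples-count T (d ℕ.⊔ k) p) (multiples-count T (d ℕ.⊔ k) p)))

  -- Splits by which of `d` and `k` is the larger; the two halves become equal after interchanging
  -- the summation variables.
  Φ-half : ∀ d k → Φ d k ℕ.≤ ⟦ k ℕ.≤? d ⟧ ℕ.* ((T ÷ d) ℕ.* (T ÷ d)) ℕ.+ ⟦ d ℕ.≤? k ⟧ ℕ.* ((T ÷ k) ℕ.* (T ÷ k))
  Φ-half d k with k ℕ.≤? d | d ℕ.≤? k
  ... | yes le | _ = ℕP.≤-trans (ℕP.≤-reflexive (trans (cong (λ n → (T ÷ n) ℕ.* (T ÷ n)) (ℕP.m≥n⇒m⊔n≡m le)) (sym (ℕP.*-identityˡ _)))) (ℕP.m≤m+n _ _)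
  ... | no _ | yes le = ℕP.≤-reflexive (trans (cong (λ n → (T ÷ n) ℕ.* (T ÷ n)) (ℕP.m≤n⇒m⊔n≡n le)) (sym (ℕP.*-identityˡ _)))
  ... | no n | no n' = ⊥-elim (n (ℕP.<⇒≤ (ℕP.≰⇒> n')))

  below-count : ∀ d → d ∈ range T → ∑ (range T) (λ k → ⟦ k ℕ.≤? d ⟧) ℕ.≤ d
  below-count d _ = ℕP.≤-trans (count-injection (λ k → k ℕ.≤? d) (λ _ → yes tt) (range T) {range d} (λ k → k) (range-unique T) (λ k m le → ∈-range (proj₁ (range-∈ m)) le , tt) (λ _ _ _ _ _ _ e → e))
      (ℕP.≤-reflexive (trans (∑-const (range d) 1) (trans (ℕP.*-identityʳ _) (length-range d))))

  -- At most `d` values `k ≤ d` occur, and `d (T ÷ d) ≤ T` absorbs this multiplicity into one of the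
  -- two quotients.
  half-count : ∑ (range T) (λ d → ∑ (range T) λ k → ⟦ k ℕ.≤? d ⟧ ℕ.* ((T ÷ d) ℕ.* (T ÷ d))) ℕ.≤ T ℕ.* harmonic T
  half-count = begin
    ∑ (range T) (λ d → ∑ (range T) λ k → ⟦ k ℕ.≤? d ⟧ ℕ.* ((T ÷ d) ℕ.* (T ÷ d))) ≡⟨ ∑-cong (range T) (λ d _ → ∑-*ʳ (range T) ((T ÷ d) ℕ.* (T ÷ d)) (λ k → ⟦ k ℕ.≤? d ⟧)) ⟩
    ∑ (range T) (λ d → ∑ (range T) (λ k → ⟦ k ℕ.≤? d ⟧) ℕ.* ((T ÷ d) ℕ.* (T ÷ d))) ≤⟨ ∑-mono (range T) (λ d md → ℕP.≤-trans (ℕP.*-monoˡ-≤ ((T ÷ d) ℕ.* (T ÷ d)) (below-count d md)) (ℕP.≤-trans (ℕP.≤-reflexive (sym (ℕP.*-assoc d (T ÷ d) (T ÷ d)))) (ℕP.*-monoˡ-≤ (T ÷ d) (*-÷-≤ T d)))) ⟩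
    ∑ (range T) (λ d → T ℕ.* (T ÷ d)) ≡⟨ ∑-*ˡ (range T) T (T ÷_) ⟩
    T ℕ.* harmonic T ∎
    where open ℕP.≤-Reasoning

proportional-encode : ∀ T → proportional-count T ℕ.≤ ∑ (range T) λ d → ∑ (range T) λ k → Φ T d k
proportional-encode T = ℕP.≤-trans (ℕP.≤-reflexive (sym (quads-sum T (λ x → ⟦ prop? T x ⟧)))) (ℕP.≤-trans
  (count-injection (prop? T) (small? T) (quads T) (encode T) (quads-unique T) (encode-∈ T) (encode-injective T)) (small-count T))

proportional-count≤ : ∀ T → proportional-count T ℕ.≤ 2 ℕ.* (T ℕ.* harmonic T)
proportional-count≤ T = begin
  proportional-count T ≤⟨ proportional-encode T ⟩
  ∑ (range T) (λ d → ∑ (range T) λ k → Φ T d k) ≤⟨ ∑-mono (range T) (λ d _ → ∑-mono (range T) λ k _ → Φ-half T d k) ⟩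
  ∑ (range T) (λ d → ∑ (range T) λ k → A d k ℕ.+ A k d) ≡⟨ trans (∑-cong (range T) λ d _ → ∑-+ (range T) (A d) (λ k → A k d)) (∑-+ (range T) (λ d → ∑ (range T) (A d)) (λ d → ∑ (range T) λ k → A k d)) ⟩
  ∑ (range T) (λ d → ∑ (range T) (A d)) ℕ.+ ∑ (range T) (λ d → ∑ (range T) λ k → A k d) ≡⟨ cong (∑ (range T) (λ d → ∑ (range T) (A d)) ℕ.+_) (sym (∑-swap (range T) (range T) A)) ⟩
  ∑ (range T) (λ d → ∑ (range T) (A d)) ℕ.+ ∑ (range T) (λ d → ∑ (range T) (A d)) ≤⟨ ℕP.+-mono-≤ (half-count T) (half-count T) ⟩
  T ℕ.* harmonic T ℕ.+ T ℕ.* harmonic T ≡⟨ lem (T ℕ.* harmonic T) ⟩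
  2 ℕ.* (T ℕ.* harmonic T) ∎
  where
    open ℕP.≤-Reasoning
    A : ℕ → ℕ → ℕ
    A d k = ⟦ k ℕ.≤? d ⟧ ℕ.* ((T ÷ d) ℕ.* (T ÷ d))
    lem : ∀ x → x ℕ.+ x ≡ 2 ℕ.* x
    lem = solveℕ-∀

-- Small integers with a prescribed ratio modulo q

pos-∸ : ∀ {m n} → n ℕ.≤ m → + (m ℕ.∸ n) ≡ + m - + n
pos-∸ {m} {n} le = sym (trans (ℤP.[+m]-[+n]≡m⊖n m n) (ℤP.⊖-≥ le))

length-cartesianProduct : ∀ {A B : Set} (xs : List A) (ys : List B) → length (cartesianProduct xs ys) ≡ length xs ℕ.* length ys
length-cartesianProduct xs ys = begin
  length (cartesianProduct xs ys) ≡⟨ sym (trans (∑-const (cartesianProduct xs ys) 1) (ℕP.*-identityʳ _)) ⟩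
  ∑ (cartesianProduct xs ys) (λ _ → 1) ≡⟨ ∑-× xs ys (λ _ → 1) ⟩
  ∑ xs (λ _ → ∑ ys (λ _ → 1)) ≡⟨ ∑-const xs _ ⟩
  length xs ℕ.* ∑ ys (λ _ → 1) ≡⟨ cong (length xs ℕ.*_) (trans (∑-const ys 1) (ℕP.*-identityʳ _)) ⟩
  length xs ℕ.* length ys ∎
  where open ≡-Reasoning

module Ratios (q : ℕ) .{{_ : NonZero q}} (pr : Prime q) (T : ℕ) (T²<q : T ℕ.* T ℕ.< q) where
  open Modular q pr

  T<q : T ℕ.< q
  T<q = below T T²<q
    where below : ∀ T → T ℕ.* T ℕ.< q → T ℕ.< q
          below zero lt = lt
          below (suc T) lt = ℕP.≤-<-trans (ℕP.m≤m*n (suc T) (suc T)) lt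

  pairs : List (ℕ × ℕ)
  pairs = cartesianProduct (range T) (range T)

  pairs-unique : Unique pairs
  pairs-unique = Unique.cartesianProduct⁺ (range-unique T) (range-unique T)

  length-pairs : length pairs ≡ T ℕ.* T
  length-pairs = trans (length-cartesianProduct (range T) (range T)) (cong₂ ℕ._*_ (length-range T) (length-range T))

  pair-∈ : ∀ {x} → x ∈ pairs → (1 ℕ.≤ proj₁ x × proj₁ x ℕ.≤ T) × (1 ℕ.≤ proj₂ x × proj₂ x ℕ.≤ T)
  pair-∈ m = range-∈ (proj₁ (∈-cartesianProduct⁻ (range T) (range T) m)) , range-∈ (proj₂ (∈-cartesianProduct⁻ (range T) (range T) m))

  entry-unit : ∀ {n} → 1 ℕ.≤ n → n ℕ.≤ T → ¬ Z (+ n)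
  entry-unit 1≤n n≤T = ¬Z-residue (λ n≡0 → ℕP.<⇒≢ 1≤n (sym n≡0)) (ℕP.≤-<-trans n≤T T<q)

  entry-≡ : ∀ {m n} → m ℕ.≤ T → n ℕ.≤ T → Z (+ m - + n) → m ≡ n
  entry-≡ {m} {n} lm ln z = ℤP.+-injective (ℤP.i-j≡0⇒i≡j (+ m) (+ n) (Z-small _ (∣m-n∣<q (ℕP.≤-<-trans lm T<q) (ℕP.≤-<-trans ln T<q)) z))

  -- Both products are at most `T²`, hence below `q`, so a congruence between them is an equation of
  -- integers.
  product-≡ : ∀ {a b c d} → a ℕ.≤ T → b ℕ.≤ T → c ℕ.≤ T → d ℕ.≤ T → Z (+ a * + b - + c * + d) → a ℕ.* b ≡ c ℕ.* d
  product-≡ {a} {b} {c} {d} la lb lc ld z = ℤP.+-injective (ℤP.i-j≡0⇒i≡j _ _ (Z-small _ (∣m-n∣<q (ℕP.≤-<-trans (ℕP.*-mono-≤ la lb) T²<q) (ℕP.≤-<-trans (ℕP.*-mono-≤ lc ld) T²<q))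
      (subst Z (sym (cong₂ _-_ (ℤP.pos-* a b) (ℤP.pos-* c d))) z)))

  value : ℤ → ℕ × ℕ → ℤ
  value μ (c , c') = + c - μ * + c'

  -- the pairs whose entries have ratio s μ, where s is a sign
  ratio-count : ℤ → ℤ → ℕ
  ratio-count s μ = ∑ pairs λ x → ⟦ Z? (value (s * μ) x) ⟧

  Unit : ℤ → Set
  Unit s = ∃[ t ] t * s ≡ 1ℤ

  private
    ratio-product : ∀ s → Unit s → ∀ x y → x ∈ pairs → y ∈ pairs → ∑ residues (λ μ → ⟦ Z? (value (s * μ) x) ⟧ ℕ.* ⟦ Z? (value (s * μ) y) ⟧) ℕ.≤ ⟦ proportional? (proj₁ x) (proj₂ x) (proj₁ y) (proj₂ y) ⟧
    ratio-product s (t , ts) (e , e') (f , f') mx my = decide (proportional? e e' f f')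
      where
        be = pair-∈ mx
        bf = pair-∈ my
        lem : ∀ e e' f f' m → e * f' - e' * f ≡ f' * (e - m * e') + - e' * (f - m * f')
        lem = solve-∀
        uniq : ∀ e e' t s μ ν → t * s * (μ - ν) * e' ≡ - t * (e - s * μ * e') + t * (e - s * ν * e')
        uniq = solve-∀
        one : ∀ x → 1ℤ * x ≡ x
        one = ℤP.*-identityˡ
        each : ¬ e ℕ.* f' ≡ e' ℕ.* f → ∀ μ → (d : Dec (Z (value (s * μ) (e , e')))) (d' : Dec (Z (value (s * μ) (f , f')))) → ⟦ d ⟧ ℕ.* ⟦ d' ⟧ ≡ 0
        each n μ (no _) _ = refl
        each n μ (yes _) (no _) = refl
        each n μ (yes p) (yes r) = contradiction (product-≡ (proj₂ (proj₁ be)) (proj₂ (proj₂ bf)) (proj₂ (proj₂ be)) (proj₂ (proj₁ bf)) (Z₂ (+ f') (- + e') p r (lem (+ e) (+ e') (+ f) (+ f') (s * μ)))) n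
        decide : (d : Dec (e ℕ.* f' ≡ e' ℕ.* f)) → ∑ residues (λ μ → ⟦ Z? (value (s * μ) (e , e')) ⟧ ℕ.* ⟦ Z? (value (s * μ) (f , f')) ⟧) ℕ.≤ ⟦ d ⟧
        decide (no n) = ℕP.≤-reflexive (trans (∑-cong residues λ μ _ → each n μ (Z? (value (s * μ) (e , e'))) (Z? (value (s * μ) (f , f')))) (∑-zero residues))
        decide (yes _) = ℕP.≤-trans (∑-mono residues λ μ _ → ℕP.≤-trans (ℕP.*-monoʳ-≤ ⟦ Z? (value (s * μ) (e , e')) ⟧ (⟦⟧≤1 (Z? (value (s * μ) (f , f'))))) (ℕP.≤-reflexive (ℕP.*-identityʳ _)))
          (count≤1 (λ μ → Z? (value (s * μ) (e , e'))) residues residues-unique λ μ ν mμ mν p r → residue-≡ mμ mν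
            (subst Z (trans (cong (_* (μ - ν)) ts) (one (μ - ν))) (Z-cancel (+ e') (t * s * (μ - ν)) (entry-unit (proj₁ (proj₂ be)) (proj₂ (proj₂ be))) (subst Z (ℤP.*-comm (t * s * (μ - ν)) (+ e')) (Z₂ (- t) t p r (uniq (+ e) (+ e') t s μ ν))))))

  -- The squares count pairs of pairs with the same ratio. Such pairs are proportional over the
  -- integers by `product-≡`, and since the entries are units each pair determines its ratio, so no
  -- proportional quadruple is counted twice.
  ratio-count² : ∀ s → Unit s → ∑ residues (λ μ → ratio-count s μ ℕ.* ratio-count s μ) ℕ.≤ proportional-count T
  ratio-count² s us = begin
    ∑ residues (λ μ → ratio-count s μ ℕ.* ratio-count s μ) ≡⟨ ∑-cong residues (λ μ _ → sym (∑-product pairs pairs (I μ) (I μ))) ⟩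
    ∑ residues (λ μ → ∑ pairs λ x → ∑ pairs λ y → I μ x ℕ.* I μ y) ≡⟨ ∑-swap residues pairs (λ μ x → ∑ pairs λ y → I μ x ℕ.* I μ y) ⟩
    ∑ pairs (λ x → ∑ residues λ μ → ∑ pairs λ y → I μ x ℕ.* I μ y) ≡⟨ ∑-cong pairs (λ x _ → ∑-swap residues pairs (λ μ y → I μ x ℕ.* I μ y)) ⟩
    ∑ pairs (λ x → ∑ pairs λ y → ∑ residues λ μ → I μ x ℕ.* I μ y) ≤⟨ ∑-mono pairs (λ x mx → ∑-mono pairs λ y my → ratio-product s us x y mx my) ⟩
    ∑ pairs (λ x → ∑ pairs λ y → ⟦ proportional? (proj₁ x) (proj₂ x) (proj₁ y) (proj₂ y) ⟧) ≡⟨ trans (∑-× (range T) (range T) (λ x → ∑ pairs λ y → ⟦ proportional? (proj₁ x) (proj₂ x) (proj₁ y) (proj₂ y) ⟧)) (∑-cong (range T) λ e _ → ∑-cong (range T) λ e' _ → ∑-× (range T) (range T) (λ y → ⟦ proportional? e e' (proj₁ y) (proj₂ y) ⟧)) ⟩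
    proportional-count T ∎
    where
      open ℕP.≤-Reasoning
      I : ℤ → ℕ × ℕ → ℕ
      I μ x = ⟦ Z? (value (s * μ) x) ⟧

  -- One for the base solution, and one ratio count for each sign pattern of the difference from it:
  -- equal signs give ratio `μ`, opposite signs give ratio `− μ`.
  coset-bound : ℤ → ℕ
  coset-bound μ = 1 ℕ.+ (ratio-count 1ℤ μ ℕ.+ ratio-count 1ℤ μ ℕ.+ (ratio-count (- 1ℤ) μ ℕ.+ ratio-count (- 1ℤ) μ))

  -- Translating by one solution turns the others into pairs of ratio ± μ.
  coset-count : ∀ μ → ¬ Z μ → {P : ℕ × ℕ → Set} (P? : ∀ x → Dec (P x)) →
    (∀ x y → x ∈ pairs → y ∈ pairs → P x → P y → Z (value μ x - value μ y)) → ∑ pairs (λ x → ⟦ P? x ⟧) ℕ.≤ coset-bound μ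
  coset-count μ nμ {P} P? same = decide (any? P? pairs)
    where
      module _ (c₀ c₀' : ℕ) (m₀ : (c₀ , c₀') ∈ pairs) (p₀ : P (c₀ , c₀')) where
        diff : ∀ {c c'} → (c , c') ∈ pairs → P (c , c') → Z ((+ c - + c₀) - μ * (+ c' - + c₀'))
        diff {c} {c'} m p = Z₁ 1ℤ (same (c , c') (c₀ , c₀') m m₀ p p₀) (lem (+ c) (+ c₀) (+ c') (+ c₀') μ)
          where lem : ∀ c c₀ c' c₀' μ → (c - c₀) - μ * (c' - c₀') ≡ 1ℤ * (c - μ * c' - (c₀ - μ * c₀'))
                lem = solve-∀

        Centre Up Down Right Left : ℕ × ℕ → Set
        Centre x = x ≡ (c₀ , c₀')
        Up x = P x × (c₀ ℕ.< proj₁ x × c₀' ℕ.< proj₂ x)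
        Down x = P x × (proj₁ x ℕ.< c₀ × proj₂ x ℕ.< c₀')
        Right x = P x × (c₀ ℕ.< proj₁ x × proj₂ x ℕ.< c₀')
        Left x = P x × (proj₁ x ℕ.< c₀ × c₀' ℕ.< proj₂ x)

        centre? : ∀ x → Dec (Centre x)
        centre? x = ≡-dec ℕ._≟_ ℕ._≟_ x (c₀ , c₀')
        up? : ∀ x → Dec (Up x)
        up? x = P? x ×-dec (c₀ ℕ.<? proj₁ x ×-dec c₀' ℕ.<? proj₂ x)
        down? : ∀ x → Dec (Down x)
        down? x = P? x ×-dec (proj₁ x ℕ.<? c₀ ×-dec proj₂ x ℕ.<? c₀')
        right? : ∀ x → Dec (Right x)
        right? x = P? x ×-dec (c₀ ℕ.<? proj₁ x ×-dec proj₂ x ℕ.<? c₀')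
        left? : ∀ x → Dec (Left x)
        left? x = P? x ×-dec (proj₁ x ℕ.<? c₀ ×-dec c₀' ℕ.<? proj₂ x)

        bounds₀ = pair-∈ m₀

        pieces : ℕ × ℕ → ℕ
        pieces x = ⟦ centre? x ⟧ ℕ.+ (⟦ up? x ⟧ ℕ.+ ⟦ down? x ⟧ ℕ.+ (⟦ right? x ⟧ ℕ.+ ⟦ left? x ⟧))

        -- A difference with one coordinate zero vanishes entirely, because `μ` is a unit and the
        -- entries are below `q`. So apart from the centre only the four open quadrants occur.
        cover : ∀ x → x ∈ pairs → P x → 1 ℕ.≤ pieces x
        cover (c , c') m p with ℕP.<-cmp c c₀ | ℕP.<-cmp c' c₀'
        ... | tri≈ _ refl _ | tri≈ _ refl _ = ℕP.≤-trans (⟦⟧-1≤ (centre? (c , c')) refl) (ℕP.m≤m+n _ _)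
        ... | tri≈ _ refl _ | tri< lt _ _ = contradiction (entry-≡ (proj₂ (proj₂ (pair-∈ m))) (proj₂ (proj₂ bounds₀)) (Z-cancel μ (+ c' - + c₀') nμ (Z₁ (- 1ℤ) (diff m p) (lem (+ c) (+ c' - + c₀') μ)))) (ℕP.<⇒≢ lt)
          where lem : ∀ c d μ → μ * d ≡ - 1ℤ * ((c - c) - μ * d)
                lem = solve-∀
        ... | tri≈ _ refl _ | tri> _ _ gt = contradiction (entry-≡ (proj₂ (proj₂ (pair-∈ m))) (proj₂ (proj₂ bounds₀)) (Z-cancel μ (+ c' - + c₀') nμ (Z₁ (- 1ℤ) (diff m p) (lem (+ c) (+ c' - + c₀') μ)))) (λ e → ℕP.<⇒≢ gt (sym e))
          where lem : ∀ c d μ → μ * d ≡ - 1ℤ * ((c - c) - μ * d)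
                lem = solve-∀
        ... | tri< lt _ _ | tri≈ _ refl _ = contradiction (entry-≡ (proj₂ (proj₁ (pair-∈ m))) (proj₂ (proj₁ bounds₀)) (Z₁ 1ℤ (diff m p) (lem (+ c - + c₀) (+ c') μ))) (ℕP.<⇒≢ lt)
          where lem : ∀ d c μ → d ≡ 1ℤ * (d - μ * (c - c))
                lem = solve-∀
        ... | tri> _ _ gt | tri≈ _ refl _ = contradiction (entry-≡ (proj₂ (proj₁ (pair-∈ m))) (proj₂ (proj₁ bounds₀)) (Z₁ 1ℤ (diff m p) (lem (+ c - + c₀) (+ c') μ))) (λ e → ℕP.<⇒≢ gt (sym e))
          where lem : ∀ d c μ → d ≡ 1ℤ * (d - μ * (c - c))
                lem = solve-∀
        ... | tri< lt _ _ | tri< lt' _ _ = ℕP.≤-trans (⟦⟧-1≤ (down? (c , c')) (p , lt , lt')) (ℕP.≤-trans (ℕP.m≤n+m _ ⟦ up? (c , c') ⟧) (ℕP.≤-trans (ℕP.m≤m+n _ _) (ℕP.m≤n+m _ ⟦ centre? (c , c') ⟧)))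
        ... | tri> _ _ gt | tri> _ _ gt' = ℕP.≤-trans (⟦⟧-1≤ (up? (c , c')) (p , gt , gt')) (ℕP.≤-trans (ℕP.m≤m+n _ ⟦ down? (c , c') ⟧) (ℕP.≤-trans (ℕP.m≤m+n _ _) (ℕP.m≤n+m _ ⟦ centre? (c , c') ⟧)))
        ... | tri> _ _ gt | tri< lt' _ _ = ℕP.≤-trans (⟦⟧-1≤ (right? (c , c')) (p , gt , lt')) (ℕP.≤-trans (ℕP.m≤m+n _ ⟦ left? (c , c') ⟧) (ℕP.≤-trans (ℕP.m≤n+m _ (⟦ up? (c , c') ⟧ ℕ.+ ⟦ down? (c , c') ⟧)) (ℕP.m≤n+m _ ⟦ centre? (c , c') ⟧)))
        ... | tri< lt _ _ | tri> _ _ gt' = ℕP.≤-trans (⟦⟧-1≤ (left? (c , c')) (p , lt , gt')) (ℕP.≤-trans (ℕP.m≤n+m _ ⟦ right? (c , c') ⟧) (ℕP.≤-trans (ℕP.m≤n+m _ (⟦ up? (c , c') ⟧ ℕ.+ ⟦ down? (c , c') ⟧)) (ℕP.m≤n+m _ ⟦ centre? (c , c') ⟧)))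

        ∸-∈ : ∀ {m n} → n ℕ.< m → m ℕ.≤ T → m ℕ.∸ n ∈ range T
        ∸-∈ {m} {n} lt le = ∈-range (ℕP.m<n⇒0<n∸m lt) (ℕP.≤-trans (ℕP.m∸n≤m m n) le)

        up-count : ∑ pairs (λ x → ⟦ up? x ⟧) ℕ.≤ ratio-count 1ℤ μ
        up-count = count-injection up? (λ x → Z? (value (1ℤ * μ) x)) pairs (λ x → (proj₁ x ℕ.∸ c₀ , proj₂ x ℕ.∸ c₀')) pairs-unique
          (λ { (c , c') m (p , lt , lt') → ∈-cartesianProduct⁺ (∸-∈ lt (proj₂ (proj₁ (pair-∈ m)))) (∸-∈ lt' (proj₂ (proj₂ (pair-∈ m)))) ,
             Z₁ 1ℤ (diff m p) (trans (cong₂ (λ x y → x - 1ℤ * μ * y) (pos-∸ (ℕP.<⇒≤ lt)) (pos-∸ (ℕP.<⇒≤ lt'))) (lem (+ c - + c₀) (+ c' - + c₀') μ)) })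
          (λ { (c , c') (d , d') _ _ (_ , lt , lt') (_ , gt , gt') e → cong₂ _,_ (ℕP.∸-cancelʳ-≡ (ℕP.<⇒≤ lt) (ℕP.<⇒≤ gt) (cong proj₁ e)) (ℕP.∸-cancelʳ-≡ (ℕP.<⇒≤ lt') (ℕP.<⇒≤ gt') (cong proj₂ e)) })
          where lem : ∀ x y μ → x - 1ℤ * μ * y ≡ 1ℤ * (x - μ * y)
                lem = solve-∀

        down-count : ∑ pairs (λ x → ⟦ down? x ⟧) ℕ.≤ ratio-count 1ℤ μ
        down-count = count-injection down? (λ x → Z? (value (1ℤ * μ) x)) pairs (λ x → (c₀ ℕ.∸ proj₁ x , c₀' ℕ.∸ proj₂ x)) pairs-unique
          (λ { (c , c') m (p , lt , lt') → ∈-cartesianProduct⁺ (∸-∈ lt (proj₂ (proj₁ bounds₀))) (∸-∈ lt' (proj₂ (proj₂ bounds₀))) ,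
             Z₁ (- 1ℤ) (diff m p) (trans (cong₂ (λ x y → x - 1ℤ * μ * y) (pos-∸ (ℕP.<⇒≤ lt)) (pos-∸ (ℕP.<⇒≤ lt'))) (lem (+ c) (+ c₀) (+ c') (+ c₀') μ)) })
          (λ { (c , c') (d , d') _ _ (_ , lt , lt') (_ , gt , gt') e → cong₂ _,_ (ℕP.∸-cancelˡ-≡ (ℕP.<⇒≤ lt) (ℕP.<⇒≤ gt) (cong proj₁ e)) (ℕP.∸-cancelˡ-≡ (ℕP.<⇒≤ lt') (ℕP.<⇒≤ gt') (cong proj₂ e)) })
          where lem : ∀ c c₀ c' c₀' μ → c₀ - c - 1ℤ * μ * (c₀' - c') ≡ - 1ℤ * ((c - c₀) - μ * (c' - c₀'))
                lem = solve-∀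

        right-count : ∑ pairs (λ x → ⟦ right? x ⟧) ℕ.≤ ratio-count (- 1ℤ) μ
        right-count = count-injection right? (λ x → Z? (value (- 1ℤ * μ) x)) pairs (λ x → (proj₁ x ℕ.∸ c₀ , c₀' ℕ.∸ proj₂ x)) pairs-unique
          (λ { (c , c') m (p , lt , lt') → ∈-cartesianProduct⁺ (∸-∈ lt (proj₂ (proj₁ (pair-∈ m)))) (∸-∈ lt' (proj₂ (proj₂ bounds₀))) ,
             Z₁ 1ℤ (diff m p) (trans (cong₂ (λ x y → x - - 1ℤ * μ * y) (pos-∸ (ℕP.<⇒≤ lt)) (pos-∸ (ℕP.<⇒≤ lt'))) (lem (+ c) (+ c₀) (+ c') (+ c₀') μ)) })
          (λ { (c , c') (d , d') _ _ (_ , lt , lt') (_ , gt , gt') e → cong₂ _,_ (ℕP.∸-cancelʳ-≡ (ℕP.<⇒≤ lt) (ℕP.<⇒≤ gt) (cong proj₁ e)) (ℕP.∸-cancelˡ-≡ (ℕP.<⇒≤ lt') (ℕP.<⇒≤ gt') (cong proj₂ e)) })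
          where lem : ∀ c c₀ c' c₀' μ → c - c₀ - - 1ℤ * μ * (c₀' - c') ≡ 1ℤ * ((c - c₀) - μ * (c' - c₀'))
                lem = solve-∀

        left-count : ∑ pairs (λ x → ⟦ left? x ⟧) ℕ.≤ ratio-count (- 1ℤ) μ
        left-count = count-injection left? (λ x → Z? (value (- 1ℤ * μ) x)) pairs (λ x → (c₀ ℕ.∸ proj₁ x , proj₂ x ℕ.∸ c₀')) pairs-unique
          (λ { (c , c') m (p , lt , lt') → ∈-cartesianProduct⁺ (∸-∈ lt (proj₂ (proj₁ bounds₀))) (∸-∈ lt' (proj₂ (proj₂ (pair-∈ m)))) ,
             Z₁ (- 1ℤ) (diff m p) (trans (cong₂ (λ x y → x - - 1ℤ * μ * y) (pos-∸ (ℕP.<⇒≤ lt)) (pos-∸ (ℕP.<⇒≤ lt'))) (lem (+ c) (+ c₀) (+ c') (+ c₀') μ)) })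
          (λ { (c , c') (d , d') _ _ (_ , lt , lt') (_ , gt , gt') e → cong₂ _,_ (ℕP.∸-cancelˡ-≡ (ℕP.<⇒≤ lt) (ℕP.<⇒≤ gt) (cong proj₁ e)) (ℕP.∸-cancelʳ-≡ (ℕP.<⇒≤ lt') (ℕP.<⇒≤ gt') (cong proj₂ e)) })
          where lem : ∀ c c₀ c' c₀' μ → c₀ - c - - 1ℤ * μ * (c' - c₀') ≡ - 1ℤ * ((c - c₀) - μ * (c' - c₀'))
                lem = solve-∀

        centre-count : ∑ pairs (λ x → ⟦ centre? x ⟧) ℕ.≤ 1
        centre-count = count≤1 centre? pairs pairs-unique λ x y _ _ p r → trans p (sym r)

        bound : ∑ pairs (λ x → ⟦ P? x ⟧) ℕ.≤ coset-bound μ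
        bound = ℕP.≤-trans (∑-mono pairs λ x m → ⟦⟧-≤ (P? x) (cover x m)) (ℕP.≤-trans (ℕP.≤-reflexive sum-split)
          (ℕP.+-mono-≤ centre-count (ℕP.+-mono-≤ (ℕP.+-mono-≤ up-count down-count) (ℕP.+-mono-≤ right-count left-count))))
          where
            sum-split = trans (∑-+ pairs (λ x → ⟦ centre? x ⟧) (λ x → ⟦ up? x ⟧ ℕ.+ ⟦ down? x ⟧ ℕ.+ (⟦ right? x ⟧ ℕ.+ ⟦ left? x ⟧))) (cong (∑ pairs (λ x → ⟦ centre? x ⟧) ℕ.+_)
              (trans (∑-+ pairs (λ x → ⟦ up? x ⟧ ℕ.+ ⟦ down? x ⟧) (λ x → ⟦ right? x ⟧ ℕ.+ ⟦ left? x ⟧)) (cong₂ ℕ._+_ (∑-+ pairs (λ x → ⟦ up? x ⟧) (λ x → ⟦ down? x ⟧)) (∑-+ pairs (λ x → ⟦ right? x ⟧) (λ x → ⟦ left? x ⟧)))))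

      decide : Dec (Any P pairs) → ∑ pairs (λ x → ⟦ P? x ⟧) ℕ.≤ coset-bound μ
      decide (no n) = ℕP.≤-trans (ℕP.≤-reflexive (trans (∑-cong pairs λ x m → ⟦⟧-no (P? x) λ p → n (lose m p)) (∑-zero pairs))) z≤n
      decide (yes a) = bound (proj₁ (proj₁ (find a))) (proj₂ (proj₁ (find a))) (proj₁ (proj₂ (find a))) (proj₂ (proj₂ (find a)))

  -- By Cauchy-Schwarz `(1 + 2a + 2b)² ≤ 3 + 12a² + 12b²`, and `ratio-count²` bounds the mean square
  -- of each ratio count.
  coset-bound² : ∑ residues (λ μ → coset-bound μ ℕ.* coset-bound μ) ℕ.≤ 3 ℕ.* q ℕ.+ 24 ℕ.* proportional-count T
  coset-bound² = begin
    ∑ residues (λ μ → coset-bound μ ℕ.* coset-bound μ) ≤⟨ ∑-mono residues (λ μ _ → square (ratio-count 1ℤ μ) (ratio-count (- 1ℤ) μ)) ⟩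
    ∑ residues (λ μ → 3 ℕ.+ (12 ℕ.* (a μ ℕ.* a μ) ℕ.+ 12 ℕ.* (b μ ℕ.* b μ))) ≡⟨ trans (∑-+ residues (λ _ → 3) (λ μ → 12 ℕ.* (a μ ℕ.* a μ) ℕ.+ 12 ℕ.* (b μ ℕ.* b μ))) (cong₂ ℕ._+_ (trans (∑-const residues 3) (trans (cong (ℕ._* 3) length-residues) (ℕP.*-comm q 3)))
        (trans (∑-+ residues (λ μ → 12 ℕ.* (a μ ℕ.* a μ)) (λ μ → 12 ℕ.* (b μ ℕ.* b μ))) (cong₂ ℕ._+_ (∑-*ˡ residues 12 (λ μ → a μ ℕ.* a μ)) (∑-*ˡ residues 12 (λ μ → b μ ℕ.* b μ))))) ⟩
    3 ℕ.* q ℕ.+ (12 ℕ.* ∑ residues (λ μ → a μ ℕ.* a μ) ℕ.+ 12 ℕ.* ∑ residues (λ μ → b μ ℕ.* b μ)) ≤⟨ ℕP.+-monoʳ-≤ (3 ℕ.* q) (ℕP.+-mono-≤ (ℕP.*-monoʳ-≤ 12 (ratio-count² 1ℤ (1ℤ , refl))) (ℕP.*-monoʳ-≤ 12 (ratio-count² (- 1ℤ) (- 1ℤ , refl)))) ⟩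
    3 ℕ.* q ℕ.+ (12 ℕ.* proportional-count T ℕ.+ 12 ℕ.* proportional-count T) ≡⟨ cong (3 ℕ.* q ℕ.+_) (lem (proportional-count T)) ⟩
    3 ℕ.* q ℕ.+ 24 ℕ.* proportional-count T ∎
    where
      open ℕP.≤-Reasoning
      a b : ℤ → ℕ
      a μ = ratio-count 1ℤ μ
      b μ = ratio-count (- 1ℤ) μ
      lem : ∀ x → 12 ℕ.* x ℕ.+ 12 ℕ.* x ≡ 24 ℕ.* x
      lem = solveℕ-∀
      two-mul : ∀ a b → 2 ℕ.* (a ℕ.* b) ℕ.≤ a ℕ.* a ℕ.+ b ℕ.* b
      two-mul a b with ℕP.≤-total a b
      ... | inj₁ le with ℕP.m≤n⇒∃[o]m+o≡n le
      ...   | o , refl = ℕP.≤-trans (ℕP.m≤m+n _ (o ℕ.* o)) (ℕP.≤-reflexive (e a o))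
              where e : ∀ a o → 2 ℕ.* (a ℕ.* (a ℕ.+ o)) ℕ.+ o ℕ.* o ≡ a ℕ.* a ℕ.+ (a ℕ.+ o) ℕ.* (a ℕ.+ o)
                    e = solveℕ-∀
      two-mul a b | inj₂ le with ℕP.m≤n⇒∃[o]m+o≡n le
      ...   | o , refl = ℕP.≤-trans (ℕP.m≤m+n _ (o ℕ.* o)) (ℕP.≤-reflexive (e b o))
              where e : ∀ b o → 2 ℕ.* ((b ℕ.+ o) ℕ.* b) ℕ.+ o ℕ.* o ≡ (b ℕ.+ o) ℕ.* (b ℕ.+ o) ℕ.+ b ℕ.* b
                    e = solveℕ-∀
      square : ∀ a b → (1 ℕ.+ (a ℕ.+ a ℕ.+ (b ℕ.+ b))) ℕ.* (1 ℕ.+ (a ℕ.+ a ℕ.+ (b ℕ.+ b))) ℕ.≤ 3 ℕ.+ (12 ℕ.* (a ℕ.* a) ℕ.+ 12 ℕ.* (b ℕ.* b))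
      square a b = ℕP.≤-trans (ℕP.≤-reflexive (e₁ a b)) (ℕP.≤-trans (ℕP.+-monoʳ-≤ (1 ℕ.+ 4 ℕ.* (a ℕ.* a) ℕ.+ 4 ℕ.* (b ℕ.* b)) (ℕP.+-mono-≤ (two-mul 1 (2 ℕ.* a)) (ℕP.+-mono-≤ (two-mul 1 (2 ℕ.* b)) (two-mul (2 ℕ.* a) (2 ℕ.* b))))) (ℕP.≤-reflexive (e₂ a b)))
        where
          e₁ : ∀ a b → (1 ℕ.+ (a ℕ.+ a ℕ.+ (b ℕ.+ b))) ℕ.* (1 ℕ.+ (a ℕ.+ a ℕ.+ (b ℕ.+ b))) ≡ 1 ℕ.+ 4 ℕ.* (a ℕ.* a) ℕ.+ 4 ℕ.* (b ℕ.* b) ℕ.+ (2 ℕ.* (1 ℕ.* (2 ℕ.* a)) ℕ.+ (2 ℕ.* (1 ℕ.* (2 ℕ.* b)) ℕ.+ 2 ℕ.* (2 ℕ.* a ℕ.* (2 ℕ.* b))))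
          e₁ = solveℕ-∀
          e₂ : ∀ a b → 1 ℕ.+ 4 ℕ.* (a ℕ.* a) ℕ.+ 4 ℕ.* (b ℕ.* b) ℕ.+ (1 ℕ.* 1 ℕ.+ 2 ℕ.* a ℕ.* (2 ℕ.* a) ℕ.+ (1 ℕ.* 1 ℕ.+ 2 ℕ.* b ℕ.* (2 ℕ.* b) ℕ.+ (2 ℕ.* a ℕ.* (2 ℕ.* a) ℕ.+ 2 ℕ.* b ℕ.* (2 ℕ.* b)))) ≡ 3 ℕ.+ (12 ℕ.* (a ℕ.* a) ℕ.+ 12 ℕ.* (b ℕ.* b))
          e₂ = solveℕ-∀

-- (a , b , s) and (c , d , t) are the last two rows of a matrix
Tuple : Set
Tuple = (ℕ × ℕ × ℕ) × (ℕ × ℕ × ℕ)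

vector : ℕ × ℕ × ℕ → V3
vector (a , b , s) = v3 (+ a) (+ b) (+ s)

tuples : ℕ → List Tuple
tuples T = cartesianProduct triples triples
  where triples = cartesianProduct (range T) (cartesianProduct (range T) (range T))

tuples-unique : ∀ T → Unique (tuples T)
tuples-unique T = Unique.cartesianProduct⁺ u u
  where u = Unique.cartesianProduct⁺ (range-unique T) (Unique.cartesianProduct⁺ (range-unique T) (range-unique T))

-- Pairs of matrices whose last rows become dependent

module BadPairs (q : ℕ) .{{_ : NonZero q}} (pr : Prime q) (T : ℕ) (T²<q : T ℕ.* T ℕ.< q) where
  open Modular q pr
  open Ratios q pr T T²<q

  -- The failure of `Good` at one ratio, expressed on tuples so that it is independent of the choice
  -- of top rows.
  bad? : ∀ μ (ω ω' : Tuple) → Dec (Zⱽ ((vector (proj₁ ω) ⊟ μ ⋆ vector (proj₁ ω')) ×ᵥ (vector (proj₂ ω) ⊟ μ ⋆ vector (proj₂ ω'))))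
  bad? μ ω ω' = Zⱽ? ((vector (proj₁ ω) ⊟ μ ⋆ vector (proj₁ ω')) ×ᵥ (vector (proj₂ ω) ⊟ μ ⋆ vector (proj₂ ω')))

  units : List ℤ
  units = filter (λ μ → ¬? (Z? μ)) residues

  private
    Sextuple : Set
    Sextuple = (ℕ × ℕ) × (ℕ × ℕ) × (ℕ × ℕ) × (ℕ × ℕ) × (ℕ × ℕ) × (ℕ × ℕ)

    sextuples : List Sextuple
    sextuples = cartesianProduct pairs (cartesianProduct pairs (cartesianProduct pairs (cartesianProduct pairs (cartesianProduct pairs pairs))))

    cross? : ∀ μ (x : Sextuple) → let (x₁ , x₂ , x₃ , y₁ , y₂ , y₃) = x in Dec (Zⱽ (v3 (value μ x₁) (value μ x₂) (value μ x₃) ×ᵥ v3 (value μ y₁) (value μ y₂) (value μ y₃)))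
    cross? μ (x₁ , x₂ , x₃ , y₁ , y₂ , y₃) = Zⱽ? (v3 (value μ x₁) (value μ x₂) (value μ x₃) ×ᵥ v3 (value μ y₁) (value μ y₂) (value μ y₃))

    ∑ₚ : (ℕ × ℕ → ℕ) → ℕ
    ∑ₚ = ∑ pairs

    sextuples-sum : ∀ (F : Sextuple → ℕ) → ∑ sextuples F ≡ ∑ₚ λ x₁ → ∑ₚ λ x₂ → ∑ₚ λ x₃ → ∑ₚ λ y₁ → ∑ₚ λ y₂ → ∑ₚ λ y₃ → F (x₁ , x₂ , x₃ , y₁ , y₂ , y₃)
    sextuples-sum F = trans (∑-× pairs _ F) (∑-cong pairs λ x₁ _ → trans (∑-× pairs _ (λ r → F (x₁ , r))) (∑-cong pairs λ x₂ _ → trans (∑-× pairs _ (λ r → F (x₁ , x₂ , r)))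
      (∑-cong pairs λ x₃ _ → trans (∑-× pairs _ (λ r → F (x₁ , x₂ , x₃ , r))) (∑-cong pairs λ y₁ _ → ∑-× pairs pairs (λ r → F (x₁ , x₂ , x₃ , y₁ , r))))))

    M : ℕ
    M = T ℕ.* T

    ∑ₚ-bound : ∀ K {F : ℕ × ℕ → ℕ} → (∀ x → F x ℕ.≤ K) → ∑ₚ F ℕ.≤ M ℕ.* K
    ∑ₚ-bound K h = ℕP.≤-trans (∑-bound pairs K (λ x _ → h x)) (ℕP.≤-reflexive (cong (ℕ._* K) length-pairs))

    module _ (μ : ℤ) (nμ : ¬ Z μ) where
      G g₀ : ℕ
      G = coset-bound μ
      g₀ = ∑ₚ λ x → ⟦ Z? (value μ x) ⟧

      linear? : ∀ k r (y : ℕ × ℕ) → Dec (¬ Z k × Z (k * value μ y - r))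
      linear? k r y = ¬? (Z? k) ×-dec Z? (k * value μ y - r)

      -- The coefficient `k` is a unit, so all solutions share one `value` modulo `q`, which is the
      -- hypothesis of `coset-count`.
      linear-count : ∀ k r → ∑ₚ (λ y → ⟦ linear? k r y ⟧) ℕ.≤ G
      linear-count k r = coset-count μ nμ (linear? k r) λ x y _ _ (nk , p) (_ , p') → Z-cancel k (value μ x - value μ y) nk (Z₂ 1ℤ (- 1ℤ) p p' (lem k r (value μ x) (value μ y)))
        where lem : ∀ k r x y → k * (x - y) ≡ 1ℤ * (k * x - r) + - 1ℤ * (k * y - r)
              lem = solve-∀

      two-linear : ∀ k r k' r' → ∑ₚ (λ y → ∑ₚ λ y' → ⟦ linear? k r y ⟧ ℕ.* ⟦ linear? k' r' y' ⟧) ℕ.≤ G ℕ.* G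
      two-linear k r k' r' = ℕP.≤-trans (ℕP.≤-reflexive (∑-product pairs pairs (λ y → ⟦ linear? k r y ⟧) (λ y → ⟦ linear? k' r' y ⟧))) (ℕP.*-mono-≤ (linear-count k r) (linear-count k' r'))

      g₀≤G : g₀ ℕ.≤ G
      g₀≤G = coset-count μ nμ (λ x → Z? (value μ x)) λ x y _ _ p p' → Z₂ 1ℤ (- 1ℤ) p p' (lem (value μ x) (value μ y))
        where lem : ∀ x y → x - y ≡ 1ℤ * x + - 1ℤ * y
              lem = solve-∀

      g₀≤T : g₀ ℕ.≤ T
      g₀≤T = ℕP.≤-trans (ℕP.≤-reflexive (trans (∑-× (range T) (range T) (λ x → ⟦ Z? (value μ x) ⟧)) (∑-swap (range T) (range T) (λ c c' → ⟦ Z? (value μ (c , c')) ⟧))))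
        (ℕP.≤-trans (∑-bound (range T) 1 λ c' _ → count≤1 (λ c → Z? (value μ (c , c'))) (range T) (range-unique T) λ c d mc md p p' → entry-≡ (proj₂ (range-∈ mc)) (proj₂ (range-∈ md)) (Z₂ 1ℤ (- 1ℤ) p p' (lem (+ c) (+ d) (μ * + c'))))
          (ℕP.≤-reflexive (trans (ℕP.*-identityʳ _) (length-range T))))
        where lem : ∀ c d m → c - d ≡ 1ℤ * (c - m) + - 1ℤ * (d - m)
              lem = solve-∀

      -- The cases of a vanishing cross product: in `K₀` the first vector is zero; in the others a
      -- named coordinate of it is a unit, and then the matching coordinate of the second vector
      -- determines the remaining two by linear equations.
      K₀ K₁ K₂ K₃ : ℕ × ℕ → ℕ × ℕ → ℕ × ℕ → ℕ × ℕ → ℕ × ℕ → ℕ × ℕ → ℕ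
      K₀ x₁ x₂ x₃ y₁ y₂ y₃ = ⟦ Z? (value μ x₁) ⟧ ℕ.* (⟦ Z? (value μ x₂) ⟧ ℕ.* ⟦ Z? (value μ x₃) ⟧)
      K₁ x₁ x₂ x₃ y₁ y₂ y₃ = ⟦ linear? (value μ x₁) (value μ x₂ * value μ y₁) y₂ ⟧ ℕ.* ⟦ linear? (value μ x₁) (value μ x₃ * value μ y₁) y₃ ⟧
      K₂ x₁ x₂ x₃ y₁ y₂ y₃ = ⟦ linear? (value μ x₂) (value μ x₁ * value μ y₂) y₁ ⟧ ℕ.* ⟦ linear? (value μ x₂) (value μ x₃ * value μ y₂) y₃ ⟧
      K₃ x₁ x₂ x₃ y₁ y₂ y₃ = ⟦ linear? (value μ x₃) (value μ x₁ * value μ y₃) y₁ ⟧ ℕ.* ⟦ linear? (value μ x₃) (value μ x₂ * value μ y₃) y₂ ⟧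

      cover : ∀ x₁ x₂ x₃ y₁ y₂ y₃ → ⟦ cross? μ (x₁ , x₂ , x₃ , y₁ , y₂ , y₃) ⟧ ℕ.≤ K₀ x₁ x₂ x₃ y₁ y₂ y₃ ℕ.+ (K₁ x₁ x₂ x₃ y₁ y₂ y₃ ℕ.+ (K₂ x₁ x₂ x₃ y₁ y₂ y₃ ℕ.+ K₃ x₁ x₂ x₃ y₁ y₂ y₃))
      cover x₁ x₂ x₃ y₁ y₂ y₃ = ⟦⟧-≤ (cross? μ (x₁ , x₂ , x₃ , y₁ , y₂ , y₃)) λ z → split z (Z? (value μ x₁)) (Z? (value μ x₂)) (Z? (value μ x₃))
        where
          neg : ∀ a b c d → a * b - c * d ≡ - 1ℤ * (c * d - a * b)
          neg = solve-∀
          C = Zⱽ (v3 (value μ x₁) (value μ x₂) (value μ x₃) ×ᵥ v3 (value μ y₁) (value μ y₂) (value μ y₃))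
          product : ∀ {P Q : Set} (p : Dec P) (r : Dec Q) → P → Q → 1 ℕ.≤ ⟦ p ⟧ ℕ.* ⟦ r ⟧
          product p r x y = ℕP.*-mono-≤ (⟦⟧-1≤ p x) (⟦⟧-1≤ r y)
          flip : ∀ {a b c d} → Z (a * b - c * d) → Z (c * d - a * b)
          flip {a} {b} {c} {d} z = Z₁ (- 1ℤ) z (neg c d a b)
          u₁ = value μ x₁
          u₂ = value μ x₂
          u₃ = value μ x₃
          w₁ = value μ y₁
          w₂ = value μ y₂
          w₃ = value μ y₃
          split : C → Dec (Z (value μ x₁)) → Dec (Z (value μ x₂)) → Dec (Z (value μ x₃)) →
            1 ℕ.≤ K₀ x₁ x₂ x₃ y₁ y₂ y₃ ℕ.+ (K₁ x₁ x₂ x₃ y₁ y₂ y₃ ℕ.+ (K₂ x₁ x₂ x₃ y₁ y₂ y₃ ℕ.+ K₃ x₁ x₂ x₃ y₁ y₂ y₃))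
          split z (no n₁) _ _ = ℕP.≤-trans (product (linear? u₁ (u₂ * w₁) y₂) (linear? u₁ (u₃ * w₁) y₃) (n₁ , zz z) (n₁ , flip {u₃} {w₁} {u₁} {w₃} (zy z))) (ℕP.≤-trans (ℕP.m≤m+n _ _) (ℕP.m≤n+m _ (K₀ x₁ x₂ x₃ y₁ y₂ y₃)))
          split z (yes _) (no n₂) _ = ℕP.≤-trans (product (linear? u₂ (u₁ * w₂) y₁) (linear? u₂ (u₃ * w₂) y₃) (n₂ , flip {u₁} {w₂} {u₂} {w₁} (zz z)) (n₂ , zx z))
             (ℕP.≤-trans (ℕP.m≤m+n _ _) (ℕP.≤-trans (ℕP.m≤n+m _ (K₁ x₁ x₂ x₃ y₁ y₂ y₃)) (ℕP.m≤n+m _ (K₀ x₁ x₂ x₃ y₁ y₂ y₃))))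
          split z (yes _) (yes _) (no n₃) = ℕP.≤-trans (product (linear? u₃ (u₁ * w₃) y₁) (linear? u₃ (u₂ * w₃) y₂) (n₃ , zy z) (n₃ , flip {u₂} {w₃} {u₃} {w₂} (zx z)))
             (ℕP.≤-trans (ℕP.m≤n+m _ (K₂ x₁ x₂ x₃ y₁ y₂ y₃)) (ℕP.≤-trans (ℕP.m≤n+m _ (K₁ x₁ x₂ x₃ y₁ y₂ y₃)) (ℕP.m≤n+m _ (K₀ x₁ x₂ x₃ y₁ y₂ y₃))))
          split z (yes z₁) (yes z₂) (yes z₃) = ℕP.≤-trans (ℕP.*-mono-≤ (⟦⟧-1≤ (Z? u₁) z₁) (ℕP.*-mono-≤ (⟦⟧-1≤ (Z? u₂) z₂) (⟦⟧-1≤ (Z? u₃) z₃))) (ℕP.m≤m+n _ _)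

      ∑₆ : (ℕ × ℕ → ℕ × ℕ → ℕ × ℕ → ℕ × ℕ → ℕ × ℕ → ℕ × ℕ → ℕ) → ℕ
      ∑₆ F = ∑ₚ λ x₁ → ∑ₚ λ x₂ → ∑ₚ λ x₃ → ∑ₚ λ y₁ → ∑ₚ λ y₂ → ∑ₚ λ y₃ → F x₁ x₂ x₃ y₁ y₂ y₃

      ∑₆-+ : ∀ F F' → ∑₆ (λ x₁ x₂ x₃ y₁ y₂ y₃ → F x₁ x₂ x₃ y₁ y₂ y₃ ℕ.+ F' x₁ x₂ x₃ y₁ y₂ y₃) ≡ ∑₆ F ℕ.+ ∑₆ F'
      ∑₆-+ F F' = add λ x₁ → add λ x₂ → add λ x₃ → add λ y₁ → add λ y₂ → ∑-+ pairs (F x₁ x₂ x₃ y₁ y₂) (F' x₁ x₂ x₃ y₁ y₂)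
        where
          add : ∀ {f g h : ℕ × ℕ → ℕ} → (∀ x → f x ≡ g x ℕ.+ h x) → ∑ₚ f ≡ ∑ₚ g ℕ.+ ∑ₚ h
          add {f} {g} {h} e = trans (∑-cong pairs λ x _ → e x) (∑-+ pairs g h)

      B : ℕ
      B = M ℕ.* (M ℕ.* (M ℕ.* (M ℕ.* (G ℕ.* G))))

      ∑K₁ : ∑₆ K₁ ℕ.≤ B
      ∑K₁ = ∑ₚ-bound _ λ x₁ → ∑ₚ-bound _ λ x₂ → ∑ₚ-bound _ λ x₃ → ∑ₚ-bound _ λ y₁ → two-linear (value μ x₁) (value μ x₂ * value μ y₁) (value μ x₁) (value μ x₃ * value μ y₁)

      ∑K₂ : ∑₆ K₂ ℕ.≤ B
      ∑K₂ = ∑ₚ-bound _ λ x₁ → ∑ₚ-bound _ λ x₂ → ∑ₚ-bound _ λ x₃ → ℕP.≤-trans (ℕP.≤-reflexive (∑-swap pairs pairs (λ y₁ y₂ → ∑ₚ λ y₃ → K₂ x₁ x₂ x₃ y₁ y₂ y₃)))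
        (∑ₚ-bound _ λ y₂ → two-linear (value μ x₂) (value μ x₁ * value μ y₂) (value μ x₂) (value μ x₃ * value μ y₂))

      ∑K₃ : ∑₆ K₃ ℕ.≤ B
      ∑K₃ = ∑ₚ-bound _ λ x₁ → ∑ₚ-bound _ λ x₂ → ∑ₚ-bound _ λ x₃ → ℕP.≤-trans (ℕP.≤-reflexive (trans (∑-cong pairs λ y₁ _ → ∑-swap pairs pairs (λ y₂ y₃ → K₃ x₁ x₂ x₃ y₁ y₂ y₃)) (∑-swap pairs pairs (λ y₁ y₃ → ∑ₚ λ y₂ → K₃ x₁ x₂ x₃ y₁ y₂ y₃))))
        (∑ₚ-bound _ λ y₃ → two-linear (value μ x₃) (value μ x₁ * value μ y₃) (value μ x₃) (value μ x₂ * value μ y₃))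

      -- Of the three vanishing conditions two are charged with `G` and the third with `T`, at most
      -- `T²`. This brings the case to the same bound `B` as the others.
      ∑K₀ : ∑₆ K₀ ℕ.≤ B
      ∑K₀ = begin
        ∑₆ K₀ ≤⟨ ∑-mono pairs (λ x₁ _ → ∑-mono pairs λ x₂ _ → ∑-mono pairs λ x₃ _ → ∑ₚ-bound (M ℕ.* (M ℕ.* I₃ x₁ x₂ x₃)) λ _ → ∑ₚ-bound (M ℕ.* I₃ x₁ x₂ x₃) λ _ → ∑ₚ-bound (I₃ x₁ x₂ x₃) λ _ → ℕP.≤-refl) ⟩
        (∑ₚ λ x₁ → ∑ₚ λ x₂ → ∑ₚ λ x₃ → M ℕ.* (M ℕ.* (M ℕ.* I₃ x₁ x₂ x₃))) ≡⟨ ∑-cong pairs (λ x₁ _ → ∑-cong pairs λ x₂ _ → ∑-cong pairs λ x₃ _ → e₁ M (I x₁) (I x₂) (I x₃)) ⟩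
        (∑ₚ λ x₁ → ∑ₚ λ x₂ → ∑ₚ λ x₃ → M ℕ.* (M ℕ.* M) ℕ.* I x₁ ℕ.* I x₂ ℕ.* I x₃) ≡⟨ ∑-cong pairs (λ x₁ _ → ∑-product pairs pairs (λ x₂ → M ℕ.* (M ℕ.* M) ℕ.* I x₁ ℕ.* I x₂) I) ⟩
        (∑ₚ λ x₁ → ∑ₚ (λ x₂ → M ℕ.* (M ℕ.* M) ℕ.* I x₁ ℕ.* I x₂) ℕ.* g₀) ≡⟨ trans (∑-*ʳ pairs g₀ (λ x₁ → ∑ₚ (λ x₂ → M ℕ.* (M ℕ.* M) ℕ.* I x₁ ℕ.* I x₂))) (cong (ℕ._* g₀) (trans (∑-product pairs pairs (λ x₁ → M ℕ.* (M ℕ.* M) ℕ.* I x₁) I) (cong (ℕ._* g₀) (∑-*ˡ pairs (M ℕ.* (M ℕ.* M)) I)))) ⟩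
        M ℕ.* (M ℕ.* M) ℕ.* g₀ ℕ.* g₀ ℕ.* g₀ ≤⟨ ℕP.*-mono-≤ (ℕP.*-mono-≤ (ℕP.*-monoʳ-≤ (M ℕ.* (M ℕ.* M)) (ℕP.≤-trans g₀≤T (T≤M T))) g₀≤G) g₀≤G ⟩
        M ℕ.* (M ℕ.* M) ℕ.* M ℕ.* G ℕ.* G ≡⟨ e₂ M G ⟩
        B ∎
        where
          open ℕP.≤-Reasoning
          I : ℕ × ℕ → ℕ
          I x = ⟦ Z? (value μ x) ⟧
          I₃ : ℕ × ℕ → ℕ × ℕ → ℕ × ℕ → ℕ
          I₃ x₁ x₂ x₃ = I x₁ ℕ.* (I x₂ ℕ.* I x₃)
          e₁ : ∀ m x y z → m ℕ.* (m ℕ.* (m ℕ.* (x ℕ.* (y ℕ.* z)))) ≡ m ℕ.* (m ℕ.* m) ℕ.* x ℕ.* y ℕ.* z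
          e₁ = solveℕ-∀
          e₂ : ∀ m g → m ℕ.* (m ℕ.* m) ℕ.* m ℕ.* g ℕ.* g ≡ m ℕ.* (m ℕ.* (m ℕ.* (m ℕ.* (g ℕ.* g))))
          e₂ = solveℕ-∀
          T≤M : ∀ T → T ℕ.≤ T ℕ.* T
          T≤M zero = z≤n
          T≤M (suc T) = ℕP.m≤m*n (suc T) (suc T)

      cross-count : ∑ sextuples (λ x → ⟦ cross? μ x ⟧) ℕ.≤ 4 ℕ.* B
      cross-count = begin
        ∑ sextuples (λ x → ⟦ cross? μ x ⟧) ≡⟨ sextuples-sum (λ x → ⟦ cross? μ x ⟧) ⟩
        ∑₆ (λ x₁ x₂ x₃ y₁ y₂ y₃ → ⟦ cross? μ (x₁ , x₂ , x₃ , y₁ , y₂ , y₃) ⟧) ≤⟨ ∑-mono pairs (λ x₁ _ → ∑-mono pairs λ x₂ _ → ∑-mono pairs λ x₃ _ → ∑-mono pairs λ y₁ _ → ∑-mono pairs λ y₂ _ → ∑-mono pairs λ y₃ _ → cover x₁ x₂ x₃ y₁ y₂ y₃) ⟩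
        ∑₆ (λ x₁ x₂ x₃ y₁ y₂ y₃ → K₀ x₁ x₂ x₃ y₁ y₂ y₃ ℕ.+ (K₁ x₁ x₂ x₃ y₁ y₂ y₃ ℕ.+ (K₂ x₁ x₂ x₃ y₁ y₂ y₃ ℕ.+ K₃ x₁ x₂ x₃ y₁ y₂ y₃)))
          ≡⟨ trans (∑₆-+ K₀ (λ x₁ x₂ x₃ y₁ y₂ y₃ → K₁ x₁ x₂ x₃ y₁ y₂ y₃ ℕ.+ (K₂ x₁ x₂ x₃ y₁ y₂ y₃ ℕ.+ K₃ x₁ x₂ x₃ y₁ y₂ y₃))) (cong (∑₆ K₀ ℕ.+_) (trans (∑₆-+ K₁ (λ x₁ x₂ x₃ y₁ y₂ y₃ → K₂ x₁ x₂ x₃ y₁ y₂ y₃ ℕ.+ K₃ x₁ x₂ x₃ y₁ y₂ y₃)) (cong (∑₆ K₁ ℕ.+_) (∑₆-+ K₂ K₃)))) ⟩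
        ∑₆ K₀ ℕ.+ (∑₆ K₁ ℕ.+ (∑₆ K₂ ℕ.+ ∑₆ K₃)) ≤⟨ ℕP.+-mono-≤ ∑K₀ (ℕP.+-mono-≤ ∑K₁ (ℕP.+-mono-≤ ∑K₂ ∑K₃)) ⟩
        B ℕ.+ (B ℕ.+ (B ℕ.+ B)) ≡⟨ four B ⟩
        4 ℕ.* B ∎
        where
          open ℕP.≤-Reasoning
          four : ∀ b → b ℕ.+ (b ℕ.+ (b ℕ.+ b)) ≡ 4 ℕ.* b
          four = solveℕ-∀

    pair-up : Tuple × Tuple → Sextuple
    pair-up (((a , b , s) , (c , d , t)) , ((a' , b' , s') , (c' , d' , t'))) = (a , a') , (b , b') , (s , s') , (c , c') , (d , d') , (t , t')

    pair-up-injective : ∀ x y → pair-up x ≡ pair-up y → x ≡ y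
    pair-up-injective (((a , b , s) , (c , d , t)) , ((a' , b' , s') , (c' , d' , t'))) _ refl = refl

    pair-up-∈ : ∀ x → x ∈ cartesianProduct (tuples T) (tuples T) → pair-up x ∈ sextuples
    pair-up-∈ (((a , b , s) , (c , d , t)) , ((a' , b' , s') , (c' , d' , t'))) m =
        ∈-cartesianProduct⁺ (pr₂ (e₁ ω) (e₁ ω')) (∈-cartesianProduct⁺ (pr₂ (e₂ ω) (e₂ ω')) (∈-cartesianProduct⁺ (pr₂ (e₃ ω) (e₃ ω')) (∈-cartesianProduct⁺ (pr₂ (e₄ ω) (e₄ ω')) (∈-cartesianProduct⁺ (pr₂ (e₅ ω) (e₅ ω')) (pr₂ (e₆ ω) (e₆ ω'))))))
      where
        pr₂ : ∀ {x y} → x ∈ range T → y ∈ range T → (x , y) ∈ pairs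
        pr₂ = ∈-cartesianProduct⁺
        D = cartesianProduct (range T) (range T)
        Tr = cartesianProduct (range T) D
        ω = proj₁ (∈-cartesianProduct⁻ (tuples T) (tuples T) m)
        ω' = proj₂ (∈-cartesianProduct⁻ (tuples T) (tuples T) m)
        module _ {a b s c d t : ℕ} (m : ((a , b , s) , (c , d , t)) ∈ tuples T) where
          left = proj₁ (∈-cartesianProduct⁻ Tr Tr m)
          right = proj₂ (∈-cartesianProduct⁻ Tr Tr m)
          e₁ = proj₁ (∈-cartesianProduct⁻ (range T) D left)
          e₂ = proj₁ (∈-cartesianProduct⁻ (range T) (range T) (proj₂ (∈-cartesianProduct⁻ (range T) D left)))
          e₃ = proj₂ (∈-cartesianProduct⁻ (range T) (range T) (proj₂ (∈-cartesianProduct⁻ (range T) D left)))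
          e₄ = proj₁ (∈-cartesianProduct⁻ (range T) D right)
          e₅ = proj₁ (∈-cartesianProduct⁻ (range T) (range T) (proj₂ (∈-cartesianProduct⁻ (range T) D right)))
          e₆ = proj₂ (∈-cartesianProduct⁻ (range T) (range T) (proj₂ (∈-cartesianProduct⁻ (range T) D right)))

  -- For fixed `μ`, four of the six pairs of corresponding entries are free and two are confined to
  -- cosets, in each of four cases. Summing the squared coset bounds over `μ` uses `coset-bound²`.
  bad-count : ∑ (tuples T) (λ ω → ∑ (tuples T) λ ω' → ∑ units λ μ → ⟦ bad? μ ω ω' ⟧) ℕ.≤ 4 ℕ.* (T ℕ.* T ℕ.* (T ℕ.* T ℕ.* (T ℕ.* T ℕ.* (T ℕ.* T ℕ.* (3 ℕ.* q ℕ.+ 24 ℕ.* proportional-count T)))))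
  bad-count = begin
    ∑ Ω (λ ω → ∑ Ω λ ω' → ∑ units λ μ → ⟦ bad? μ ω ω' ⟧) ≡⟨ ∑-cong Ω (λ ω _ → ∑-swap Ω units (λ ω' μ → ⟦ bad? μ ω ω' ⟧)) ⟩
    ∑ Ω (λ ω → ∑ units λ μ → ∑ Ω λ ω' → ⟦ bad? μ ω ω' ⟧) ≡⟨ ∑-swap Ω units (λ ω μ → ∑ Ω λ ω' → ⟦ bad? μ ω ω' ⟧) ⟩
    ∑ units (λ μ → ∑ Ω λ ω → ∑ Ω λ ω' → ⟦ bad? μ ω ω' ⟧) ≤⟨ ∑-mono units (λ μ mμ → each μ (proj₂ (∈-filter⁻ (λ μ → ¬? (Z? μ)) {xs = residues} mμ))) ⟩
    ∑ units (λ μ → 4 ℕ.* (M ℕ.* (M ℕ.* (M ℕ.* (M ℕ.* (coset-bound μ ℕ.* coset-bound μ)))))) ≡⟨ ∑-cong units (λ μ _ → assoc M (coset-bound μ ℕ.* coset-bound μ)) ⟩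
    ∑ units (λ μ → 4 ℕ.* (M ℕ.* (M ℕ.* (M ℕ.* M))) ℕ.* (coset-bound μ ℕ.* coset-bound μ)) ≡⟨ ∑-*ˡ units (4 ℕ.* (M ℕ.* (M ℕ.* (M ℕ.* M)))) (λ μ → coset-bound μ ℕ.* coset-bound μ) ⟩
    4 ℕ.* (M ℕ.* (M ℕ.* (M ℕ.* M))) ℕ.* ∑ units (λ μ → coset-bound μ ℕ.* coset-bound μ) ≤⟨ ℕP.*-monoʳ-≤ (4 ℕ.* (M ℕ.* (M ℕ.* (M ℕ.* M)))) (ℕP.≤-trans (∑-injection units (λ μ → μ) (λ μ → coset-bound μ ℕ.* coset-bound μ) (Unique.filter⁺ (λ μ → ¬? (Z? μ)) residues-unique) (λ μ m → proj₁ (∈-filter⁻ (λ μ → ¬? (Z? μ)) {xs = residues} m)) (λ _ _ _ _ e → e)) coset-bound²) ⟩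
    4 ℕ.* (M ℕ.* (M ℕ.* (M ℕ.* M))) ℕ.* (3 ℕ.* q ℕ.+ 24 ℕ.* proportional-count T) ≡⟨ sym (assoc M (3 ℕ.* q ℕ.+ 24 ℕ.* proportional-count T)) ⟩
    4 ℕ.* (M ℕ.* (M ℕ.* (M ℕ.* (M ℕ.* (3 ℕ.* q ℕ.+ 24 ℕ.* proportional-count T))))) ∎
    where
      open ℕP.≤-Reasoning
      Ω = tuples T
      assoc : ∀ m g → 4 ℕ.* (m ℕ.* (m ℕ.* (m ℕ.* (m ℕ.* g)))) ≡ 4 ℕ.* (m ℕ.* (m ℕ.* (m ℕ.* m))) ℕ.* g
      assoc = solveℕ-∀
      each : ∀ μ → ¬ Z μ → ∑ Ω (λ ω → ∑ Ω λ ω' → ⟦ bad? μ ω ω' ⟧) ℕ.≤ 4 ℕ.* (M ℕ.* (M ℕ.* (M ℕ.* (M ℕ.* (coset-bound μ ℕ.* coset-bound μ)))))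
      each μ nμ = ℕP.≤-trans (ℕP.≤-reflexive (sym (∑-× Ω Ω (λ p → ⟦ bad? μ (proj₁ p) (proj₂ p) ⟧)))) (ℕP.≤-trans
        (count-injection (λ p → bad? μ (proj₁ p) (proj₂ p)) (cross? μ) (cartesianProduct Ω Ω) pair-up (Unique.cartesianProduct⁺ (tuples-unique T) (tuples-unique T))
          (λ { x@(((a , b , s) , (c , d , t)) , ((a' , b' , s') , (c' , d' , t'))) m z → pair-up-∈ x m , z }) (λ x y _ _ _ _ → pair-up-injective x y)) (cross-count μ nμ))

-- Density of coprime pairs

∑-range-ones : ∀ T → ∑ (range T) (λ _ → 1) ≡ T
∑-range-ones T = trans (∑-const (range T) 1) (trans (ℕP.*-identityʳ _) (length-range T))

-- telescoping 1/k² ≤ 1/(k-1) - 1/k, cleared of denominators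
tail-squares : ∀ T k → 2 ℕ.* (2 ℕ.+ k) ℕ.* ∑ (range k) (λ i → (T ÷ (2 ℕ.+ i)) ℕ.* (T ÷ (2 ℕ.+ i))) ℕ.+ 2 ℕ.* (T ℕ.* T) ℕ.≤ (2 ℕ.+ k) ℕ.* (T ℕ.* T)
tail-squares T zero = ℕP.≤-refl
tail-squares T (suc k) = ℕP.*-cancelˡ-≤ (2 ℕ.+ k) (ℕP.+-cancelʳ-≤ (2 ℕ.* suc n ℕ.* A) _ _ (begin
  n ℕ.* (2 ℕ.* (2 ℕ.+ suc k) ℕ.* ∑ (range (suc k)) F ℕ.+ 2 ℕ.* A) ℕ.+ 2 ℕ.* suc n ℕ.* A ≡⟨ cong₂ (λ m s → n ℕ.* (2 ℕ.* m ℕ.* s ℕ.+ 2 ℕ.* A) ℕ.+ 2 ℕ.* suc n ℕ.* A) (ℕP.+-suc 2 k) (trans (∑-range-suc k F) (cong (λ y → S ℕ.+ y ℕ.* y) (cong (T ÷_) (ℕP.+-suc 2 k)))) ⟩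
  n ℕ.* (2 ℕ.* suc n ℕ.* (S ℕ.+ x ℕ.* x) ℕ.+ 2 ℕ.* A) ℕ.+ 2 ℕ.* suc n ℕ.* A ≡⟨ e₁ n S (x ℕ.* x) A ⟩
  suc n ℕ.* (2 ℕ.* n ℕ.* S ℕ.+ 2 ℕ.* A) ℕ.+ 2 ℕ.* (n ℕ.* suc n ℕ.* (x ℕ.* x)) ℕ.+ 2 ℕ.* n ℕ.* A ≤⟨ ℕP.+-monoˡ-≤ (2 ℕ.* n ℕ.* A) (ℕP.+-mono-≤ (ℕP.*-monoʳ-≤ (suc n) (tail-squares T k)) (ℕP.*-monoʳ-≤ 2 small)) ⟩
  suc n ℕ.* (n ℕ.* A) ℕ.+ 2 ℕ.* A ℕ.+ 2 ℕ.* n ℕ.* A ≡⟨ e₂ n A ⟩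
  n ℕ.* (suc n ℕ.* A) ℕ.+ 2 ℕ.* suc n ℕ.* A ≡⟨ cong (λ m → n ℕ.* (m ℕ.* A) ℕ.+ 2 ℕ.* suc n ℕ.* A) (sym (ℕP.+-suc 2 k)) ⟩
  n ℕ.* ((2 ℕ.+ suc k) ℕ.* A) ℕ.+ 2 ℕ.* suc n ℕ.* A ∎))
  where
    open ℕP.≤-Reasoning
    F : ℕ → ℕ
    F i = (T ÷ (2 ℕ.+ i)) ℕ.* (T ÷ (2 ℕ.+ i))
    n A S x : ℕ
    n = 2 ℕ.+ k
    A = T ℕ.* T
    S = ∑ (range k) F
    x = T ÷ suc n
    e₁ : ∀ n s y a → n ℕ.* (2 ℕ.* (1 ℕ.+ n) ℕ.* (s ℕ.+ y) ℕ.+ 2 ℕ.* a) ℕ.+ 2 ℕ.* (1 ℕ.+ n) ℕ.* a ≡ (1 ℕ.+ n) ℕ.* (2 ℕ.* n ℕ.* s ℕ.+ 2 ℕ.* a) ℕ.+ 2 ℕ.* (n ℕ.* (1 ℕ.+ n) ℕ.* y) ℕ.+ 2 ℕ.* n ℕ.* a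
    e₁ = solveℕ-∀
    e₂ : ∀ n a → (1 ℕ.+ n) ℕ.* (n ℕ.* a) ℕ.+ 2 ℕ.* a ℕ.+ 2 ℕ.* n ℕ.* a ≡ n ℕ.* ((1 ℕ.+ n) ℕ.* a) ℕ.+ 2 ℕ.* (1 ℕ.+ n) ℕ.* a
    e₂ = solveℕ-∀
    e₃ : ∀ m x → m ℕ.* m ℕ.* (x ℕ.* x) ≡ m ℕ.* x ℕ.* (m ℕ.* x)
    e₃ = solveℕ-∀
    small : n ℕ.* suc n ℕ.* (x ℕ.* x) ℕ.≤ A
    small = ℕP.≤-trans (ℕP.*-monoˡ-≤ (x ℕ.* x) (ℕP.*-monoˡ-≤ (suc n) (ℕP.n≤1+n n))) (ℕP.≤-trans (ℕP.≤-reflexive (e₃ (suc n) x)) (ℕP.*-mono-≤ (*-÷-≤ T (suc n)) (*-÷-≤ T (suc n))))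

-- The term `k = 2` is at most `T² / 4`, and the terms from 3 on telescope to at most `T² / 2`.
quotient-squares : ∀ T → 2 ℕ.≤ T → 4 ℕ.* ∑ (range T) (λ k → ⟦ 2 ℕ.≤? k ⟧ ℕ.* ((T ÷ k) ℕ.* (T ÷ k))) ℕ.≤ 3 ℕ.* (T ℕ.* T)
quotient-squares T 2≤T with ℕP.m≤n⇒∃[o]m+o≡n 2≤T
... | k , refl = begin
    4 ℕ.* ∑ (range (2 ℕ.+ k)) G ≡⟨ cong (4 ℕ.*_) (∑-range-+ 2 k G) ⟩
    4 ℕ.* (∑ (range 2) G ℕ.+ ∑ (range k) (λ i → G (2 ℕ.+ i))) ≡⟨ cong₂ (λ u v → 4 ℕ.* (u ℕ.+ v)) head (∑-cong (range k) λ i _ → trans (cong (ℕ._* (y i ℕ.* y i)) (⟦⟧-yes (2 ℕ.≤? (2 ℕ.+ i)) (s≤s (s≤s z≤n)))) (ℕP.*-identityˡ (y i ℕ.* y i))) ⟩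
    4 ℕ.* (y 0 ℕ.* y 0 ℕ.+ S) ≡⟨ e₁ (y 0) S ⟩
    2 ℕ.* y 0 ℕ.* (2 ℕ.* y 0) ℕ.+ 2 ℕ.* (2 ℕ.* S) ≤⟨ ℕP.+-mono-≤ (ℕP.*-mono-≤ (*-÷-≤ U 2) (*-÷-≤ U 2)) (ℕP.*-monoʳ-≤ 2 half) ⟩
    U ℕ.* U ℕ.+ 2 ℕ.* (U ℕ.* U) ≡⟨ e₂ (U ℕ.* U) ⟩
    3 ℕ.* (U ℕ.* U) ∎
  where
    open ℕP.≤-Reasoning
    U S : ℕ
    U = 2 ℕ.+ k
    y : ℕ → ℕ
    y i = U ÷ (2 ℕ.+ i)
    S = ∑ (range k) (λ i → y i ℕ.* y i)
    G : ℕ → ℕ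
    G k = ⟦ 2 ℕ.≤? k ⟧ ℕ.* ((U ÷ k) ℕ.* (U ÷ k))
    head : ∑ (range 2) G ≡ y 0 ℕ.* y 0
    head = trans (ℕP.+-identityʳ _) (ℕP.+-identityʳ _)
    e₁ : ∀ y s → 4 ℕ.* (y ℕ.* y ℕ.+ s) ≡ 2 ℕ.* y ℕ.* (2 ℕ.* y) ℕ.+ 2 ℕ.* (2 ℕ.* s)
    e₁ = solveℕ-∀
    e₂ : ∀ a → a ℕ.+ 2 ℕ.* a ≡ 3 ℕ.* a
    e₂ = solveℕ-∀
    e₃ : ∀ u s → u ℕ.* (2 ℕ.* s) ≡ 2 ℕ.* u ℕ.* s
    e₃ = solveℕ-∀
    half : 2 ℕ.* S ℕ.≤ U ℕ.* U
    half = ℕP.*-cancelˡ-≤ U (ℕP.≤-trans (ℕP.≤-reflexive (e₃ U S)) (ℕP.≤-trans (ℕP.m≤m+n _ (2 ℕ.* (U ℕ.* U))) (tail-squares U k)))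

divisible-count : ∀ T k → 1 ℕ.≤ k → ∑ (range T) (λ b → ⟦ k ℕD.∣? b ⟧) ℕ.≤ T ÷ k
divisible-count T k 1≤k = ℕP.≤-trans (count-injection (λ b → k ℕD.∣? b) (λ _ → yes tt) (range T) {range (T ÷ k)} (_÷ k) (range-unique T)
    (λ b m kb → ∈-range (*-≤⇒≤-÷ b k 1 1≤k (ℕP.≤-trans (ℕP.≤-reflexive (ℕP.*-identityʳ k)) (ℕD.∣⇒≤ {{ℕ.>-nonZero (proj₁ (range-∈ m))}} kb))) (mono b (proj₂ (range-∈ m))) , tt)
    (λ b c _ _ kb kc e → trans (sym (exact b kb)) (trans (cong (k ℕ.*_) e) (exact c kc))))
  (ℕP.≤-reflexive (∑-range-ones (T ÷ k)))
  where
    mono : ∀ b → b ℕ.≤ T → b ÷ k ℕ.≤ T ÷ k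
    mono b le = *-≤⇒≤-÷ T k (b ÷ k) 1≤k (ℕP.≤-trans (*-÷-≤ b k) le)
    exact' : ∀ b k → 1 ℕ.≤ k → k ℕD.∣ b → k ℕ.* (b ÷ k) ≡ b
    exact' b (suc k) _ d = trans (ℕP.*-comm (suc k) (b ÷ suc k)) (m/n*n≡m d)
    exact : ∀ b → k ℕD.∣ b → k ℕ.* (b ÷ k) ≡ b
    exact b = exact' b k 1≤k

-- A pair that is not coprime shares some divisor `k ≥ 2`, and at most `(T ÷ k)²` pairs share a
-- given one. By `quotient-squares` these exhaust at most three quarters.
coprime-count : ∀ T → 2 ℕ.≤ T → T ℕ.* T ℕ.≤ 4 ℕ.* ∑ (range T) (λ b → ∑ (range T) λ d → ⟦ coprime? b d ⟧)
coprime-count T 2≤T = ℕP.+-cancelʳ-≤ (3 ℕ.* (T ℕ.* T)) (T ℕ.* T) _ (begin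
    T ℕ.* T ℕ.+ 3 ℕ.* (T ℕ.* T) ≡⟨ e₁ T ⟩
    4 ℕ.* (T ℕ.* T) ≡⟨ cong (4 ℕ.*_) (sym (trans (∑-const (range T) (∑ (range T) λ _ → 1)) (cong₂ ℕ._*_ (length-range T) (∑-range-ones T)))) ⟩
    4 ℕ.* ∑ (range T) (λ b → ∑ (range T) λ d → 1) ≤⟨ ℕP.*-monoʳ-≤ 4 (∑-mono (range T) λ b mb → ∑-mono (range T) λ d md → cover b d mb md) ⟩
    4 ℕ.* ∑ (range T) (λ b → ∑ (range T) λ d → ⟦ coprime? b d ⟧ ℕ.+ common b d) ≡⟨ cong (4 ℕ.*_) (trans (∑-cong (range T) λ b _ → ∑-+ (range T) (λ d → ⟦ coprime? b d ⟧) (common b)) (∑-+ (range T) (λ b → ∑ (range T) λ d → ⟦ coprime? b d ⟧) (λ b → ∑ (range T) (common b)))) ⟩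
    4 ℕ.* (C ℕ.+ ∑ (range T) (λ b → ∑ (range T) (common b))) ≡⟨ ℕP.*-distribˡ-+ 4 C _ ⟩
    4 ℕ.* C ℕ.+ 4 ℕ.* ∑ (range T) (λ b → ∑ (range T) (common b)) ≤⟨ ℕP.+-monoʳ-≤ (4 ℕ.* C) (ℕP.≤-trans (ℕP.*-monoʳ-≤ 4 common-count) (quotient-squares T 2≤T)) ⟩
    4 ℕ.* C ℕ.+ 3 ℕ.* (T ℕ.* T) ∎)
  where
    open ℕP.≤-Reasoning
    C : ℕ
    C = ∑ (range T) (λ b → ∑ (range T) λ d → ⟦ coprime? b d ⟧)
    e₁ : ∀ t → t ℕ.* t ℕ.+ 3 ℕ.* (t ℕ.* t) ≡ 4 ℕ.* (t ℕ.* t)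
    e₁ = solveℕ-∀
    term : ℕ → ℕ → ℕ → ℕ
    term b d k = ⟦ 2 ℕ.≤? k ⟧ ℕ.* (⟦ k ℕD.∣? b ⟧ ℕ.* ⟦ k ℕD.∣? d ⟧)
    common : ℕ → ℕ → ℕ
    common b d = ∑ (range T) (term b d)
    ≥2 : ∀ g → ¬ g ≡ 1 → 1 ℕ.≤ g → 2 ℕ.≤ g
    ≥2 g n 1≤g = ℕP.≤∧≢⇒< 1≤g λ e → n (sym e)
    cover : ∀ b d → b ∈ range T → d ∈ range T → 1 ℕ.≤ ⟦ coprime? b d ⟧ ℕ.+ common b d
    cover b d mb md = decide (gcd b d ℕ.≟ 1)
      where
        g∣b = gcd[m,n]∣m b d
        1≤b = proj₁ (range-∈ mb)
        g≤b : gcd b d ℕ.≤ b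
        g≤b = ℕD.∣⇒≤ {{ℕ.>-nonZero 1≤b}} g∣b
        1≤g : 1 ℕ.≤ gcd b d
        1≤g = ℕP.n≢0⇒n>0 λ g≡0 → ℕP.<⇒≢ 1≤b (sym (ℕD.0∣⇒≡0 (subst (ℕD._∣ b) g≡0 g∣b)))
        decide : Dec (gcd b d ≡ 1) → 1 ℕ.≤ ⟦ coprime? b d ⟧ ℕ.+ common b d
        decide (yes e) = ℕP.≤-trans (⟦⟧-1≤ (coprime? b d) (gcd≡1⇒coprime e)) (ℕP.m≤m+n _ _)
        decide (no n) = ℕP.≤-trans (ℕP.*-mono-≤ (⟦⟧-1≤ (2 ℕ.≤? gcd b d) (≥2 (gcd b d) n 1≤g)) (ℕP.*-mono-≤ (⟦⟧-1≤ (gcd b d ℕD.∣? b) g∣b) (⟦⟧-1≤ (gcd b d ℕD.∣? d) (gcd[m,n]∣n b d))))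
          (ℕP.≤-trans (∑-elem (range T) (term b d) (∈-range 1≤g (ℕP.≤-trans g≤b (proj₂ (range-∈ mb))))) (ℕP.m≤n+m _ ⟦ coprime? b d ⟧))
    common-count : ∑ (range T) (λ b → ∑ (range T) (common b)) ℕ.≤ ∑ (range T) (λ k → ⟦ 2 ℕ.≤? k ⟧ ℕ.* ((T ÷ k) ℕ.* (T ÷ k)))
    common-count = begin
      ∑ (range T) (λ b → ∑ (range T) λ d → ∑ (range T) (term b d)) ≡⟨ ∑-cong (range T) (λ b _ → ∑-swap (range T) (range T) (term b)) ⟩
      ∑ (range T) (λ b → ∑ (range T) λ k → ∑ (range T) λ d → term b d k) ≡⟨ ∑-swap (range T) (range T) (λ b k → ∑ (range T) λ d → term b d k) ⟩
      ∑ (range T) (λ k → ∑ (range T) λ b → ∑ (range T) λ d → term b d k) ≡⟨ ∑-cong (range T) (λ k _ → trans (∑-cong (range T) λ b _ → ∑-*ˡ (range T) ⟦ 2 ℕ.≤? k ⟧ (λ d → ⟦ k ℕD.∣? b ⟧ ℕ.* ⟦ k ℕD.∣? d ⟧)) (trans (∑-*ˡ (range T) ⟦ 2 ℕ.≤? k ⟧ (λ b → ∑ (range T) λ d → ⟦ k ℕD.∣? b ⟧ ℕ.* ⟦ k ℕD.∣? d ⟧)) (cong (⟦ 2 ℕ.≤? k ⟧ ℕ.*_) (∑-product (range T) (range T) (λ b → ⟦ k ℕD.∣? b ⟧) (λ d → ⟦ k ℕD.∣? d ⟧))))) ⟩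
      ∑ (range T) (λ k → ⟦ 2 ℕ.≤? k ⟧ ℕ.* (∑ (range T) (λ b → ⟦ k ℕD.∣? b ⟧) ℕ.* ∑ (range T) (λ d → ⟦ k ℕD.∣? d ⟧))) ≤⟨ ∑-mono (range T) (λ k mk → ℕP.*-monoʳ-≤ ⟦ 2 ℕ.≤? k ⟧ (ℕP.*-mono-≤ (divisible-count T k (proj₁ (range-∈ mk))) (divisible-count T k (proj₁ (range-∈ mk))))) ⟩
      ∑ (range T) (λ k → ⟦ 2 ℕ.≤? k ⟧ ℕ.* ((T ÷ k) ℕ.* (T ÷ k))) ∎

prime-divisor : ∀ n → 2 ℕ.≤ n → ∃[ p ] (Prime p × p ℕD.∣ n)
prime-divisor n 2≤n = from (factorise n {{ℕ.>-nonZero (ℕP.<⇒≤ 2≤n)}})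
  where
    from : PrimeFactorisation n → ∃[ p ] (Prime p × p ℕD.∣ n)
    from record { factors = [] ; isFactorisation = e } = contradiction (subst (2 ℕ.≤_) e 2≤n) λ { (s≤s ()) }
    from record { factors = p ∷ ps ; isFactorisation = e ; factorsPrime = pp ∷ _ } = p , pp , subst (p ℕD.∣_) (sym e) (ℕD.m∣m*n _)

-- Many matrices with small entries

-- With `b` and `d` in the second column, `form b d a c` and `form b d s t` are up to sign the two
-- minors of the lower rows that involve this column.
form : ℕ → ℕ → ℕ → ℕ → ℤ
form b d a c = + a * + d - + b * + c

module AtPrime (T : ℕ) (p : ℕ) .{{_ : NonZero p}} (pr : Prime p) where
  open Modular p pr

  -- Members of a single residue class modulo `p` are told apart by their quotients, which range
  -- over `0 … T ÷ p`.
  class-count : {P : ℕ → Set} (P? : ∀ n → Dec (P n)) → (∀ m n → P m → P n → Z (+ m - + n)) → ∑ (range T) (λ n → ⟦ P? n ⟧) ℕ.≤ suc (T ÷ p)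
  class-count {P} P? same = ℕP.≤-trans (count-injection P? (λ _ → yes tt) (range T) {range (suc (T ÷ p))} (λ n → suc (n ÷ p)) (range-unique T)
      (λ n m _ → ∈-range (s≤s z≤n) (s≤s (mono n (proj₂ (range-∈ m)))) , tt) (λ m n _ _ pm pn e → equal m n (same m n pm pn) (ℕP.suc-injective e)))
    (ℕP.≤-reflexive (∑-range-ones (suc (T ÷ p))))
    where
      1≤p : 1 ℕ.≤ p
      1≤p = ℕP.<⇒≤ 1<q
      mono : ∀ n → n ℕ.≤ T → n ÷ p ℕ.≤ T ÷ p
      mono n le = *-≤⇒≤-÷ T p (n ÷ p) 1≤p (ℕP.≤-trans (*-÷-≤ n p) le)
      ÷-/ : ∀ n p .{{_ : NonZero p}} → n ÷ p ≡ n ℕ./ p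
      ÷-/ n (suc p) = refl
      division : ∀ n → n ≡ n ℕ.% p ℕ.+ (n ÷ p) ℕ.* p
      division n = trans (m≡m%n+[m/n]*n n p) (cong (λ k → n ℕ.% p ℕ.+ k ℕ.* p) (sym (÷-/ n p)))
      lem : ∀ r s k → r - s ≡ 1ℤ * (r + k - (s + k))
      lem = solve-∀
      cast : ∀ n → + n ≡ + (n ℕ.% p) + + ((n ÷ p) ℕ.* p)
      cast n = trans (cong +_ (division n)) (ℤP.pos-+ (n ℕ.% p) ((n ÷ p) ℕ.* p))
      equal : ∀ m n → Z (+ m - + n) → m ÷ p ≡ n ÷ p → m ≡ n
      equal m n z e = trans (division m) (trans (cong₂ (λ r k → r ℕ.+ k ℕ.* p) same-remainder e) (sym (division n)))
        where
          same-remainder : m ℕ.% p ≡ n ℕ.% p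
          same-remainder = ℤP.+-injective (ℤP.i-j≡0⇒i≡j _ _ (Z-small _ (∣m-n∣<q (m%n<n m p) (m%n<n n p))
            (Z₁ 1ℤ z (trans (lem (+ (m ℕ.% p)) (+ (n ℕ.% p)) (+ ((m ÷ p) ℕ.* p))) (cong (1ℤ *_) (sym (cong₂ _-_ (cast m) (trans (cast n) (cong (λ k → + (n ℕ.% p) + + (k ℕ.* p)) (sym e))))))))))

  -- for coprime b, d one of the two coefficients of the form is invertible modulo p
  form-count : ∀ b d → Coprime b d → ∑ (range T) (λ a → ∑ (range T) λ c → ⟦ Z? (form b d a c) ⟧) ℕ.≤ T ℕ.* suc (T ÷ p)
  form-count b d cop = choose (Z? (+ d)) (Z? (+ b))
    where
      da : ∀ a a' b c d → d * (a - a') ≡ 1ℤ * (a * d - b * c) + - 1ℤ * (a' * d - b * c)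
      da = solve-∀
      dc : ∀ a b c c' d → b * (c - c') ≡ - 1ℤ * (a * d - b * c) + 1ℤ * (a * d - b * c')
      dc = solve-∀
      K : ℕ
      K = suc (T ÷ p)
      sized : length (range T) ℕ.* K ≡ T ℕ.* K
      sized = cong (ℕ._* K) (length-range T)
      choose : Dec (Z (+ d)) → Dec (Z (+ b)) → ∑ (range T) (λ a → ∑ (range T) λ c → ⟦ Z? (form b d a c) ⟧) ℕ.≤ T ℕ.* K
      choose (no nd) _ = ℕP.≤-trans (ℕP.≤-reflexive (∑-swap (range T) (range T) (λ a c → ⟦ Z? (form b d a c) ⟧))) (ℕP.≤-trans
        (∑-bound (range T) K λ c _ → class-count (λ a → Z? (form b d a c)) λ a a' z z' → Z-cancel (+ d) (+ a - + a') nd (Z₂ 1ℤ (- 1ℤ) z z' (da (+ a) (+ a') (+ b) (+ c) (+ d)))) (ℕP.≤-reflexive sized))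
      choose (yes _) (no nb) = ℕP.≤-trans
        (∑-bound (range T) K λ a _ → class-count (λ c → Z? (form b d a c)) λ c c' z z' → Z-cancel (+ b) (+ c - + c') nb (Z₂ (- 1ℤ) 1ℤ z z' (dc (+ a) (+ b) (+ c) (+ c') (+ d)))) (ℕP.≤-reflexive sized)
      choose (yes zd) (yes zb) = contradiction (cop (∣⇒∣ᵤ zb , ∣⇒∣ᵤ zd)) λ e → ℕP.<⇒≢ 1<q (sym e)

-- the condition that the last two rows extend to a matrix with a row (e , 0 , g) on top
Extends : Tuple → Set
Extends ((a , b , s) , (c , d , t)) = Coprime b d × Coprime ∣ form b d s t ∣ ∣ form b d a c ∣

extends? : ∀ ω → Dec (Extends ω)
extends? ((a , b , s) , (c , d , t)) = coprime? b d ×-dec coprime? ∣ form b d s t ∣ ∣ form b d a c ∣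

S₀ : ℕ → List Tuple
S₀ T = filter extends? (tuples T)

-- The hypothesis `large` lets a sixteenth of `T⁴` absorb all the sieve errors of order `L T³`.
module _ (T L : ℕ) (T<2^L : T ℕ.< 2 ℕ.^ L) (large : 16 ℕ.* (2 ℕ.* L ℕ.+ 3) ℕ.≤ T) where

  private
    2≤T : 2 ℕ.≤ T
    2≤T = ℕP.≤-trans (ℕP.≤-trans (s≤s (s≤s z≤n)) (ℕP.*-monoʳ-≤ 16 (ℕP.m≤n+m 3 (2 ℕ.* L)))) large

    1≤T : 1 ℕ.≤ T
    1≤T = ℕP.<⇒≤ 2≤T

    I : List ℕ
    I = range T

  module _ (b d : ℕ) (mb : b ∈ range T) (md : d ∈ range T) (cop : Coprime b d) where
    private
      1≤b = proj₁ (range-∈ mb)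
      b≤T = proj₂ (range-∈ mb)
      1≤d = proj₁ (range-∈ md)
      d≤T = proj₂ (range-∈ md)

      φ : ℕ → ℕ → ℤ
      φ = form b d

      good? : ∀ a c s t → Dec (Coprime ∣ φ s t ∣ ∣ φ a c ∣)
      good? a c s t = coprime? ∣ φ s t ∣ ∣ φ a c ∣

      zero? : ∀ a c → Dec (φ a c ≡ 0ℤ)
      zero? a c = φ a c ℤ.≟ 0ℤ

      term : ℕ → ℕ → ℕ → ℕ → ℕ → ℕ
      term a c s t p = ⟦ prime? p ⟧ ℕ.* (⟦ + p ∣? φ a c ⟧ ℕ.* ⟦ + p ∣? φ s t ⟧)

      Large : ℕ → ℕ → ℕ → ℕ → ℕ → Set
      Large a c s t p = (Prime p × T ℕ.< p) × ((+ p) ∣ (φ a c)) × ((+ p) ∣ (φ s t))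

      large? : ∀ a c s t p → Dec (Large a c s t p)
      large? a c s t p = (prime? p ×-dec T ℕ.<? p) ×-dec ((+ p ∣? φ a c) ×-dec (+ p ∣? φ s t))

      HasLarge : ℕ → ℕ → ℕ → ℕ → Set
      HasLarge a c s t = ¬ φ a c ≡ 0ℤ × Any (Large a c s t) (range (T ℕ.* T))

      hasLarge? : ∀ a c s t → Dec (HasLarge a c s t)
      hasLarge? a c s t = ¬? (zero? a c) ×-dec any? (large? a c s t) (range (T ℕ.* T))

      form≤ : ∀ a c → a ∈ I → c ∈ I → ∣ φ a c ∣ ℕ.≤ T ℕ.* T
      form≤ a c ma mc = ℕP.≤-trans (ℕP.≤-reflexive (cong ∣_∣ (trans (cong₂ _-_ (sym (ℤP.pos-* a d)) (sym (ℤP.pos-* b c))) (ℤP.[+m]-[+n]≡m⊖n (a ℕ.* d) (b ℕ.* c)))))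
        (ℕP.≤-trans (ℤP.∣m⊝n∣≤m⊔n (a ℕ.* d) (b ℕ.* c)) (ℕP.⊔-lub (ℕP.*-mono-≤ (proj₂ (range-∈ ma)) d≤T) (ℕP.*-mono-≤ b≤T (proj₂ (range-∈ mc)))))

      -- A common divisor above one has a prime factor. Primes up to `T` are handled by density,
      -- larger ones by uniqueness; the latter needs a nonzero value of the form, so zeros are
      -- separated first.
      cover : ∀ a c s t → a ∈ I → c ∈ I → 1 ℕ.≤ ⟦ good? a c s t ⟧ ℕ.+ (⟦ zero? a c ⟧ ℕ.+ (∑ I (term a c s t) ℕ.+ ⟦ hasLarge? a c s t ⟧))
      cover a c s t ma mc = decide (gcd ∣ φ s t ∣ ∣ φ a c ∣ ℕ.≟ 1) (zero? a c)
        where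
          g = gcd ∣ φ s t ∣ ∣ φ a c ∣
          goal : Set
          goal = 1 ℕ.≤ ⟦ good? a c s t ⟧ ℕ.+ (⟦ zero? a c ⟧ ℕ.+ (∑ I (term a c s t) ℕ.+ ⟦ hasLarge? a c s t ⟧))
          via₁ : 1 ℕ.≤ ⟦ zero? a c ⟧ ℕ.+ (∑ I (term a c s t) ℕ.+ ⟦ hasLarge? a c s t ⟧) → goal
          via₁ le = ℕP.≤-trans le (ℕP.m≤n+m _ ⟦ good? a c s t ⟧)
          via₂ : 1 ℕ.≤ ∑ I (term a c s t) ℕ.+ ⟦ hasLarge? a c s t ⟧ → goal
          via₂ le = via₁ (ℕP.≤-trans le (ℕP.m≤n+m _ ⟦ zero? a c ⟧))
          decide : Dec (g ≡ 1) → Dec (φ a c ≡ 0ℤ) → goal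
          decide (yes e) _ = ℕP.≤-trans (⟦⟧-1≤ (good? a c s t) (gcd≡1⇒coprime e)) (ℕP.m≤m+n _ _)
          decide (no _) (yes z) = via₁ (ℕP.≤-trans (⟦⟧-1≤ (zero? a c) z) (ℕP.m≤m+n _ _))
          decide (no n) (no nz) = from (prime-divisor g (ℕP.≤∧≢⇒< (ℕP.n≢0⇒n>0 λ g≡0 → nz (ℤP.∣i∣≡0⇒i≡0 (gcd[m,n]≡0⇒n≡0 ∣ φ s t ∣ g≡0))) λ e → n (sym e)))
            where
              from : ∃[ p ] (Prime p × p ℕD.∣ g) → goal
              from (p , pp , p∣g) = via₂ (size (T ℕ.<? p))
                where
                  p∣φ : (+ p) ∣ (φ a c)
                  p∣φ = ∣ᵤ⇒∣ (ℕD.∣-trans p∣g (gcd[m,n]∣n ∣ φ s t ∣ ∣ φ a c ∣))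
                  p∣φ' : (+ p) ∣ (φ s t)
                  p∣φ' = ∣ᵤ⇒∣ (ℕD.∣-trans p∣g (gcd[m,n]∣m ∣ φ s t ∣ ∣ φ a c ∣))
                  1≤p : 1 ℕ.≤ p
                  1≤p = ℕ.>-nonZero⁻¹ p {{prime⇒nonZero pp}}
                  size : Dec (T ℕ.< p) → 1 ℕ.≤ ∑ I (term a c s t) ℕ.+ ⟦ hasLarge? a c s t ⟧
                  size (no le) = ℕP.≤-trans (ℕP.*-mono-≤ (⟦⟧-1≤ (prime? p) pp) (ℕP.*-mono-≤ (⟦⟧-1≤ (+ p ∣? φ a c) p∣φ) (⟦⟧-1≤ (+ p ∣? φ s t) p∣φ')))
                    (ℕP.≤-trans (∑-elem I (term a c s t) (∈-range 1≤p (ℕP.≮⇒≥ le))) (ℕP.m≤m+n _ _))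
                  size (yes lt) = ℕP.≤-trans (⟦⟧-1≤ (hasLarge? a c s t) (nz , lose (∈-range 1≤p p≤T²) ((pp , lt) , p∣φ , p∣φ'))) (ℕP.m≤n+m _ (∑ I (term a c s t)))
                    where p≤T² : p ℕ.≤ T ℕ.* T
                          p≤T² = ℕP.≤-trans (ℕD.∣⇒≤ {{ℕ.≢-nonZero λ e → nz (ℤP.∣i∣≡0⇒i≡0 e)}} (∣⇒∣ᵤ p∣φ)) (form≤ a c ma mc)

      ∑₄ : (ℕ → ℕ → ℕ → ℕ → ℕ) → ℕ
      ∑₄ F = ∑ I λ a → ∑ I λ c → ∑ I λ s → ∑ I λ t → F a c s t

      ∑₄-+ : ∀ F G → ∑₄ (λ a c s t → F a c s t ℕ.+ G a c s t) ≡ ∑₄ F ℕ.+ ∑₄ G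
      ∑₄-+ F G = add λ a → add λ c → add λ s → ∑-+ I (F a c s) (G a c s)
        where
          add : ∀ {f g h : ℕ → ℕ} → (∀ x → f x ≡ g x ℕ.+ h x) → ∑ I f ≡ ∑ I g ℕ.+ ∑ I h
          add {f} {g} {h} e = trans (∑-cong I λ x _ → e x) (∑-+ I g h)

      I-bound : ∀ K {F : ℕ → ℕ} → (∀ x → x ∈ I → F x ℕ.≤ K) → ∑ I F ℕ.≤ T ℕ.* K
      I-bound K h = ℕP.≤-trans (∑-bound I K h) (ℕP.≤-reflexive (cong (ℕ._* K) (length-range T)))

      zeros : ∑₄ (λ a c s t → ⟦ zero? a c ⟧) ℕ.≤ T ℕ.* T ℕ.* T
      zeros = begin
        ∑₄ (λ a c s t → ⟦ zero? a c ⟧) ≡⟨ ∑-cong I (λ a _ → ∑-cong I λ c _ → trans (∑-const I _) (cong₂ ℕ._*_ (length-range T) (trans (∑-const I _) (cong (ℕ._* ⟦ zero? a c ⟧) (length-range T))))) ⟩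
        ∑ I (λ a → ∑ I λ c → T ℕ.* (T ℕ.* ⟦ zero? a c ⟧)) ≡⟨ ∑-swap I I (λ a c → T ℕ.* (T ℕ.* ⟦ zero? a c ⟧)) ⟩
        ∑ I (λ c → ∑ I λ a → T ℕ.* (T ℕ.* ⟦ zero? a c ⟧)) ≡⟨ ∑-cong I (λ c _ → trans (∑-*ˡ I T (λ a → T ℕ.* ⟦ zero? a c ⟧)) (cong (T ℕ.*_) (∑-*ˡ I T (λ a → ⟦ zero? a c ⟧)))) ⟩
        ∑ I (λ c → T ℕ.* (T ℕ.* ∑ I (λ a → ⟦ zero? a c ⟧))) ≤⟨ I-bound (T ℕ.* (T ℕ.* 1)) (λ c _ → ℕP.*-monoʳ-≤ T (ℕP.*-monoʳ-≤ T (count≤1 (λ a → zero? a c) I (range-unique T) λ a a' _ _ e e' → ℤP.+-injective (ℤP.*-cancelʳ-≡ (+ a) (+ a') (+ d) {{ℕ.>-nonZero 1≤d}} (trans (ℤP.i-j≡0⇒i≡j (+ a * + d) (+ b * + c) e) (sym (ℤP.i-j≡0⇒i≡j (+ a' * + d) (+ b * + c) e'))))))) ⟩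
        T ℕ.* (T ℕ.* (T ℕ.* 1)) ≡⟨ e₁ T ⟩
        T ℕ.* T ℕ.* T ∎
        where
          open ℕP.≤-Reasoning
          e₁ : ∀ t → t ℕ.* (t ℕ.* (t ℕ.* 1)) ≡ t ℕ.* t ℕ.* t
          e₁ = solveℕ-∀

      -- For a fixed prime the conditions on `(a , c)` and on `(s , t)` are independent, and each
      -- has at most `T (1 + T ÷ p)` solutions by `form-count`.
      small-primes : ∑₄ (λ a c s t → ∑ I (term a c s t)) ℕ.≤ T ℕ.* T ℕ.* ∑ I (λ p → ⟦ 2 ℕ.≤? p ⟧ ℕ.* (suc (T ÷ p) ℕ.* suc (T ÷ p)))
      small-primes = begin
        ∑₄ (λ a c s t → ∑ I (term a c s t)) ≡⟨ ∑-cong I (λ a _ → ∑-cong I λ c _ → trans (∑-cong I λ s _ → ∑-swap I I (term a c s)) (∑-swap I I (λ s p → ∑ I λ t → term a c s t p))) ⟩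
        ∑ I (λ a → ∑ I λ c → ∑ I λ p → ∑ I λ s → ∑ I λ t → term a c s t p) ≡⟨ trans (∑-cong I λ a _ → ∑-swap I I (λ c p → ∑ I λ s → ∑ I λ t → term a c s t p)) (∑-swap I I (λ a p → ∑ I λ c → ∑ I λ s → ∑ I λ t → term a c s t p)) ⟩
        ∑ I (λ p → ∑ I λ a → ∑ I λ c → ∑ I λ s → ∑ I λ t → term a c s t p) ≤⟨ ∑-mono I (λ p _ → at p (prime? p)) ⟩
        ∑ I (λ p → T ℕ.* T ℕ.* (⟦ 2 ℕ.≤? p ⟧ ℕ.* (suc (T ÷ p) ℕ.* suc (T ÷ p)))) ≡⟨ ∑-*ˡ I (T ℕ.* T) (λ p → ⟦ 2 ℕ.≤? p ⟧ ℕ.* (suc (T ÷ p) ℕ.* suc (T ÷ p))) ⟩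
        T ℕ.* T ℕ.* ∑ I (λ p → ⟦ 2 ℕ.≤? p ⟧ ℕ.* (suc (T ÷ p) ℕ.* suc (T ÷ p))) ∎
        where
          open ℕP.≤-Reasoning
          e₂ : ∀ t k → t ℕ.* k ℕ.* (t ℕ.* k) ≡ t ℕ.* t ℕ.* (1 ℕ.* (k ℕ.* k))
          e₂ = solveℕ-∀
          at : ∀ p → (e : Dec (Prime p)) → ∑₄ (λ a c s t → ⟦ e ⟧ ℕ.* (⟦ + p ∣? φ a c ⟧ ℕ.* ⟦ + p ∣? φ s t ⟧)) ℕ.≤ T ℕ.* T ℕ.* (⟦ 2 ℕ.≤? p ⟧ ℕ.* (suc (T ÷ p) ℕ.* suc (T ÷ p)))
          at p (no _) = ℕP.≤-trans (ℕP.≤-reflexive (trans (∑-cong I λ a _ → trans (∑-cong I λ c _ → trans (∑-cong I λ s _ → ∑-zero I) (∑-zero I)) (∑-zero I)) (∑-zero I))) z≤n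
          at p (yes pp) = begin
            ∑₄ (λ a c s t → 1 ℕ.* (⟦ + p ∣? φ a c ⟧ ℕ.* ⟦ + p ∣? φ s t ⟧)) ≡⟨ ∑-cong I (λ a _ → ∑-cong I λ c _ → trans (∑-cong I λ s _ → trans (∑-cong I λ t _ → ℕP.*-identityˡ _) (∑-*ˡ I ⟦ + p ∣? φ a c ⟧ (λ t → ⟦ + p ∣? φ s t ⟧))) (∑-*ˡ I ⟦ + p ∣? φ a c ⟧ (λ s → ∑ I λ t → ⟦ + p ∣? φ s t ⟧))) ⟩
            ∑ I (λ a → ∑ I λ c → ⟦ + p ∣? φ a c ⟧ ℕ.* F) ≡⟨ trans (∑-cong I λ a _ → ∑-*ʳ I F (λ c → ⟦ + p ∣? φ a c ⟧)) (∑-*ʳ I F (λ a → ∑ I λ c → ⟦ + p ∣? φ a c ⟧)) ⟩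
            F ℕ.* F ≤⟨ ℕP.*-mono-≤ F≤ F≤ ⟩
            T ℕ.* suc (T ÷ p) ℕ.* (T ℕ.* suc (T ÷ p)) ≡⟨ e₂ T (suc (T ÷ p)) ⟩
            T ℕ.* T ℕ.* (1 ℕ.* (suc (T ÷ p) ℕ.* suc (T ÷ p))) ≡⟨ cong (λ n → T ℕ.* T ℕ.* (n ℕ.* (suc (T ÷ p) ℕ.* suc (T ÷ p)))) (sym (⟦⟧-yes (2 ℕ.≤? p) (ℕ.nonTrivial⇒n>1 p {{prime⇒nonTrivial pp}}))) ⟩
            T ℕ.* T ℕ.* (⟦ 2 ℕ.≤? p ⟧ ℕ.* (suc (T ÷ p) ℕ.* suc (T ÷ p))) ∎
            where
              F : ℕ
              F = ∑ I λ s → ∑ I λ t → ⟦ + p ∣? φ s t ⟧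
              F≤ : F ℕ.≤ T ℕ.* suc (T ÷ p)
              F≤ = AtPrime.form-count T p {{prime⇒nonZero pp}} pp b d cop

      -- Two different primes above `T` dividing `n` would make `n` exceed `T²`.
      same-prime : ∀ {p p' n} → Prime p → Prime p' → T ℕ.< p → T ℕ.< p' → p ℕD.∣ n → p' ℕD.∣ n → 1 ℕ.≤ n → n ℕ.≤ T ℕ.* T → p ≡ p'
      same-prime {p} {p'} pp pp' lt lt' (ℕD.divides k refl) p'∣n 1≤n n≤ with euclidsLemma k p pp' p'∣n
      ... | inj₂ p'∣p = [ (λ p'≡1 → contradiction p'≡1 λ e → ℕP.<⇒≢ (ℕ.nonTrivial⇒n>1 p' {{prime⇒nonTrivial pp'}}) (sym e)) , (λ e → sym e) ]′ (prime⇒irreducible pp p'∣p)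
      ... | inj₁ (ℕD.divides j refl) = contradiction n≤ (ℕP.<⇒≱ (ℕP.<-≤-trans (ℕP.*-mono-< lt' lt) (ℕP.*-monoˡ-≤ p (ℕP.m≤n*m p' j {{ℕ.≢-nonZero λ { refl → contradiction 1≤n λ () }}}))))

      -- A nonzero value of the form at `(a , c)` has at most one prime factor above `T`. Modulo
      -- that prime `d` is a unit, so `t` determines `s`, and three free variables remain.
      large-primes : ∑₄ (λ a c s t → ⟦ hasLarge? a c s t ⟧) ℕ.≤ T ℕ.* T ℕ.* T
      large-primes = ℕP.≤-trans (I-bound _ λ a ma → I-bound _ λ c mc → ℕP.≤-trans (ℕP.≤-reflexive (∑-swap I I (λ s t → ⟦ hasLarge? a c s t ⟧))) (I-bound 1 λ t mt → count≤1 (λ s → hasLarge? a c s t) I (range-unique T) (unique a c t ma mc)))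
          (ℕP.≤-reflexive (e₁ T))
        where
          e₁ : ∀ t → t ℕ.* (t ℕ.* (t ℕ.* 1)) ≡ t ℕ.* t ℕ.* t
          e₁ = solveℕ-∀
          unique : ∀ a c t → a ∈ I → c ∈ I → ∀ s s' → s ∈ I → s' ∈ I → HasLarge a c s t → HasLarge a c s' t → s ≡ s'
          unique a c t ma mc s s' ms ms' (nz , any₁) (_ , any₂) with find any₁ | find any₂
          ... | p , _ , ((pp , lt) , pφ , pψ) | p' , _ , ((pp' , lt') , pφ' , pψ') = conclude (same-prime pp pp' lt lt' (∣⇒∣ᵤ pφ) (∣⇒∣ᵤ pφ') (ℕP.n≢0⇒n>0 λ e → nz (ℤP.∣i∣≡0⇒i≡0 e)) (form≤ a c ma mc))
            where
              conclude : p ≡ p' → s ≡ s'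
              conclude refl = ℤP.+-injective (ℤP.i-j≡0⇒i≡j (+ s) (+ s') (Z-small (+ s - + s') (∣m-n∣<q (ℕP.≤-<-trans (proj₂ (range-∈ ms)) lt) (ℕP.≤-<-trans (proj₂ (range-∈ ms')) lt))
                  (Z-cancel (+ d) (+ s - + s') (¬Z-residue (λ e → ℕP.<⇒≢ 1≤d (sym e)) (ℕP.≤-<-trans d≤T lt)) (Z₂ 1ℤ (- 1ℤ) pψ pψ' (lem (+ s) (+ s') (+ b) (+ t) (+ d))))))
                where
                  instance
                    nzp : NonZero p
                    nzp = prime⇒nonZero pp
                  open Modular p pp
                  lem : ∀ a a' b c d → d * (a - a') ≡ 1ℤ * (a * d - b * c) + - 1ℤ * (a' * d - b * c)
                  lem = solve-∀

      square-sum : 16 ℕ.* ∑ I (λ p → ⟦ 2 ℕ.≤? p ⟧ ℕ.* (suc (T ÷ p) ℕ.* suc (T ÷ p))) ℕ.≤ 12 ℕ.* (T ℕ.* T) ℕ.+ 16 ℕ.* (2 ℕ.* L ℕ.+ 1) ℕ.* T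
      square-sum = begin
        16 ℕ.* ∑ I (λ p → ⟦ 2 ℕ.≤? p ⟧ ℕ.* (suc (T ÷ p) ℕ.* suc (T ÷ p))) ≤⟨ ℕP.*-monoʳ-≤ 16 (∑-mono I λ p _ → each p (2 ℕ.≤? p)) ⟩
        16 ℕ.* ∑ I (λ p → ⟦ 2 ℕ.≤? p ⟧ ℕ.* ((T ÷ p) ℕ.* (T ÷ p)) ℕ.+ (2 ℕ.* (T ÷ p) ℕ.+ 1)) ≡⟨ cong (16 ℕ.*_) (trans (∑-+ I (λ p → ⟦ 2 ℕ.≤? p ⟧ ℕ.* ((T ÷ p) ℕ.* (T ÷ p))) (λ p → 2 ℕ.* (T ÷ p) ℕ.+ 1)) (cong (Q ℕ.+_) (trans (∑-+ I (λ p → 2 ℕ.* (T ÷ p)) (λ _ → 1)) (cong₂ ℕ._+_ (∑-*ˡ I 2 (T ÷_)) (∑-range-ones T))))) ⟩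
        16 ℕ.* (Q ℕ.+ (2 ℕ.* harmonic T ℕ.+ T)) ≡⟨ e₁ Q (harmonic T) T ⟩
        4 ℕ.* (4 ℕ.* Q) ℕ.+ 16 ℕ.* (2 ℕ.* harmonic T ℕ.+ T) ≤⟨ ℕP.+-mono-≤ (ℕP.*-monoʳ-≤ 4 (quotient-squares T 2≤T)) (ℕP.*-monoʳ-≤ 16 (ℕP.+-monoˡ-≤ T (ℕP.*-monoʳ-≤ 2 (harmonic≤ T L T<2^L)))) ⟩
        4 ℕ.* (3 ℕ.* (T ℕ.* T)) ℕ.+ 16 ℕ.* (2 ℕ.* (L ℕ.* T) ℕ.+ T) ≡⟨ e₂ T L ⟩
        12 ℕ.* (T ℕ.* T) ℕ.+ 16 ℕ.* (2 ℕ.* L ℕ.+ 1) ℕ.* T ∎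
        where
          open ℕP.≤-Reasoning
          Q : ℕ
          Q = ∑ I (λ p → ⟦ 2 ℕ.≤? p ⟧ ℕ.* ((T ÷ p) ℕ.* (T ÷ p)))
          e₁ : ∀ q h t → 16 ℕ.* (q ℕ.+ (2 ℕ.* h ℕ.+ t)) ≡ 4 ℕ.* (4 ℕ.* q) ℕ.+ 16 ℕ.* (2 ℕ.* h ℕ.+ t)
          e₁ = solveℕ-∀
          e₂ : ∀ t l → 4 ℕ.* (3 ℕ.* (t ℕ.* t)) ℕ.+ 16 ℕ.* (2 ℕ.* (l ℕ.* t) ℕ.+ t) ≡ 12 ℕ.* (t ℕ.* t) ℕ.+ 16 ℕ.* (2 ℕ.* l ℕ.+ 1) ℕ.* t
          e₂ = solveℕ-∀
          e₃ : ∀ x → 1 ℕ.* ((1 ℕ.+ x) ℕ.* (1 ℕ.+ x)) ≡ 1 ℕ.* (x ℕ.* x) ℕ.+ (2 ℕ.* x ℕ.+ 1)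
          e₃ = solveℕ-∀
          each : ∀ p (e : Dec (2 ℕ.≤ p)) → ⟦ e ⟧ ℕ.* (suc (T ÷ p) ℕ.* suc (T ÷ p)) ℕ.≤ ⟦ e ⟧ ℕ.* ((T ÷ p) ℕ.* (T ÷ p)) ℕ.+ (2 ℕ.* (T ÷ p) ℕ.+ 1)
          each p (yes _) = ℕP.≤-reflexive (e₃ (T ÷ p))
          each p (no _) = z≤n

    -- In units of `T⁴ / 16`, small primes cost 12 by `quotient-squares`, and the zeros, the large
    -- primes and the lower-order terms together cost 1. Three of sixteen remain.
    completions : 3 ℕ.* (T ℕ.* T ℕ.* (T ℕ.* T)) ℕ.≤ 16 ℕ.* (∑ (range T) λ a → ∑ (range T) λ c → ∑ (range T) λ s → ∑ (range T) λ t → ⟦ coprime? ∣ form b d s t ∣ ∣ form b d a c ∣ ⟧)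
    completions = ℕP.+-cancelʳ-≤ (13 ℕ.* T⁴) _ _ (begin
      3 ℕ.* T⁴ ℕ.+ 13 ℕ.* T⁴ ≡⟨ e₁ T⁴ ⟩
      16 ℕ.* T⁴ ≡⟨ cong (16 ℕ.*_) (sym all) ⟩
      16 ℕ.* ∑₄ (λ a c s t → 1) ≤⟨ ℕP.*-monoʳ-≤ 16 (∑-mono I λ a ma → ∑-mono I λ c mc → ∑-mono I λ s _ → ∑-mono I λ t _ → cover a c s t ma mc) ⟩
      16 ℕ.* ∑₄ (λ a c s t → ⟦ good? a c s t ⟧ ℕ.+ (⟦ zero? a c ⟧ ℕ.+ (∑ I (term a c s t) ℕ.+ ⟦ hasLarge? a c s t ⟧)))
        ≡⟨ cong (16 ℕ.*_) (trans (∑₄-+ (λ a c s t → ⟦ good? a c s t ⟧) (λ a c s t → ⟦ zero? a c ⟧ ℕ.+ (∑ I (term a c s t) ℕ.+ ⟦ hasLarge? a c s t ⟧)))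
             (cong (Gd ℕ.+_) (trans (∑₄-+ (λ a c s t → ⟦ zero? a c ⟧) (λ a c s t → ∑ I (term a c s t) ℕ.+ ⟦ hasLarge? a c s t ⟧)) (cong (∑₄ (λ a c s t → ⟦ zero? a c ⟧) ℕ.+_) (∑₄-+ (λ a c s t → ∑ I (term a c s t)) (λ a c s t → ⟦ hasLarge? a c s t ⟧)))))) ⟩
      16 ℕ.* (Gd ℕ.+ (∑₄ (λ a c s t → ⟦ zero? a c ⟧) ℕ.+ (∑₄ (λ a c s t → ∑ I (term a c s t)) ℕ.+ ∑₄ (λ a c s t → ⟦ hasLarge? a c s t ⟧)))) ≤⟨ ℕP.*-monoʳ-≤ 16 (ℕP.+-monoʳ-≤ Gd (ℕP.+-mono-≤ zeros (ℕP.+-mono-≤ small-primes large-primes))) ⟩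
      16 ℕ.* (Gd ℕ.+ (T ℕ.* T ℕ.* T ℕ.+ (T ℕ.* T ℕ.* Sq ℕ.+ T ℕ.* T ℕ.* T))) ≡⟨ e₂ Gd T Sq ⟩
      16 ℕ.* Gd ℕ.+ (T ℕ.* T ℕ.* (16 ℕ.* Sq) ℕ.+ 32 ℕ.* (T ℕ.* T ℕ.* T)) ≤⟨ ℕP.+-monoʳ-≤ (16 ℕ.* Gd) (ℕP.+-monoˡ-≤ (32 ℕ.* (T ℕ.* T ℕ.* T)) (ℕP.*-monoʳ-≤ (T ℕ.* T) square-sum)) ⟩
      16 ℕ.* Gd ℕ.+ (T ℕ.* T ℕ.* (12 ℕ.* (T ℕ.* T) ℕ.+ 16 ℕ.* (2 ℕ.* L ℕ.+ 1) ℕ.* T) ℕ.+ 32 ℕ.* (T ℕ.* T ℕ.* T)) ≡⟨ cong (16 ℕ.* Gd ℕ.+_) (e₃ T L) ⟩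
      16 ℕ.* Gd ℕ.+ (12 ℕ.* T⁴ ℕ.+ 16 ℕ.* (2 ℕ.* L ℕ.+ 3) ℕ.* (T ℕ.* T ℕ.* T)) ≤⟨ ℕP.+-monoʳ-≤ (16 ℕ.* Gd) (ℕP.+-monoʳ-≤ (12 ℕ.* T⁴) (ℕP.*-monoˡ-≤ (T ℕ.* T ℕ.* T) large)) ⟩
      16 ℕ.* Gd ℕ.+ (12 ℕ.* T⁴ ℕ.+ T ℕ.* (T ℕ.* T ℕ.* T)) ≡⟨ cong (16 ℕ.* Gd ℕ.+_) (e₄ T) ⟩
      16 ℕ.* Gd ℕ.+ 13 ℕ.* T⁴ ∎)
      where
        open ℕP.≤-Reasoning
        T⁴ Gd Sq : ℕ
        T⁴ = T ℕ.* T ℕ.* (T ℕ.* T)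
        Gd = ∑₄ (λ a c s t → ⟦ good? a c s t ⟧)
        Sq = ∑ I (λ p → ⟦ 2 ℕ.≤? p ⟧ ℕ.* (suc (T ÷ p) ℕ.* suc (T ÷ p)))
        e₁ : ∀ x → 3 ℕ.* x ℕ.+ 13 ℕ.* x ≡ 16 ℕ.* x
        e₁ = solveℕ-∀
        e₂ : ∀ g t s → 16 ℕ.* (g ℕ.+ (t ℕ.* t ℕ.* t ℕ.+ (t ℕ.* t ℕ.* s ℕ.+ t ℕ.* t ℕ.* t))) ≡ 16 ℕ.* g ℕ.+ (t ℕ.* t ℕ.* (16 ℕ.* s) ℕ.+ 32 ℕ.* (t ℕ.* t ℕ.* t))
        e₂ = solveℕ-∀
        e₃ : ∀ t l → t ℕ.* t ℕ.* (12 ℕ.* (t ℕ.* t) ℕ.+ 16 ℕ.* (2 ℕ.* l ℕ.+ 1) ℕ.* t) ℕ.+ 32 ℕ.* (t ℕ.* t ℕ.* t) ≡ 12 ℕ.* (t ℕ.* t ℕ.* (t ℕ.* t)) ℕ.+ 16 ℕ.* (2 ℕ.* l ℕ.+ 3) ℕ.* (t ℕ.* t ℕ.* t)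
        e₃ = solveℕ-∀
        e₄ : ∀ t → 12 ℕ.* (t ℕ.* t ℕ.* (t ℕ.* t)) ℕ.+ t ℕ.* (t ℕ.* t ℕ.* t) ≡ 13 ℕ.* (t ℕ.* t ℕ.* (t ℕ.* t))
        e₄ = solveℕ-∀
        all : ∑₄ (λ a c s t → 1) ≡ T⁴
        all = trans (∑-cong I λ a _ → trans (∑-cong I λ c _ → trans (∑-cong I λ s _ → ∑-range-ones T) (trans (∑-const I T) (cong (ℕ._* T) (length-range T)))) (trans (∑-const I (T ℕ.* T)) (cong (ℕ._* (T ℕ.* T)) (length-range T)))) (trans (∑-const I (T ℕ.* (T ℕ.* T))) (trans (cong (ℕ._* (T ℕ.* (T ℕ.* T))) (length-range T)) (e₅ T)))
          where e₅ : ∀ t → t ℕ.* (t ℕ.* (t ℕ.* t)) ≡ t ℕ.* t ℕ.* (t ℕ.* t)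
                e₅ = solveℕ-∀

  private
    Six : Set
    Six = (ℕ × ℕ) × ((ℕ × ℕ) × (ℕ × ℕ))

    P : List (ℕ × ℕ)
    P = cartesianProduct I I

    sixes : List Six
    sixes = cartesianProduct P (cartesianProduct P P)

    arrange : Six → Tuple
    arrange ((b , d) , ((a , c) , (s , t))) = (a , b , s) , (c , d , t)

    sixes-sum : ∀ (F : Six → ℕ) → ∑ sixes F ≡ ∑ I λ b → ∑ I λ d → ∑ I λ a → ∑ I λ c → ∑ I λ s → ∑ I λ t → F ((b , d) , ((a , c) , (s , t)))
    sixes-sum F = trans (∑-× P (cartesianProduct P P) F) (trans (∑-× I I (λ x → ∑ (cartesianProduct P P) λ r → F (x , r))) (∑-cong I λ b _ → ∑-cong I λ d _ →
      trans (∑-× P P (λ r → F ((b , d) , r))) (trans (∑-× I I (λ y → ∑ P λ z → F ((b , d) , (y , z)))) (∑-cong I λ a _ → ∑-cong I λ c _ → ∑-× I I (λ z → F ((b , d) , ((a , c) , z)))))))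

    ∑₆ : (ℕ → ℕ → ℕ → ℕ → ℕ → ℕ → ℕ) → ℕ
    ∑₆ F = ∑ I λ b → ∑ I λ d → ∑ I λ a → ∑ I λ c → ∑ I λ s → ∑ I λ t → F b d a c s t

    S₀-sum : ∑ sixes (λ x → ⟦ extends? (arrange x) ⟧) ℕ.≤ length (S₀ T)
    S₀-sum = ℕP.≤-trans (count-injection (λ x → extends? (arrange x)) extends? sixes arrange
        (Unique.cartesianProduct⁺ pu (Unique.cartesianProduct⁺ pu pu))
        (λ { ((b , d) , ((a , c) , (s , t))) m e → member m , e }) (λ { ((b , d) , ((a , c) , (s , t))) _ _ _ _ _ refl → refl }))
      (ℕP.≤-reflexive (sym (length-filter-∑ extends? (tuples T))))
      where
        pu : Unique P
        pu = Unique.cartesianProduct⁺ (range-unique T) (range-unique T)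
        member : ∀ {b d a c s t} → ((b , d) , ((a , c) , (s , t))) ∈ sixes → ((a , b , s) , (c , d , t)) ∈ tuples T
        member m = ∈-cartesianProduct⁺ (∈-cartesianProduct⁺ (proj₁ ac) (∈-cartesianProduct⁺ (proj₁ bd) (proj₁ st))) (∈-cartesianProduct⁺ (proj₂ ac) (∈-cartesianProduct⁺ (proj₂ bd) (proj₂ st)))
          where
            bd = ∈-cartesianProduct⁻ I I (proj₁ (∈-cartesianProduct⁻ P (cartesianProduct P P) m))
            rest = ∈-cartesianProduct⁻ P P (proj₂ (∈-cartesianProduct⁻ P (cartesianProduct P P) m))
            ac = ∈-cartesianProduct⁻ I I (proj₁ rest)
            st = ∈-cartesianProduct⁻ I I (proj₂ rest)

  -- A quarter of the pairs `(b , d)` are coprime, and each admits a proportion `3/16` of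
  -- completions; the resulting `3/64` is weakened to `1/64`.
  many-matrices : T ℕ.* T ℕ.* (T ℕ.* T ℕ.* (T ℕ.* T)) ℕ.≤ 64 ℕ.* length (S₀ T)
  many-matrices = ℕP.*-cancelˡ-≤ 3 (begin
    3 ℕ.* (T ℕ.* T ℕ.* T⁴) ≡⟨ e₁ (T ℕ.* T) T⁴ ⟩
    T ℕ.* T ℕ.* (3 ℕ.* T⁴) ≤⟨ ℕP.*-monoˡ-≤ (3 ℕ.* T⁴) (coprime-count T 2≤T) ⟩
    4 ℕ.* ∑ I (λ b → ∑ I λ d → ⟦ coprime? b d ⟧) ℕ.* (3 ℕ.* T⁴) ≡⟨ trans (ℕP.*-assoc 4 (∑ I (λ b → ∑ I λ d → ⟦ coprime? b d ⟧)) (3 ℕ.* T⁴)) (cong (4 ℕ.*_) (sym (trans (∑-cong I λ b _ → ∑-*ʳ I (3 ℕ.* T⁴) (λ d → ⟦ coprime? b d ⟧)) (∑-*ʳ I (3 ℕ.* T⁴) (λ b → ∑ I λ d → ⟦ coprime? b d ⟧))))) ⟩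
    4 ℕ.* ∑ I (λ b → ∑ I λ d → ⟦ coprime? b d ⟧ ℕ.* (3 ℕ.* T⁴)) ≤⟨ ℕP.*-monoʳ-≤ 4 (∑-mono I λ b mb → ∑-mono I λ d md → each b d mb md (coprime? b d)) ⟩
    4 ℕ.* ∑ I (λ b → ∑ I λ d → 16 ℕ.* H b d) ≡⟨ cong (4 ℕ.*_) (trans (∑-cong I λ b _ → ∑-*ˡ I 16 (H b)) (∑-*ˡ I 16 (λ b → ∑ I (H b)))) ⟩
    4 ℕ.* (16 ℕ.* ∑ I (λ b → ∑ I (H b))) ≡⟨ trans (sym (ℕP.*-assoc 4 16 (∑ I (λ b → ∑ I (H b))))) (cong (64 ℕ.*_) (sym (sixes-sum (λ x → ⟦ extends? (arrange x) ⟧)))) ⟩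
    64 ℕ.* ∑ sixes (λ x → ⟦ extends? (arrange x) ⟧) ≤⟨ ℕP.*-monoʳ-≤ 64 S₀-sum ⟩
    64 ℕ.* length (S₀ T) ≤⟨ ℕP.m≤n*m (64 ℕ.* length (S₀ T)) 3 ⟩
    3 ℕ.* (64 ℕ.* length (S₀ T)) ∎)
    where
      open ℕP.≤-Reasoning
      T⁴ : ℕ
      T⁴ = T ℕ.* T ℕ.* (T ℕ.* T)
      e₁ : ∀ a b → 3 ℕ.* (a ℕ.* b) ≡ a ℕ.* (3 ℕ.* b)
      e₁ = solveℕ-∀
      H : ℕ → ℕ → ℕ
      H b d = ∑ I λ a → ∑ I λ c → ∑ I λ s → ∑ I λ t → ⟦ extends? ((a , b , s) , (c , d , t)) ⟧
      each : ∀ b d → b ∈ I → d ∈ I → (e : Dec (Coprime b d)) → ⟦ e ⟧ ℕ.* (3 ℕ.* T⁴) ℕ.≤ 16 ℕ.* H b d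
      each b d mb md (no _) = z≤n
      each b d mb md (yes cop) = ℕP.≤-trans (ℕP.≤-reflexive (ℕP.*-identityˡ (3 ℕ.* T⁴))) (ℕP.≤-trans (completions b d mb md cop) (ℕP.*-monoʳ-≤ 16
        (∑-mono I λ a _ → ∑-mono I λ c _ → ∑-mono I λ s _ → ∑-mono I λ t _ → ⟦⟧-mono (coprime? ∣ form b d s t ∣ ∣ form b d a c ∣) (extends? ((a , b , s) , (c , d , t))) (cop ,_))))

-- Completing two rows to a matrix of determinant one

bézout : ∀ x y → Coprime ∣ x ∣ ∣ y ∣ → ∃[ e ] ∃[ g ] e * x + g * y ≡ 1ℤ
bézout x y cop = from (sign x) (sign y) (coprime-Bézout cop)
  where
    sign : ∀ x → ∃[ s ] + ∣ x ∣ ≡ s * x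
    sign (+ n) = 1ℤ , sym (ℤP.*-identityˡ (+ n))
    sign -[1+ n ] = - 1ℤ , sym (ℤP.-1*i≡-i -[1+ n ])
    cast : ∀ u m v n → 1 ℕ.+ v ℕ.* n ≡ u ℕ.* m → + u * + m - + v * + n ≡ 1ℤ
    cast u m v n e = trans (cong₂ _-_ (trans (sym (ℤP.pos-* u m)) (trans (cong +_ (sym e)) (ℤP.pos-+ 1 (v ℕ.* n)))) (sym (ℤP.pos-* v n))) (lem (+ (v ℕ.* n)))
      where lem : ∀ t → 1ℤ + t - t ≡ 1ℤ
            lem = solve-∀
    from : ∃[ s ] + ∣ x ∣ ≡ s * x → ∃[ t ] + ∣ y ∣ ≡ t * y → Bézout.Identity 1 ∣ x ∣ ∣ y ∣ → ∃[ e ] ∃[ g ] e * x + g * y ≡ 1ℤ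
    from (s , hs) (t , ht) (Bézout.+- u v e) = + u * s , - + v * t , trans (lem (+ u) s x (+ v) t y) (trans (cong₂ (λ a b → + u * a - + v * b) (sym hs) (sym ht)) (cast u (∣ x ∣) v (∣ y ∣) e))
      where lem : ∀ u s x v t y → u * s * x + - v * t * y ≡ u * (s * x) - v * (t * y)
            lem = solve-∀
    from (s , hs) (t , ht) (Bézout.-+ u v e) = - + u * s , + v * t , trans (lem (+ u) s x (+ v) t y) (trans (cong₂ (λ a b → + v * b - + u * a) (sym hs) (sym ht)) (cast v (∣ y ∣) u (∣ x ∣) e))
      where lem : ∀ u s x v t y → - u * s * x + v * t * y ≡ v * (t * y) - u * (s * x)
            lem = solve-∀

-- Cramer's rule with the denominator multiplied out: the coordinates of `r` in the basis `u`, `v`,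
-- `w`.
expansion : ∀ u v w r → (u ∙ (v ×ᵥ w)) ⋆ r ≡ (r ∙ (v ×ᵥ w)) ⋆ u ⊞ (r ∙ (w ×ᵥ u)) ⋆ v ⊞ (r ∙ (u ×ᵥ v)) ⋆ w
expansion (v3 a b c) (v3 d e f) (v3 g h i) (v3 x y z) = v3-≡ (lx a b c d e f g h i x y z) (ly a b c d e f g h i x y z) (lz a b c d e f g h i x y z)
  where
    lx : ∀ a b c d e f g h i x y z → (a * (e * i - f * h) + b * (f * g - d * i) + c * (d * h - e * g)) * x ≡
      (x * (e * i - f * h) + y * (f * g - d * i) + z * (d * h - e * g)) * a + (x * (h * c - i * b) + y * (i * a - g * c) + z * (g * b - h * a)) * d + (x * (b * f - c * e) + y * (c * d - a * f) + z * (a * e - b * d)) * g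
    lx = solve-∀
    ly : ∀ a b c d e f g h i x y z → (a * (e * i - f * h) + b * (f * g - d * i) + c * (d * h - e * g)) * y ≡
      (x * (e * i - f * h) + y * (f * g - d * i) + z * (d * h - e * g)) * b + (x * (h * c - i * b) + y * (i * a - g * c) + z * (g * b - h * a)) * e + (x * (b * f - c * e) + y * (c * d - a * f) + z * (a * e - b * d)) * h
    ly = solve-∀
    lz : ∀ a b c d e f g h i x y z → (a * (e * i - f * h) + b * (f * g - d * i) + c * (d * h - e * g)) * z ≡
      (x * (e * i - f * h) + y * (f * g - d * i) + z * (d * h - e * g)) * c + (x * (h * c - i * b) + y * (i * a - g * c) + z * (g * b - h * a)) * f + (x * (b * f - c * e) + y * (c * d - a * f) + z * (a * e - b * d)) * i
    lz = solve-∀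

triple-cyclic : ∀ u v w → u ∙ (v ×ᵥ w) ≡ (u ×ᵥ v) ∙ w
triple-cyclic (v3 a b c) (v3 d e f) (v3 g h i) = lem a b c d e f g h i
  where lem : ∀ a b c d e f g h i → a * (e * i - f * h) + b * (f * g - d * i) + c * (d * h - e * g) ≡ (b * f - c * e) * g + (c * d - a * f) * h + (a * e - b * d) * i
        lem = solve-∀

shift-⊥ : ∀ r u v i j → (r ⊟ i ⋆ u ⊟ j ⋆ v) ∙ (u ×ᵥ v) ≡ r ∙ (u ×ᵥ v)
shift-⊥ (v3 x y z) (v3 a b c) (v3 d e f) i j = lem x y z a b c d e f i j
  where lem : ∀ x y z a b c d e f i j → (x - i * a - j * d) * (b * f - c * e) + (y - i * b - j * e) * (c * d - a * f) + (z - i * c - j * f) * (a * e - b * d) ≡ x * (b * f - c * e) + y * (c * d - a * f) + z * (a * e - b * d)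
        lem = solve-∀

det-rows : ∀ r u v → det (rows r u v) ≡ r ∙ (u ×ᵥ v)
det-rows (v3 a b c) (v3 d e f) (v3 g h i) = lem a b c d e f g h i
  where lem : ∀ a b c d e f g h i → a * (e * i - f * h) - b * (d * i - f * g) + c * (d * h - e * g) ≡ a * (e * i - f * h) + b * (f * g - d * i) + c * (d * h - e * g)
        lem = solve-∀

abs≤square : ∀ x → ∣ x ∣ ℕ.≤ ∣ x ∣ ℕ.* ∣ x ∣
abs≤square x = go ∣ x ∣
  where go : ∀ n → n ℕ.≤ n ℕ.* n
        go zero = z≤n
        go (suc n) = ℕP.m≤m*n (suc n) (suc n)

square-abs : ∀ x → x * x ≡ + (∣ x ∣ ℕ.* ∣ x ∣)
square-abs (+ n) = sym (ℤP.pos-* n n)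
square-abs -[1+ n ] = refl

norm² : ∀ n → n ∙ n ≡ + (∣ vx n ∣ ℕ.* ∣ vx n ∣ ℕ.+ ∣ vy n ∣ ℕ.* ∣ vy n ∣ ℕ.+ ∣ vz n ∣ ℕ.* ∣ vz n ∣)
norm² (v3 x y z) = trans (cong₂ _+_ (cong₂ _+_ (square-abs x) (square-abs y)) (square-abs z)) (trans (cong (_+ + (∣ z ∣ ℕ.* ∣ z ∣)) (sym (ℤP.pos-+ (∣ x ∣ ℕ.* ∣ x ∣) (∣ y ∣ ℕ.* ∣ y ∣)))) (sym (ℤP.pos-+ _ (∣ z ∣ ℕ.* ∣ z ∣))))

record Bounded (K : ℕ) (v : V3) : Set where
  constructor bounded
  field
    bx : ∣ vx v ∣ ℕ.≤ K
    by : ∣ vy v ∣ ℕ.≤ K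
    bz : ∣ vz v ∣ ℕ.≤ K

-- Subtracting multiples of u and w brings a solution r of r ∙ (u × w) = 1 into the fundamental domain of the lattice they span.
reduce : ∀ T u w r → Bounded T u → Bounded T w → r ∙ (u ×ᵥ w) ≡ 1ℤ → ∃[ r' ] (r' ∙ (u ×ᵥ w) ≡ 1ℤ × Bounded (2 ℕ.* T ℕ.+ 1) r')
reduce T u w r (bounded ux uy uz) (bounded wx wy wz) one = r' , trans (shift-⊥ r u w i j) one , bounded
    (coordinate-bound (vx u) (vx w) (vx n) (vx r') (scaled-coordinate vx (λ _ _ → refl) (λ _ _ → refl) (λ _ _ → refl)) ux wx n-x)
    (coordinate-bound (vy u) (vy w) (vy n) (vy r') (scaled-coordinate vy (λ _ _ → refl) (λ _ _ → refl) (λ _ _ → refl)) uy wy n-y)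
    (coordinate-bound (vz u) (vz w) (vz n) (vz r') (scaled-coordinate vz (λ _ _ → refl) (λ _ _ → refl) (λ _ _ → refl)) uz wz n-z)
  where
    n : V3
    n = u ×ᵥ w
    m : ℕ
    m = ∣ vx n ∣ ℕ.* ∣ vx n ∣ ℕ.+ ∣ vy n ∣ ℕ.* ∣ vy n ∣ ℕ.+ ∣ vz n ∣ ℕ.* ∣ vz n ∣
    n-x : ∣ vx n ∣ ℕ.≤ m
    n-x = ℕP.≤-trans (abs≤square (vx n)) (ℕP.≤-trans (ℕP.m≤m+n _ (∣ vy n ∣ ℕ.* ∣ vy n ∣)) (ℕP.m≤m+n _ _))
    n-y : ∣ vy n ∣ ℕ.≤ m
    n-y = ℕP.≤-trans (abs≤square (vy n)) (ℕP.≤-trans (ℕP.m≤n+m _ (∣ vx n ∣ ℕ.* ∣ vx n ∣)) (ℕP.m≤m+n _ _))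
    n-z : ∣ vz n ∣ ℕ.≤ m
    n-z = ℕP.≤-trans (abs≤square (vz n)) (ℕP.m≤n+m _ _)
    m≢0 : ¬ m ≡ 0
    m≢0 e = contradiction (trans (sym one) (trans (cong (r ∙_) (v3-≡ (z (vx n) n-x) (z (vy n) n-y) (z (vz n) n-z))) (zero-∙ r))) λ ()
      where
        z : ∀ x → ∣ x ∣ ℕ.≤ m → x ≡ 0ℤ
        z x le = ℤP.∣i∣≡0⇒i≡0 (ℕP.n≤0⇒n≡0 (subst (λ t → ∣ x ∣ ℕ.≤ t) e le))
        zero-∙ : ∀ r → r ∙ v3 0ℤ 0ℤ 0ℤ ≡ 0ℤ
        zero-∙ (v3 x y z) = lem x y z
          where lem : ∀ x y z → x * 0ℤ + y * 0ℤ + z * 0ℤ ≡ 0ℤ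
                lem = solve-∀
    instance
      nz : NonZero m
      nz = ℕ.≢-nonZero m≢0
    -- By `expansion` with the basis `u`, `w`, `n`, whose volume is `m = n ∙ n`, the multiple `m r`
    -- equals `A u + B w + n`. Subtracting `i u + j w` from `r` replaces `A` and `B` by their
    -- remainders modulo `m`.
    A B i j : ℤ
    A = r ∙ (w ×ᵥ n)
    B = r ∙ (n ×ᵥ u)
    i = A /ℕ m
    j = B /ℕ m
    a b : ℕ
    a = A %ℕ m
    b = B %ℕ m
    r' : V3
    r' = r ⊟ i ⋆ u ⊟ j ⋆ w
    volume : u ∙ (w ×ᵥ n) ≡ + m
    volume = trans (triple-cyclic u w n) (norm² n)
    combination : (+ m) ⋆ r ≡ A ⋆ u ⊞ B ⋆ w ⊞ 1ℤ ⋆ n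
    combination = trans (cong (_⋆ r) (sym volume)) (trans (expansion u w n r) (cong (λ t → A ⋆ u ⊞ B ⋆ w ⊞ t ⋆ n) one))
    scaled-coordinate : ∀ (π : V3 → ℤ) → (∀ k v → π (k ⋆ v) ≡ k * π v) → (∀ v v' → π (v ⊞ v') ≡ π v + π v') → (∀ v v' → π (v ⊟ v') ≡ π v - π v') →
      + m * π r' ≡ + a * π u + + b * π w + π n
    scaled-coordinate π π⋆ π⊞ π⊟ = trans (cong (+ m *_) (trans (π⊟ (r ⊟ i ⋆ u) (j ⋆ w)) (cong₂ _-_ (trans (π⊟ r (i ⋆ u)) (cong (λ t → π r - t) (π⋆ i u))) (π⋆ j w))))
      (trans (l₁ (+ m) (π r) i (π u) j (π w)) (trans (cong (λ t → t - i * + m * π u - j * + m * π w) coordinate)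
       (trans (cong₂ (λ s t → s * π u + t * π w + 1ℤ * π n - i * + m * π u - j * + m * π w) (a≡a%ℕn+[a/ℕn]*n A m) (a≡a%ℕn+[a/ℕn]*n B m)) (l₂ (+ a) (i * + m) (π u) (+ b) (j * + m) (π w) (π n)))))
      where
        coordinate : + m * π r ≡ A * π u + B * π w + 1ℤ * π n
        coordinate = trans (sym (π⋆ (+ m) r)) (trans (cong π combination) (trans (π⊞ (A ⋆ u ⊞ B ⋆ w) (1ℤ ⋆ n)) (cong₂ _+_ (trans (π⊞ (A ⋆ u) (B ⋆ w)) (cong₂ _+_ (π⋆ A u) (π⋆ B w))) (π⋆ 1ℤ n))))
        l₁ : ∀ m r i u j w → m * (r - i * u - j * w) ≡ m * r - i * m * u - j * m * w
        l₁ = solve-∀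
        l₂ : ∀ a i u b j w n → (a + i) * u + (b + j) * w + 1ℤ * n - i * u - j * w ≡ a * u + b * w + n
        l₂ = solve-∀
    coordinate-bound : ∀ x y z t → + m * t ≡ + a * x + + b * y + z → ∣ x ∣ ℕ.≤ T → ∣ y ∣ ℕ.≤ T → ∣ z ∣ ℕ.≤ m → ∣ t ∣ ℕ.≤ 2 ℕ.* T ℕ.+ 1
    coordinate-bound x y z t e hx hy hz = ℕP.*-cancelˡ-≤ m (begin
      m ℕ.* ∣ t ∣ ≡⟨ sym (ℤP.abs-* (+ m) t) ⟩
      ∣ + m * t ∣ ≡⟨ cong ∣_∣ e ⟩
      ∣ + a * x + + b * y + z ∣ ≤⟨ ℕP.≤-trans (ℤP.∣i+j∣≤∣i∣+∣j∣ (+ a * x + + b * y) z) (ℕP.+-monoˡ-≤ ∣ z ∣ (ℤP.∣i+j∣≤∣i∣+∣j∣ (+ a * x) (+ b * y))) ⟩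
      ∣ + a * x ∣ ℕ.+ ∣ + b * y ∣ ℕ.+ ∣ z ∣ ≡⟨ cong₂ (λ p q → p ℕ.+ q ℕ.+ ∣ z ∣) (ℤP.abs-* (+ a) x) (ℤP.abs-* (+ b) y) ⟩
      a ℕ.* ∣ x ∣ ℕ.+ b ℕ.* ∣ y ∣ ℕ.+ ∣ z ∣ ≤⟨ ℕP.+-mono-≤ (ℕP.+-mono-≤ (ℕP.*-mono-≤ (ℕP.<⇒≤ (n%ℕd<d A m)) hx) (ℕP.*-mono-≤ (ℕP.<⇒≤ (n%ℕd<d B m)) hy)) hz ⟩
      m ℕ.* T ℕ.+ m ℕ.* T ℕ.+ m ≡⟨ lem m T ⟩
      m ℕ.* (2 ℕ.* T ℕ.+ 1) ∎)
      where
        open ℕP.≤-Reasoning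
        lem : ∀ m t → m ℕ.* t ℕ.+ m ℕ.* t ℕ.+ m ≡ m ℕ.* (2 ℕ.* t ℕ.+ 1)
        lem = solveℕ-∀

bounds-of-tuple : ∀ T {ω} → ω ∈ tuples T → let ((a , b , s) , (c , d , t)) = ω in
  ((1 ℕ.≤ a × a ℕ.≤ T) × (1 ℕ.≤ b × b ℕ.≤ T) × (1 ℕ.≤ s × s ℕ.≤ T)) × ((1 ℕ.≤ c × c ℕ.≤ T) × (1 ℕ.≤ d × d ℕ.≤ T) × (1 ℕ.≤ t × t ℕ.≤ T))
bounds-of-tuple T m = three (proj₁ (∈-cartesianProduct⁻ Tr Tr m)) , three (proj₂ (∈-cartesianProduct⁻ Tr Tr m))
  where
    D = cartesianProduct (range T) (range T)
    Tr = cartesianProduct (range T) D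
    three : ∀ {x y z} → (x , y , z) ∈ Tr → (1 ℕ.≤ x × x ℕ.≤ T) × (1 ℕ.≤ y × y ℕ.≤ T) × (1 ℕ.≤ z × z ℕ.≤ T)
    three m = range-∈ (proj₁ p) , range-∈ (proj₁ r) , range-∈ (proj₂ r)
      where
        p = ∈-cartesianProduct⁻ (range T) D m
        r = ∈-cartesianProduct⁻ (range T) (range T) (proj₂ p)

S₀-∈ : ∀ T {ω} → ω ∈ S₀ T → ω ∈ tuples T × Extends ω
S₀-∈ T m = ∈-filter⁻ extends? {xs = tuples T} m

S₀-unique : ∀ T → Unique (S₀ T)
S₀-unique T = Unique.filter⁺ extends? (tuples-unique T)

-- The minors next to the second column are coprime, so Bézout's identity yields a top row with
-- middle entry 0. It may be long; `reduce` shortens it.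
top-row : ∀ T ω → ω ∈ S₀ T → ∃[ r ] (r ∙ (vector (proj₁ ω) ×ᵥ vector (proj₂ ω)) ≡ 1ℤ × Bounded (2 ℕ.* T ℕ.+ 1) r)
top-row T ((a , b , s) , (c , d , t)) m = from (bézout (form b d s t) (form b d a c) (proj₂ (proj₂ (S₀-∈ T m)))) (bounds-of-tuple T (proj₁ (S₀-∈ T m)))
  where
    u w : V3
    u = vector (a , b , s)
    w = vector (c , d , t)
    from : ∃[ e ] ∃[ g ] e * form b d s t + g * form b d a c ≡ 1ℤ →
      ((1 ℕ.≤ a × a ℕ.≤ T) × (1 ℕ.≤ b × b ℕ.≤ T) × (1 ℕ.≤ s × s ℕ.≤ T)) × ((1 ℕ.≤ c × c ℕ.≤ T) × (1 ℕ.≤ d × d ℕ.≤ T) × (1 ℕ.≤ t × t ℕ.≤ T)) →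
      ∃[ r ] (r ∙ (u ×ᵥ w) ≡ 1ℤ × Bounded (2 ℕ.* T ℕ.+ 1) r)
    from (e , g , eq) (((_ , a≤) , (_ , b≤) , (_ , s≤)) , ((_ , c≤) , (_ , d≤) , (_ , t≤))) =
      reduce T u w (v3 (- e) 0ℤ g) (bounded a≤ b≤ s≤) (bounded c≤ d≤ t≤) (trans (lem e g (+ a) (+ b) (+ s) (+ c) (+ d) (+ t)) eq)
      where lem : ∀ e g a b s c d t → - e * (b * t - s * d) + 0ℤ * (s * c - a * t) + g * (a * d - b * c) ≡ e * (s * d - b * t) + g * (a * d - b * c)
            lem = solve-∀

_≟ᵗ_ : (ω ω' : Tuple) → Dec (ω ≡ ω')
_≟ᵗ_ = ≡-dec (≡-dec ℕ._≟_ (≡-dec ℕ._≟_ ℕ._≟_)) (≡-dec ℕ._≟_ (≡-dec ℕ._≟_ ℕ._≟_))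

open import Data.List.Membership.DecPropositional _≟ᵗ_ using () renaming (_∈?_ to _∈ᵗ?_)

record IsMatrix (T : ℕ) (ω : Tuple) (g : M3) : Set where
  field
    top : V3
    shape : g ≡ rows top (vector (proj₁ ω)) (vector (proj₂ ω))
    special : SL g
    top-bounded : Bounded (2 ℕ.* T ℕ.+ 1) top

complete : ∀ T ω → Dec (ω ∈ S₀ T) → M3
complete T ω (yes m) = rows (proj₁ (top-row T ω m)) (vector (proj₁ ω)) (vector (proj₂ ω))
complete T ω (no _) = 𝟙

complete-correct : ∀ T ω (m? : Dec (ω ∈ S₀ T)) → ω ∈ S₀ T → IsMatrix T ω (complete T ω m?)
complete-correct T ω (yes m) _ = record { top = r ; shape = refl ; special = trans (det-rows r (vector (proj₁ ω)) (vector (proj₂ ω))) (proj₁ (proj₂ (top-row T ω m))) ; top-bounded = proj₂ (proj₂ (top-row T ω m)) }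
  where
    r : V3
    r = proj₁ (top-row T ω m)
complete-correct T ω (no n) m = contradiction m n

abstract
  -- Hidden behind `abstract`, so that the membership test in `S₀ T` and the Euclidean algorithm are
  -- not unfolded later.
  matrix : ℕ → Tuple → M3
  matrix T ω = complete T ω (ω ∈ᵗ? S₀ T)

  matrix-correct : ∀ T ω → ω ∈ S₀ T → IsMatrix T ω (matrix T ω)
  matrix-correct T ω = complete-correct T ω (ω ∈ᵗ? S₀ T)

-- Total number of collisions between the matrices

module Collisions (q : ℕ) .{{_ : NonZero q}} (pr : Prime q) (T : ℕ) (T²<q : T ℕ.* T ℕ.< q) where
  open Modular q pr
  open Fixed q pr
  open FixedCounts q pr
  open Ratios q pr T T²<q
  open BadPairs q pr T T²<q

  γ : Tuple → M3
  γ = matrix T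

  γ-SL : ∀ ω → ω ∈ S₀ T → SL (γ ω)
  γ-SL ω m = IsMatrix.special (matrix-correct T ω m)

  private
    -- a coincidence of the second columns determines the ratio μ, which is then 1
    scalar⇒equal : ∀ {ω ω'} → ω ∈ S₀ T → ω' ∈ S₀ T → ∀ μ → ¬ Z μ → Zⱽ (vector (proj₁ ω) ⊟ μ ⋆ vector (proj₁ ω')) → Zⱽ (vector (proj₂ ω) ⊟ μ ⋆ vector (proj₂ ω')) → ω ≡ ω'
    scalar⇒equal {(a , b , s) , (c , d , t)} {(a' , b' , s') , (c' , d' , t')} m m' μ nμ (zⱽ za zb zs) (zⱽ zc zd zt) =
        cong₂ _,_ (cong₂ _,_ (eq a a' a≤ a≤' za) (cong₂ _,_ (eq b b' b≤ b≤' zb) (eq s s' s≤ s≤' zs))) (cong₂ _,_ (eq c c' c≤ c≤' zc) (cong₂ _,_ (eq d d' d≤ d≤' zd) (eq t t' t≤ t≤' zt)))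
      where
        B = bounds-of-tuple T (proj₁ (S₀-∈ T m))
        B' = bounds-of-tuple T (proj₁ (S₀-∈ T m'))
        a≤ = proj₂ (proj₁ (proj₁ B))
        b≤ = proj₂ (proj₁ (proj₂ (proj₁ B)))
        s≤ = proj₂ (proj₂ (proj₂ (proj₁ B)))
        c≤ = proj₂ (proj₁ (proj₂ B))
        d≤ = proj₂ (proj₁ (proj₂ (proj₂ B)))
        t≤ = proj₂ (proj₂ (proj₂ (proj₂ B)))
        a≤' = proj₂ (proj₁ (proj₁ B'))
        b≤' = proj₂ (proj₁ (proj₂ (proj₁ B')))
        s≤' = proj₂ (proj₂ (proj₂ (proj₁ B')))
        c≤' = proj₂ (proj₁ (proj₂ B'))
        d≤' = proj₂ (proj₁ (proj₂ (proj₂ B')))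
        t≤' = proj₂ (proj₂ (proj₂ (proj₂ B')))
        1≤b' = proj₁ (proj₁ (proj₂ (proj₁ B')))
        1≤d = proj₁ (proj₁ (proj₂ (proj₂ B)))
        1≤d' = proj₁ (proj₁ (proj₂ (proj₂ B')))
        cop = proj₁ (proj₂ (S₀-∈ T m))
        cop' = proj₁ (proj₂ (S₀-∈ T m'))
        cross : ∀ b b' d d' μ → b * d' - d * b' ≡ d' * (b - μ * b') + - b' * (d - μ * d')
        cross = solve-∀
        bd' : b ℕ.* d' ≡ d ℕ.* b'
        bd' = product-≡ b≤ d≤' d≤ b≤' (Z₂ (+ d') (- + b') zb zd (cross (+ b) (+ b') (+ d) (+ d') μ))
        b≡b' : b ≡ b'
        b≡b' = ∣-antisym (coprime-divisor cop (divides d' (trans (sym bd') (ℕP.*-comm b d')))) (coprime-divisor cop' (divides d (trans (ℕP.*-comm d' b) bd')))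
        μ≡1 : Z (1ℤ - μ)
        μ≡1 = Z-cancel (+ b') (1ℤ - μ) (entry-unit 1≤b' b≤') (Z₁ 1ℤ (subst (λ x → Z (+ x - μ * + b')) b≡b' zb) (lem (+ b') μ))
          where lem : ∀ b μ → b * (1ℤ - μ) ≡ 1ℤ * (b - μ * b)
                lem = solve-∀
        eq : ∀ x x' → x ℕ.≤ T → x' ℕ.≤ T → Z (+ x - μ * + x') → x ≡ x'
        eq x x' lx lx' z = entry-≡ lx lx' (Z₂ 1ℤ (- + x') z μ≡1 (lem (+ x) (+ x') μ))
          where lem : ∀ x x' μ → x - x' ≡ 1ℤ * (x - μ * x') + - x' * (1ℤ - μ)
                lem = solve-∀

    nonScalar : ∀ {ω ω'} → ω ∈ S₀ T → ω' ∈ S₀ T → ¬ ω ≡ ω' → NonScalar (γ ω) (γ ω')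
    nonScalar {ω} {ω'} m m' n = subst₂ NonScalar (sym (IsMatrix.shape M)) (sym (IsMatrix.shape M')) λ μ nμ z → n (scalar⇒equal m m' μ nμ (Zᴹ.z₂ z) (Zᴹ.z₃ z))
      where
        M = matrix-correct T ω m
        M' = matrix-correct T ω' m'

    cross-congruent : ∀ u u' w w' μ ν → Z (μ - ν) → Zⱽ ((u ⊟ μ ⋆ u') ×ᵥ (w ⊟ μ ⋆ w')) → Zⱽ ((u ⊟ ν ⋆ u') ×ᵥ (w ⊟ ν ⋆ w'))
    cross-congruent (v3 a b c) (v3 a' b' c') (v3 x y z) (v3 x' y' z') μ ν e (zⱽ p r s) =
        zⱽ (step b b' z z' c c' y y' p) (step c c' x x' a a' z z' r) (step a a' y y' b b' x x' s)
      where
        lem : ∀ a a' b b' c c' d d' μ ν → (a - ν * a') * (b - ν * b') - (c - ν * c') * (d - ν * d') ≡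
          1ℤ * ((a - μ * a') * (b - μ * b') - (c - μ * c') * (d - μ * d')) + (a' * (b - ν * b') + b' * (a - μ * a') - c' * (d - ν * d') - d' * (c - μ * c')) * (μ - ν)
        lem = solve-∀
        step : ∀ a a' b b' c c' d d' → Z ((a - μ * a') * (b - μ * b') - (c - μ * c') * (d - μ * d')) → Z ((a - ν * a') * (b - ν * b') - (c - ν * c') * (d - ν * d'))
        step a a' b b' c c' d d' h = Z₂ 1ℤ (a' * (b - ν * b') + b' * (a - μ * a') - c' * (d - ν * d') - d' * (c - μ * c')) h e (lem a a' b b' c c' d d' μ ν)

    good : ∀ {ω ω'} → ω ∈ S₀ T → ω' ∈ S₀ T → ∑ units (λ μ → ⟦ bad? μ ω ω' ⟧) ≡ 0 → Good (γ ω) (γ ω')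
    good {ω} {ω'} m m' e = subst₂ Good (sym (IsMatrix.shape M)) (sym (IsMatrix.shape M')) λ μ nμ z →
        ℕP.<⇒≢ (ℕP.≤-trans (⟦⟧-1≤ (bad? (mod μ) ω ω') (cross-congruent (vector (proj₁ ω)) (vector (proj₁ ω')) (vector (proj₂ ω)) (vector (proj₂ ω')) μ (mod μ) (mod-≡ μ) z))
          (∑-elem units (λ μ → ⟦ bad? μ ω ω' ⟧) (∈-filter⁺ (λ μ → ¬? (Z? μ)) (mod-∈ μ) λ zm → nμ (Z₂ 1ℤ 1ℤ (mod-≡ μ) zm (split μ (mod μ)))))) (sym e)
      where
        M = matrix-correct T ω m
        M' = matrix-correct T ω' m'
        split : ∀ a b → a ≡ 1ℤ * (a - b) + 1ℤ * b
        split = solve-∀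

  private
    ≤-third : ∀ {x} a b c → x ℕ.≤ c → x ℕ.≤ a ℕ.+ (b ℕ.+ c ℕ.* 1)
    ≤-third a b c h = ℕP.≤-trans h (ℕP.≤-trans (ℕP.≤-reflexive (sym (ℕP.*-identityʳ c))) (ℕP.≤-trans (ℕP.m≤n+m (c ℕ.* 1) b) (ℕP.m≤n+m (b ℕ.+ c ℕ.* 1) a)))
    ≤-second : ∀ {x} a b c k → x ℕ.≤ b → x ℕ.≤ a ℕ.+ (b ℕ.* suc k ℕ.+ c)
    ≤-second a b c k h = ℕP.≤-trans h (ℕP.≤-trans (ℕP.m≤m*n b (suc k)) (ℕP.≤-trans (ℕP.m≤m+n (b ℕ.* suc k) c) (ℕP.m≤n+m (b ℕ.* suc k ℕ.+ c) a)))

    c₁ c₂ : ℕ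
    c₁ = 9 ℕ.* (6 ℕ.* q)
    c₂ = 9 ℕ.* (q ℕ.* q ℕ.* q)

  -- The three cases are added into a single bound. For a pair that is bad at some ratio the sum
  -- over `units` is at least one, so it pays for `54 q`; the diagonal pays the trivial bound.
  pair-coincidences : ∀ ω ω' → ω ∈ S₀ T → ω' ∈ S₀ T →
    coincidences (γ ω) (γ ω') ℕ.≤ 9 ℕ.+ (9 ℕ.* (6 ℕ.* q) ℕ.* ∑ units (λ μ → ⟦ bad? μ ω ω' ⟧) ℕ.+ 9 ℕ.* (q ℕ.* q ℕ.* q) ℕ.* ⟦ ω ≟ᵗ ω' ⟧)
  pair-coincidences ω ω' m m' = decide c₁ c₂ (coincidences-nonScalar (γ ω) (γ ω') (γ-SL ω m) (γ-SL ω' m')) (coincidences-trivial (γ ω) (γ ω')) (ω ≟ᵗ ω') (∑ units (λ μ → ⟦ bad? μ ω ω' ⟧)) refl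
    where
      decide : ∀ c₁ c₂ → (NonScalar (γ ω) (γ ω') → coincidences (γ ω) (γ ω') ℕ.≤ c₁) → coincidences (γ ω) (γ ω') ℕ.≤ c₂ → (e : Dec (ω ≡ ω')) → ∀ k → ∑ units (λ μ → ⟦ bad? μ ω ω' ⟧) ≡ k →
        coincidences (γ ω) (γ ω') ℕ.≤ 9 ℕ.+ (c₁ ℕ.* k ℕ.+ c₂ ℕ.* ⟦ e ⟧)
      decide c₁ c₂ h₁ h₂ (yes _) k _ = ≤-third 9 (c₁ ℕ.* k) c₂ h₂
      decide c₁ c₂ h₁ h₂ (no _) zero e = ℕP.≤-trans (coincidences-good (γ ω) (γ ω') (γ-SL ω m) (γ-SL ω' m') (good m m' e)) (ℕP.m≤m+n 9 (c₁ ℕ.* 0 ℕ.+ c₂ ℕ.* 0))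
      decide c₁ c₂ h₁ h₂ (no n) (suc k) _ = ≤-second 9 c₁ (c₂ ℕ.* 0) k (h₁ (nonScalar m m' n))

  badTotal : ℕ
  badTotal = 4 ℕ.* (T ℕ.* T ℕ.* (T ℕ.* T ℕ.* (T ℕ.* T ℕ.* (T ℕ.* T ℕ.* (3 ℕ.* q ℕ.+ 24 ℕ.* proportional-count T)))))

  total-coincidences : ∑ (S₀ T) (λ ω → ∑ (S₀ T) λ ω' → coincidences (γ ω) (γ ω')) ℕ.≤
    9 ℕ.* (length (S₀ T) ℕ.* length (S₀ T)) ℕ.+ (9 ℕ.* (6 ℕ.* q) ℕ.* badTotal ℕ.+ 9 ℕ.* (q ℕ.* q ℕ.* q) ℕ.* length (S₀ T))
  total-coincidences = sum-pairs (S₀ T) 9 c₁ c₂ badTotal (λ ω ω' → coincidences (γ ω) (γ ω')) (λ ω ω' → ∑ units (λ μ → ⟦ bad? μ ω ω' ⟧)) (S₀-unique T) pair-coincidences bad≤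
    where
      -- Stated for arbitrary constants and functions, so that the summation is independent of the
      -- large numerical factors.
      sum-pairs : ∀ Σ₀ c₀ c₁ c₂ t (α β : Tuple → Tuple → ℕ) → Unique Σ₀ →
        (∀ ω ω' → ω ∈ Σ₀ → ω' ∈ Σ₀ → α ω ω' ℕ.≤ c₀ ℕ.+ (c₁ ℕ.* β ω ω' ℕ.+ c₂ ℕ.* ⟦ ω ≟ᵗ ω' ⟧)) → ∑ Σ₀ (λ ω → ∑ Σ₀ (β ω)) ℕ.≤ t →
        ∑ Σ₀ (λ ω → ∑ Σ₀ λ ω' → α ω ω') ℕ.≤ c₀ ℕ.* (length Σ₀ ℕ.* length Σ₀) ℕ.+ (c₁ ℕ.* t ℕ.+ c₂ ℕ.* length Σ₀)
      sum-pairs Σ₀ c₀ c₁ c₂ t α β unique pairwise bad≤ = begin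
        ∑ Σ₀ (λ ω → ∑ Σ₀ λ ω' → α ω ω') ≤⟨ ∑-mono Σ₀ (λ ω m → ∑-mono Σ₀ λ ω' m' → pairwise ω ω' m m') ⟩
        ∑ Σ₀ (λ ω → ∑ Σ₀ λ ω' → c₀ ℕ.+ (c₁ ℕ.* β ω ω' ℕ.+ c₂ ℕ.* ⟦ ω ≟ᵗ ω' ⟧)) ≡⟨ trans (∑-cong Σ₀ λ ω _ → trans (∑-+ Σ₀ (λ _ → c₀) (λ ω' → c₁ ℕ.* β ω ω' ℕ.+ c₂ ℕ.* ⟦ ω ≟ᵗ ω' ⟧)) (cong (∑ Σ₀ (λ _ → c₀) ℕ.+_) (trans (∑-+ Σ₀ (λ ω' → c₁ ℕ.* β ω ω') (λ ω' → c₂ ℕ.* ⟦ ω ≟ᵗ ω' ⟧)) (cong₂ ℕ._+_ (∑-*ˡ Σ₀ c₁ (β ω)) (∑-*ˡ Σ₀ c₂ (λ ω' → ⟦ ω ≟ᵗ ω' ⟧))))))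
            (trans (∑-+ Σ₀ (λ _ → ∑ Σ₀ (λ _ → c₀)) (λ ω → c₁ ℕ.* ∑ Σ₀ (β ω) ℕ.+ c₂ ℕ.* ∑ Σ₀ (λ ω' → ⟦ ω ≟ᵗ ω' ⟧))) (cong₂ ℕ._+_ constants (trans (∑-+ Σ₀ (λ ω → c₁ ℕ.* ∑ Σ₀ (β ω)) (λ ω → c₂ ℕ.* ∑ Σ₀ (λ ω' → ⟦ ω ≟ᵗ ω' ⟧))) (cong₂ ℕ._+_ (∑-*ˡ Σ₀ c₁ (λ ω → ∑ Σ₀ (β ω))) (∑-*ˡ Σ₀ c₂ (λ ω → ∑ Σ₀ (λ ω' → ⟦ ω ≟ᵗ ω' ⟧))))))) ⟩
        c₀ ℕ.* (length Σ₀ ℕ.* length Σ₀) ℕ.+ (c₁ ℕ.* ∑ Σ₀ (λ ω → ∑ Σ₀ (β ω)) ℕ.+ c₂ ℕ.* ∑ Σ₀ (λ ω → ∑ Σ₀ (λ ω' → ⟦ ω ≟ᵗ ω' ⟧))) ≤⟨ ℕP.+-monoʳ-≤ (c₀ ℕ.* (length Σ₀ ℕ.* length Σ₀)) (ℕP.+-mono-≤ (ℕP.*-monoʳ-≤ c₁ bad≤) (ℕP.*-monoʳ-≤ c₂ diagonal)) ⟩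
        c₀ ℕ.* (length Σ₀ ℕ.* length Σ₀) ℕ.+ (c₁ ℕ.* t ℕ.+ c₂ ℕ.* length Σ₀) ∎
        where
          open ℕP.≤-Reasoning
          constants : ∑ Σ₀ (λ _ → ∑ Σ₀ (λ _ → c₀)) ≡ c₀ ℕ.* (length Σ₀ ℕ.* length Σ₀)
          constants = trans (∑-const Σ₀ _) (trans (cong (length Σ₀ ℕ.*_) (∑-const Σ₀ c₀)) (lem (length Σ₀) c₀))
            where lem : ∀ n c → n ℕ.* (n ℕ.* c) ≡ c ℕ.* (n ℕ.* n)
                  lem = solveℕ-∀
          diagonal : ∑ Σ₀ (λ ω → ∑ Σ₀ (λ ω' → ⟦ ω ≟ᵗ ω' ⟧)) ℕ.≤ length Σ₀
          diagonal = ℕP.≤-trans (∑-bound Σ₀ 1 λ ω _ → count≤1 (ω ≟ᵗ_) Σ₀ unique λ x y _ _ p r → trans (sym p) r) (ℕP.≤-reflexive (ℕP.*-identityʳ _))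
      sub : (F : Tuple → ℕ) → ∑ (S₀ T) F ℕ.≤ ∑ (tuples T) F
      sub F = ∑-injection (S₀ T) (λ ω → ω) F (S₀-unique T) (λ ω m → proj₁ (S₀-∈ T m)) (λ _ _ _ _ e → e)
      bad≤ : ∑ (S₀ T) (λ ω → ∑ (S₀ T) λ ω' → ∑ units (λ μ → ⟦ bad? μ ω ω' ⟧)) ℕ.≤ badTotal
      bad≤ = ℕP.≤-trans (∑-mono (S₀ T) λ ω _ → sub (λ ω' → ∑ units (λ μ → ⟦ bad? μ ω ω' ⟧))) (ℕP.≤-trans (sub (λ ω → ∑ (tuples T) (λ ω' → ∑ units (λ μ → ⟦ bad? μ ω ω' ⟧)))) bad-count)

-- Diffusion along the elementary generators

abstract
  collision-constant : ℕ
  collision-constant = 9 ℕ.+ (51840 ℕ.* 4096 ℕ.+ 576 ℕ.* 64)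

  -- Everything is measured against `M = T²` with `q ≤ 4M` and `M³ ≤ 64s`. The bad pairs give
  -- `51840 = 9 · 6 · 4 · 4 · 60` with `60 = 3 · 4 + 24 · 2`, and `4096 = 64²`; the diagonal gives
  -- `576 = 9 · 4³` and one factor 64.
  collision-arithmetic : ∀ T q L s p → q ℕ.≤ 4 ℕ.* (T ℕ.* T) → p ℕ.≤ 2 ℕ.* (T ℕ.* (L ℕ.* T)) → 1 ℕ.≤ L → T ℕ.* T ℕ.* (T ℕ.* T ℕ.* (T ℕ.* T)) ℕ.≤ 64 ℕ.* s →
    9 ℕ.* (s ℕ.* s) ℕ.+ (9 ℕ.* (6 ℕ.* q) ℕ.* (4 ℕ.* (T ℕ.* T ℕ.* (T ℕ.* T ℕ.* (T ℕ.* T ℕ.* (T ℕ.* T ℕ.* (3 ℕ.* q ℕ.+ 24 ℕ.* p)))))) ℕ.+ 9 ℕ.* (q ℕ.* q ℕ.* q) ℕ.* s) ℕ.≤ collision-constant ℕ.* (L ℕ.* (s ℕ.* s))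
  collision-arithmetic T q L s p q≤ p≤ 1≤L M³≤ = begin
      9 ℕ.* (s ℕ.* s) ℕ.+ (9 ℕ.* (6 ℕ.* q) ℕ.* (4 ℕ.* (M ℕ.* (M ℕ.* (M ℕ.* (M ℕ.* (3 ℕ.* q ℕ.+ 24 ℕ.* p)))))) ℕ.+ 9 ℕ.* (q ℕ.* q ℕ.* q) ℕ.* s)
        ≤⟨ ℕP.+-mono-≤ (ℕP.*-monoʳ-≤ 9 (grow (s ℕ.* s))) (ℕP.+-mono-≤ bad diagonal) ⟩
      9 ℕ.* (L ℕ.* (s ℕ.* s)) ℕ.+ (51840 ℕ.* (L ℕ.* (4096 ℕ.* (s ℕ.* s))) ℕ.+ 576 ℕ.* (64 ℕ.* (L ℕ.* (s ℕ.* s)))) ≡⟨ l₅ 9 51840 4096 576 64 L (s ℕ.* s) ⟩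
      (9 ℕ.+ (51840 ℕ.* 4096 ℕ.+ 576 ℕ.* 64)) ℕ.* (L ℕ.* (s ℕ.* s)) ∎
    where
      open ℕP.≤-Reasoning
      M : ℕ
      M = T ℕ.* T
      M³ : ℕ
      M³ = M ℕ.* (M ℕ.* M)
      grow : ∀ x → x ℕ.≤ L ℕ.* x
      grow x = ℕP.≤-trans (ℕP.≤-reflexive (sym (ℕP.*-identityˡ x))) (ℕP.*-monoˡ-≤ x 1≤L)
      l₅ : ∀ a b c d e L x → a ℕ.* (L ℕ.* x) ℕ.+ (b ℕ.* (L ℕ.* (c ℕ.* x)) ℕ.+ d ℕ.* (e ℕ.* (L ℕ.* x))) ≡ (a ℕ.+ (b ℕ.* c ℕ.+ d ℕ.* e)) ℕ.* (L ℕ.* x)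
      l₅ = solveℕ-∀
      X≤ : 3 ℕ.* q ℕ.+ 24 ℕ.* p ℕ.≤ 60 ℕ.* (L ℕ.* M)
      X≤ = ℕP.≤-trans (ℕP.+-mono-≤ (ℕP.*-monoʳ-≤ 3 (ℕP.≤-trans q≤ (ℕP.*-monoʳ-≤ 4 (grow M)))) (ℕP.*-monoʳ-≤ 24 p≤)) (ℕP.≤-reflexive (l₁ L T))
        where l₁ : ∀ L T → 3 ℕ.* (4 ℕ.* (L ℕ.* (T ℕ.* T))) ℕ.+ 24 ℕ.* (2 ℕ.* (T ℕ.* (L ℕ.* T))) ≡ 60 ℕ.* (L ℕ.* (T ℕ.* T))
              l₁ = solveℕ-∀
      square : M³ ℕ.* M³ ℕ.≤ 4096 ℕ.* (s ℕ.* s)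
      square = ℕP.≤-trans (ℕP.*-mono-≤ M³≤ M³≤) (ℕP.≤-reflexive (l₂ s))
        where l₂ : ∀ s → 64 ℕ.* s ℕ.* (64 ℕ.* s) ≡ 4096 ℕ.* (s ℕ.* s)
              l₂ = solveℕ-∀
      bad : 9 ℕ.* (6 ℕ.* q) ℕ.* (4 ℕ.* (M ℕ.* (M ℕ.* (M ℕ.* (M ℕ.* (3 ℕ.* q ℕ.+ 24 ℕ.* p)))))) ℕ.≤ 51840 ℕ.* (L ℕ.* (4096 ℕ.* (s ℕ.* s)))
      bad = ℕP.≤-trans (ℕP.*-mono-≤ (ℕP.*-monoʳ-≤ 9 (ℕP.*-monoʳ-≤ 6 q≤)) (ℕP.*-monoʳ-≤ 4 (ℕP.*-monoʳ-≤ M (ℕP.*-monoʳ-≤ M (ℕP.*-monoʳ-≤ M (ℕP.*-monoʳ-≤ M X≤))))))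
        (generic 9 6 4 60 51840 refl square)
        where
          l₃ : ∀ a b c e L M → a ℕ.* (b ℕ.* (c ℕ.* M)) ℕ.* (c ℕ.* (M ℕ.* (M ℕ.* (M ℕ.* (M ℕ.* (e ℕ.* (L ℕ.* M))))))) ≡ a ℕ.* b ℕ.* c ℕ.* c ℕ.* e ℕ.* (L ℕ.* (M ℕ.* (M ℕ.* M) ℕ.* (M ℕ.* (M ℕ.* M))))
          l₃ = solveℕ-∀
          generic : ∀ a b c e A → a ℕ.* b ℕ.* c ℕ.* c ℕ.* e ≡ A → ∀ {t} → M³ ℕ.* M³ ℕ.≤ t → a ℕ.* (b ℕ.* (c ℕ.* M)) ℕ.* (c ℕ.* (M ℕ.* (M ℕ.* (M ℕ.* (M ℕ.* (e ℕ.* (L ℕ.* M))))))) ℕ.≤ A ℕ.* (L ℕ.* t)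
          generic a b c e A refl h = ℕP.≤-trans (ℕP.≤-reflexive (l₃ a b c e L M)) (ℕP.*-monoʳ-≤ (a ℕ.* b ℕ.* c ℕ.* c ℕ.* e) (ℕP.*-monoʳ-≤ L h))
      diagonal : 9 ℕ.* (q ℕ.* q ℕ.* q) ℕ.* s ℕ.≤ 576 ℕ.* (64 ℕ.* (L ℕ.* (s ℕ.* s)))
      diagonal = ℕP.≤-trans (ℕP.*-monoˡ-≤ s (ℕP.*-monoʳ-≤ 9 (ℕP.*-mono-≤ (ℕP.*-mono-≤ q≤ q≤) q≤))) (ℕP.≤-trans (ℕP.≤-reflexive (l₄ M s)) (ℕP.*-monoʳ-≤ 576 (ℕP.≤-trans (ℕP.*-monoˡ-≤ s M³≤)
          (ℕP.≤-trans (ℕP.≤-reflexive (ℕP.*-assoc 64 s s)) (ℕP.*-monoʳ-≤ 64 (grow (s ℕ.* s)))))))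
        where l₄ : ∀ M s → 9 ℕ.* (4 ℕ.* M ℕ.* (4 ℕ.* M) ℕ.* (4 ℕ.* M)) ℕ.* s ≡ 576 ℕ.* (M ℕ.* (M ℕ.* M) ℕ.* s)
              l₄ = solveℕ-∀

record MBounded (K : ℕ) (g : M3) : Set where
  constructor mbounded
  field
    bounded₁ : Bounded K (row₁ g)
    bounded₂ : Bounded K (row₂ g)
    bounded₃ : Bounded K (row₃ g)

-- Bernoulli's inequality (1 + 1/c)ᵏ ≥ 1 + k/c for b/a = 1 + 1/c
geometric-decay : ∀ a b c → a ℕ.* suc c ≡ b ℕ.* c → a ℕ.≤ b → ∀ k → a ℕ.^ k ℕ.* (c ℕ.+ k) ℕ.≤ c ℕ.* b ℕ.^ k
geometric-decay a b c ratio a≤b zero = ℕP.≤-reflexive (l₀ c)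
  where l₀ : ∀ c → 1 ℕ.* (c ℕ.+ 0) ≡ c ℕ.* 1
        l₀ = solveℕ-∀
geometric-decay a b c ratio a≤b (suc k) = begin
    a ℕ.* a ℕ.^ k ℕ.* (c ℕ.+ suc k) ≡⟨ l₁ a (a ℕ.^ k) c k ⟩
    a ℕ.^ k ℕ.* (a ℕ.* suc c ℕ.+ a ℕ.* k) ≤⟨ ℕP.*-monoʳ-≤ (a ℕ.^ k) (ℕP.+-mono-≤ (ℕP.≤-reflexive ratio) (ℕP.*-monoˡ-≤ k a≤b)) ⟩
    a ℕ.^ k ℕ.* (b ℕ.* c ℕ.+ b ℕ.* k) ≡⟨ l₂ (a ℕ.^ k) b c k ⟩
    b ℕ.* (a ℕ.^ k ℕ.* (c ℕ.+ k)) ≤⟨ ℕP.*-monoʳ-≤ b (geometric-decay a b c ratio a≤b k) ⟩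
    b ℕ.* (c ℕ.* b ℕ.^ k) ≡⟨ l₃ b c (b ℕ.^ k) ⟩
    c ℕ.* (b ℕ.* b ℕ.^ k) ∎
  where
    open ℕP.≤-Reasoning
    l₁ : ∀ a p c k → a ℕ.* p ℕ.* (c ℕ.+ (1 ℕ.+ k)) ≡ p ℕ.* (a ℕ.* (1 ℕ.+ c) ℕ.+ a ℕ.* k)
    l₁ = solveℕ-∀
    l₂ : ∀ p b c k → p ℕ.* (b ℕ.* c ℕ.+ b ℕ.* k) ≡ b ℕ.* (p ℕ.* (c ℕ.+ k))
    l₂ = solveℕ-∀
    l₃ : ∀ b c p → b ℕ.* (c ℕ.* p) ≡ c ℕ.* (b ℕ.* p)
    l₃ = solveℕ-∀

row-sum : V3 → ℕ
row-sum v = ∣ vx v ∣ ℕ.+ ∣ vy v ∣ ℕ.+ ∣ vz v ∣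

-- Rows of an elementary matrix have absolute sum at most two, so multiplying by it on the left at
-- most doubles the largest entry.
data Short (s : M3) : Set where
  short : row-sum (row₁ s) ℕ.≤ 2 → row-sum (row₂ s) ℕ.≤ 2 → row-sum (row₃ s) ℕ.≤ 2 → Short s

short? : ∀ s → Dec (Short s)
short? s = map′ (λ { (a , b , c) → short a b c }) (λ { (short a b c) → a , b , c }) (row-sum (row₁ s) ℕP.≤? 2 ×-dec row-sum (row₂ s) ℕP.≤? 2 ×-dec row-sum (row₃ s) ℕP.≤? 2)

generators-short : All.All Short generators
generators-short = does-true (All.all? short? generators) refl

combination-bound : ∀ K a b c x y z → ∣ a ∣ ℕ.+ ∣ b ∣ ℕ.+ ∣ c ∣ ℕ.≤ 2 → ∣ x ∣ ℕ.≤ K → ∣ y ∣ ℕ.≤ K → ∣ z ∣ ℕ.≤ K → ∣ a * x + b * y + c * z ∣ ℕ.≤ 2 ℕ.* K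
combination-bound K a b c x y z h hx hy hz = begin
    ∣ a * x + b * y + c * z ∣ ≤⟨ ℕP.≤-trans (ℤP.∣i+j∣≤∣i∣+∣j∣ (a * x + b * y) (c * z)) (ℕP.+-monoˡ-≤ (∣ c * z ∣) (ℤP.∣i+j∣≤∣i∣+∣j∣ (a * x) (b * y))) ⟩
    ∣ a * x ∣ ℕ.+ ∣ b * y ∣ ℕ.+ ∣ c * z ∣ ≤⟨ ℕP.+-mono-≤ (ℕP.+-mono-≤ (part a x hx) (part b y hy)) (part c z hz) ⟩
    ∣ a ∣ ℕ.* K ℕ.+ ∣ b ∣ ℕ.* K ℕ.+ ∣ c ∣ ℕ.* K ≡⟨ lem (∣ a ∣) (∣ b ∣) (∣ c ∣) K ⟩
    (∣ a ∣ ℕ.+ ∣ b ∣ ℕ.+ ∣ c ∣) ℕ.* K ≤⟨ ℕP.*-monoˡ-≤ K h ⟩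
    2 ℕ.* K ∎
  where
    open ℕP.≤-Reasoning
    part : ∀ a x → ∣ x ∣ ℕ.≤ K → ∣ a * x ∣ ℕ.≤ ∣ a ∣ ℕ.* K
    part a x h = ℕP.≤-trans (ℕP.≤-reflexive (ℤP.abs-* a x)) (ℕP.*-monoʳ-≤ (∣ a ∣) h)
    lem : ∀ a b c k → a ℕ.* k ℕ.+ b ℕ.* k ℕ.+ c ℕ.* k ≡ (a ℕ.+ b ℕ.+ c) ℕ.* k
    lem = solveℕ-∀

short-·-bounded : ∀ {K} s g → Short s → MBounded K g → MBounded (2 ℕ.* K) (s · g)
short-·-bounded {K} (mat a b c d e f g h i) (mat a' b' c' d' e' f' g' h' i') (short s₁ s₂ s₃) (mbounded (bounded x y z) (bounded x' y' z') (bounded x'' y'' z'')) = mbounded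
  (bounded (combination-bound K a b c a' d' g' s₁ x x' x'') (combination-bound K a b c b' e' h' s₁ y y' y'') (combination-bound K a b c c' f' i' s₁ z z' z''))
  (bounded (combination-bound K d e f a' d' g' s₂ x x' x'') (combination-bound K d e f b' e' h' s₂ y y' y'') (combination-bound K d e f c' f' i' s₂ z z' z''))
  (bounded (combination-bound K g h i a' d' g' s₃ x x' x'') (combination-bound K g h i b' e' h' s₃ y y' y'') (combination-bound K g h i c' f' i' s₃ z z' z''))

MBounded-mono : ∀ {K K'} → K ℕ.≤ K' → ∀ {g} → MBounded K g → MBounded K' g
MBounded-mono le (mbounded a b c) = mbounded (mono a) (mono b) (mono c)
  where
    mono : ∀ {v} → Bounded _ v → Bounded _ v
    mono (bounded x y z) = bounded (ℕP.≤-trans x le) (ℕP.≤-trans y le) (ℕP.≤-trans z le)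

generator-·-bounded : ∀ {K s} g → s ∈ generators → MBounded K g → MBounded (2 ℕ.* K) (s · g)
generator-·-bounded g ms = short-·-bounded _ g (All.lookup generators-short ms)

module Unreached (q : ℕ) .{{_ : NonZero q}} (pr : Prime q) where
  open Modular q pr
  open Fixed q pr
  open Connected q pr
  open Mixing flags flags-unique act act-∈ act-· act-𝟙

  record Joins (K : ℕ) (x y : FlagRep) : Set where
    constructor joins
    field
      element : M3
      element-SL : SL element
      element-bounded : MBounded K element
      element-act : act element x ≡ y

  Joins-mono : ∀ {K K' x y} → K ℕ.≤ K' → Joins K x y → Joins K' x y
  Joins-mono le (joins g sg bg e) = joins g sg (MBounded-mono le {g} bg) e

  B-zero : ∀ f y → f y ≡ 0ℤ → neighbours f y ≡ 0ℤ → B f y ≡ 0ℤ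
  B-zero f y e z = cong₂ (λ a b → + 12 * a + b) e z

  -- The step from `y` to `s y` is undone by `s⁻¹`, which is again a generator.
  Joins-step : ∀ {K x y s} → x ∈ flags → y ∈ flags → s ∈ generators → Joins K x (act s y) → Joins (2 ℕ.* K) x y
  Joins-step {K} {x} {y} {s} mx my ms (joins g sg bg e) = joins (inverse s · g) (SL-· (inverse s) g (SL-inverse s ss) sg) (generator-·-bounded g (All.lookup inverse-generators ms) bg)
      (trans (act-· (inverse s) g x (SL-inverse s ss) sg mx) (trans (cong (act (inverse s)) e) (trans (sym (act-· (inverse s) s y (SL-inverse s ss) ss my)) (trans (cong (λ h → act h y) (·-inverseˡ s ss)) (act-𝟙 y my)))))
    where
      ss : SL s
      ss = All.lookup generators-SL ms

  ∑ℤ-nonzero : ∀ {A : Set} (xs : List A) (f : A → ℤ) → ¬ ∑ℤ xs f ≡ 0ℤ → ∃[ x ] (x ∈ xs × ¬ f x ≡ 0ℤ)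
  ∑ℤ-nonzero [] f n = contradiction refl n
  ∑ℤ-nonzero (x ∷ xs) f n = from (f x ℤP.≟ 0ℤ)
    where
      from : Dec (f x ≡ 0ℤ) → ∃[ y ] (y ∈ x ∷ xs × ¬ f y ≡ 0ℤ)
      from (no h) = x , here refl , h
      from (yes e) with ∑ℤ-nonzero xs f (λ z → n (cong₂ _+_ e z))
      ... | y , m , h = y , there m , h

  -- A nonzero value of `B g` at `y` requires a nonzero value of `g` at `y` or at a neighbour of
  -- `y`, so each application of `B` costs one more step of the walk.
  support-B^ : ∀ K x f → x ∈ flags → (∀ y → y ∈ flags → ¬ f y ≡ 0ℤ → Joins K x y) → ∀ m y → y ∈ flags → ¬ B^ m f y ≡ 0ℤ → Joins (2 ℕ.^ m ℕ.* K) x y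
  support-B^ K x f mx h zero y my n = subst (λ k → Joins k x y) (sym (ℕP.*-identityˡ K)) (h y my n)
  support-B^ K x f mx h (suc m) y my n = from (B^ m f y ℤP.≟ 0ℤ)
    where
      IH : ∀ z → z ∈ flags → ¬ B^ m f z ≡ 0ℤ → Joins (2 ℕ.^ m ℕ.* K) x z
      IH = support-B^ K x f mx h m
      double : 2 ℕ.* (2 ℕ.^ m ℕ.* K) ≡ 2 ℕ.^ suc m ℕ.* K
      double = sym (ℕP.*-assoc 2 (2 ℕ.^ m) K)
      from : Dec (B^ m f y ≡ 0ℤ) → Joins (2 ℕ.^ suc m ℕ.* K) x y
      from (no n') = subst (λ k → Joins k x y) double (Joins-mono (ℕP.m≤n*m (2 ℕ.^ m ℕ.* K) 2) (IH y my n'))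
      from (yes e) = step (∑ℤ-nonzero generators (λ s → B^ m f (act s y)) λ z → n (B-zero (B^ m f) y e z))
        where
          step : ∃[ s ] (s ∈ generators × ¬ B^ m f (act s y) ≡ 0ℤ) → Joins (2 ℕ.^ suc m ℕ.* K) x y
          step (s , ms , n') = subst (λ k → Joins k x y) double (Joins-step mx my ms (IH (act s y) (act-∈ s y (All.lookup generators-SL ms) my) n'))

  zeros : (FlagRep → ℤ) → ℕ
  zeros g = ∑ flags λ y → ⟦ g y ℤP.≟ 0ℤ ⟧

  -- Each zero of g contributes (S g)² to ∑ (N g − S g)² = N Var g.
  zeros-Var : ∀ g → + zeros g * (S g * S g) ℤ.≤ N * Var g
  zeros-Var g = begin
      + zeros g * (S g * S g) ≡⟨ trans (cong (_* (S g * S g)) (sym (∑ℤ-pos flags λ y → ⟦ g y ℤP.≟ 0ℤ ⟧))) (sym (∑ℤ-*ʳ flags (S g * S g) λ y → + ⟦ g y ℤP.≟ 0ℤ ⟧)) ⟩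
      ∑ℤ flags (λ y → + ⟦ g y ℤP.≟ 0ℤ ⟧ * (S g * S g)) ≤⟨ ∑ℤ-mono flags (λ y _ → pointwise (g y) (S g) (g y ℤP.≟ 0ℤ)) ⟩
      ∑ℤ flags (λ y → (N * g y - S g) * (N * g y - S g)) ≡⟨ ∑ℤ-cong flags (λ y _ → l₁ N (g y) (S g)) ⟩
      ∑ℤ flags (λ y → N * N * (g y * g y) + (- (+ 2) * (N * S g) * g y + S g * S g)) ≡⟨ trans (∑ℤ-+ flags (λ y → N * N * (g y * g y)) (λ y → - (+ 2) * (N * S g) * g y + S g * S g)) (cong₂ _+_ (∑ℤ-*ˡ flags (N * N) (λ y → g y * g y)) (trans (∑ℤ-+ flags (λ y → - (+ 2) * (N * S g) * g y) (λ y → S g * S g)) (cong₂ _+_ (∑ℤ-*ˡ flags (- (+ 2) * (N * S g)) g) (∑ℤ-const flags (S g * S g))))) ⟩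
      N * N * ⟨ g , g ⟩ + (- (+ 2) * (N * S g) * S g + N * (S g * S g)) ≡⟨ l₂ N ⟨ g , g ⟩ (S g) ⟩
      N * Var g ∎
    where
      open ℤP.≤-Reasoning
      l₁ : ∀ n x s → (n * x - s) * (n * x - s) ≡ n * n * (x * x) + (- (+ 2) * (n * s) * x + s * s)
      l₁ = solve-∀
      l₂ : ∀ n a s → n * n * a + (- (+ 2) * (n * s) * s + n * (s * s)) ≡ n * (n * a - s * s)
      l₂ = solve-∀
      pointwise : ∀ x s (d : Dec (x ≡ 0ℤ)) → + ⟦ d ⟧ * (s * s) ℤ.≤ (N * x - s) * (N * x - s)
      pointwise x s (no _) = square≥0 (N * x - s)
      pointwise .0ℤ s (yes refl) = ℤP.≤-reflexive (l₃ N s)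
        where l₃ : ∀ n s → 1ℤ * (s * s) ≡ (n * 0ℤ - s) * (n * 0ℤ - s)
              l₃ = solve-∀

abstract
  spread-constant : ℕ
  spread-constant = mixing-factor ℕ.* collision-constant ℕ.* (479 ℕ.* (479 ℕ.* 479))

  -- The mixing rate is (479/480)ᵐ; with m = 3 k its cube beats the factor L.
  spread-arithmetic : ∀ k u s N L c → 1 ℕ.≤ s → c ℕ.≤ collision-constant ℕ.* (L ℕ.* (s ℕ.* s)) →
    dilation ℕ.^ (3 ℕ.* k) ℕ.* (u ℕ.* (s ℕ.* s)) ℕ.≤ mixing-factor ℕ.* (N ℕ.* N ℕ.* (contraction ℕ.^ (3 ℕ.* k) ℕ.* c)) →
    u ℕ.* (suc k ℕ.* suc k ℕ.* suc k) ℕ.≤ spread-constant ℕ.* (L ℕ.* (N ℕ.* N))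
  spread-arithmetic k u s N L c 1≤s c≤ h = generic mixing-factor collision-constant 479 dilation contraction (s≤s z≤n) 1≤dilation (geometric-decay contraction dilation 479 dilation-contraction contraction≤dilation k) c≤ h
    where
      generic : ∀ A K e b a → 1 ℕ.≤ e → 1 ℕ.≤ b → a ℕ.^ k ℕ.* (e ℕ.+ k) ℕ.≤ e ℕ.* b ℕ.^ k → c ℕ.≤ K ℕ.* (L ℕ.* (s ℕ.* s)) →
        b ℕ.^ (3 ℕ.* k) ℕ.* (u ℕ.* (s ℕ.* s)) ℕ.≤ A ℕ.* (N ℕ.* N ℕ.* (a ℕ.^ (3 ℕ.* k) ℕ.* c)) →
        u ℕ.* (suc k ℕ.* suc k ℕ.* suc k) ℕ.≤ A ℕ.* K ℕ.* (e ℕ.* (e ℕ.* e)) ℕ.* (L ℕ.* (N ℕ.* N))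
      generic A K e b a 1≤e 1≤b decay c≤ h = ℕP.*-cancelˡ-≤ (Q ℕ.* (s ℕ.* s)) {{ℕ.>-nonZero (ℕP.*-mono-≤ (ℕP.*-mono-≤ 1≤B (ℕP.*-mono-≤ 1≤B 1≤B)) (ℕP.*-mono-≤ 1≤s 1≤s))}} (begin
          Q ℕ.* (s ℕ.* s) ℕ.* (u ℕ.* (suc k ℕ.* suc k ℕ.* suc k)) ≤⟨ ℕP.*-monoʳ-≤ (Q ℕ.* (s ℕ.* s)) (ℕP.*-monoʳ-≤ u (ℕP.*-mono-≤ (ℕP.*-mono-≤ κ≤ κ≤) κ≤)) ⟩
          Q ℕ.* (s ℕ.* s) ℕ.* (u ℕ.* (κ ℕ.* κ ℕ.* κ)) ≡⟨ l₁ Q (s ℕ.* s) u κ ⟩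
          Q ℕ.* (u ℕ.* (s ℕ.* s)) ℕ.* (κ ℕ.* κ ℕ.* κ) ≤⟨ ℕP.*-monoˡ-≤ (κ ℕ.* κ ℕ.* κ) (ℕP.≤-trans (ℕP.≤-reflexive (cong (ℕ._* (u ℕ.* (s ℕ.* s))) (sym (cube b)))) (ℕP.≤-trans h (ℕP.≤-reflexive (cong (λ t → A ℕ.* (N ℕ.* N ℕ.* (t ℕ.* c))) (cube a))))) ⟩
          A ℕ.* (N ℕ.* N ℕ.* (P ℕ.* c)) ℕ.* (κ ℕ.* κ ℕ.* κ) ≤⟨ ℕP.*-monoˡ-≤ (κ ℕ.* κ ℕ.* κ) (ℕP.*-monoʳ-≤ A (ℕP.*-monoʳ-≤ (N ℕ.* N) (ℕP.*-monoʳ-≤ P c≤))) ⟩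
          A ℕ.* (N ℕ.* N ℕ.* (P ℕ.* (K ℕ.* (L ℕ.* (s ℕ.* s))))) ℕ.* (κ ℕ.* κ ℕ.* κ) ≡⟨ l₂ A (N ℕ.* N) (a ℕ.^ k) K L (s ℕ.* s) κ ⟩
          A ℕ.* K ℕ.* (L ℕ.* (N ℕ.* N)) ℕ.* (s ℕ.* s) ℕ.* (a ℕ.^ k ℕ.* κ ℕ.* (a ℕ.^ k ℕ.* κ ℕ.* (a ℕ.^ k ℕ.* κ))) ≤⟨ ℕP.*-monoʳ-≤ (A ℕ.* K ℕ.* (L ℕ.* (N ℕ.* N)) ℕ.* (s ℕ.* s)) (ℕP.*-mono-≤ decay (ℕP.*-mono-≤ decay decay)) ⟩
          A ℕ.* K ℕ.* (L ℕ.* (N ℕ.* N)) ℕ.* (s ℕ.* s) ℕ.* (e ℕ.* b ℕ.^ k ℕ.* (e ℕ.* b ℕ.^ k ℕ.* (e ℕ.* b ℕ.^ k))) ≡⟨ l₃ (A ℕ.* K) (L ℕ.* (N ℕ.* N)) (s ℕ.* s) e (b ℕ.^ k) ⟩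
          Q ℕ.* (s ℕ.* s) ℕ.* (A ℕ.* K ℕ.* (e ℕ.* (e ℕ.* e)) ℕ.* (L ℕ.* (N ℕ.* N))) ∎)
        where
          open ℕP.≤-Reasoning
          κ P Q : ℕ
          κ = e ℕ.+ k
          P = a ℕ.^ k ℕ.* (a ℕ.^ k ℕ.* a ℕ.^ k)
          Q = b ℕ.^ k ℕ.* (b ℕ.^ k ℕ.* b ℕ.^ k)
          κ≤ : suc k ℕ.≤ κ
          κ≤ = ℕP.+-monoˡ-≤ k 1≤e
          1≤B : 1 ℕ.≤ b ℕ.^ k
          1≤B = ℕP.≤-trans (ℕP.≤-reflexive (sym (ℕP.^-zeroˡ k))) (ℕP.^-monoˡ-≤ k 1≤b)
          cube : ∀ b → b ℕ.^ (3 ℕ.* k) ≡ b ℕ.^ k ℕ.* (b ℕ.^ k ℕ.* b ℕ.^ k)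
          cube b = trans (cong (b ℕ.^_) (cong (λ t → k ℕ.+ (k ℕ.+ t)) (ℕP.+-identityʳ k))) (trans (ℕP.^-distribˡ-+-* b k (k ℕ.+ k)) (cong (b ℕ.^ k ℕ.*_) (ℕP.^-distribˡ-+-* b k k)))
          l₁ : ∀ Q t u κ → Q ℕ.* t ℕ.* (u ℕ.* (κ ℕ.* κ ℕ.* κ)) ≡ Q ℕ.* (u ℕ.* t) ℕ.* (κ ℕ.* κ ℕ.* κ)
          l₁ = solveℕ-∀
          l₂ : ∀ A M p K L t κ → A ℕ.* (M ℕ.* (p ℕ.* (p ℕ.* p) ℕ.* (K ℕ.* (L ℕ.* t)))) ℕ.* (κ ℕ.* κ ℕ.* κ) ≡ A ℕ.* K ℕ.* (L ℕ.* M) ℕ.* t ℕ.* (p ℕ.* κ ℕ.* (p ℕ.* κ ℕ.* (p ℕ.* κ)))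
          l₂ = solveℕ-∀
          l₃ : ∀ A M t e p → A ℕ.* M ℕ.* t ℕ.* (e ℕ.* p ℕ.* (e ℕ.* p ℕ.* (e ℕ.* p))) ≡ p ℕ.* (p ℕ.* p) ℕ.* t ℕ.* (A ℕ.* (e ℕ.* (e ℕ.* e)) ℕ.* M)
          l₃ = solveℕ-∀

-- Unreached pairs of flags

module Spread (q : ℕ) .{{_ : NonZero q}} (pr : Prime q) (T L : ℕ) (T²<q : T ℕ.* T ℕ.< q) (q≤4T² : q ℕ.≤ 4 ℕ.* (T ℕ.* T))
    (T<2^L : T ℕ.< 2 ℕ.^ L) (large : 16 ℕ.* (2 ℕ.* L ℕ.+ 3) ℕ.≤ T) (1≤L : 1 ℕ.≤ L) where
  open Modular q pr
  open Fixed q pr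
  open Connected q pr
  open Collisions q pr T T²<q
  open Unreached q pr
  open Mixing flags flags-unique act act-∈ act-· act-𝟙

  private
    Σ₀ : List Tuple
    Σ₀ = S₀ T

    s n : ℕ
    s = length Σ₀
    n = length flags

  collisions≤ : ∑ Σ₀ (λ ω → ∑ Σ₀ λ ω' → coincidences (γ ω) (γ ω')) ℕ.≤ collision-constant ℕ.* (L ℕ.* (s ℕ.* s))
  collisions≤ = ℕP.≤-trans total-coincidences (collision-arithmetic T q L s (proportional-count T) q≤4T²
    (ℕP.≤-trans (proportional-count≤ T) (ℕP.*-monoʳ-≤ 2 (ℕP.*-monoʳ-≤ T (harmonic≤ T L T<2^L)))) 1≤L (many-matrices T L T<2^L large))

  1≤s : 1 ℕ.≤ s
  1≤s = positive s (ℕP.≤-trans (ℕP.*-mono-≤ T² (ℕP.*-mono-≤ T² T²)) (many-matrices T L T<2^L large))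
    where
      1≤T : 1 ℕ.≤ T
      1≤T = ℕP.≤-trans (ℕP.≤-trans (s≤s z≤n) (ℕP.*-monoʳ-≤ 16 (ℕP.m≤n+m 3 (2 ℕ.* L)))) large
      T² : 1 ℕ.≤ T ℕ.* T
      T² = ℕP.*-mono-≤ 1≤T 1≤T
      positive : ∀ s → 1 ℕ.≤ 64 ℕ.* s → 1 ℕ.≤ s
      positive zero h = contradiction (subst (1 ℕ.≤_) (ℕP.*-zeroʳ 64) h) λ ()
      positive (suc s) _ = s≤s z≤n

  hits : FlagRep → FlagRep → ℕ
  hits x y = ∑ Σ₀ λ ω → ⟦ act (γ ω) x ≟ᶠ y ⟧

  private
    at-most-one : ∀ z → ∑ flags (λ y → ⟦ z ≟ᶠ y ⟧) ℕ.≤ 1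
    at-most-one z = count≤1 (z ≟ᶠ_) flags flags-unique λ x y _ _ p r → trans (sym p) r

    one : ∀ {z} → z ∈ flags → ∑ flags (λ y → ⟦ z ≟ᶠ y ⟧) ≡ 1
    one {z} m = ℕP.≤-antisym (at-most-one z) (ℕP.≤-trans (⟦⟧-1≤ (z ≟ᶠ z) refl) (∑-elem flags (λ y → ⟦ z ≟ᶠ y ⟧) m))

    pair : ∀ z w (d : Dec (z ≡ w)) → ∑ flags (λ y → ⟦ z ≟ᶠ y ⟧ ℕ.* ⟦ w ≟ᶠ y ⟧) ℕ.≤ ⟦ d ⟧
    pair z w (yes _) = ℕP.≤-trans (∑-mono flags λ y _ → ℕP.≤-trans (ℕP.*-monoʳ-≤ ⟦ z ≟ᶠ y ⟧ (⟦⟧≤1 (w ≟ᶠ y))) (ℕP.≤-reflexive (ℕP.*-identityʳ _))) (at-most-one z)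
    pair z w (no n) = ℕP.≤-reflexive (trans (∑-cong flags λ y _ → disjoint (z ≟ᶠ y) (w ≟ᶠ y)) (∑-zero flags))
      where
        disjoint : ∀ {y} (d : Dec (z ≡ y)) (e : Dec (w ≡ y)) → ⟦ d ⟧ ℕ.* ⟦ e ⟧ ≡ 0
        disjoint (yes p) (yes r) = contradiction (trans p (sym r)) n
        disjoint (yes _) (no _) = refl
        disjoint (no _) _ = refl

  hits-total : ∀ x → x ∈ flags → ∑ flags (hits x) ≡ s
  hits-total x mx = trans (∑-swap flags Σ₀ λ y ω → ⟦ act (γ ω) x ≟ᶠ y ⟧) (trans (∑-cong Σ₀ λ ω m → one (act-∈ (γ ω) x (γ-SL ω m) mx)) (trans (∑-const Σ₀ 1) (ℕP.*-identityʳ s)))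

  -- Squaring a hit count counts pairs of matrices with the same image of `x`; summed over `x` these
  -- are the coincidences.
  hits²-total : ∑ flags (λ x → ∑ flags λ y → hits x y ℕ.* hits x y) ℕ.≤ ∑ Σ₀ (λ ω → ∑ Σ₀ λ ω' → coincidences (γ ω) (γ ω'))
  hits²-total = begin
    ∑ flags (λ x → ∑ flags λ y → hits x y ℕ.* hits x y) ≤⟨ ∑-mono flags (λ x _ → square x) ⟩
    ∑ flags (λ x → ∑ Σ₀ λ ω → ∑ Σ₀ λ ω' → ⟦ act (γ ω) x ≟ᶠ act (γ ω') x ⟧) ≡⟨ ∑-swap flags Σ₀ (λ x ω → ∑ Σ₀ λ ω' → ⟦ act (γ ω) x ≟ᶠ act (γ ω') x ⟧) ⟩
    ∑ Σ₀ (λ ω → ∑ flags λ x → ∑ Σ₀ λ ω' → ⟦ act (γ ω) x ≟ᶠ act (γ ω') x ⟧) ≡⟨ ∑-cong Σ₀ (λ ω _ → ∑-swap flags Σ₀ λ x ω' → ⟦ act (γ ω) x ≟ᶠ act (γ ω') x ⟧) ⟩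
    ∑ Σ₀ (λ ω → ∑ Σ₀ λ ω' → coincidences (γ ω) (γ ω')) ∎
    where
      open ℕP.≤-Reasoning
      I : FlagRep → FlagRep → Tuple → ℕ
      I x y ω = ⟦ act (γ ω) x ≟ᶠ y ⟧
      square : ∀ x → ∑ flags (λ y → hits x y ℕ.* hits x y) ℕ.≤ ∑ Σ₀ λ ω → ∑ Σ₀ λ ω' → ⟦ act (γ ω) x ≟ᶠ act (γ ω') x ⟧
      square x = begin
        ∑ flags (λ y → hits x y ℕ.* hits x y) ≡⟨ ∑-cong flags (λ y _ → ∑-product Σ₀ Σ₀ (I x y) (I x y)) ⟨
        ∑ flags (λ y → ∑ Σ₀ λ ω → ∑ Σ₀ λ ω' → I x y ω ℕ.* I x y ω') ≡⟨ ∑-swap flags Σ₀ (λ y ω → ∑ Σ₀ λ ω' → I x y ω ℕ.* I x y ω') ⟩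
        ∑ Σ₀ (λ ω → ∑ flags λ y → ∑ Σ₀ λ ω' → I x y ω ℕ.* I x y ω') ≡⟨ ∑-cong Σ₀ (λ ω _ → ∑-swap flags Σ₀ λ y ω' → I x y ω ℕ.* I x y ω') ⟩
        ∑ Σ₀ (λ ω → ∑ Σ₀ λ ω' → ∑ flags λ y → I x y ω ℕ.* I x y ω') ≤⟨ ∑-mono Σ₀ (λ ω _ → ∑-mono Σ₀ λ ω' _ → pair (act (γ ω) x) (act (γ ω') x) (act (γ ω) x ≟ᶠ act (γ ω') x)) ⟩
        ∑ Σ₀ (λ ω → ∑ Σ₀ λ ω' → ⟦ act (γ ω) x ≟ᶠ act (γ ω') x ⟧) ∎

  diffused : ℕ → FlagRep → FlagRep → ℤ
  diffused m x = B^ m λ y → + hits x y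

  γ-bounded : ∀ ω → ω ∈ Σ₀ → MBounded (2 ℕ.* T ℕ.+ 1) (γ ω)
  γ-bounded ω m = subst (MBounded (2 ℕ.* T ℕ.+ 1)) (sym (IsMatrix.shape M)) (rows-bounded (IsMatrix.top M) (IsMatrix.top-bounded M) (bounds-of-tuple T (proj₁ (S₀-∈ T m))))
    where
      M : IsMatrix T ω (γ ω)
      M = matrix-correct T ω m
      weaken : ∀ {x} → 1 ℕ.≤ x × x ℕ.≤ T → x ℕ.≤ 2 ℕ.* T ℕ.+ 1
      weaken (_ , h) = ℕP.≤-trans h (ℕP.≤-trans (ℕP.m≤n*m T 2) (ℕP.m≤m+n (2 ℕ.* T) 1))
      rows-bounded : ∀ r → Bounded (2 ℕ.* T ℕ.+ 1) r → let ((a , b , c) , (d , e , f)) = ω in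
        ((1 ℕ.≤ a × a ℕ.≤ T) × (1 ℕ.≤ b × b ℕ.≤ T) × (1 ℕ.≤ c × c ℕ.≤ T)) × ((1 ℕ.≤ d × d ℕ.≤ T) × (1 ℕ.≤ e × e ℕ.≤ T) × (1 ℕ.≤ f × f ℕ.≤ T)) → MBounded (2 ℕ.* T ℕ.+ 1) (rows r (vector (proj₁ ω)) (vector (proj₂ ω)))
      rows-bounded (v3 x y z) h ((ha , hb , hc) , (hd , he , hf)) = mbounded h (bounded (weaken ha) (weaken hb) (weaken hc)) (bounded (weaken hd) (weaken he) (weaken hf))

  diffused-joins : ∀ m x y → x ∈ flags → y ∈ flags → ¬ diffused m x y ≡ 0ℤ → Joins (2 ℕ.^ m ℕ.* (2 ℕ.* T ℕ.+ 1)) x y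
  diffused-joins m x y mx my = support-B^ (2 ℕ.* T ℕ.+ 1) x (λ y → + hits x y) mx hit m y my
    where
      hit : ∀ y → y ∈ flags → ¬ + hits x y ≡ 0ℤ → Joins (2 ℕ.* T ℕ.+ 1) x y
      hit y my n = from (∑ℤ-nonzero Σ₀ (λ ω → + ⟦ act (γ ω) x ≟ᶠ y ⟧) λ e → n (trans (sym (∑ℤ-pos Σ₀ λ ω → ⟦ act (γ ω) x ≟ᶠ y ⟧)) e))
        where
          equal : ∀ {z} (d : Dec (z ≡ y)) → ¬ + ⟦ d ⟧ ≡ 0ℤ → z ≡ y
          equal (yes e) _ = e
          equal (no _) n = contradiction refl n
          from : ∃[ ω ] (ω ∈ Σ₀ × ¬ + ⟦ act (γ ω) x ≟ᶠ y ⟧ ≡ 0ℤ) → Joins (2 ℕ.* T ℕ.+ 1) x y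
          from (ω , m , n) = joins (γ ω) (γ-SL ω m) (γ-bounded ω m) (equal (act (γ ω) x ≟ᶠ y) n)

  -- The walk multiplies the total hit count `s` by `24 ^ m`, so each zero costs `24 ^ (2 m) s²` in
  -- `zeros-Var`, while `mixing` bounds the variance from above. With the denominators `5 ^ m`
  -- cleared, the left factor is `dilation = 5 · 24²`.
  zeros-bound : ∀ m x → x ∈ flags → dilation ℕ.^ m ℕ.* (zeros (diffused m x) ℕ.* (s ℕ.* s)) ℕ.≤ mixing-factor ℕ.* (n ℕ.* n ℕ.* (contraction ℕ.^ m ℕ.* ∑ flags (λ y → hits x y ℕ.* hits x y)))
  zeros-bound m x mx = generic 5 576 24 contraction dilation mixing-factor refl dilation-≡ (zeros-Var g) (mixing poincaré m f) (S-B^ m f)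
    where
      f g : FlagRep → ℤ
      f y = + hits x y
      g = diffused m x
      u c : ℕ
      u = zeros g
      c = ∑ flags λ y → hits x y ℕ.* hits x y
      sum-f : S f ≡ + s
      sum-f = trans (∑ℤ-pos flags (hits x)) (cong +_ (hits-total x mx))
      norm-f : ⟨ f , f ⟩ ≡ + c
      norm-f = trans (∑ℤ-cong flags λ y _ → sym (ℤP.pos-* (hits x y) (hits x y))) (∑ℤ-pos flags λ y → hits x y ℕ.* hits x y)
      pos-^ : ∀ a m → + (a ℕ.^ m) ≡ (+ a) ℤ.^ m
      pos-^ a zero = refl
      pos-^ a (suc m) = trans (ℤP.pos-* a (a ℕ.^ m)) (cong (+ a *_) (pos-^ a m))
      *-^ : ∀ a b m → (a ℕ.* b) ℕ.^ m ≡ a ℕ.^ m ℕ.* b ℕ.^ m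
      *-^ a b zero = refl
      *-^ a b (suc m) = trans (cong (a ℕ.* b ℕ.*_) (*-^ a b m)) (lem a b (a ℕ.^ m) (b ℕ.^ m))
        where lem : ∀ a b p r → a ℕ.* b ℕ.* (p ℕ.* r) ≡ a ℕ.* p ℕ.* (b ℕ.* r)
              lem = solveℕ-∀
      generic : ∀ a b d p r A → b ≡ d ℕ.* d → r ≡ a ℕ.* b → + u * (S g * S g) ℤ.≤ N * Var g → (+ a) ℤ.^ m * Var g ℤ.≤ + A * (N * ((+ p) ℤ.^ m * ⟨ f , f ⟩)) → S g ≡ (+ d) ℤ.^ m * S f →
        r ℕ.^ m ℕ.* (u ℕ.* (s ℕ.* s)) ℕ.≤ A ℕ.* (n ℕ.* n ℕ.* (p ℕ.^ m ℕ.* c))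
      generic a b d p r A refl refl h₁ h₂ h₃ = ℤP.drop‿+≤+ (begin
          + ((a ℕ.* (d ℕ.* d)) ℕ.^ m ℕ.* (u ℕ.* (s ℕ.* s))) ≡⟨ trans (ℤP.pos-* ((a ℕ.* (d ℕ.* d)) ℕ.^ m) (u ℕ.* (s ℕ.* s))) (cong₂ _*_ left (trans (ℤP.pos-* u (s ℕ.* s)) (cong (+ u *_) (ℤP.pos-* s s)))) ⟩
          (+ a) ℤ.^ m * ((+ d) ℤ.^ m * (+ d) ℤ.^ m) * (+ u * (+ s * + s)) ≡⟨ l₁ ((+ a) ℤ.^ m) ((+ d) ℤ.^ m) (+ u) (+ s) ⟩
          (+ a) ℤ.^ m * (+ u * ((+ d) ℤ.^ m * + s * ((+ d) ℤ.^ m * + s))) ≡⟨ cong (λ t → (+ a) ℤ.^ m * (+ u * (t * t))) (sym (trans h₃ (cong ((+ d) ℤ.^ m *_) sum-f))) ⟩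
          (+ a) ℤ.^ m * (+ u * (S g * S g)) ≤⟨ scale-left h₁ ⟩
          (+ a) ℤ.^ m * (N * Var g) ≡⟨ l₂ ((+ a) ℤ.^ m) N (Var g) ⟩
          N * ((+ a) ℤ.^ m * Var g) ≤⟨ *-monoˡ n h₂ ⟩
          N * (+ A * (N * ((+ p) ℤ.^ m * ⟨ f , f ⟩))) ≡⟨ l₃ N (+ A) ((+ p) ℤ.^ m * ⟨ f , f ⟩) ⟩
          + A * (N * N * ((+ p) ℤ.^ m * ⟨ f , f ⟩)) ≡⟨ right ⟩
          + (A ℕ.* (n ℕ.* n ℕ.* (p ℕ.^ m ℕ.* c))) ∎)
        where
          open ℤP.≤-Reasoning
          l₁ : ∀ a d u s → a * (d * d) * (u * (s * s)) ≡ a * (u * (d * s * (d * s)))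
          l₁ = solve-∀
          l₂ : ∀ a n v → a * (n * v) ≡ n * (a * v)
          l₂ = solve-∀
          l₃ : ∀ n a t → n * (a * (n * t)) ≡ a * (n * n * t)
          l₃ = solve-∀
          left : + ((a ℕ.* (d ℕ.* d)) ℕ.^ m) ≡ (+ a) ℤ.^ m * ((+ d) ℤ.^ m * (+ d) ℤ.^ m)
          left = trans (cong +_ (trans (*-^ a (d ℕ.* d) m) (cong (a ℕ.^ m ℕ.*_) (*-^ d d m)))) (trans (ℤP.pos-* (a ℕ.^ m) (d ℕ.^ m ℕ.* d ℕ.^ m)) (cong₂ _*_ (pos-^ a m) (trans (ℤP.pos-* (d ℕ.^ m) (d ℕ.^ m)) (cong₂ _*_ (pos-^ d m) (pos-^ d m)))))
          right : + A * (N * N * ((+ p) ℤ.^ m * ⟨ f , f ⟩)) ≡ + (A ℕ.* (n ℕ.* n ℕ.* (p ℕ.^ m ℕ.* c)))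
          right = sym (trans (ℤP.pos-* A (n ℕ.* n ℕ.* (p ℕ.^ m ℕ.* c))) (cong (+ A *_) (trans (ℤP.pos-* (n ℕ.* n) (p ℕ.^ m ℕ.* c)) (cong₂ _*_ (ℤP.pos-* n n) (trans (ℤP.pos-* (p ℕ.^ m) c) (cong₂ _*_ (pos-^ p m) (sym norm-f)))))))
          scale-left : ∀ {x y} → x ℤ.≤ y → (+ a) ℤ.^ m * x ℤ.≤ (+ a) ℤ.^ m * y
          scale-left {x} {y} h = subst (λ t → t * x ℤ.≤ t * y) (pos-^ a m) (*-monoˡ (a ℕ.^ m) h)

  -- Summing `zeros-bound` over `x` brings in the second moment of the hits, which the collision
  -- count bounds by `L s²` up to a constant; `spread-arithmetic` trades the exponential decay for
  -- the cube of `k + 1`.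
  unreached-total : ∀ k → ∑ flags (λ x → zeros (diffused (3 ℕ.* k) x)) ℕ.* (suc k ℕ.* suc k ℕ.* suc k) ℕ.≤ spread-constant ℕ.* (L ℕ.* (n ℕ.* n))
  unreached-total k = spread-arithmetic k (∑ flags U) s n L (∑ flags C) 1≤s (ℕP.≤-trans hits²-total collisions≤) (sum-up dilation contraction mixing-factor (zeros-bound (3 ℕ.* k)))
    where
      U C : FlagRep → ℕ
      U x = zeros (diffused (3 ℕ.* k) x)
      C x = ∑ flags λ y → hits x y ℕ.* hits x y
      sum-up : ∀ b a A → (∀ x → x ∈ flags → b ℕ.^ (3 ℕ.* k) ℕ.* (U x ℕ.* (s ℕ.* s)) ℕ.≤ A ℕ.* (n ℕ.* n ℕ.* (a ℕ.^ (3 ℕ.* k) ℕ.* C x))) →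
        b ℕ.^ (3 ℕ.* k) ℕ.* (∑ flags U ℕ.* (s ℕ.* s)) ℕ.≤ A ℕ.* (n ℕ.* n ℕ.* (a ℕ.^ (3 ℕ.* k) ℕ.* ∑ flags C))
      sum-up b a A h = begin
        P ℕ.* (∑ flags U ℕ.* (s ℕ.* s)) ≡⟨ cong (P ℕ.*_) (∑-*ʳ flags (s ℕ.* s) U) ⟨
        P ℕ.* ∑ flags (λ x → U x ℕ.* (s ℕ.* s)) ≡⟨ ∑-*ˡ flags P (λ x → U x ℕ.* (s ℕ.* s)) ⟨
        ∑ flags (λ x → P ℕ.* (U x ℕ.* (s ℕ.* s))) ≤⟨ ∑-mono flags h ⟩
        ∑ flags (λ x → A ℕ.* (n ℕ.* n ℕ.* (R ℕ.* C x))) ≡⟨ trans (∑-*ˡ flags A (λ x → n ℕ.* n ℕ.* (R ℕ.* C x))) (cong (A ℕ.*_) (trans (∑-*ˡ flags (n ℕ.* n) (λ x → R ℕ.* C x)) (cong (n ℕ.* n ℕ.*_) (∑-*ˡ flags R C)))) ⟩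
        A ℕ.* (n ℕ.* n ℕ.* (R ℕ.* ∑ flags C)) ∎
        where
          open ℕP.≤-Reasoning
          P R : ℕ
          P = b ℕ.^ (3 ℕ.* k)
          R = a ℕ.^ (3 ℕ.* k)

-- Flags as pairs of normalised vectors

toMat : M3 → Mat3
toMat g Fin.zero Fin.zero = M3.a₁₁ g
toMat g Fin.zero (Fin.suc Fin.zero) = M3.a₁₂ g
toMat g Fin.zero (Fin.suc (Fin.suc Fin.zero)) = M3.a₁₃ g
toMat g (Fin.suc Fin.zero) Fin.zero = M3.a₂₁ g
toMat g (Fin.suc Fin.zero) (Fin.suc Fin.zero) = M3.a₂₂ g
toMat g (Fin.suc Fin.zero) (Fin.suc (Fin.suc Fin.zero)) = M3.a₂₃ g
toMat g (Fin.suc (Fin.suc Fin.zero)) Fin.zero = M3.a₃₁ g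
toMat g (Fin.suc (Fin.suc Fin.zero)) (Fin.suc Fin.zero) = M3.a₃₂ g
toMat g (Fin.suc (Fin.suc Fin.zero)) (Fin.suc (Fin.suc Fin.zero)) = M3.a₃₃ g

module FlagModel (q : ℕ) .{{_ : NonZero q}} (pr : Prime q) where
  open Modular q pr
  open Fixed q pr
  open FixedCounts q pr

  ι : Fq q → ℤ
  ι a = + toℕ a

  private
    ι-mod : ∀ n → Z (ι (n modℕ q) - + n)
    ι-mod n = divides (- + (n / q)) (trans (cong₂ _-_ (cong +_ (FinP.toℕ-fromℕ< _)) (trans (cong +_ (m≡m%n+[m/n]*n n q)) (trans (ℤP.pos-+ (n % q) (n / q ℕ.* q)) (cong (λ t → + (n % q) + t) (ℤP.pos-* (n / q) q))))) (lem (+ (n % q)) (+ (n / q)) (+ q)))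
      where lem : ∀ r d q → r - (r + d * q) ≡ - d * q
            lem = solve-∀

    ι-⊕ : ∀ a b → Z (ι (_⊕_ q a b) - (ι a + ι b))
    ι-⊕ a b = subst (λ t → Z (ι (_⊕_ q a b) - t)) (ℤP.pos-+ (toℕ a) (toℕ b)) (ι-mod (toℕ a ℕ.+ toℕ b))

    ι-⊗ : ∀ a b → Z (ι (_⊗_ q a b) - ι a * ι b)
    ι-⊗ a b = subst (λ t → Z (ι (_⊗_ q a b) - t)) (ℤP.pos-* (toℕ a) (toℕ b)) (ι-mod (toℕ a ℕ.* toℕ b))

    ι-red : ∀ z → Z (ι (red q z) - z)
    ι-red z = Z₂ 1ℤ 1ℤ (ι-mod (z %ℕ q)) (divides (- (z /ℕ q)) (trans (cong (λ t → + (z %ℕ q) - t) (a≡a%ℕn+[a/ℕn]*n z q)) (lem (+ (z %ℕ q)) (z /ℕ q) (+ q)))) (split (ι (red q z)) (+ (z %ℕ q)) z)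
      where
        lem : ∀ r d q → r - (r + d * q) ≡ - d * q
        lem = solve-∀
        split : ∀ a b c → a - c ≡ 1ℤ * (a - b) + 1ℤ * (b - c)
        split = solve-∀

    ι-injective : ∀ {a b} → Z (ι a - ι b) → a ≡ b
    ι-injective {a} {b} z = FinP.toℕ-injective (ℤP.+-injective (residue-≡ (∈-residues (FinP.toℕ<n a)) (∈-residues (FinP.toℕ<n b)) z))

    ι-zero : Z (ι (zeroF q))
    ι-zero = Z₁ 1ℤ (ι-mod 0) (lem (ι (zeroF q)))
      where lem : ∀ x → x ≡ 1ℤ * (x - 0ℤ)
            lem = solve-∀

    ≡-zeroF : ∀ {a} → Z (ι a) → a ≡ zeroF q
    ≡-zeroF {a} z = ι-injective (Z₂ 1ℤ (- 1ℤ) z ι-zero (lem (ι a) (ι (zeroF q))))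
      where lem : ∀ a b → a - b ≡ 1ℤ * a + - 1ℤ * b
            lem = solve-∀

    red-1≢zeroF : ¬ red q 1ℤ ≡ zeroF q
    red-1≢zeroF e = ¬Z-1 (Z₂ (- 1ℤ) 1ℤ (ι-red 1ℤ) (subst (λ a → Z (ι a)) (sym e) ι-zero) (lem (ι (red q 1ℤ))))
      where lem : ∀ a → 1ℤ ≡ - 1ℤ * (a - 1ℤ) + 1ℤ * a
            lem = solve-∀

  vec : Pt q → V3
  vec (a ∷ b ∷ c ∷ []) = v3 (ι a) (ι b) (ι c)

  pt : V3 → Pt q
  pt (v3 a b c) = red q a ∷ red q b ∷ red q c ∷ []

  infix 4 _≋_
  -- Equality of vectors modulo `q`, finer than proportionality `_∼_`. Under it `vec` and `pt` are
  -- mutually inverse.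
  record _≋_ (u v : V3) : Set where
    constructor congruent
    field difference : Zⱽ (u ⊟ v)

  private
    ≋-≡ : ∀ {u v} → u ≡ v → u ≋ v
    ≋-≡ {u} refl = congruent (zⱽ (Z-≡0 (lem (vx u))) (Z-≡0 (lem (vy u))) (Z-≡0 (lem (vz u))))
      where lem : ∀ a → a - a ≡ 0ℤ
            lem = solve-∀

    ≋-sym : ∀ {u v} → u ≋ v → v ≋ u
    ≋-sym {u} {v} (congruent (zⱽ p r s)) = congruent (zⱽ (Z₁ (- 1ℤ) p (lem (vx u) (vx v))) (Z₁ (- 1ℤ) r (lem (vy u) (vy v))) (Z₁ (- 1ℤ) s (lem (vz u) (vz v))))
      where lem : ∀ a b → b - a ≡ - 1ℤ * (a - b)
            lem = solve-∀

    ≋-trans : ∀ {u v w} → u ≋ v → v ≋ w → u ≋ w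
    ≋-trans {u} {v} {w} (congruent (zⱽ p r s)) (congruent (zⱽ p' r' s')) = congruent (zⱽ (Z₂ 1ℤ 1ℤ p p' (lem (vx u) (vx v) (vx w))) (Z₂ 1ℤ 1ℤ r r' (lem (vy u) (vy v) (vy w))) (Z₂ 1ℤ 1ℤ s s' (lem (vz u) (vz v) (vz w))))
      where lem : ∀ a b c → a - c ≡ 1ℤ * (a - b) + 1ℤ * (b - c)
            lem = solve-∀

    ≋-⊞ : ∀ u v u' v' → u ≋ u' → v ≋ v' → u ⊞ v ≋ u' ⊞ v'
    ≋-⊞ u v u' v' (congruent (zⱽ p r s)) (congruent (zⱽ p' r' s')) = congruent (zⱽ (Z₂ 1ℤ 1ℤ p p' (lem (vx u) (vx v) (vx u') (vx v'))) (Z₂ 1ℤ 1ℤ r r' (lem (vy u) (vy v) (vy u') (vy v'))) (Z₂ 1ℤ 1ℤ s s' (lem (vz u) (vz v) (vz u') (vz v'))))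
      where lem : ∀ a b c d → a + b - (c + d) ≡ 1ℤ * (a - c) + 1ℤ * (b - d)
            lem = solve-∀

    ∙-≋ : ∀ u {v w} → v ≋ w → Z (u ∙ w) → Z (u ∙ v)
    ∙-≋ u@(v3 a b c) {v@(v3 x y z)} {w@(v3 x' y' z')} (congruent d) h = Z₂ 1ℤ 1ℤ (Z-∙ u (v ⊟ w) d) h (lem a b c x y z x' y' z')
      where lem : ∀ a b c x y z x' y' z' → a * x + b * y + c * z ≡ 1ℤ * (a * (x - x') + b * (y - y') + c * (z - z')) + 1ℤ * (a * x' + b * y' + c * z')
            lem = solve-∀

    ⊙-≋ : ∀ g {v w} → v ≋ w → g ⊙ v ≋ g ⊙ w
    ⊙-≋ g {v} {w} (congruent d) = congruent (zⱽ (step (row₁ g) v w d) (step (row₂ g) v w d) (step (row₃ g) v w d))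
      where
        lem : ∀ a b c x y z x' y' z' → a * x + b * y + c * z - (a * x' + b * y' + c * z') ≡ 1ℤ * (a * (x - x') + b * (y - y') + c * (z - z'))
        lem = solve-∀
        step : ∀ u v w → Zⱽ (v ⊟ w) → Z (u ∙ v - u ∙ w)
        step u@(v3 a b c) v@(v3 x y z) w@(v3 x' y' z') d = Z₁ 1ℤ (Z-∙ u (v ⊟ w) d) (lem a b c x y z x' y' z')

    ×ᵥ-≋ : ∀ u {v w} → v ≋ w → Zⱽ (u ×ᵥ w) → Zⱽ (u ×ᵥ v)
    ×ᵥ-≋ (v3 a b c) {v3 x y z} {v3 x' y' z'} (congruent (zⱽ p r s)) (zⱽ e f g) = zⱽ (Z₃ b (- c) 1ℤ s r e (lem b c y z y' z')) (Z₃ c (- a) 1ℤ p s f (lem c a z x z' x')) (Z₃ a (- b) 1ℤ r p g (lem a b x y x' y'))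
      where lem : ∀ b c y z y' z' → b * z - c * y ≡ b * (z - z') + - c * (y - y') + 1ℤ * (b * z' - c * y')
            lem = solve-∀

    ×ᵥ-∼ : ∀ {v w} u → v ∼ w → Zⱽ (w ×ᵥ u) → Zⱽ (v ×ᵥ u)
    ×ᵥ-∼ {v3 x y z} {v3 x' y' z'} (v3 a b c) (scaled k _ (zⱽ p r s)) (zⱽ e f g) = zⱽ (Z₃ c (- b) k r s e (lem y z y' z' b c k)) (Z₃ a (- c) k s p f (lem z x z' x' c a k)) (Z₃ b (- a) k p r g (lem x y x' y' a b k))
      where lem : ∀ y z y' z' b c k → y * c - z * b ≡ c * (y - k * y') + - b * (z - k * z') + k * (y' * c - z' * b)
            lem = solve-∀

    ×ᵥ-swap : ∀ u v → Zⱽ (u ×ᵥ v) → Zⱽ (v ×ᵥ u)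
    ×ᵥ-swap (v3 a b c) (v3 x y z) (zⱽ p r s) = zⱽ (Z₁ (- 1ℤ) p (lem b c y z)) (Z₁ (- 1ℤ) r (lem c a z x)) (Z₁ (- 1ℤ) s (lem a b x y))
      where lem : ∀ b c y z → y * c - z * b ≡ - 1ℤ * (b * z - c * y)
            lem = solve-∀

    vec-injective : ∀ {p p'} → vec p ≋ vec p' → p ≡ p'
    vec-injective {a ∷ b ∷ c ∷ []} {a' ∷ b' ∷ c' ∷ []} (congruent (zⱽ x y z)) = cong₂ _∷_ (ι-injective x) (cong₂ _∷_ (ι-injective y) (cong₂ _∷_ (ι-injective z) refl))

    vec-pt : ∀ v → vec (pt v) ≋ v
    vec-pt (v3 a b c) = congruent (zⱽ (ι-red a) (ι-red b) (ι-red c))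

    vec-·P : ∀ c p → vec (_·P_ q c p) ≋ ι c ⋆ vec p
    vec-·P k (a ∷ b ∷ c ∷ []) = congruent (zⱽ (ι-⊗ k a) (ι-⊗ k b) (ι-⊗ k c))

    vec-+P : ∀ p p' → vec (_+P_ q p p') ≋ vec p ⊞ vec p'
    vec-+P (a ∷ b ∷ c ∷ []) (a' ∷ b' ∷ c' ∷ []) = congruent (zⱽ (ι-⊕ a a') (ι-⊕ b b') (ι-⊕ c c'))

    vec-combination : ∀ a u b w → vec (_+P_ q (_·P_ q a u) (_·P_ q b w)) ≋ ι a ⋆ vec u ⊞ ι b ⋆ vec w
    vec-combination a u b w = ≋-trans (vec-+P (_·P_ q a u) (_·P_ q b w)) (≋-⊞ (vec (_·P_ q a u)) (vec (_·P_ q b w)) (ι a ⋆ vec u) (ι b ⋆ vec w) (vec-·P a u) (vec-·P b w))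

    red-⋆ : ∀ k u → ι (red q k) ⋆ u ≋ k ⋆ u
    red-⋆ k u = congruent (zⱽ (Z₁ (vx u) (ι-red k) (lem (ι (red q k)) k (vx u))) (Z₁ (vy u) (ι-red k) (lem (ι (red q k)) k (vy u))) (Z₁ (vz u) (ι-red k) (lem (ι (red q k)) k (vz u))))
      where lem : ∀ k l u → k * u - l * u ≡ u * (k - l)
            lem = solve-∀

    vec-red-combination : ∀ a u b w → vec (_+P_ q (_·P_ q (red q a) u) (_·P_ q (red q b) w)) ≋ a ⋆ vec u ⊞ b ⋆ vec w
    vec-red-combination a u b w = ≋-trans (vec-combination (red q a) u (red q b) w) (≋-⊞ (ι (red q a) ⋆ vec u) (ι (red q b) ⋆ vec w) (a ⋆ vec u) (b ⋆ vec w) (red-⋆ a (vec u)) (red-⋆ b (vec w)))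

    vec-actPt : ∀ g p → vec (actPt q (toMat g) p) ≋ g ⊙ vec p
    vec-actPt (mat a b c d e f g h i) (x ∷ y ∷ z ∷ []) = congruent (zⱽ (row a b c) (row d e f) (row g h i))
      where
        term : ∀ a x → Z (ι (_⊗_ q (red q a) x) - a * ι x)
        term a x = Z₂ 1ℤ (ι x) (ι-⊗ (red q a) x) (ι-red a) (lem (ι (_⊗_ q (red q a) x)) (ι (red q a)) a (ι x))
          where lem : ∀ t r a x → t - a * x ≡ 1ℤ * (t - r * x) + x * (r - a)
                lem = solve-∀
        sum : ∀ {s t} a b → Z (ι s - a) → Z (ι t - b) → Z (ι (_⊕_ q s t) - (a + b))
        sum {s} {t} a b h k = Z₃ 1ℤ 1ℤ 1ℤ (ι-⊕ s t) h k (lem (ι (_⊕_ q s t)) (ι s) (ι t) a b)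
          where lem : ∀ u s t a b → u - (a + b) ≡ 1ℤ * (u - (s + t)) + 1ℤ * (s - a) + 1ℤ * (t - b)
                lem = solve-∀
        row : ∀ a b c → Z (ι (_⊕_ q (_⊕_ q (_⊗_ q (red q a) x) (_⊗_ q (red q b) y)) (_⊗_ q (red q c) z)) - (a * ι x + b * ι y + c * ι z))
        row a b c = sum (a * ι x + b * ι y) (c * ι z) (sum (a * ι x) (b * ι y) (term a x) (term b y)) (term c z)

    nonzero-vec : ∀ {v} → ¬ v ≡ zeroPt q → ¬ Zⱽ (vec v)
    nonzero-vec {a ∷ b ∷ c ∷ []} n (zⱽ x y z) = n (cong₂ _∷_ (≡-zeroF x) (cong₂ _∷_ (≡-zeroF y) (cong₂ _∷_ (≡-zeroF z) refl)))

    vec-zeroPt : Zⱽ (vec (zeroPt q))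
    vec-zeroPt = zⱽ ι-zero ι-zero ι-zero

    Zⱽ-≋ : ∀ {u v} → u ≋ v → Zⱽ v → Zⱽ u
    Zⱽ-≋ {u} {v} (congruent (zⱽ p r s)) (zⱽ x y z) = zⱽ (Z₂ 1ℤ 1ℤ p x (lem (vx u) (vx v))) (Z₂ 1ℤ 1ℤ r y (lem (vy u) (vy v))) (Z₂ 1ℤ 1ℤ s z (lem (vz u) (vz v)))
      where lem : ∀ a b → a ≡ 1ℤ * (a - b) + 1ℤ * b
            lem = solve-∀

    line-span : ∀ v w → ¬ Zⱽ v → Zⱽ (v ×ᵥ w) → ∃[ c ] w ≋ c ⋆ v
    line-span v w nv z = decide (Zⱽ? w)
      where
        lem : ∀ a b → a - 0ℤ * b ≡ 1ℤ * a
        lem = solve-∀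
        decide : Dec (Zⱽ w) → ∃[ c ] w ≋ c ⋆ v
        decide (yes (zⱽ p r s)) = 0ℤ , congruent (zⱽ (Z₁ 1ℤ p (lem (vx w) (vx v))) (Z₁ 1ℤ r (lem (vy w) (vy v))) (Z₁ 1ℤ s (lem (vz w) (vz v))))
        decide (no nw) = _∼_.factor par , congruent (_∼_.difference par)
          where
            par : w ∼ v
            par = parallel w v nw nv (×ᵥ-swap v w z)

    self-× : ∀ v c → Zⱽ (v ×ᵥ (c ⋆ v))
    self-× (v3 x y z) c = zⱽ (Z-≡0 (lem y z c)) (Z-≡0 (lem z x c)) (Z-≡0 (lem x y c))
      where lem : ∀ y z c → y * (c * z) - z * (c * y) ≡ 0ℤ
            lem = solve-∀

  in-line : ∀ v → ¬ Zⱽ (vec v) → ∀ p → (∃[ c ] p ≡ _·P_ q c v) ⇔ Zⱽ (vec v ×ᵥ vec p)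
  in-line v nv p = mk⇔ (λ { (c , refl) → ×ᵥ-≋ (vec v) (vec-·P c v) (self-× (vec v) (ι c)) }) λ z → from (line-span (vec v) (vec p) nv z)
    where
      from : ∃[ c ] vec p ≋ c ⋆ vec v → ∃[ c ] p ≡ _·P_ q c v
      from (c , e) = red q c , vec-injective (≋-trans e (≋-sym (≋-trans (vec-·P (red q c) v) (red-⋆ c (vec v)))))

  private
    -- Some coordinate vector `e` has unit product with the normal, so `expansion` writes `r` in
    -- terms of `e`, `u` and `w`. The coefficient of `e` is `r ∙ (u ×ᵥ w)`, which vanishes by
    -- hypothesis.
    plane-span : ∀ u w r → ¬ Zⱽ (u ×ᵥ w) → Z ((u ×ᵥ w) ∙ r) → ∃[ a ] ∃[ b ] r ≋ a ⋆ u ⊞ b ⋆ w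
    plane-span u w r n z = choose (Z? (vx m)) (Z? (vy m))
      where
        m : V3
        m = u ×ᵥ w
        build : ∀ e → ¬ Z (e ∙ m) → ∃[ a ] ∃[ b ] r ≋ a ⋆ u ⊞ b ⋆ w
        build e nk = i * A , i * B , congruent (zⱽ (coordinate (vx r) (vx u) (vx w) (vx e) (cong vx eq)) (coordinate (vy r) (vy u) (vy w) (vy e) (cong vy eq)) (coordinate (vz r) (vz u) (vz w) (vz e) (cong vz eq)))
          where
            k i A B R : ℤ
            k = e ∙ m
            i = inv k
            A = r ∙ (w ×ᵥ e)
            B = r ∙ (e ×ᵥ u)
            R = r ∙ m
            zR : Z R
            zR = subst Z (∙-comm m r) z
              where
                ∙-comm : ∀ u v → u ∙ v ≡ v ∙ u
                ∙-comm (v3 a b c) (v3 x y z) = lem a b c x y z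
                  where lem : ∀ a b c x y z → a * x + b * y + c * z ≡ x * a + y * b + z * c
                        lem = solve-∀
            eq : k ⋆ r ≡ R ⋆ e ⊞ A ⋆ u ⊞ B ⋆ w
            eq = expansion e u w r
            lem : ∀ x u w e k i A B R → x - (i * A * u + i * B * w) ≡ x * (1ℤ - k * i) + (i * (k * x - (R * e + A * u + B * w)) + i * e * R)
            lem = solve-∀
            coordinate : ∀ x u w e → k * x ≡ R * e + A * u + B * w → Z (x - (i * A * u + i * B * w))
            coordinate x u w e h = Z₂ x (i * e) (inv-≡ k nk) zR (trans (lem x u w e k i A B R) (cong (λ t → x * (1ℤ - k * i) + t) (trans (cong (λ t → i * (t - (R * e + A * u + B * w)) + i * e * R) h) (cancel i (R * e + A * u + B * w) (i * e * R)))))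
              where cancel : ∀ i s t → i * (s - s) + t ≡ t
                    cancel = solve-∀
        e₁ : ∀ a b c → 1ℤ * a + 0ℤ * b + 0ℤ * c ≡ a
        e₁ = solve-∀
        e₂ : ∀ a b c → 0ℤ * a + 1ℤ * b + 0ℤ * c ≡ b
        e₂ = solve-∀
        e₃ : ∀ a b c → 0ℤ * a + 0ℤ * b + 1ℤ * c ≡ c
        e₃ = solve-∀
        choose : Dec (Z (vx m)) → Dec (Z (vy m)) → ∃[ a ] ∃[ b ] r ≋ a ⋆ u ⊞ b ⋆ w
        choose (no nx) _ = build (v3 1ℤ 0ℤ 0ℤ) λ h → nx (subst Z (e₁ (vx m) (vy m) (vz m)) h)
        choose (yes _) (no ny) = build (v3 0ℤ 1ℤ 0ℤ) λ h → ny (subst Z (e₂ (vx m) (vy m) (vz m)) h)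
        choose (yes zx') (yes zy') = build (v3 0ℤ 0ℤ 1ℤ) λ h → n (zⱽ zx' zy' (subst Z (e₃ (vx m) (vy m) (vz m)) h))

    normal-⊥ : ∀ u w a b → Z ((u ×ᵥ w) ∙ (a ⋆ u ⊞ b ⋆ w))
    normal-⊥ (v3 x y z) (v3 x' y' z') a b = Z-≡0 (lem x y z x' y' z' a b)
      where lem : ∀ x y z x' y' z' a b → (y * z' - z * y') * (a * x + b * x') + (z * x' - x * z') * (a * y + b * y') + (x * y' - y * x') * (a * z + b * z') ≡ 0ℤ
            lem = solve-∀

  in-plane : ∀ u w → ¬ Zⱽ (vec u ×ᵥ vec w) → ∀ p → (∃[ a ] ∃[ b ] p ≡ _+P_ q (_·P_ q a u) (_·P_ q b w)) ⇔ Z ((vec u ×ᵥ vec w) ∙ vec p)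
  in-plane u w n p = mk⇔ (λ { (a , b , refl) → ∙-≋ (vec u ×ᵥ vec w) (vec-combination a u b w) (normal-⊥ (vec u) (vec w) (ι a) (ι b)) }) λ z → from (plane-span (vec u) (vec w) (vec p) n z)
    where
      from : ∃[ a ] ∃[ b ] vec p ≋ a ⋆ vec u ⊞ b ⋆ vec w → ∃[ a ] ∃[ b ] p ≡ _+P_ q (_·P_ q a u) (_·P_ q b w)
      from (a , b , e) = red q a , red q b , vec-injective (≋-trans e (≋-sym (vec-red-combination a u b w)))

  -- If the cross product vanished, `w` would be congruent to some `c u`, and the coefficients `− c`
  -- and 1 would contradict independence; the case `u ≡ 0` is excluded by the coefficients 1 and 0.
  LinIndep⇒ : ∀ u w → LinIndep q u w → ¬ Zⱽ (vec u ×ᵥ vec w)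
  LinIndep⇒ u w ind z = dependent (line-span (vec u) (vec w) u≢0 z)
    where
      relation : ∀ a b → Zⱽ (a ⋆ vec u ⊞ b ⋆ vec w) → red q a ≡ zeroF q × red q b ≡ zeroF q
      relation a b h = ind (red q a) (red q b) (vec-injective (≋-trans (vec-red-combination a u b w) (both h vec-zeroPt)))
        where
          both : ∀ {x y} → Zⱽ x → Zⱽ y → x ≋ y
          both {x} {y} (zⱽ a b c) (zⱽ a' b' c') = congruent (zⱽ (Z₂ 1ℤ (- 1ℤ) a a' (lem (vx x) (vx y))) (Z₂ 1ℤ (- 1ℤ) b b' (lem (vy x) (vy y))) (Z₂ 1ℤ (- 1ℤ) c c' (lem (vz x) (vz y))))
            where lem : ∀ a b → a - b ≡ 1ℤ * a + - 1ℤ * b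
                  lem = solve-∀
      u≢0 : ¬ Zⱽ (vec u)
      u≢0 (zⱽ a b c) = red-1≢zeroF (proj₁ (relation 1ℤ 0ℤ (zⱽ (Z₁ 1ℤ a (lem (vx (vec u)) (vx (vec w)))) (Z₁ 1ℤ b (lem (vy (vec u)) (vy (vec w)))) (Z₁ 1ℤ c (lem (vz (vec u)) (vz (vec w)))))))
        where lem : ∀ a b → 1ℤ * a + 0ℤ * b ≡ 1ℤ * a
              lem = solve-∀
      dependent : ¬ (∃[ c ] vec w ≋ c ⋆ vec u)
      dependent (c , congruent (zⱽ p r s)) = red-1≢zeroF (proj₂ (relation (- c) 1ℤ (zⱽ (Z₁ 1ℤ p (lem (vx (vec u)) (vx (vec w)) c)) (Z₁ 1ℤ r (lem (vy (vec u)) (vy (vec w)) c)) (Z₁ 1ℤ s (lem (vz (vec u)) (vz (vec w)) c)))))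
        where lem : ∀ a b c → - c * a + 1ℤ * b ≡ 1ℤ * (b - c * a)
              lem = solve-∀

  LinIndep⇐ : ∀ u w → ¬ Zⱽ (vec u ×ᵥ vec w) → LinIndep q u w
  LinIndep⇐ u w n a b e = ≡-zeroF (proj₁ zeros) , ≡-zeroF (proj₂ zeros)
    where
      zeros : Z (ι a) × Z (ι b)
      zeros = independent (ι a) (ι b) (vec u) (vec w) n (Zⱽ-≋ (≋-sym (vec-combination a u b w)) (subst (λ p → Zⱽ (vec p)) (sym e) vec-zeroPt))

  private
    ≋⇒∼ : ∀ {u v} → u ≋ v → u ∼ v
    ≋⇒∼ {u} {v} (congruent (zⱽ p r s)) = scaled 1ℤ ¬Z-1 (zⱽ (Z₁ 1ℤ p (lem (vx u) (vx v))) (Z₁ 1ℤ r (lem (vy u) (vy v))) (Z₁ 1ℤ s (lem (vz u) (vz v))))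
      where lem : ∀ a b → a - 1ℤ * b ≡ 1ℤ * (a - b)
            lem = solve-∀

    ∙-comm : ∀ u v → u ∙ v ≡ v ∙ u
    ∙-comm (v3 a b c) (v3 x y z) = lem a b c x y z
      where lem : ∀ a b c x y z → a * x + b * y + c * z ≡ x * a + y * b + z * c
            lem = solve-∀

    ∙-≋ˡ : ∀ {u v} w → u ≋ v → Z (v ∙ w) → Z (u ∙ w)
    ∙-≋ˡ {u} {v} w e h = subst Z (∙-comm w u) (∙-≋ w e (subst Z (∙-comm v w) h))

    ×ᵥ-cong-≋ : ∀ {u v u' v'} → u ≋ u' → v ≋ v' → u ×ᵥ v ≋ u' ×ᵥ v'
    ×ᵥ-cong-≋ {v3 a b c} {v3 x y z} {v3 a' b' c'} {v3 x' y' z'} (congruent (zⱽ p r s)) (congruent (zⱽ p' r' s')) = congruent (zⱽ (step b c y z b' c' y' z' r s r' s') (step c a z x c' a' z' x' s p s' p') (step a b x y a' b' x' y' p r p' r'))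
      where
        lem : ∀ b c y z b' c' y' z' → b * z - c * y - (b' * z' - c' * y') ≡ z * (b - b') + b' * (z - z') + - 1ℤ * (y * (c - c') + c' * (y - y'))
        lem = solve-∀
        step : ∀ b c y z b' c' y' z' → Z (b - b') → Z (c - c') → Z (y - y') → Z (z - z') → Z (b * z - c * y - (b' * z' - c' * y'))
        step b c y z b' c' y' z' hb hc hy hz = Z₃ z b' (- 1ℤ) hb hz (Z₂ y c' hc hy refl) (lem b c y z b' c' y' z')

    ⊥-left : ∀ u w → Z (u ∙ (u ×ᵥ w))
    ⊥-left (v3 a b c) (v3 x y z) = Z-≡0 (lem a b c x y z)
      where lem : ∀ a b c x y z → a * (b * z - c * y) + b * (c * x - a * z) + c * (a * y - b * x) ≡ 0ℤ
            lem = solve-∀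

    ⊥-right : ∀ u w → Z (w ∙ (u ×ᵥ w))
    ⊥-right (v3 a b c) (v3 x y z) = Z-≡0 (lem a b c x y z)
      where lem : ∀ a b c x y z → x * (b * z - c * y) + y * (c * x - a * z) + z * (a * y - b * x) ≡ 0ℤ
            lem = solve-∀

    self-×ᵥ : ∀ v → Zⱽ (v ×ᵥ v)
    self-×ᵥ (v3 x y z) = zⱽ (Z-≡0 (lem y z)) (Z-≡0 (lem z x)) (Z-≡0 (lem x y))
      where lem : ∀ y z → y * z - z * y ≡ 0ℤ
            lem = solve-∀

  -- An explicit basis of the plane normal to `l`. Since the leading coordinate is 1, the cross
  -- product equals `l` over the integers, not only up to a factor.
  basis : ∀ {l} → Point l → ∃[ u ] ∃[ w ] u ×ᵥ w ≡ l
  basis (point₁ {a} {b} _ _) = v3 (- a) 1ℤ 0ℤ , v3 (- b) 0ℤ 1ℤ , v3-≡ refl (l₁ a b) (l₂ a b)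
    where
      l₁ : ∀ a b → 0ℤ * - b - - a * 1ℤ ≡ a
      l₁ = solve-∀
      l₂ : ∀ a b → - a * 0ℤ - 1ℤ * - b ≡ b
      l₂ = solve-∀
  basis (point₂ {a} _) = v3 0ℤ (- a) 1ℤ , v3 1ℤ 0ℤ 0ℤ , v3-≡ (l₁ a) refl (l₂ a)
    where
      l₁ : ∀ a → - a * 0ℤ - 1ℤ * 0ℤ ≡ 0ℤ
      l₁ = solve-∀
      l₂ : ∀ a → 0ℤ * 0ℤ - - a * 1ℤ ≡ a
      l₂ = solve-∀
  basis point₃ = v3 1ℤ 0ℤ 0ℤ , v3 0ℤ 1ℤ 0ℤ , refl

  -- Describes the two subspaces by decidable congruences: membership in the line is collinearity
  -- with `v`, membership in the plane is orthogonality to `l`.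
  record Models (x : Flag q) (r : FlagRep) : Set where
    constructor models
    field
      models-line : ∀ p → V₁ x p ⇔ Zⱽ (proj₁ r ×ᵥ vec p)
      models-plane : ∀ p → V₂ x p ⇔ Z (proj₂ r ∙ vec p)

  private
    ⇔-sym : ∀ {A B : Set} → A ⇔ B → B ⇔ A
    ⇔-sym e = mk⇔ (Equivalence.from e) (Equivalence.to e)

    ⇔-trans : ∀ {A B C : Set} → A ⇔ B → B ⇔ C → A ⇔ C
    ⇔-trans e f = mk⇔ (λ a → Equivalence.to f (Equivalence.to e a)) λ c → Equivalence.from e (Equivalence.from f c)

    ×ᵥ-⇔ : ∀ {v w} → v ∼ w → ∀ p → Zⱽ (v ×ᵥ p) ⇔ Zⱽ (w ×ᵥ p)
    ×ᵥ-⇔ e p = mk⇔ (×ᵥ-∼ p (∼-sym e)) (×ᵥ-∼ p e)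

    ∙-⇔ : ∀ {l m} → l ∼ m → ∀ p → Z (l ∙ p) ⇔ Z (m ∙ p)
    ∙-⇔ e p = mk⇔ (Z-∙-∼ (∼-sym e) (∼-refl p)) (Z-∙-∼ e (∼-refl p))

  flagOf : (r : FlagRep) → IsFlag r → Flag q
  flagOf (v , l) (isFlag pv pl s) = flag (λ p → Zⱽ (v ×ᵥ vec p)) (λ p → Z (l ∙ vec p)) isLine (isPlane (basis pl)) inside
    where
      nv : ¬ Zⱽ (vec (pt v))
      nv z = Point-nonzero pv (Zⱽ-≋ (≋-sym (vec-pt v)) z)
      isLine : IsLine q (λ p → Zⱽ (v ×ᵥ vec p))
      isLine = pt v , (λ e → nv (subst (λ p → Zⱽ (vec p)) (sym e) vec-zeroPt)) , λ p → ⇔-trans (×ᵥ-⇔ (∼-sym (≋⇒∼ (vec-pt v))) (vec p)) (⇔-sym (in-line (pt v) nv p))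
      isPlane : ∃[ u ] ∃[ w ] u ×ᵥ w ≡ l → IsPlane q (λ p → Z (l ∙ vec p))
      isPlane (u , w , e) = pt u , pt w , LinIndep⇐ (pt u) (pt w) nn , λ p → ⇔-trans (∙-⇔ (∼-sym (≋⇒∼ n≋l)) (vec p)) (⇔-sym (in-plane (pt u) (pt w) nn p))
        where
          n≋l : vec (pt u) ×ᵥ vec (pt w) ≋ l
          n≋l = ≋-trans (×ᵥ-cong-≋ (vec-pt u) (vec-pt w)) (≋-≡ e)
          nn : ¬ Zⱽ (vec (pt u) ×ᵥ vec (pt w))
          nn z = Point-nonzero pl (Zⱽ-≋ (≋-sym n≋l) z)
      inside : ∀ p → Zⱽ (v ×ᵥ vec p) → Z (l ∙ vec p)
      inside p z = from (line-span v (vec p) (Point-nonzero pv) z)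
        where
          from : ∃[ c ] vec p ≋ c ⋆ v → Z (l ∙ vec p)
          from (c , e) = ∙-≋ l e (Z₁ c s (lem l v))
            where
              lem : ∀ l v → l ∙ (c ⋆ v) ≡ c * (v ∙ l)
              lem (v3 a b d) (v3 x y z) = lem' a b d x y z c
                where lem' : ∀ a b d x y z c → a * (c * x) + b * (c * y) + d * (c * z) ≡ c * (x * a + y * b + z * d)
                      lem' = solve-∀

  flagOf-models : ∀ r (f : IsFlag r) → Models (flagOf r f) r
  flagOf-models (v , l) (isFlag _ _ _) = models (λ p → mk⇔ (λ z → z) λ z → z) λ p → mk⇔ (λ z → z) λ z → z

  represent : ∀ x → ∃[ r ] (IsFlag r × Models x r)
  represent (flag V W (v , v≢0 , onV) (u , w , ind , onW) V⊆W) = (normalise (vec v) , normalise n) , isFlag (normalise-point (vec v)) (normalise-point n) incident' ,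
      models (λ p → ⇔-trans (onV p) (⇔-trans (in-line v nv p) (×ᵥ-⇔ v∼ (vec p)))) λ p → ⇔-trans (onW p) (⇔-trans (in-plane u w nn p) (∙-⇔ n∼ (vec p)))
    where
      n : V3
      n = vec u ×ᵥ vec w
      nv : ¬ Zⱽ (vec v)
      nv = nonzero-vec v≢0
      nn : ¬ Zⱽ n
      nn = LinIndep⇒ u w ind
      v∼ : vec v ∼ normalise (vec v)
      v∼ = normalise-∼ (vec v) nv
      n∼ : n ∼ normalise n
      n∼ = normalise-∼ n nn
      v∈W : W v
      v∈W = V⊆W v (Equivalence.from (onV v) (Equivalence.from (in-line v nv v) (self-×ᵥ (vec v))))
      incident' : Z (normalise (vec v) ∙ normalise n)
      incident' = Z-∙-∼ (∼-sym v∼) (∼-sym n∼) (subst Z (∙-comm n (vec v)) (Equivalence.to (in-plane u w nn v) (Equivalence.to (onW v) v∈W)))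

  Models-≈ : ∀ {x y r} → Models x r → Models y r → _≈F_ q x y
  Models-≈ (models l₁ p₁) (models l₂ p₂) = (λ p → ⇔-trans (l₁ p) (⇔-sym (l₂ p))) , λ p → ⇔-trans (p₁ p) (⇔-sym (p₂ p))

  -- The point is recovered by testing `v` itself for membership in the other line, and the normal
  -- by testing a basis of the plane.
  Models-unique : ∀ {x y r r'} → IsFlag r → IsFlag r' → Models x r → Models y r' → _≈F_ q x y → r ≡ r'
  Models-unique {x} {y} {v , l} {v' , l'} (isFlag pv pl _) (isFlag pv' pl' _) (models l₁ p₁) (models l₂ p₂) (e₁ , e₂) = cong₂ _,_ line-≡ (plane-≡ (basis pl))
    where
      line-≡ : v ≡ v'
      line-≡ = sym (Point-∼ pv' pv (parallel v' v (Point-nonzero pv') (Point-nonzero pv)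
        (×ᵥ-≋ v' (≋-sym (vec-pt v)) (Equivalence.to (l₂ (pt v)) (Equivalence.to (e₁ (pt v)) (Equivalence.from (l₁ (pt v)) (×ᵥ-≋ v (vec-pt v) (self-×ᵥ v))))))))
      plane-≡ : ∃[ u ] ∃[ w ] u ×ᵥ w ≡ l → l ≡ l'
      plane-≡ (u , w , refl) = orthogonal-unique u w (Point-nonzero pl) pl pl' (⊥-left u w) (⊥-right u w) (transfer u (⊥-left u w)) (transfer w (⊥-right u w))
        where
          transfer : ∀ t → Z (t ∙ (u ×ᵥ w)) → Z (t ∙ l')
          transfer t h = subst Z (∙-comm l' t) (∙-≋ l' (≋-sym (vec-pt t)) (Equivalence.to (p₂ (pt t)) (Equivalence.to (e₂ (pt t)) (Equivalence.from (p₁ (pt t)) (∙-≋ (u ×ᵥ w) (vec-pt t) (subst Z (∙-comm t (u ×ᵥ w)) h))))))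

  -- Inequivalent flags have different models, so a list of distinct flags injects into `flags`.
  IsNumFlags⇒≤ : ∀ {n} → IsNumFlags q n → n ℕ.≤ length flags
  IsNumFlags⇒≤ (Ls , distinct , refl , _) = ℕP.≤-trans (ℕP.≤-reflexive (trans (sym (length-map rep Ls)) (sym (trans (∑-const (map rep Ls) 1) (ℕP.*-identityʳ _)))))
      (ℕP.≤-trans (∑-injection (map rep Ls) (λ r → r) (λ _ → 1) unique rep-∈ (λ _ _ _ _ e → e)) (ℕP.≤-reflexive (trans (∑-const flags 1) (ℕP.*-identityʳ _))))
    where
      rep : Flag q → FlagRep
      rep x = proj₁ (represent x)
      unique : Unique (map rep Ls)
      unique = AllPairsP.map⁺ (AllPairs.map (λ {x} {y} n e → n (Models-≈ (proj₂ (proj₂ (represent x))) (subst (Models y) (sym e) (proj₂ (proj₂ (represent y)))))) distinct)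
      rep-∈ : ∀ r → r ∈ map rep Ls → r ∈ flags
      rep-∈ r m with ∈-map⁻ rep m
      ... | x , _ , refl = ∈-flags (proj₁ (proj₂ (represent x)))

  toFlags : (rs : List FlagRep) → All IsFlag rs → List (Flag q)
  toFlags [] [] = []
  toFlags (r ∷ rs) (f ∷ fs) = flagOf r f ∷ toFlags rs fs

  length-toFlags : ∀ rs fs → length (toFlags rs fs) ≡ length rs
  length-toFlags [] [] = refl
  length-toFlags (r ∷ rs) (f ∷ fs) = cong suc (length-toFlags rs fs)

  toFlags-∈ : ∀ {rs} fs {x} → x ∈ toFlags rs fs → ∃[ r ] (r ∈ rs × IsFlag r × Models x r)
  toFlags-∈ (_∷_ {r} f fs) (here refl) = r , here refl , f , flagOf-models r f
  toFlags-∈ (f ∷ fs) (there m) with toFlags-∈ fs m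
  ... | r , mr , h = r , there mr , h

  toFlags-distinct : ∀ {rs} fs → Unique rs → DistinctFlags q (toFlags rs fs)
  toFlags-distinct [] [] = []
  toFlags-distinct (_∷_ {r} f fs) (r∉ ∷ u) = All.tabulate (λ m e → apart (toFlags-∈ fs m) e) ∷ toFlags-distinct fs u
    where
      apart : ∀ {x} → ∃[ r' ] (r' ∈ _ × IsFlag r' × Models x r') → ¬ _≈F_ q (flagOf r f) x
      apart (r' , m , f' , h) e = All.lookup r∉ m (Models-unique f f' (flagOf-models r f) h e)

  -- `×ᵥ-⊙` carries the collinearity test from `v` to `g v`, and `∙-invariant` carries the
  -- orthogonality test from `l` to `cof g l`. For the converse inclusions the preimage of a point
  -- is taken under `inverse g`.
  act-ActsTo : ∀ g {x y r} → SL g → IsFlag r → Models x r → Models y (act g r) → ActsTo q (toMat g) x y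
  act-ActsTo g {x} {y} {v , l} δ (isFlag pv pl _) (models l₁ p₁) (models l₂ p₂) = 
      (λ p → mk⇔ (λ { (t , h , refl) → Equivalence.from (l₂ p) (Equivalence.to (onLine t p (vec-actPt g t)) (Equivalence.to (l₁ t) h)) })
                 λ h → pre p , Equivalence.from (l₁ (pre p)) (Equivalence.from (onLine (pre p) p (pre-≋ p)) (Equivalence.to (l₂ p) h)) , pre-≡ p) ,
      (λ p → mk⇔ (λ { (t , h , refl) → Equivalence.from (p₂ p) (Equivalence.to (onPlane t p (vec-actPt g t)) (Equivalence.to (p₁ t) h)) })
                 λ h → pre p , Equivalence.from (p₁ (pre p)) (Equivalence.from (onPlane (pre p) p (pre-≋ p)) (Equivalence.to (p₂ p) h)) , pre-≡ p)
    where
      onLine : ∀ t p → vec p ≋ g ⊙ vec t → Zⱽ (v ×ᵥ vec t) ⇔ Zⱽ (normalise (g ⊙ v) ×ᵥ vec p)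
      onLine t p e = mk⇔
          (λ z → ×ᵥ-∼ (vec p) (∼-sym g∼) (×ᵥ-≋ (g ⊙ v) e (subst Zⱽ (sym (×ᵥ-⊙ g v (vec t))) (Zⱽ-⊙ (cof g) z))))
          λ z → decide (Zⱽ? (v ×ᵥ vec t)) (subst Zⱽ (×ᵥ-⊙ g v (vec t)) (×ᵥ-≋ (g ⊙ v) (≋-sym e) (×ᵥ-∼ (vec p) g∼ z)))
        where
          g∼ : g ⊙ v ∼ normalise (g ⊙ v)
          g∼ = act-∼ˡ g {v} {l} δ pv
          decide : Dec (Zⱽ (v ×ᵥ vec t)) → Zⱽ (cof g ⊙ (v ×ᵥ vec t)) → Zⱽ (v ×ᵥ vec t)
          decide (yes z) _ = z
          decide (no n) z = contradiction z (¬Zⱽ-⊙ (cof g) (SL-cof g δ) n)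
      onPlane : ∀ t p → vec p ≋ g ⊙ vec t → Z (l ∙ vec t) ⇔ Z (normalise (cof g ⊙ l) ∙ vec p)
      onPlane t p e = mk⇔ (λ z → Z-∙-∼ (∼-sym g∼) (≋⇒∼ e) (subst Z (sym swap) z)) λ z → subst Z swap (Z-∙-∼ g∼ (∼-sym (≋⇒∼ e)) z)
        where
          g∼ : cof g ⊙ l ∼ normalise (cof g ⊙ l)
          g∼ = act-∼ʳ g {v} {l} δ pl
          swap : (cof g ⊙ l) ∙ (g ⊙ vec t) ≡ l ∙ vec t
          swap = trans (∙-comm (cof g ⊙ l) (g ⊙ vec t)) (trans (∙-invariant g (vec t) l δ) (∙-comm (vec t) l))
      pre : Pt q → Pt q
      pre p = pt (inverse g ⊙ vec p)
      pre-≋ : ∀ p → vec p ≋ g ⊙ vec (pre p)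
      pre-≋ p = ≋-sym (≋-trans (⊙-≋ g (vec-pt (inverse g ⊙ vec p))) (≋-≡ (trans (sym (⊙-· g (inverse g) (vec p))) (trans (cong (_⊙ vec p) (·-inverseʳ g δ)) (𝟙-⊙ (vec p))))))
      pre-≡ : ∀ p → actPt q (toMat g) (pre p) ≡ p
      pre-≡ p = vec-injective (≋-trans (vec-actPt g (pre p)) (≋-sym (pre-≋ p)))

-- Numerical estimates

log-exists : ∀ n → ∃[ l ] (2 ℕ.^ l ℕ.≤ suc n × suc n ℕ.< 2 ℕ.^ suc l)
log-exists zero = 0 , s≤s z≤n , s≤s (s≤s z≤n)
log-exists (suc n) = step (log-exists n)
  where
    step : ∃[ l ] (2 ℕ.^ l ℕ.≤ suc n × suc n ℕ.< 2 ℕ.^ suc l) → ∃[ l ] (2 ℕ.^ l ℕ.≤ suc (suc n) × suc (suc n) ℕ.< 2 ℕ.^ suc l)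
    step (l , lo , hi) = decide (ℕP.m≤n⇒m<n∨m≡n hi)
      where
        decide : suc (suc n) ℕ.< 2 ℕ.^ suc l ⊎ suc (suc n) ≡ 2 ℕ.^ suc l → ∃[ l ] (2 ℕ.^ l ℕ.≤ suc (suc n) × suc (suc n) ℕ.< 2 ℕ.^ suc l)
        decide (inj₁ lt) = l , ℕP.m≤n⇒m≤1+n lo , lt
        decide (inj₂ e) = suc l , ℕP.≤-reflexive (sym e) , subst (ℕ._< 2 ℕ.^ suc (suc l)) (sym e) (ℕP.^-monoʳ-< 2 (s≤s (s≤s z≤n)) (ℕP.n<1+n (suc l)))

-- The root is rounded so that its square stays strictly below `n + 2`; then `n + 2 ≤ (t + 1)²`, and
-- `t + 1 ≤ 2t` gives the factor 4.
sqrt-exists : ∀ n → ∃[ t ] (1 ℕ.≤ t × t ℕ.* t ℕ.< 2 ℕ.+ n × 2 ℕ.+ n ℕ.≤ 4 ℕ.* (t ℕ.* t))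
sqrt-exists n with go n
  where
    go : ∀ n → ∃[ t ] (1 ℕ.≤ t × t ℕ.* t ℕ.< 2 ℕ.+ n × 2 ℕ.+ n ℕ.≤ suc t ℕ.* suc t)
    go zero = 1 , s≤s z≤n , s≤s (s≤s z≤n) , s≤s (s≤s z≤n)
    go (suc n) with go n
    ... | t , 1≤t , lo , hi with suc t ℕ.* suc t ℕP.<? 3 ℕ.+ n
    ...   | yes lt = suc t , s≤s z≤n , lt , ℕP.≤-trans (s≤s hi) (ℕP.*-mono-< (ℕP.n<1+n (suc t)) (ℕP.n<1+n (suc t)))
    ...   | no ¬lt = t , 1≤t , ℕP.m≤n⇒m≤1+n lo , ℕP.≮⇒≥ ¬lt
... | t , 1≤t , lo , hi = t , 1≤t , lo , ℕP.≤-trans hi (ℕP.≤-trans (ℕP.*-mono-≤ double double) (ℕP.≤-reflexive (lem t)))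
  where
    double : suc t ℕ.≤ t ℕ.+ t
    double = ℕP.+-monoˡ-≤ t 1≤t
    lem : ∀ t → (t ℕ.+ t) ℕ.* (t ℕ.+ t) ≡ 4 ℕ.* (t ℕ.* t)
    lem = solveℕ-∀

-- Raising `l` by one doubles the right side, while the square on the left at most doubles; the
-- threshold 24 starts the induction by direct computation.
quadratic≤2^ : ∀ l → 24 ℕ.≤ l → 1024 ℕ.* ((2 ℕ.* l ℕ.+ 5) ℕ.* (2 ℕ.* l ℕ.+ 5)) ℕ.≤ 2 ℕ.^ l
quadratic≤2^ l 24≤l = subst (λ l → 1024 ℕ.* ((2 ℕ.* l ℕ.+ 5) ℕ.* (2 ℕ.* l ℕ.+ 5)) ℕ.≤ 2 ℕ.^ l) (ℕP.m∸n+n≡m 24≤l) (go (l ℕ.∸ 24))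
  where
    double : ∀ c l → c ℕ.* ((2 ℕ.* suc l ℕ.+ 5) ℕ.* (2 ℕ.* suc l ℕ.+ 5)) ℕ.≤ 2 ℕ.* (c ℕ.* ((2 ℕ.* l ℕ.+ 5) ℕ.* (2 ℕ.* l ℕ.+ 5)))
    double c l = ℕP.≤-trans (ℕP.*-monoʳ-≤ c (ℕP.≤-trans (ℕP.m≤m+n _ (4 ℕ.* (l ℕ.* l) ℕ.+ 12 ℕ.* l ℕ.+ 1)) (ℕP.≤-reflexive (expand l)))) (ℕP.≤-reflexive (swap c ((2 ℕ.* l ℕ.+ 5) ℕ.* (2 ℕ.* l ℕ.+ 5))))
      where
        expand : ∀ l → (2 ℕ.* (1 ℕ.+ l) ℕ.+ 5) ℕ.* (2 ℕ.* (1 ℕ.+ l) ℕ.+ 5) ℕ.+ (4 ℕ.* (l ℕ.* l) ℕ.+ 12 ℕ.* l ℕ.+ 1) ≡ 2 ℕ.* ((2 ℕ.* l ℕ.+ 5) ℕ.* (2 ℕ.* l ℕ.+ 5))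
        expand = solveℕ-∀
        swap : ∀ c x → c ℕ.* (2 ℕ.* x) ≡ 2 ℕ.* (c ℕ.* x)
        swap = solveℕ-∀
    go : ∀ j → 1024 ℕ.* ((2 ℕ.* (j ℕ.+ 24) ℕ.+ 5) ℕ.* (2 ℕ.* (j ℕ.+ 24) ℕ.+ 5)) ℕ.≤ 2 ℕ.^ (j ℕ.+ 24)
    go zero = ℕP.≤ᵇ⇒≤ (1024 ℕ.* (53 ℕ.* 53)) (2 ℕ.^ 24) _
    go (suc j) = ℕP.≤-trans (double 1024 (j ℕ.+ 24)) (ℕP.*-monoʳ-≤ 2 (go j))

^-distrib-* : ∀ a b n → (a ℕ.* b) ℕ.^ n ≡ a ℕ.^ n ℕ.* b ℕ.^ n
^-distrib-* a b zero = refl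
^-distrib-* a b (suc n) = trans (cong (a ℕ.* b ℕ.*_) (^-distrib-* a b n)) (lem a b (a ℕ.^ n) (b ℕ.^ n))
  where lem : ∀ a b p r → a ℕ.* b ℕ.* (p ℕ.* r) ≡ a ℕ.* p ℕ.* (b ℕ.* r)
        lem = solveℕ-∀

-- From `2T + 1 ≤ 4T` and `T² ≤ q` one gets `e² ≤ 2^(6k + 4) q`. Raised to the power `d`, the power
-- of two is at most `2^(2l) ≤ q²`, and `q²` fits into `q^(2a)` because `a ≥ 1`.
norm-arithmetic : ∀ q d a k T l e → 1 ℕ.≤ T → T ℕ.* T ℕ.≤ q → 2 ℕ.^ l ℕ.≤ q → d ℕ.* (6 ℕ.* k) ℕ.≤ l → d ℕ.* 4 ℕ.≤ l → 1 ℕ.≤ a →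
  e ℕ.≤ 2 ℕ.^ (3 ℕ.* k) ℕ.* (2 ℕ.* T ℕ.+ 1) → e ℕ.^ (2 ℕ.* d) ℕ.≤ q ℕ.^ (d ℕ.+ 2 ℕ.* a)
norm-arithmetic q d a k T l e 1≤T T²≤q 2^l≤q 6dk≤l 4d≤l 1≤a e≤ = begin
    e ℕ.^ (2 ℕ.* d) ≡⟨ ℕP.^-*-assoc e 2 d ⟨
    (e ℕ.^ 2) ℕ.^ d ≤⟨ ℕP.^-monoˡ-≤ d square ⟩
    (2 ℕ.^ (6 ℕ.* k ℕ.+ 4) ℕ.* q) ℕ.^ d ≡⟨ ^-distrib-* (2 ℕ.^ (6 ℕ.* k ℕ.+ 4)) q d ⟩
    (2 ℕ.^ (6 ℕ.* k ℕ.+ 4)) ℕ.^ d ℕ.* q ℕ.^ d ≤⟨ ℕP.*-monoˡ-≤ (q ℕ.^ d) power ⟩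
    q ℕ.^ 2 ℕ.* q ℕ.^ d ≡⟨ ℕP.*-comm (q ℕ.^ 2) (q ℕ.^ d) ⟩
    q ℕ.^ d ℕ.* q ℕ.^ 2 ≡⟨ ℕP.^-distribˡ-+-* q d 2 ⟨
    q ℕ.^ (d ℕ.+ 2) ≤⟨ ℕP.^-monoʳ-≤ q {{ℕ.>-nonZero (ℕP.≤-trans (ℕP.*-mono-≤ 1≤T 1≤T) T²≤q)}} (ℕP.+-monoʳ-≤ d (ℕP.*-monoʳ-≤ 2 1≤a)) ⟩
    q ℕ.^ (d ℕ.+ 2 ℕ.* a) ∎
  where
    open ℕP.≤-Reasoning
    P : ℕ
    P = 2 ℕ.^ (3 ℕ.* k)
    e≤' : e ℕ.≤ P ℕ.* (4 ℕ.* T)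
    e≤' = ℕP.≤-trans e≤ (ℕP.*-monoʳ-≤ P (ℕP.≤-trans (ℕP.+-monoʳ-≤ (2 ℕ.* T) (ℕP.≤-trans 1≤T (ℕP.m≤n*m T 2))) (ℕP.≤-reflexive (lem T))))
      where lem : ∀ T → 2 ℕ.* T ℕ.+ 2 ℕ.* T ≡ 4 ℕ.* T
            lem = solveℕ-∀
    square : e ℕ.^ 2 ℕ.≤ 2 ℕ.^ (6 ℕ.* k ℕ.+ 4) ℕ.* q
    square = begin
      e ℕ.^ 2 ≡⟨ cong (e ℕ.*_) (ℕP.*-identityʳ e) ⟩
      e ℕ.* e ≤⟨ ℕP.*-mono-≤ e≤' e≤' ⟩
      P ℕ.* (4 ℕ.* T) ℕ.* (P ℕ.* (4 ℕ.* T)) ≡⟨ lem P T ⟩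
      P ℕ.* P ℕ.* 16 ℕ.* (T ℕ.* T) ≤⟨ ℕP.*-monoʳ-≤ (P ℕ.* P ℕ.* 16) T²≤q ⟩
      P ℕ.* P ℕ.* 16 ℕ.* q ≡⟨ cong (λ t → t ℕ.* 16 ℕ.* q) (ℕP.^-distribˡ-+-* 2 (3 ℕ.* k) (3 ℕ.* k)) ⟨
      2 ℕ.^ (3 ℕ.* k ℕ.+ 3 ℕ.* k) ℕ.* 2 ℕ.^ 4 ℕ.* q ≡⟨ cong (ℕ._* q) (ℕP.^-distribˡ-+-* 2 (3 ℕ.* k ℕ.+ 3 ℕ.* k) 4) ⟨
      2 ℕ.^ (3 ℕ.* k ℕ.+ 3 ℕ.* k ℕ.+ 4) ℕ.* q ≡⟨ cong (λ t → 2 ℕ.^ (t ℕ.+ 4) ℕ.* q) (six k) ⟩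
      2 ℕ.^ (6 ℕ.* k ℕ.+ 4) ℕ.* q ∎
      where
        lem : ∀ P T → P ℕ.* (4 ℕ.* T) ℕ.* (P ℕ.* (4 ℕ.* T)) ≡ P ℕ.* P ℕ.* 16 ℕ.* (T ℕ.* T)
        lem = solveℕ-∀
        six : ∀ k → 3 ℕ.* k ℕ.+ 3 ℕ.* k ≡ 6 ℕ.* k
        six = solveℕ-∀
    power : (2 ℕ.^ (6 ℕ.* k ℕ.+ 4)) ℕ.^ d ℕ.≤ q ℕ.^ 2
    power = begin
      (2 ℕ.^ (6 ℕ.* k ℕ.+ 4)) ℕ.^ d ≡⟨ ℕP.^-*-assoc 2 (6 ℕ.* k ℕ.+ 4) d ⟩
      2 ℕ.^ ((6 ℕ.* k ℕ.+ 4) ℕ.* d) ≤⟨ ℕP.^-monoʳ-≤ 2 (ℕP.≤-trans (ℕP.≤-reflexive (trans (ℕP.*-comm (6 ℕ.* k ℕ.+ 4) d) (ℕP.*-distribˡ-+ d (6 ℕ.* k) 4))) (ℕP.+-mono-≤ 6dk≤l 4d≤l)) ⟩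
      2 ℕ.^ (l ℕ.+ l) ≡⟨ ℕP.^-distribˡ-+-* 2 l l ⟩
      2 ℕ.^ l ℕ.* 2 ℕ.^ l ≤⟨ ℕP.*-mono-≤ 2^l≤q 2^l≤q ⟩
      q ℕ.* q ≡⟨ cong (q ℕ.*_) (ℕP.*-identityʳ q) ⟨
      q ℕ.^ 2 ∎

-- The estimate is obtained for the length of `flags`, whereas `LargeSet` speaks of any number `n`
-- of flags. For `κ ≤ K` the claim holds trivially; otherwise `κ − K` is a nonnegative factor of
-- `n`.
proportion-mono : ∀ K κ y {n N} → n ℕ.≤ N → N ℕ.* κ ℕ.≤ y ℕ.* κ ℕ.+ K ℕ.* N → n ℕ.* κ ℕ.≤ y ℕ.* κ ℕ.+ K ℕ.* n
proportion-mono K κ y {n} {N} n≤N h = cases (ℕP.≤-total κ K)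
  where
    cases : κ ℕ.≤ K ⊎ K ℕ.≤ κ → n ℕ.* κ ℕ.≤ y ℕ.* κ ℕ.+ K ℕ.* n
    cases (inj₁ κ≤K) = ℕP.≤-trans (ℕP.≤-reflexive (ℕP.*-comm n κ)) (ℕP.≤-trans (ℕP.*-monoˡ-≤ n κ≤K) (ℕP.m≤n+m (K ℕ.* n) (y ℕ.* κ)))
    cases (inj₂ K≤κ) = ℕP.≤-trans (ℕP.≤-reflexive (trans (cong (n ℕ.*_) (sym split)) (trans (ℕP.*-distribˡ-+ n (κ ℕ.∸ K) K) (cong (n ℕ.* (κ ℕ.∸ K) ℕ.+_) (ℕP.*-comm n K)))))
        (ℕP.+-monoˡ-≤ (K ℕ.* n) (ℕP.≤-trans (ℕP.*-monoˡ-≤ (κ ℕ.∸ K) n≤N) (ℕP.+-cancelʳ-≤ (K ℕ.* N) (N ℕ.* (κ ℕ.∸ K)) (y ℕ.* κ)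
          (ℕP.≤-trans (ℕP.≤-reflexive (trans (cong (N ℕ.* (κ ℕ.∸ K) ℕ.+_) (ℕP.*-comm K N)) (trans (sym (ℕP.*-distribˡ-+ N (κ ℕ.∸ K) K)) (cong (N ℕ.*_) split)))) h))))
      where
        split : κ ℕ.∸ K ℕ.+ K ≡ κ
        split = ℕP.m∸n+n≡m K≤κ

fraction≤ : ∀ K k n y → n ℕ.* suc k ℕ.≤ y ℕ.* suc k ℕ.+ K ℕ.* n → (1ℚ ℚ.- + K ℚ./ suc k) ℚ.* ℕtoℚ n ℚ.≤ ℕtoℚ y
fraction≤ K k n y h = ℚP.toℚᵘ-cancel-≤ (ℚᵘP.≤-respʳ-≃ (ℚᵘP.≃-sym (ℚP.toℚᵘ-fromℚᵘ (mkℚᵘ (+ y) 0))) (ℚᵘP.≤-respˡ-≃ (ℚᵘP.≃-sym left) (*≤* integers)))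
  where
    left : toℚᵘ ((1ℚ ℚ.- + K ℚ./ suc k) ℚ.* ℕtoℚ n) ℚᵘ.≃ (ℚᵘ.1ℚᵘ ℚᵘ.+ ℚᵘ.- mkℚᵘ (+ K) k) ℚᵘ.* mkℚᵘ (+ n) 0
    left = ℚᵘP.≃-trans (ℚP.toℚᵘ-homo-* (1ℚ ℚ.- + K ℚ./ suc k) (ℕtoℚ n)) (ℚᵘP.*-cong
      (ℚᵘP.≃-trans (ℚP.toℚᵘ-homo-+ 1ℚ (ℚ.- (+ K ℚ./ suc k))) (ℚᵘP.+-congʳ ℚᵘ.1ℚᵘ (ℚᵘP.≃-trans (ℚP.toℚᵘ-homo‿- (+ K ℚ./ suc k)) (ℚᵘP.-‿cong (ℚP.toℚᵘ-fromℚᵘ (mkℚᵘ (+ K) k))))))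
      (ℚP.toℚᵘ-fromℚᵘ (mkℚᵘ (+ n) 0)))
    integers : (1ℤ * + suc k + - (+ K) * 1ℤ) * + n * 1ℤ ℤ.≤ + y * + (1 ℕ.* suc k ℕ.* 1)
    integers = ℤP.≤-trans (ℤP.≤-reflexive (l₁ (+ suc k) (+ K) (+ n))) (ℤP.≤-trans (move (+ n * + suc k) (+ y * + suc k) (+ K * + n) (ℤP.≤-trans (ℤP.≤-reflexive (sym (ℤP.pos-* n (suc k)))) (ℤP.≤-trans (ℤ.+≤+ h) (ℤP.≤-reflexive (trans (ℤP.pos-+ (y ℕ.* suc k) (K ℕ.* n)) (cong₂ _+_ (ℤP.pos-* y (suc k)) (ℤP.pos-* K n)))))))
        (ℤP.≤-reflexive (cong (λ t → + y * + t) (sym (trans (ℕP.*-identityʳ (1 ℕ.* suc k)) (ℕP.*-identityˡ (suc k)))))))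
      where
        move : ∀ i j k → i ℤ.≤ j + k → i - k ℤ.≤ j
        move i j k h = ℤP.≤-trans (ℤP.+-monoˡ-≤ (- k) h) (ℤP.≤-reflexive (cancel j k))
          where cancel : ∀ j k → j + k + - k ≡ j
                cancel = solve-∀
        l₁ : ∀ s K n → (1ℤ * s + - K * 1ℤ) * n * 1ℤ ≡ n * s - K * n
        l₁ = solve-∀

positive-numerator : ∀ δ → 0ℚ ℚ.< δ → 1 ℕ.≤ ∣ ↥ δ ∣ × 0ℤ ℤ.≤ ↥ δ
positive-numerator (mkℚ (+ suc n) _ _) _ = s≤s z≤n , ℤ.+≤+ z≤n
positive-numerator (mkℚ (+ zero) _ _) h = contradiction (ℚ.positive h) λ ()
positive-numerator (mkℚ -[1+ n ] _ _) h = contradiction (ℚ.positive h) λ ()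

-- A positive rational is at least the reciprocal of its denominator, so it suffices to compare with
-- `1 / ↧ₙ δ`.
fraction-∣∣≤ : ∀ K k δ → 0ℚ ℚ.< δ → K ℕ.* ↧ₙ δ ℕ.≤ suc k → ℚ.∣ + K ℚ./ suc k ∣ ℚ.≤ δ
fraction-∣∣≤ K k δ 0<δ h = subst (ℚ._≤ δ) (sym (ℚP.0≤p⇒∣p∣≡p (ℚP.nonNegative⁻¹ (+ K ℚ./ suc k) {{ℚP.normalize-nonNeg K (suc k)}})))
    (ℚP.toℚᵘ-cancel-≤ (ℚᵘP.≤-respˡ-≃ (ℚᵘP.≃-sym (ℚP.toℚᵘ-fromℚᵘ (mkℚᵘ (+ K) k))) (compare δ (positive-numerator δ 0<δ) h)))
  where
    compare : ∀ δ → 1 ℕ.≤ ∣ ↥ δ ∣ × 0ℤ ℤ.≤ ↥ δ → K ℕ.* ↧ₙ δ ℕ.≤ suc k → mkℚᵘ (+ K) k ℚᵘ.≤ toℚᵘ δ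
    compare (mkℚ (+ p) r _) (1≤p , _) h = *≤* (subst₂ ℤ._≤_ (ℤP.pos-* K (suc r)) (ℤP.pos-* p (suc k)) (ℤ.+≤+ (ℕP.≤-trans h (ℕP.≤-trans (ℕP.≤-reflexive (sym (ℕP.*-identityˡ (suc k)))) (ℕP.*-monoˡ-≤ (suc k) 1≤p)))))

-- Markov's inequality
exceptional-count : ∀ {A : Set} (xs : List A) (U : A → ℕ) K κ → 1 ℕ.≤ K → ∑ xs U ℕ.* (κ ℕ.* κ) ℕ.≤ K ℕ.* K ℕ.* (length xs ℕ.* length xs) →
  ∑ xs (λ x → ⟦ ¬? (U x ℕ.* κ ℕP.≤? K ℕ.* length xs) ⟧) ℕ.* κ ℕ.≤ K ℕ.* length xs
exceptional-count xs U K κ 1≤K h = cases (length xs) refl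
  where
    open ℕP.≤-Reasoning
    b : ℕ
    b = ∑ xs λ x → ⟦ ¬? (U x ℕ.* κ ℕP.≤? K ℕ.* length xs) ⟧
    pointwise : ∀ u v → ⟦ ¬? (u ℕP.≤? v) ⟧ ℕ.* v ℕ.≤ u
    pointwise u v = go (u ℕP.≤? v)
      where
        go : (d : Dec (u ℕ.≤ v)) → ⟦ ¬? d ⟧ ℕ.* v ℕ.≤ u
        go (yes _) = z≤n
        go (no n) = ℕP.≤-trans (ℕP.≤-reflexive (ℕP.*-identityˡ v)) (ℕP.<⇒≤ (ℕP.≰⇒> n))
    b≤ : b ℕ.* (K ℕ.* length xs) ℕ.≤ ∑ xs U ℕ.* κ
    b≤ = begin
      b ℕ.* (K ℕ.* length xs) ≡⟨ ∑-*ʳ xs (K ℕ.* length xs) (λ x → ⟦ ¬? (U x ℕ.* κ ℕP.≤? K ℕ.* length xs) ⟧) ⟨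
      ∑ xs (λ x → ⟦ ¬? (U x ℕ.* κ ℕP.≤? K ℕ.* length xs) ⟧ ℕ.* (K ℕ.* length xs)) ≤⟨ ∑-mono xs (λ x _ → pointwise (U x ℕ.* κ) (K ℕ.* length xs)) ⟩
      ∑ xs (λ x → U x ℕ.* κ) ≡⟨ ∑-*ʳ xs κ U ⟩
      ∑ xs U ℕ.* κ ∎
    main : 1 ℕ.≤ length xs → b ℕ.* κ ℕ.≤ K ℕ.* length xs
    main 1≤n = ℕP.*-cancelˡ-≤ (K ℕ.* length xs) {{ℕ.>-nonZero (ℕP.*-mono-≤ 1≤K 1≤n)}} (begin
      K ℕ.* length xs ℕ.* (b ℕ.* κ) ≡⟨ l₁ (K ℕ.* length xs) b κ ⟩
      b ℕ.* (K ℕ.* length xs) ℕ.* κ ≤⟨ ℕP.*-monoˡ-≤ κ b≤ ⟩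
      ∑ xs U ℕ.* κ ℕ.* κ ≡⟨ ℕP.*-assoc (∑ xs U) κ κ ⟩
      ∑ xs U ℕ.* (κ ℕ.* κ) ≤⟨ h ⟩
      K ℕ.* K ℕ.* (length xs ℕ.* length xs) ≡⟨ l₂ K (length xs) ⟩
      K ℕ.* length xs ℕ.* (K ℕ.* length xs) ∎)
      where
        l₁ : ∀ m b k → m ℕ.* (b ℕ.* k) ≡ b ℕ.* m ℕ.* k
        l₁ = solveℕ-∀
        l₂ : ∀ K n → K ℕ.* K ℕ.* (n ℕ.* n) ≡ K ℕ.* n ℕ.* (K ℕ.* n)
        l₂ = solveℕ-∀
    cases : ∀ n → length xs ≡ n → b ℕ.* κ ℕ.≤ K ℕ.* length xs
    cases (suc n) e = main (subst (1 ℕ.≤_) (sym e) (s≤s z≤n))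
    cases zero e = ℕP.≤-trans (ℕP.*-monoˡ-≤ κ (ℕP.≤-trans (∑-bound xs 1 λ x _ → ⟦⟧≤1 (¬? (U x ℕ.* κ ℕP.≤? K ℕ.* length xs))) (ℕP.≤-reflexive (cong (ℕ._* 1) e)))) z≤n

filter-complement : ∀ {A : Set} {P : A → Set} (P? : ∀ x → Dec (P x)) (xs : List A) κ M → ∑ xs (λ x → ⟦ ¬? (P? x) ⟧) ℕ.* κ ℕ.≤ M → length xs ℕ.* κ ℕ.≤ length (filter P? xs) ℕ.* κ ℕ.+ M
filter-complement P? xs κ M h = ℕP.≤-trans (ℕP.≤-reflexive (trans (cong (ℕ._* κ) count) (ℕP.*-distribʳ-+ κ (length (filter P? xs)) (∑ xs λ x → ⟦ ¬? (P? x) ⟧)))) (ℕP.+-monoʳ-≤ (length (filter P? xs) ℕ.* κ) h)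
  where
    partition : ∀ {P : Set} (d : Dec P) → 1 ≡ ⟦ d ⟧ ℕ.+ ⟦ ¬? d ⟧
    partition (yes _) = refl
    partition (no _) = refl
    count : length xs ≡ length (filter P? xs) ℕ.+ ∑ xs (λ x → ⟦ ¬? (P? x) ⟧)
    count = trans (sym (trans (∑-const xs 1) (ℕP.*-identityʳ _))) (trans (∑-cong xs λ x _ → partition (P? x)) (trans (∑-+ xs (λ x → ⟦ P? x ⟧) (λ x → ⟦ ¬? (P? x) ⟧)) (cong (ℕ._+ ∑ xs (λ x → ⟦ ¬? (P? x) ⟧)) (sym (length-filter-∑ P? xs)))))

-- Assembling the theorem

Spreads : ℚ → (q : ℕ) .{{_ : NonZero q}} → ℚ → Set₁
Spreads ε q c =
  ∃[ Y ] (DistinctFlags q Y × LargeSet q c Y ×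
    (∀ x → x ∈ Y →
      ∃[ Z ] (DistinctFlags q Z × LargeSet q c Z ×
        (∀ y → y ∈ Z →
          ∃[ γ ] (InSL3ℤ γ × NormBound ε q γ × ActsTo q γ x y)))))

-- The allowed exceptional proportion is at least one, so the empty set will do for `Y`.
Spreads-trivial : ∀ ε q .{{_ : NonZero q}} K k → suc k ℕ.≤ K → Spreads ε q (+ K ℚ./ suc k)
Spreads-trivial ε q K k k<K = [] , [] , (λ n _ → fraction≤ K k n 0 (ℕP.≤-trans (ℕP.*-monoʳ-≤ n k<K) (ℕP.≤-reflexive (ℕP.*-comm n K)))) , λ x ()

NormBound-entries : ∀ ε q K g → (∀ e → e ℕ.≤ K → e ℕ.^ (2 ℕ.* ↧ₙ ε) ℕ.≤ q ℕ.^ (↧ₙ ε ℕ.+ 2 ℕ.* ∣ ↥ ε ∣)) → MBounded K g → NormBound ε q (toMat g)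
NormBound-entries ε q K g h (mbounded (bounded a b c) (bounded d e f) (bounded x y z)) = entrywise
  where
    entrywise : NormBound ε q (toMat g)
    entrywise Fin.zero Fin.zero = h _ a
    entrywise Fin.zero (Fin.suc Fin.zero) = h _ b
    entrywise Fin.zero (Fin.suc (Fin.suc Fin.zero)) = h _ c
    entrywise (Fin.suc Fin.zero) Fin.zero = h _ d
    entrywise (Fin.suc Fin.zero) (Fin.suc Fin.zero) = h _ e
    entrywise (Fin.suc Fin.zero) (Fin.suc (Fin.suc Fin.zero)) = h _ f
    entrywise (Fin.suc (Fin.suc Fin.zero)) Fin.zero = h _ x
    entrywise (Fin.suc (Fin.suc Fin.zero)) (Fin.suc Fin.zero) = h _ y
    entrywise (Fin.suc (Fin.suc Fin.zero)) (Fin.suc (Fin.suc Fin.zero)) = h _ z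

module _ (q : ℕ) .{{_ : NonZero q}} (pr : Prime q) (T L : ℕ) (T²<q : T ℕ.* T ℕ.< q) (q≤4T² : q ℕ.≤ 4 ℕ.* (T ℕ.* T))
    (T<2^L : T ℕ.< 2 ℕ.^ L) (large : 16 ℕ.* (2 ℕ.* L ℕ.+ 3) ℕ.≤ T) (1≤L : 1 ℕ.≤ L)
    (k K : ℕ) (1≤K : 1 ℕ.≤ K) (spread≤ : spread-constant ℕ.* L ℕ.≤ K ℕ.* K ℕ.* suc k) where
  open Modular q pr
  open Unreached q pr
  open Spread q pr T L T²<q q≤4T² T<2^L large 1≤L
  open FlagModel q pr

  private
    N : ℕ
    N = length flags

    U : FlagRep → ℕ
    U x = zeros (diffused (3 ℕ.* k) x)

    U-total : ∑ flags U ℕ.* (suc k ℕ.* suc k) ℕ.≤ K ℕ.* K ℕ.* (N ℕ.* N)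
    U-total = ℕP.*-cancelʳ-≤ (∑ flags U ℕ.* (suc k ℕ.* suc k)) (K ℕ.* K ℕ.* (N ℕ.* N)) (suc k) (begin
      ∑ flags U ℕ.* (suc k ℕ.* suc k) ℕ.* suc k ≡⟨ ℕP.*-assoc (∑ flags U) (suc k ℕ.* suc k) (suc k) ⟩
      ∑ flags U ℕ.* (suc k ℕ.* suc k ℕ.* suc k) ≤⟨ unreached-total k ⟩
      spread-constant ℕ.* (L ℕ.* (N ℕ.* N)) ≡⟨ ℕP.*-assoc spread-constant L (N ℕ.* N) ⟨
      spread-constant ℕ.* L ℕ.* (N ℕ.* N) ≤⟨ ℕP.*-monoˡ-≤ (N ℕ.* N) spread≤ ⟩
      K ℕ.* K ℕ.* suc k ℕ.* (N ℕ.* N) ≡⟨ lem (K ℕ.* K) (suc k) (N ℕ.* N) ⟩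
      K ℕ.* K ℕ.* (N ℕ.* N) ℕ.* suc k ∎)
      where
        open ℕP.≤-Reasoning
        lem : ∀ a b c → a ℕ.* b ℕ.* c ≡ a ℕ.* c ℕ.* b
        lem = solveℕ-∀

    -- Passes from a decidable property of models that fails rarely to a list of genuine flags, each
    -- accompanied by a model with the property.
    selection : ∀ {P : FlagRep → Set} (P? : ∀ x → Dec (P x)) → ∑ flags (λ x → ⟦ ¬? (P? x) ⟧) ℕ.* suc k ℕ.≤ K ℕ.* N →
      ∃[ Y ] (DistinctFlags q Y × LargeSet q (+ K ℚ./ suc k) Y × (∀ x → x ∈ Y → ∃[ r ] (P r × IsFlag r × Models x r)))
    selection {P} P? h = toFlags rs fs , toFlags-distinct fs (Unique.filter⁺ P? flags-unique) ,
        (λ n num → fraction≤ K k n (length (toFlags rs fs)) (proportion-mono K (suc k) (length (toFlags rs fs)) (IsNumFlags⇒≤ num)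
          (subst (λ y → N ℕ.* suc k ℕ.≤ y ℕ.* suc k ℕ.+ K ℕ.* N) (sym (length-toFlags rs fs)) (filter-complement P? flags (suc k) (K ℕ.* N) h)))) ,
        λ x m → from (toFlags-∈ fs m)
      where
        rs : List FlagRep
        rs = filter P? flags
        fs : All IsFlag rs
        fs = All.tabulate λ m → flags-∈ (proj₁ (∈-filter⁻ P? {xs = flags} m))
        from : ∀ {x} → ∃[ r ] (r ∈ rs × IsFlag r × Models x r) → ∃[ r ] (P r × IsFlag r × Models x r)
        from (r , m , h) = r , proj₂ (∈-filter⁻ P? {xs = flags} m) , h

    nonzeros : ∀ r → U r ℕ.* suc k ℕ.≤ K ℕ.* N → ∑ flags (λ y → ⟦ ¬? (¬? (diffused (3 ℕ.* k) r y ℤP.≟ 0ℤ)) ⟧) ℕ.* suc k ℕ.≤ K ℕ.* N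
    nonzeros r h = ℕP.≤-trans (ℕP.*-monoˡ-≤ (suc k) (∑-mono flags λ y _ → ℕP.≤-reflexive (double (diffused (3 ℕ.* k) r y ℤP.≟ 0ℤ)))) h
      where
        double : ∀ {P : Set} (d : Dec P) → ⟦ ¬? (¬? d) ⟧ ≡ ⟦ d ⟧
        double (yes _) = refl
        double (no _) = refl

  -- `Y` consists of the flags from which few flags are unreached, which are most flags by
  -- `exceptional-count`. For each of them `Z` consists of the flags where the diffused hit count is
  -- nonzero, and `diffused-joins` supplies the matrix.
  Spreads-large : ∀ ε → (∀ e → e ℕ.≤ 2 ℕ.^ (3 ℕ.* k) ℕ.* (2 ℕ.* T ℕ.+ 1) → e ℕ.^ (2 ℕ.* ↧ₙ ε) ℕ.≤ q ℕ.^ (↧ₙ ε ℕ.+ 2 ℕ.* ∣ ↥ ε ∣)) → Spreads ε q (+ K ℚ./ suc k)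
  Spreads-large ε norm = outer (selection good? (exceptional-count flags U K (suc k) 1≤K U-total))
    where
      good? : ∀ x → Dec (U x ℕ.* suc k ℕ.≤ K ℕ.* N)
      good? x = U x ℕ.* suc k ℕP.≤? K ℕ.* N

      connect : ∀ {x y r r'} → IsFlag r → IsFlag r' → Models x r → Models y r' → ¬ diffused (3 ℕ.* k) r r' ≡ 0ℤ → ∃[ γ ] (InSL3ℤ γ × NormBound ε q γ × ActsTo q γ x y)
      connect {x} {y} {r} {r'} fr fr' mx my n = from (diffused-joins (3 ℕ.* k) r r' (∈-flags fr) (∈-flags fr') n)
        where
          from : Joins (2 ℕ.^ (3 ℕ.* k) ℕ.* (2 ℕ.* T ℕ.+ 1)) r r' → ∃[ γ ] (InSL3ℤ γ × NormBound ε q γ × ActsTo q γ x y)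
          from (joins g δ b e) = toMat g , δ , NormBound-entries ε q (2 ℕ.^ (3 ℕ.* k) ℕ.* (2 ℕ.* T ℕ.+ 1)) g norm b , act-ActsTo g {x} {y} {r} δ fr mx (subst (Models y) (sym e) my)

      inner : ∀ {x} → ∃[ r ] (U r ℕ.* suc k ℕ.≤ K ℕ.* N × IsFlag r × Models x r) →
        ∃[ Z' ] (DistinctFlags q Z' × LargeSet q (+ K ℚ./ suc k) Z' × (∀ y → y ∈ Z' → ∃[ γ ] (InSL3ℤ γ × NormBound ε q γ × ActsTo q γ x y)))
      inner {x} (r , h , fr , mx) = from (selection (λ y → ¬? (diffused (3 ℕ.* k) r y ℤP.≟ 0ℤ)) (nonzeros r h))
        where
          from : ∃[ Z' ] (DistinctFlags q Z' × LargeSet q (+ K ℚ./ suc k) Z' × (∀ y → y ∈ Z' → ∃[ r' ] (¬ diffused (3 ℕ.* k) r r' ≡ 0ℤ × IsFlag r' × Models y r'))) →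
            ∃[ Z' ] (DistinctFlags q Z' × LargeSet q (+ K ℚ./ suc k) Z' × (∀ y → y ∈ Z' → ∃[ γ ] (InSL3ℤ γ × NormBound ε q γ × ActsTo q γ x y)))
          from (Z' , dist , lrg , rep) = Z' , dist , lrg , λ y m → finish (rep y m)
            where
              finish : ∀ {y} → ∃[ r' ] (¬ diffused (3 ℕ.* k) r r' ≡ 0ℤ × IsFlag r' × Models y r') → ∃[ γ ] (InSL3ℤ γ × NormBound ε q γ × ActsTo q γ x y)
              finish (r' , n , fr' , my) = connect fr fr' mx my n

      outer : ∃[ Y ] (DistinctFlags q Y × LargeSet q (+ K ℚ./ suc k) Y × (∀ x → x ∈ Y → ∃[ r ] (U r ℕ.* suc k ℕ.≤ K ℕ.* N × IsFlag r × Models x r))) → Spreads ε q (+ K ℚ./ suc k)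
      outer (Y , dist , lrg , rep) = Y , dist , lrg , λ x m → inner (rep x m)

log : ℕ → ℕ
log q = proj₁ (log-exists (ℕ.pred q))

log-lower : ∀ q .{{_ : NonZero q}} → 2 ℕ.^ log q ℕ.≤ q
log-lower (suc n) = proj₁ (proj₂ (log-exists n))

log-upper : ∀ q .{{_ : NonZero q}} → q ℕ.< 2 ℕ.^ suc (log q)
log-upper (suc n) = proj₂ (proj₂ (log-exists n))

≤-log : ∀ m q → 2 ℕ.^ m ℕ.≤ q → m ℕ.≤ log q
≤-log m q h = ℕP.≮⇒≥ λ lt → ℕP.<-irrefl refl (ℕP.<-≤-trans (log-upper q {{nz}}) (ℕP.≤-trans (ℕP.^-monoʳ-≤ 2 lt) h))
  where
    nz : NonZero q
    nz = ℕ.>-nonZero (ℕP.≤-trans (ℕP.m^n>0 2 m) h)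

theorem5p1 : (ε : ℚ) → 0ℚ < ε →
    ∃[ f ] (TendsToZeroOnPrimes f ×
    ((q : ℕ) .{{_ : NonZero q}} → Prime q →
    ∃[ Y ] (DistinctFlags q Y × LargeSet q (f q) Y ×
    (∀ x → x ∈ Y →
    ∃[ Z ] (DistinctFlags q Z × LargeSet q (f q) Z ×
    (∀ y → y ∈ Z →
    ∃[ γ ] (InSL3ℤ γ × NormBound ε q γ × ActsTo q γ x y)))))))
theorem5p1 ε 0<ε = f , tends , spreads
  where
    d D K : ℕ
    d = ↧ₙ ε
    -- The walk of length `3k` multiplies entries by at most `2 ^ (3k)`. With `k = log q / (6d)`
    -- this is at most `q^(1/(2d))`, half of the exponent that `ε ≥ 1/d` allows.
    D = d ℕ.* 6
    -- The summand 24 makes `log q` large enough for the numerical estimates whenever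
    -- `K / (k + 1) < 1`; the other summand absorbs `spread-constant` and the ratio between `log q`
    -- and `k`.
    K = 24 ℕ.+ D ℕ.* spread-constant

    1≤d : 1 ℕ.≤ d
    1≤d = s≤s z≤n

    instance
      D≢0 : NonZero D
      D≢0 = ℕ.>-nonZero (ℕP.*-mono-≤ 1≤d (s≤s {n = 5} z≤n))

    k : ℕ → ℕ
    k q = log q / D

    f : ℕ → ℚ
    f q = + K ℚ./ suc (k q)

    tends : TendsToZeroOnPrimes f
    -- From this threshold on `log q / D` is at least `K · ↧ₙ δ`, so `K / (k + 1)` is at most
    -- `1 / ↧ₙ δ`.
    tends δ 0<δ = 2 ℕ.^ (K ℕ.* ↧ₙ δ ℕ.* D) , λ q h _ → fraction-∣∣≤ K (k q) δ 0<δ (ℕP.m≤n⇒m≤1+n (ℕP.≤-trans (ℕP.≤-reflexive (sym (m*n/n≡m (K ℕ.* ↧ₙ δ) D))) (/-monoˡ-≤ D (≤-log (K ℕ.* ↧ₙ δ ℕ.* D) q h))))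

    spreads : (q : ℕ) .{{_ : NonZero q}} → Prime q → Spreads ε q (f q)
    spreads q pr = cases (suc (k q) ℕP.≤? K)
      where
        l κ : ℕ
        l = log q
        κ = k q

        cases : Dec (suc κ ℕ.≤ K) → Spreads ε q (f q)
        cases (yes h) = Spreads-trivial ε q K κ h
        cases (no n) = from (sqrt-exists (q ℕ.∸ 2))
          where
            q≡ : 2 ℕ.+ (q ℕ.∸ 2) ≡ q
            q≡ = ℕP.m+[n∸m]≡n (Modular.1<q q pr)

            κD≤l : κ ℕ.* D ℕ.≤ l
            κD≤l = m/n*n≤m l D

            24≤κ : 24 ℕ.≤ κ
            24≤κ = ℕP.≤-trans (ℕP.m≤m+n 24 (D ℕ.* spread-constant)) (ℕP.≤-pred (ℕP.≰⇒> n))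

            24d≤l : 24 ℕ.* d ℕ.≤ l
            24d≤l = ℕP.≤-trans (ℕP.*-mono-≤ 24≤κ (ℕP.m≤m*n d 6)) κD≤l

            24≤l : 24 ℕ.≤ l
            24≤l = ℕP.≤-trans (ℕP.*-monoʳ-≤ 24 1≤d) 24d≤l

            l< : suc l ℕ.≤ suc κ ℕ.* D
            l< = ℕP.≤-trans (ℕP.≤-reflexive (cong suc (m≡m%n+[m/n]*n l D))) (ℕP.+-monoˡ-≤ (κ ℕ.* D) (m%n<n l D))

            spread≤ : spread-constant ℕ.* suc l ℕ.≤ K ℕ.* K ℕ.* suc κ
            -- Here `suc l` is the bound `L` on the logarithm of `T`, and the division defining `κ`
            -- gives `suc l ≤ suc κ · D`.
            spread≤ = begin
              spread-constant ℕ.* suc l ≤⟨ ℕP.*-monoʳ-≤ spread-constant l< ⟩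
              spread-constant ℕ.* (suc κ ℕ.* D) ≡⟨ lem spread-constant (suc κ) D ⟩
              D ℕ.* spread-constant ℕ.* suc κ ≤⟨ ℕP.*-monoˡ-≤ (suc κ) (ℕP.≤-trans (ℕP.m≤n+m (D ℕ.* spread-constant) 24) (ℕP.m≤m*n K K)) ⟩
              K ℕ.* K ℕ.* suc κ ∎
              where
                open ℕP.≤-Reasoning
                lem : ∀ c k d → c ℕ.* (k ℕ.* d) ≡ d ℕ.* c ℕ.* k
                lem = solveℕ-∀

            from : ∃[ T ] (1 ℕ.≤ T × T ℕ.* T ℕ.< 2 ℕ.+ (q ℕ.∸ 2) × 2 ℕ.+ (q ℕ.∸ 2) ℕ.≤ 4 ℕ.* (T ℕ.* T)) → Spreads ε q (f q)
            from (T , 1≤T , lo , hi) = Spreads-large q pr T (suc l) T²<q q≤4T² T<2^L large (s≤s z≤n) κ K (s≤s z≤n) spread≤ ε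
                λ e h → norm-arithmetic q d (∣ ↥ ε ∣) κ T l e 1≤T (ℕP.<⇒≤ T²<q) (log-lower q) (ℕP.≤-trans (ℕP.≤-reflexive (six d κ)) κD≤l) (ℕP.≤-trans (ℕP.≤-trans (ℕP.≤-reflexive (ℕP.*-comm d 4)) (ℕP.*-monoˡ-≤ d (ℕP.m≤m+n 4 20))) 24d≤l) (proj₁ (positive-numerator ε 0<ε)) h
              where
                six : ∀ d k → d ℕ.* (6 ℕ.* k) ≡ k ℕ.* (d ℕ.* 6)
                six = solveℕ-∀
                T²<q : T ℕ.* T ℕ.< q
                T²<q = subst (T ℕ.* T ℕ.<_) q≡ lo
                q≤4T² : q ℕ.≤ 4 ℕ.* (T ℕ.* T)
                q≤4T² = subst (ℕ._≤ 4 ℕ.* (T ℕ.* T)) q≡ hi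
                T<2^L : T ℕ.< 2 ℕ.^ suc l
                T<2^L = ℕP.≤-<-trans (ℕP.≤-trans (ℕP.≤-reflexive (sym (ℕP.*-identityʳ T))) (ℕP.*-monoʳ-≤ T 1≤T)) (ℕP.<-trans T²<q (log-upper q))
                large : 16 ℕ.* (2 ℕ.* suc l ℕ.+ 3) ℕ.≤ T
                -- A smaller `T` would make `4T²` less than `2 ^ l`, hence less than `q`, against
                -- the choice of `T`.
                large = ℕP.≮⇒≥ λ T< → ℕP.<-irrefl refl (begin-strict
                    4 ℕ.* (T ℕ.* T) <⟨ ℕP.*-monoʳ-< 4 (ℕP.*-mono-< T< T<) ⟩
                    4 ℕ.* (16 ℕ.* (2 ℕ.* suc l ℕ.+ 3) ℕ.* (16 ℕ.* (2 ℕ.* suc l ℕ.+ 3))) ≡⟨ lem l ⟩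
                    1024 ℕ.* ((2 ℕ.* l ℕ.+ 5) ℕ.* (2 ℕ.* l ℕ.+ 5)) ≤⟨ quadratic≤2^ l 24≤l ⟩
                    2 ℕ.^ l ≤⟨ log-lower q ⟩
                    q ≤⟨ q≤4T² ⟩
                    4 ℕ.* (T ℕ.* T) ∎)
                  where
                    open ℕP.≤-Reasoning
                    lem : ∀ l → 4 ℕ.* (16 ℕ.* (2 ℕ.* (1 ℕ.+ l) ℕ.+ 3) ℕ.* (16 ℕ.* (2 ℕ.* (1 ℕ.+ l) ℕ.+ 3))) ≡ 1024 ℕ.* ((2 ℕ.* l ℕ.+ 5) ℕ.* (2 ℕ.* l ℕ.+ 5))
                    lem = solveℕ-∀
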